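{- Let $1\le k\le n$ be integers, let $\mathcal F_{n,k}$ be the set of non-crossing forests on $n$ vertices with exactly $k$ components, let $\langle\rho\rangle$ be the cyclic group of order $n$ acting on $\mathcal F_{n,k}$ by rotation, and let $$f_{n,k}(q)=\frac{1}{[2n-k]_q}\begin{bmatrix} n\\ k-1\end{bmatrix}_q\begin{bmatrix} 3n-2k-1\\ n-k\end{bmatrix}_q .$$ Then the triple $\left(\mathcal F_{n,k},\langle\rho\rangle,f_{n,k}(q)\right)$ exhibits the cyclic sieving phenomenon. -}

module Defs where

open import Data.Nat as ℕ using (ℕ; zero; suc; _∸_; _<_; NonZero)
open import Data.Nat.DivMod using (_/_; _%_; m%n<n)
open import Data.Nat.GCD using (gcd)
open import Data.Nat.Divisibility using (_∣?_)
open import Data.Integer as ℤ using (ℤ; +_)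
open import Data.List using (List; []; _∷_; replicate; filter; upTo; foldr; map)
open import Data.List.Relation.Unary.All using (All)
open import Data.Fin using (Fin; toℕ; fromℕ<)
open import Data.Vec using (Vec; lookup; tabulate)
open import Data.Bool using (Bool; true)
open import Data.Product using (Σ; ∃; _×_)
open import Relation.Nullary using (¬_)
open import Relation.Binary.PropositionalEquality using (_≡_)
open import Relation.Binary.Construct.Closure.ReflexiveTransitive using (Star)
open import Function using (_∘_)
open import Function.Definitions using (Injective)

-- Polynomials in q with integer coefficients: coefficient lists,
-- lowest degree first (trailing zeros allowed; equality is up to them).

Poly : Set
Poly = List ℤ

infixl 6 _+ₚ_ _-ₚ_
infixl 7 _*ₚ_
infix 4 _≈ₚ_ _∣ₚ_

_+ₚ_ : Poly → Poly → Poly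
[] +ₚ q = q
(a ∷ p) +ₚ [] = a ∷ p
(a ∷ p) +ₚ (b ∷ q) = (a ℤ.+ b) ∷ (p +ₚ q)

scaleₚ : ℤ → Poly → Poly
scaleₚ a = map (a ℤ.*_)

-ₚ_ : Poly → Poly
-ₚ_ = map (λ a → ℤ.- a)

_-ₚ_ : Poly → Poly → Poly
p -ₚ q = p +ₚ (-ₚ q)

_*ₚ_ : Poly → Poly → Poly
[] *ₚ q = []
(a ∷ p) *ₚ q = scaleₚ a q +ₚ (ℤ.0ℤ ∷ (p *ₚ q))

shiftₚ : ℕ → Poly → Poly
shiftₚ zero p = p
shiftₚ (suc e) p = ℤ.0ℤ ∷ shiftₚ e p

constₚ : ℤ → Poly
constₚ a = a ∷ []

oneₚ : Poly
oneₚ = constₚ (ℤ.1ℤ)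

_≈ₚ_ : Poly → Poly → Set
p ≈ₚ q = All (_≡ ℤ.0ℤ) (p -ₚ q)

_∣ₚ_ : Poly → Poly → Set
p ∣ₚ g = Σ Poly λ h → (p *ₚ h) ≈ₚ g

qpowMinusOne : ℕ → Poly
qpowMinusOne e = shiftₚ e oneₚ -ₚ oneₚ

qint : ℕ → Poly
qint m = replicate m ℤ.1ℤ

-- Gaussian binomial coefficient, via the q-Pascal rule
-- [n+1, k+1]_q = [n, k]_q + q^(k+1) [n, k+1]_q
qbinom : ℕ → ℕ → Poly
qbinom n zero = oneₚ
qbinom zero (suc k) = []
qbinom (suc n) (suc k) = qbinom n k +ₚ shiftₚ (suc k) (qbinom n (suc k))

-- Evaluation at roots of unity.
-- For a primitive m-th root of unity ζ (m ≥ 1) and g ∈ ℤ[q]: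
--   g(ζ) = 0  iff  (q^m - 1) divides g · ∏_{e ∣ m, e < m} (q^e - 1),
-- since the product contains every cyclotomic factor Φ_e (e ∣ m, e < m)
-- and never Φ_m; i.e. iff Φ_m ∣ g.

properDivisorProduct : ℕ → Poly
properDivisorProduct m =
  foldr (λ e acc → qpowMinusOne e *ₚ acc) oneₚ
        (filter (λ e → e ∣? m) (Data.List.drop 1 (upTo m)))
  where import Data.List

VanishesAtPrimRoot : ℕ → Poly → Set
VanishesAtPrimRoot m g = qpowMinusOne m ∣ₚ (g *ₚ properDivisorProduct m)

EvalAtPrimRootIs : ℕ → Poly → ℤ → Set
EvalAtPrimRootIs m f c = VanishesAtPrimRoot m (f -ₚ constₚ c)

-- ω = exp(2πi/n); ω^d is a primitive (n / gcd(n,d))-th root of unity.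
ordOf : ℕ → ℕ → ℕ
ordOf n d with gcd n d
... | zero = zero
... | suc g = n / suc g

-- Graphs on the vertex set Fin n = {0,…,n-1}, placed in this order
-- around a circle; a graph is given by its adjacency matrix.

Graph : ℕ → Set
Graph n = Vec (Vec Bool n) n

Adj : ∀ {n} → Graph n → Fin n → Fin n → Set
Adj A i j = lookup (lookup A i) j ≡ true

Simple : ∀ {n} → Graph n → Set
Simple {n} A = (∀ i → ¬ Adj A i i) × (∀ i j → Adj A i j → Adj A j i)

NonCrossing : ∀ {n} → Graph n → Set
NonCrossing {n} A = ∀ (a b c d : Fin n) → Adj A a b → Adj A c d →
  toℕ a < toℕ c → toℕ c < toℕ b → toℕ b < toℕ d → ⊥'
  where open import Data.Empty renaming (⊥ to ⊥')

rotBy : ∀ {m} → ℕ → Fin m → Fin m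
rotBy {zero} d ()
rotBy {suc m} d i = fromℕ< (m%n<n (toℕ i ℕ.+ d) (suc m))

Cycle : ∀ {n} → Graph n → Set
Cycle {n} A = Σ ℕ λ l → Σ (Fin (3 ℕ.+ l) → Fin n) λ v →
  Injective _≡_ _≡_ v × (∀ i → Adj A (v i) (v (rotBy 1 i)))

Acyclic : ∀ {n} → Graph n → Set
Acyclic A = ¬ Cycle A

Connected : ∀ {n} → Graph n → Fin n → Fin n → Set
Connected A = Star (Adj A)

HasComponents : ∀ {n} → ℕ → Graph n → Set
HasComponents {n} k A = Σ (Fin k → Fin n) λ r →
  (∀ a b → Connected A (r a) (r b) → a ≡ b) × (∀ v → ∃ λ a → Connected A v (r a))

NCForest : (n k : ℕ) → Graph n → Set
NCForest n k A = Simple A × NonCrossing A × Acyclic A × HasComponents k A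

-- Rotation ρ : i ↦ i + 1 (mod n), acting on graphs:
-- {i,j} is an edge of ρ·A iff {i-1,j-1} is an edge of A.

ρ : ∀ {n} → Graph n → Graph n
ρ {n} A = tabulate λ i → tabulate λ j →
  lookup (lookup A (rotBy (n ∸ 1) i)) (rotBy (n ∸ 1) j)

ρ^ : ∀ {n} → ℕ → Graph n → Graph n
ρ^ zero A = A
ρ^ (suc d) A = ρ (ρ^ d A)

-- elements of F_{n,k} fixed by ρ^d (proof fields irrelevant, so
-- elements are determined by the underlying graph)
record Fix (n k d : ℕ) : Set where
  constructor mkFix
  field
    graph : Graph n
    .isForest : NCForest n k graph
    .fixed : ρ^ d graph ≡ graph

{-# OPTIONS --safe #-}

-- A non-crossing forest on an interval is cut at the largest neighbour of its first vertex and at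
-- the positions no edge spans.  This encodes forests by trees whose generating functions satisfy
-- I = 1 + z I³ F and F = 1 + y I F, with z marking edges and y components; the coefficients of
-- I^p F^q, also with a marked vertex, are combinations of the products
-- C(p + 3a + b, a) C(q + a + b, b), since these obey the same recurrences.
--
-- A forest fixed by a rotation of order m ≥ 2 leaves the centre of the circle either in a region
-- or on a diameter; the latter forces m = 2, as otherwise the diameter crosses its images.  In the
-- first case it consists of m copies, side by side, of a forest on n / m vertices, and is determined
-- by that forest, cut so that vertex 0 lies in its first piece, and the place of 0 in this piece.
-- In the second case it consists of two copies of a half.
--
-- On the algebraic side, dividing by [2n-k] is possible because [n-k+1] - q [n-k] = 1, which gives
-- f explicitly in terms of q-binomials.  Modulo the ideal of polynomials vanishing at a primitive
-- m-th root of unity these are evaluated by the q-Lucas theorem.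
module Submission where

-- Roots of unity enter the statement only through divisibility of integer polynomials. The
-- polynomials that vanish at a primitive m-th root in this sense form an ideal, and every value is
-- computed in the quotient ring, where two facts carry the q-Lucas theorem: q^m = 1, and the
-- Gaussian binomials [m, j] with 0 < j < m are 0. Both sides of the identity are sorted by k modulo
-- m. For m > 2 they are 0 unless m divides k; for m = 2 an odd k is exactly the case of a diameter.
-- The main obstacle is that a symmetric forest comes without a distinguished place to cut the
-- circle. A cut suits the symmetry when no edge has its short arc over it, since then no edge
-- passes over its m images either and the circle falls into equal blocks. If the cut before vertex
-- 0 does not suit, one is found at a gap on the long side of the edge nearest to the centre among
-- those whose short arc passes over it. Many cuts suit, one for each place between pieces, and this
-- ambiguity is why sums of widths over all stacks are computed besides the number of stacks.

module PolynomialRing where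
  open import Defs
  open import Algebra.Bundles using (CommutativeRing)
  open import Data.Nat using (ℕ; zero; suc)
  open import Data.Integer as ℤ using (ℤ)
  import Data.Integer.Properties as ℤ
  open import Data.Integer.Tactic.RingSolver using (solve-∀)
  open import Data.List using ([]; _∷_)
  open import Data.List.Relation.Unary.All using (All; []; _∷_)
  open import Data.Product using (_,_)
  open import Level using (0ℓ)
  open import Relation.Binary.PropositionalEquality

  -- The commutative ring of integer polynomials.

  coef : Poly → ℕ → ℤ
  coef []      _       = ℤ.0ℤ
  coef (a ∷ p) zero    = a
  coef (a ∷ p) (suc i) = coef p i

  infix 4 _≋_
  -- Coefficientwise equality ignores trailing zeros, which equality of lists does not. It is a
  -- record so that both polynomials can be inferred from a proof.
  record _≋_ (p q : Poly) : Set where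
    constructor mk≋
    field at : ∀ i → coef p i ≡ coef q i
  open _≋_ public

  coef-+ : ∀ p q i → coef (p +ₚ q) i ≡ coef p i ℤ.+ coef q i
  coef-+ []      q       i       = sym (ℤ.+-identityˡ _)
  coef-+ (a ∷ p) []      i       = sym (ℤ.+-identityʳ _)
  coef-+ (a ∷ p) (b ∷ q) zero    = refl
  coef-+ (a ∷ p) (b ∷ q) (suc i) = coef-+ p q i

  coef-scale : ∀ a p i → coef (scaleₚ a p) i ≡ a ℤ.* coef p i
  coef-scale a []      i       = sym (ℤ.*-zeroʳ a)
  coef-scale a (b ∷ p) zero    = refl
  coef-scale a (b ∷ p) (suc i) = coef-scale a p i

  coef-neg : ∀ p i → coef (-ₚ p) i ≡ ℤ.- coef p i
  coef-neg []      i       = refl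
  coef-neg (b ∷ p) zero    = refl
  coef-neg (b ∷ p) (suc i) = coef-neg p i

  coef-- : ∀ p q i → coef (p -ₚ q) i ≡ coef p i ℤ.- coef q i
  coef-- p q i = trans (coef-+ p (-ₚ q) i) (cong (λ z → coef p i ℤ.+ z) (coef-neg q i))

  All⇒zero : ∀ {p} → All (_≡ ℤ.0ℤ) p → ∀ i → coef p i ≡ ℤ.0ℤ
  All⇒zero []       i       = refl
  All⇒zero (a ∷ as) zero    = a
  All⇒zero (a ∷ as) (suc i) = All⇒zero as i

  zero⇒All : ∀ p → (∀ i → coef p i ≡ ℤ.0ℤ) → All (_≡ ℤ.0ℤ) p
  zero⇒All []      h = []
  zero⇒All (a ∷ p) h = h zero ∷ zero⇒All p (λ i → h (suc i))

  ≋⇒≈ : ∀ p q → p ≋ q → p ≈ₚ q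
  ≋⇒≈ p q h = zero⇒All (p -ₚ q) λ i → trans (coef-- p q i) (ℤ.i≡j⇒i-j≡0 (at h i))

  X∷ : Poly → Poly
  X∷ p = ℤ.0ℤ ∷ p

  coef-∷* : ∀ a p q i → coef ((a ∷ p) *ₚ q) i ≡ a ℤ.* coef q i ℤ.+ coef (X∷ (p *ₚ q)) i
  coef-∷* a p q i = trans (coef-+ (scaleₚ a q) _ i) (cong (ℤ._+ _) (coef-scale a q i))

  *-zeroˡ : ∀ p q → (∀ i → coef p i ≡ ℤ.0ℤ) → ∀ i → coef (p *ₚ q) i ≡ ℤ.0ℤ
  *-zeroˡ []      q h i = refl
  *-zeroˡ (a ∷ p) q h i = trans (coef-∷* a p q i)
    (cong₂ ℤ._+_ (trans (cong (ℤ._* coef q i) (h zero)) (ℤ.*-zeroˡ (coef q i))) (shifted i))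
    where
    shifted : ∀ i → coef (X∷ (p *ₚ q)) i ≡ ℤ.0ℤ
    shifted zero    = refl
    shifted (suc i) = *-zeroˡ p q (λ j → h (suc j)) i

  *-congˡ : ∀ p {q r} → q ≋ r → p *ₚ q ≋ p *ₚ r
  *-congˡ []      h = mk≋ λ _ → refl
  *-congˡ (a ∷ p) {q} {r} h = mk≋ λ i → trans (coef-∷* a p q i)
    (trans (cong₂ (λ x y → a ℤ.* x ℤ.+ y) (at h i) (shifted i)) (sym (coef-∷* a p r i)))
    where
    shifted : ∀ i → coef (X∷ (p *ₚ q)) i ≡ coef (X∷ (p *ₚ r)) i
    shifted zero    = refl
    shifted (suc i) = at (*-congˡ p h) i

  *-distribʳ : ∀ r p q → (p +ₚ q) *ₚ r ≋ p *ₚ r +ₚ q *ₚ r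
  *-distribʳ r []      q       = mk≋ λ _ → refl
  *-distribʳ r (a ∷ p) []      = mk≋ λ i → sym (trans (coef-+ ((a ∷ p) *ₚ r) [] i) (ℤ.+-identityʳ _))
  *-distribʳ r (a ∷ p) (b ∷ q) = mk≋ λ i → begin
    coef ((a ℤ.+ b ∷ (p +ₚ q)) *ₚ r) i
      ≡⟨ coef-∷* (a ℤ.+ b) (p +ₚ q) r i ⟩
    (a ℤ.+ b) ℤ.* coef r i ℤ.+ coef (X∷ ((p +ₚ q) *ₚ r)) i
      ≡⟨ cong (λ t → (a ℤ.+ b) ℤ.* coef r i ℤ.+ t) (shifted i) ⟩
    (a ℤ.+ b) ℤ.* coef r i ℤ.+ (coef (X∷ (p *ₚ r)) i ℤ.+ coef (X∷ (q *ₚ r)) i)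
      ≡⟨ swap a b (coef r i) _ _ ⟩
    (a ℤ.* coef r i ℤ.+ coef (X∷ (p *ₚ r)) i) ℤ.+ (b ℤ.* coef r i ℤ.+ coef (X∷ (q *ₚ r)) i)
      ≡⟨ cong₂ ℤ._+_ (coef-∷* a p r i) (coef-∷* b q r i) ⟨
    coef ((a ∷ p) *ₚ r) i ℤ.+ coef ((b ∷ q) *ₚ r) i
      ≡⟨ coef-+ ((a ∷ p) *ₚ r) ((b ∷ q) *ₚ r) i ⟨
    coef ((a ∷ p) *ₚ r +ₚ (b ∷ q) *ₚ r) i ∎
    where
    open ≡-Reasoning
    swap : ∀ a b x y z → (a ℤ.+ b) ℤ.* x ℤ.+ (y ℤ.+ z) ≡ (a ℤ.* x ℤ.+ y) ℤ.+ (b ℤ.* x ℤ.+ z)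
    swap = solve-∀
    shifted : ∀ i → coef (X∷ ((p +ₚ q) *ₚ r)) i ≡ coef (X∷ (p *ₚ r)) i ℤ.+ coef (X∷ (q *ₚ r)) i
    shifted zero    = refl
    shifted (suc i) = trans (at (*-distribʳ r p q) i) (coef-+ (p *ₚ r) _ i)

  -- The product recurses on its first factor; this is the expansion along the second one, from
  -- which commutativity follows by induction.
  *-∷ : ∀ p b q i → coef (p *ₚ (b ∷ q)) i ≡ b ℤ.* coef p i ℤ.+ coef (X∷ (p *ₚ q)) i
  *-∷ []      b q zero    = sym (trans (ℤ.+-identityʳ _) (ℤ.*-zeroʳ b))
  *-∷ []      b q (suc i) = sym (trans (ℤ.+-identityʳ _) (ℤ.*-zeroʳ b))
  *-∷ (a ∷ p) b q zero    = cong (ℤ._+ ℤ.0ℤ) (ℤ.*-comm a b)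
  *-∷ (a ∷ p) b q (suc i) = begin
    coef ((a ∷ p) *ₚ (b ∷ q)) (suc i)
      ≡⟨ coef-∷* a p (b ∷ q) (suc i) ⟩
    a ℤ.* coef q i ℤ.+ coef (p *ₚ (b ∷ q)) i
      ≡⟨ cong (λ t → a ℤ.* coef q i ℤ.+ t) (*-∷ p b q i) ⟩
    a ℤ.* coef q i ℤ.+ (b ℤ.* coef p i ℤ.+ coef (X∷ (p *ₚ q)) i)
      ≡⟨ swap (a ℤ.* coef q i) (b ℤ.* coef p i) _ ⟩
    b ℤ.* coef p i ℤ.+ (a ℤ.* coef q i ℤ.+ coef (X∷ (p *ₚ q)) i)
      ≡⟨ cong (λ t → b ℤ.* coef p i ℤ.+ t) (coef-∷* a p q i) ⟨
    b ℤ.* coef p i ℤ.+ coef ((a ∷ p) *ₚ q) i ∎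
    where
    open ≡-Reasoning
    swap : ∀ x y z → x ℤ.+ (y ℤ.+ z) ≡ y ℤ.+ (x ℤ.+ z)
    swap = solve-∀

  *-zeroʳ : ∀ p i → coef (p *ₚ []) i ≡ ℤ.0ℤ
  *-zeroʳ []      i       = refl
  *-zeroʳ (a ∷ p) zero    = refl
  *-zeroʳ (a ∷ p) (suc i) = *-zeroʳ p i

  *-comm : ∀ p q → p *ₚ q ≋ q *ₚ p
  *-comm []      q = mk≋ λ i → sym (*-zeroʳ q i)
  *-comm (a ∷ p) q = mk≋ λ i →
    trans (coef-∷* a p q i) (trans (cong (λ t → a ℤ.* coef q i ℤ.+ t) (shifted i)) (sym (*-∷ q a p i)))
    where
    shifted : ∀ i → coef (X∷ (p *ₚ q)) i ≡ coef (X∷ (q *ₚ p)) i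
    shifted zero    = refl
    shifted (suc i) = at (*-comm p q) i

  scale-* : ∀ a p q i → coef (scaleₚ a p *ₚ q) i ≡ a ℤ.* coef (p *ₚ q) i
  scale-* a []      q i = sym (ℤ.*-zeroʳ a)
  scale-* a (b ∷ p) q i = begin
    coef ((a ℤ.* b ∷ scaleₚ a p) *ₚ q) i
      ≡⟨ coef-∷* (a ℤ.* b) (scaleₚ a p) q i ⟩
    (a ℤ.* b) ℤ.* coef q i ℤ.+ coef (X∷ (scaleₚ a p *ₚ q)) i
      ≡⟨ cong (λ t → (a ℤ.* b) ℤ.* coef q i ℤ.+ t) (shifted i) ⟩
    (a ℤ.* b) ℤ.* coef q i ℤ.+ a ℤ.* coef (X∷ (p *ₚ q)) i
      ≡⟨ factor a b (coef q i) _ ⟩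
    a ℤ.* (b ℤ.* coef q i ℤ.+ coef (X∷ (p *ₚ q)) i)
      ≡⟨ cong (a ℤ.*_) (coef-∷* b p q i) ⟨
    a ℤ.* coef ((b ∷ p) *ₚ q) i ∎
    where
    open ≡-Reasoning
    factor : ∀ a b x y → (a ℤ.* b) ℤ.* x ℤ.+ a ℤ.* y ≡ a ℤ.* (b ℤ.* x ℤ.+ y)
    factor = solve-∀
    shifted : ∀ i → coef (X∷ (scaleₚ a p *ₚ q)) i ≡ a ℤ.* coef (X∷ (p *ₚ q)) i
    shifted zero    = sym (ℤ.*-zeroʳ a)
    shifted (suc i) = scale-* a p q i

  X∷-* : ∀ p q → X∷ p *ₚ q ≋ X∷ (p *ₚ q)
  X∷-* p q = mk≋ λ i → trans (coef-∷* ℤ.0ℤ p q i)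
    (trans (cong (ℤ._+ coef (X∷ (p *ₚ q)) i) (ℤ.*-zeroˡ (coef q i))) (ℤ.+-identityˡ _))

  *-assoc : ∀ p q r → (p *ₚ q) *ₚ r ≋ p *ₚ (q *ₚ r)
  *-assoc []      q r = mk≋ λ _ → refl
  *-assoc (a ∷ p) q r = mk≋ λ i → begin
    coef ((scaleₚ a q +ₚ X∷ (p *ₚ q)) *ₚ r) i
      ≡⟨ at (*-distribʳ r (scaleₚ a q) (X∷ (p *ₚ q))) i ⟩
    coef (scaleₚ a q *ₚ r +ₚ X∷ (p *ₚ q) *ₚ r) i
      ≡⟨ coef-+ (scaleₚ a q *ₚ r) _ i ⟩
    coef (scaleₚ a q *ₚ r) i ℤ.+ coef (X∷ (p *ₚ q) *ₚ r) i
      ≡⟨ cong₂ ℤ._+_ (scale-* a q r i) (trans (at (X∷-* (p *ₚ q) r) i) (shifted i)) ⟩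
    a ℤ.* coef (q *ₚ r) i ℤ.+ coef (X∷ (p *ₚ (q *ₚ r))) i
      ≡⟨ coef-∷* a p (q *ₚ r) i ⟨
    coef ((a ∷ p) *ₚ (q *ₚ r)) i ∎
    where
    open ≡-Reasoning
    shifted : ∀ i → coef (X∷ ((p *ₚ q) *ₚ r)) i ≡ coef (X∷ (p *ₚ (q *ₚ r))) i
    shifted zero    = refl
    shifted (suc i) = at (*-assoc p q r) i

  *-identityˡ : ∀ p → oneₚ *ₚ p ≋ p
  *-identityˡ p = mk≋ λ i → trans (coef-∷* ℤ.1ℤ [] p i) (trans (cong (λ t → ℤ.1ℤ ℤ.* coef p i ℤ.+ t) (X∷-zero i)) (trans (ℤ.+-identityʳ _) (ℤ.*-identityˡ _)))
    where
    X∷-zero : ∀ i → coef (X∷ []) i ≡ ℤ.0ℤ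
    X∷-zero zero    = refl
    X∷-zero (suc i) = refl

  ≋-refl : ∀ {p} → p ≋ p
  ≋-refl = mk≋ λ _ → refl

  ≋-sym : ∀ {p q} → p ≋ q → q ≋ p
  ≋-sym h = mk≋ λ i → sym (at h i)

  ≋-trans : ∀ {p q r} → p ≋ q → q ≋ r → p ≋ r
  ≋-trans g h = mk≋ λ i → trans (at g i) (at h i)

  +-cong : ∀ {p p′ q q′} → p ≋ p′ → q ≋ q′ → p +ₚ q ≋ p′ +ₚ q′
  +-cong {p} {p′} {q} {q′} g h = mk≋ λ i →
    trans (coef-+ p q i) (trans (cong₂ ℤ._+_ (at g i) (at h i)) (sym (coef-+ p′ q′ i)))

  +-assoc : ∀ p q r → (p +ₚ q) +ₚ r ≋ p +ₚ (q +ₚ r)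
  +-assoc p q r = mk≋ λ i → trans (coef-+ (p +ₚ q) r i) (trans (cong (ℤ._+ coef r i) (coef-+ p q i))
    (trans (ℤ.+-assoc (coef p i) (coef q i) (coef r i)) (sym (trans (coef-+ p (q +ₚ r) i) (cong (λ t → coef p i ℤ.+ t) (coef-+ q r i))))))

  +-comm : ∀ p q → p +ₚ q ≋ q +ₚ p
  +-comm p q = mk≋ λ i → trans (coef-+ p q i) (trans (ℤ.+-comm (coef p i) (coef q i)) (sym (coef-+ q p i)))

  +-identityʳ : ∀ p → p +ₚ [] ≋ p
  +-identityʳ p = mk≋ λ i → trans (coef-+ p [] i) (ℤ.+-identityʳ _)

  neg-inverseˡ : ∀ p → (-ₚ p) +ₚ p ≋ []
  neg-inverseˡ p = mk≋ λ i → trans (coef-+ (-ₚ p) p i) (trans (cong (ℤ._+ coef p i) (coef-neg p i)) (ℤ.+-inverseˡ (coef p i)))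

  neg-cong : ∀ {p q} → p ≋ q → -ₚ p ≋ -ₚ q
  neg-cong {p} {q} h = mk≋ λ i → trans (coef-neg p i) (trans (cong ℤ.-_ (at h i)) (sym (coef-neg q i)))

  *-cong : ∀ {p p′ q q′} → p ≋ p′ → q ≋ q′ → p *ₚ q ≋ p′ *ₚ q′
  *-cong {p} {p′} {q} {q′} g h =
    ≋-trans (*-congˡ p h) (≋-trans (*-comm p q′) (≋-trans (*-congˡ q′ g) (*-comm q′ p′)))

  *-distribˡ : ∀ p q r → p *ₚ (q +ₚ r) ≋ p *ₚ q +ₚ p *ₚ r
  *-distribˡ p q r = ≋-trans (*-comm p (q +ₚ r)) (≋-trans (*-distribʳ p q r) (+-cong (*-comm q p) (*-comm r p)))

  polyRing : CommutativeRing 0ℓ 0ℓ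
  polyRing = record
    { Carrier = Poly ; _≈_ = _≋_ ; _+_ = _+ₚ_ ; _*_ = _*ₚ_ ; -_ = -ₚ_ ; 0# = [] ; 1# = oneₚ
    ; isCommutativeRing = record
      { isRing = record
        { +-isAbelianGroup = record
          { isGroup = record
            { isMonoid = record
              { isSemigroup = record
                { isMagma = record
                  { isEquivalence = record { refl = ≋-refl ; sym = ≋-sym ; trans = ≋-trans }
                  ; ∙-cong = +-cong }
                ; assoc = +-assoc }
              ; identity = (λ p → ≋-refl) , +-identityʳ }
            ; inverse = neg-inverseˡ , λ p → ≋-trans (+-comm p (-ₚ p)) (neg-inverseˡ p)
            ; ⁻¹-cong = neg-cong }
          ; comm = +-comm }
        ; *-cong = *-cong
        ; *-assoc = *-assoc
        ; *-identity = *-identityˡ , λ p → ≋-trans (*-comm p oneₚ) (*-identityˡ p)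
        ; distrib = *-distribˡ , *-distribʳ }
      ; *-comm = *-comm } }

open import Algebra.Bundles using (CommutativeRing)

-- Gaussian binomials over a commutative ring with a chosen element q.

module QBinomial {c ℓ} (R : CommutativeRing c ℓ) (q : CommutativeRing.Carrier R) where
  open CommutativeRing R hiding (zero)
  open import Algebra.Properties.Ring ring using (+-cancelʳ)
  open import Algebra.Properties.Semiring.Exp semiring using (_^_; ^-homo-*; ^-assocʳ; ^-congˡ)
  open import Algebra.Properties.Semiring.Mult semiring using (_×_; ×-homo-+; ×1-homo-*)
  open import Algebra.Solver.Ring.NaturalCoefficients.Default commutativeSemiring
  open import Data.Nat as ℕ using (ℕ; zero; suc; _<_; s≤s; z≤n)
  import Data.Nat.Properties as ℕ
  open import Data.Nat.Combinatorics using (_C_; nCk+nC[k+1]≡[n+1]C[k+1]; k>n⇒nCk≡0)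
  open import Data.Nat.Tactic.RingSolver using () renaming (solve-∀ to ℕ-solve-∀)
  open import Relation.Binary.PropositionalEquality as ≡ using (_≡_)
  open import Relation.Binary.Reasoning.Setoid setoid

  qi : ℕ → Carrier
  qi zero    = 0#
  qi (suc n) = 1# + q * qi n

  bin : ℕ → ℕ → Carrier
  bin n       zero    = 1#
  bin zero    (suc k) = 0#
  bin (suc n) (suc k) = bin n k + q ^ suc k * bin n (suc k)

  bin-congˡ : ∀ k {n n′} → n ≡ n′ → bin n k ≈ bin n′ k
  bin-congˡ k n≡n′ = reflexive (≡.cong (λ n → bin n k) n≡n′)

  bin-congʳ : ∀ n {k k′} → k ≡ k′ → bin n k ≈ bin n k′
  bin-congʳ n k≡k′ = reflexive (≡.cong (bin n) k≡k′)

  qi-+ : ∀ m n → qi (m ℕ.+ n) ≈ qi m + q ^ m * qi n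
  qi-+ zero    n = solve 1 (λ x → x := con 0 :+ con 1 :* x) refl (qi n)
  qi-+ (suc m) n = trans (+-congˡ (*-congˡ (qi-+ m n)))
    (solve 4 (λ x y z w → con 1 :+ x :* (y :+ z :* w) := (con 1 :+ x :* y) :+ (x :* z) :* w) refl
      q (qi m) (q ^ m) (qi n))

  bin-above : ∀ {n k} → n < k → bin n k ≈ 0#
  bin-above {zero}  {suc k} _         = refl
  bin-above {suc n} {suc k} (s≤s n<k) = trans
    (+-cong (bin-above n<k) (*-congˡ (bin-above (ℕ.m<n⇒m<1+n n<k))))
    (solve 1 (λ x → con 0 :+ x :* con 0 := con 0) refl (q ^ suc k))

  bin-diag : ∀ n → bin n n ≈ 1#
  bin-diag zero    = refl
  bin-diag (suc n) = trans (+-cong (bin-diag n) (*-congˡ (bin-above (ℕ.n<1+n n))))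
    (solve 1 (λ x → con 1 :+ x :* con 0 := con 1) refl (q ^ suc n))

  absorption : ∀ n k → qi (suc k) * bin (suc n) (suc k) ≈ qi (suc n) * bin n k
  absorption zero zero = solve 1 (λ x → (con 1 :+ x :* con 0) :* (con 1 :+ x :* con 1 :* con 0) := (con 1 :+ x :* con 0) :* con 1) refl q
  absorption zero (suc k) = solve 3 (λ x y z → z :* (con 0 :+ y :* con 0) := (con 1 :+ x :* con 0) :* con 0) refl q (q ^ suc (suc k)) (qi (suc (suc k)))
  absorption (suc n) zero = begin
    qi 1 * (1# + q ^ 1 * bin (suc n) 1)
      ≈⟨ solve 3 (λ q t b → t :* (con 1 :+ q :* b) := t :+ q :* (t :* b)) refl (q ^ 1) (qi 1) (bin (suc n) 1) ⟩
    qi 1 + q ^ 1 * (qi 1 * bin (suc n) 1)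
      ≈⟨ +-congˡ (*-congˡ (absorption n zero)) ⟩
    qi 1 + q ^ 1 * (qi (suc n) * 1#)
      ≈⟨ solve 2 (λ q t → (con 1 :+ q :* con 0) :+ (q :* con 1) :* (t :* con 1) := (con 1 :+ q :* t) :* con 1) refl q (qi (suc n)) ⟩
    qi (suc (suc n)) * 1# ∎
  absorption (suc n) (suc k) = begin
    qi (suc (suc k)) * (b + q ^ suc (suc k) * bin (suc n) (suc (suc k)))
      ≈⟨ solve 4 (λ t b x y → t :* (b :+ x :* y) := t :* b :+ x :* (t :* y)) refl _ _ _ _ ⟩
    qi (suc (suc k)) * b + q ^ suc (suc k) * (qi (suc (suc k)) * bin (suc n) (suc (suc k)))
      ≈⟨ +-congˡ (*-congˡ (absorption n (suc k))) ⟩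
    qi (suc (suc k)) * b + q ^ suc (suc k) * (qi (suc n) * bin n (suc k))
      ≈⟨ solve 6 (λ q t b x s y → (con 1 :+ q :* t) :* b :+ (q :* x) :* (s :* y) := b :+ (q :* (t :* b) :+ q :* (s :* (x :* y)))) refl q (qi (suc k)) b (q ^ suc k) (qi (suc n)) (bin n (suc k)) ⟩
    b + (q * (qi (suc k) * b) + q * (qi (suc n) * (q ^ suc k * bin n (suc k))))
      ≈⟨ +-congˡ (+-congʳ (*-congˡ (absorption n k))) ⟩
    b + (q * (qi (suc n) * bin n k) + q * (qi (suc n) * (q ^ suc k * bin n (suc k))))
      ≈⟨ solve 4 (λ q s x y → (x :+ y) :+ (q :* (s :* x) :+ q :* (s :* y)) := (con 1 :+ q :* s) :* (x :+ y)) refl q (qi (suc n)) (bin n k) (q ^ suc k * bin n (suc k)) ⟩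
    qi (suc (suc n)) * b ∎
    where b = bin (suc n) (suc k)

  -- The mirror image of the defining rule, with the power of q on the other term. The variable r
  -- stands for n - k and avoids truncated subtraction.
  pascal′ : ∀ n k r → n ≡ k ℕ.+ r → bin (suc n) (suc k) ≈ q ^ r * bin n k + bin n (suc k)
  pascal′ n k zero n≡k+r = begin
    bin n k + q ^ suc k * bin n (suc k) ≈⟨ +-congˡ (*-congˡ z) ⟩
    bin n k + q ^ suc k * 0#            ≈⟨ solve 2 (λ b x → b :+ x :* con 0 := con 1 :* b :+ con 0) refl _ _ ⟩
    1# * bin n k + 0#                   ≈⟨ +-congˡ z ⟨
    1# * bin n k + bin n (suc k)        ∎
    where
    z : bin n (suc k) ≈ 0#
    z = bin-above (s≤s (ℕ.≤-reflexive (≡.trans n≡k+r (ℕ.+-identityʳ k))))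
  pascal′ zero zero    (suc r) ()
  pascal′ zero (suc k) (suc r) ()
  pascal′ (suc n) zero (suc r) eq = begin
    1# + q ^ 1 * bin (suc n) 1
      ≈⟨ +-congˡ (*-congˡ (pascal′ n zero r (ℕ.suc-injective eq))) ⟩
    1# + q ^ 1 * (q ^ r * 1# + bin n 1)
      ≈⟨ solve 3 (λ q x b → con 1 :+ (q :* con 1) :* (x :* con 1 :+ b) := (q :* x) :* con 1 :+ (con 1 :+ (q :* con 1) :* b)) refl q (q ^ r) (bin n 1) ⟩
    q ^ suc r * 1# + (1# + q ^ 1 * bin n 1) ∎
  pascal′ (suc n) (suc k) (suc r) eq = begin
    bin (suc n) (suc k) + q ^ suc (suc k) * bin (suc n) (suc (suc k))
      ≈⟨ +-cong (pascal′ n k (suc r) (ℕ.suc-injective eq))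
                (*-congˡ (pascal′ n (suc k) r (≡.trans (ℕ.suc-injective eq) (ℕ.+-suc k r)))) ⟩
    (q ^ suc r * bin n k + bin n (suc k)) + q ^ suc (suc k) * (q ^ r * bin n (suc k) + bin n (suc (suc k)))
      ≈⟨ solve 6 (λ q x y b₀ b₁ b₂ → ((q :* x) :* b₀ :+ b₁) :+ (q :* y) :* (x :* b₁ :+ b₂)
                                    := (q :* x) :* (b₀ :+ y :* b₁) :+ (b₁ :+ (q :* y) :* b₂)) refl
           q (q ^ r) (q ^ suc k) (bin n k) (bin n (suc k)) (bin n (suc (suc k))) ⟩
    q ^ suc r * bin (suc n) (suc k) + bin (suc n) (suc (suc k)) ∎

  -- `absorption` and `pascal′` express the same multiple of `bin (suc n) (suc k)` in two ways.
  -- Splitting [n+1] as [r] + q^r [k+1] produces a common term, which cancels.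
  bin-step : ∀ n k r → n ≡ k ℕ.+ r → qi (suc k) * bin n (suc k) ≈ qi r * bin n k
  bin-step n k r n≡k+r = +-cancelʳ (qi (suc k) * (q ^ r * bin n k)) _ _ (begin
    qi (suc k) * bin n (suc k) + qi (suc k) * (q ^ r * bin n k)
      ≈⟨ solve 3 (λ t x y → t :* x :+ t :* y := t :* (y :+ x)) refl _ _ _ ⟩
    qi (suc k) * (q ^ r * bin n k + bin n (suc k))
      ≈⟨ *-congˡ (pascal′ n k r n≡k+r) ⟨
    qi (suc k) * bin (suc n) (suc k)
      ≈⟨ absorption n k ⟩
    qi (suc n) * bin n k
      ≡⟨ ≡.cong (λ i → qi i * bin n k) (≡.trans (≡.cong suc (≡.trans n≡k+r (ℕ.+-comm k r))) (≡.sym (ℕ.+-suc r k))) ⟩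
    qi (r ℕ.+ suc k) * bin n k
      ≈⟨ *-congʳ (qi-+ r (suc k)) ⟩
    (qi r + q ^ r * qi (suc k)) * bin n k
      ≈⟨ solve 4 (λ s x t b → (s :+ x :* t) :* b := s :* b :+ t :* (x :* b)) refl _ _ _ _ ⟩
    qi r * bin n k + qi (suc k) * (q ^ r * bin n k) ∎)

  top : ℕ → ℕ → ℕ
  top a b′ = 3 ℕ.* a ℕ.+ b′

  -- f_{n,k} with a = n - k and k = suc b, so that 3n - 2k - 1 = top a b.
  fₙₖ : ℕ → ℕ → Carrier
  fₙₖ zero    b = 1#
  fₙₖ (suc a) b = bin n (suc b) * bin (top (suc a) b) (suc a)
    - ((bin n (suc b) * (q ^ suc b + q ^ n)) * bin (top (suc a) b) a + (q * bin n b) * bin (top (suc a) b) a)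
    where n = suc a ℕ.+ suc b

  x-y+y≈x : ∀ x y → (x - y) + y ≈ x
  x-y+y≈x x y = trans (+-assoc x (- y) y) (trans (+-congˡ (-‿inverseˡ y)) (+-identityʳ x))

  -- Multiply the leading product B₁ D₁ of `fₙₖ` by t = [2a+b+1] = [b+1] + (q^(b+1) + q^n) [a]. By
  -- `bin-step`, [b+1] B₁ = [a+1] B₀ = (1 + q [a]) B₀ and [a] D₁ = t D₀. So everything except B₀ D₁
  -- is a multiple of t, and the cofactors are what `fₙₖ` subtracts.
  fₙₖ-spec : ∀ a b → qi (2 ℕ.* a ℕ.+ suc b) * fₙₖ a b ≈ bin (a ℕ.+ suc b) b * bin (top a b) a
  fₙₖ-spec zero b = begin
    qi (suc b) * 1#                    ≈⟨ *-congˡ (bin-diag (suc b)) ⟨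
    qi (suc b) * bin (suc b) (suc b)   ≈⟨ bin-step (suc b) b 1 (ℕ.+-comm 1 b) ⟩
    qi 1 * bin (suc b) b               ≈⟨ solve 2 (λ q x → (con 1 :+ q :* con 0) :* x := x :* con 1) refl q _ ⟩
    bin (suc b) b * bin b 0            ∎
  fₙₖ-spec a@(suc a′) b = +-cancelʳ (t * sub) _ _ (begin
    t * fₙₖ a b + t * sub          ≈⟨ distribˡ t _ _ ⟨
    t * (fₙₖ a b + sub)            ≈⟨ *-congˡ (x-y+y≈x (B₁ * D₁) sub) ⟩
    t * (B₁ * D₁)                  ≈⟨ *-congʳ t-split ⟩
    (qi (suc b) + (qᵇ + qⁿ) * qi a) * (B₁ * D₁)
      ≈⟨ solve 5 (λ x y z b d → (x :+ y :* z) :* (b :* d) := (x :* b) :* d :+ y :* (b :* (z :* d))) refl _ _ _ _ _ ⟩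
    (qi (suc b) * B₁) * D₁ + (qᵇ + qⁿ) * (B₁ * (qi a * D₁))
      ≈⟨ +-congʳ (*-congʳ (bin-step n b (suc a) n≡)) ⟩
    ((1# + q * qi a) * B₀) * D₁ + (qᵇ + qⁿ) * (B₁ * (qi a * D₁))
      ≈⟨ solve 6 (λ q z b₀ b₁ d y → ((con 1 :+ q :* z) :* b₀) :* d :+ y :* (b₁ :* (z :* d))
            := b₀ :* d :+ ((b₁ :* y) :* (z :* d) :+ (q :* b₀) :* (z :* d))) refl q (qi a) B₀ B₁ D₁ (qᵇ + qⁿ) ⟩
    B₀ * D₁ + ((B₁ * (qᵇ + qⁿ)) * (qi a * D₁) + (q * B₀) * (qi a * D₁))
      ≈⟨ +-congˡ (+-cong (*-congˡ E₁) (*-congˡ E₁)) ⟩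
    B₀ * D₁ + ((B₁ * (qᵇ + qⁿ)) * (t * D₀) + (q * B₀) * (t * D₀))
      ≈⟨ solve 5 (λ x y t z d → x :+ (y :* (t :* d) :+ z :* (t :* d)) := x :+ t :* (y :* d :+ z :* d)) refl _ _ _ _ _ ⟩
    B₀ * D₁ + t * sub ∎)
    where
    n = a ℕ.+ suc b
    t = qi (2 ℕ.* a ℕ.+ suc b)
    qᵇ = q ^ suc b
    qⁿ = q ^ n
    B₀ = bin n b
    B₁ = bin n (suc b)
    D₀ = bin (top a b) a′
    D₁ = bin (top a b) a
    sub = (B₁ * (qᵇ + qⁿ)) * D₀ + (q * B₀) * D₀
    arith₁ : ∀ a′ b → 3 ℕ.* suc a′ ℕ.+ b ≡ a′ ℕ.+ (2 ℕ.* suc a′ ℕ.+ suc b)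
    arith₁ = ℕ-solve-∀
    arith₂ : ∀ a b → a ℕ.+ suc b ≡ b ℕ.+ suc a
    arith₂ = ℕ-solve-∀
    arith₃ : ∀ a b → 2 ℕ.* a ℕ.+ suc b ≡ suc b ℕ.+ (a ℕ.+ a)
    arith₃ = ℕ-solve-∀
    n≡ : n ≡ b ℕ.+ suc a
    n≡ = arith₂ a b
    E₁ : qi a * D₁ ≈ t * D₀
    E₁ = bin-step (top a b) a′ (2 ℕ.* a ℕ.+ suc b) (arith₁ a′ b)
    t-split : t ≈ qi (suc b) + (qᵇ + qⁿ) * qi a
    t-split = begin
      qi (2 ℕ.* a ℕ.+ suc b)                           ≡⟨ ≡.cong qi (arith₃ a b) ⟩
      qi (suc b ℕ.+ (a ℕ.+ a))                         ≈⟨ qi-+ (suc b) (a ℕ.+ a) ⟩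
      qi (suc b) + qᵇ * qi (a ℕ.+ a)                   ≈⟨ +-congˡ (*-congˡ (qi-+ a a)) ⟩
      qi (suc b) + qᵇ * (qi a + q ^ a * qi a)          ≈⟨ solve 4 (λ x y z w → x :+ y :* (z :+ w :* z) := x :+ (y :+ w :* y) :* z) refl (qi (suc b)) qᵇ (qi a) (q ^ a) ⟩
      qi (suc b) + (qᵇ + q ^ a * qᵇ) * qi a            ≈⟨ +-congˡ (*-congʳ (+-congˡ (^-homo-* q a (suc b)))) ⟨
      qi (suc b) + (qᵇ + qⁿ) * qi a                    ∎

  module Lucas (m′ : ℕ) (q^m≈1 : q ^ suc m′ ≈ 1#)
               (middle≈0 : ∀ j → 0 < j → j < suc m′ → bin (suc m′) j ≈ 0#) where
    m = suc m′

    bin-low : ∀ n k → k < m → bin (n ℕ.+ m) k ≈ bin n k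
    bin-low n       zero    _   = refl
    bin-low zero    (suc k) k<m = middle≈0 (suc k) (s≤s z≤n) k<m
    bin-low (suc n) (suc k) k<m =
      +-cong (bin-low n k (ℕ.<-trans (ℕ.n<1+n k) k<m)) (*-congˡ (bin-low n (suc k) k<m))

    -- Formally this is multiplication of a row by 1 + x^m: the middle entries of row m vanish, and
    -- q^m = 1 makes the powers of q in Pascal's rule agree for the indices k and m + k.
    bin-high : ∀ n k k′ → k′ ≡ m ℕ.+ k → bin (n ℕ.+ m) k′ ≈ bin n k′ + bin n k
    bin-high zero zero k′ ≡.refl = trans (bin-congʳ m (ℕ.+-identityʳ m)) (trans (bin-diag m) (sym (+-identityˡ 1#)))
    bin-high zero (suc k) k′ ≡.refl = trans (bin-above (ℕ.m<m+n m (s≤s z≤n))) (sym (+-identityˡ 0#))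
    bin-high (suc n) zero (suc k′) eq = begin
      bin (n ℕ.+ m) k′ + q ^ suc k′ * bin (n ℕ.+ m) (suc k′)
        ≈⟨ +-cong (bin-low n k′ (ℕ.≤-reflexive k′≡)) (*-congˡ (bin-high n zero (suc k′) eq)) ⟩
      bin n k′ + q ^ suc k′ * (bin n (suc k′) + 1#)
        ≈⟨ solve 3 (λ x y z → x :+ y :* (z :+ con 1) := (x :+ y :* z) :+ y) refl _ _ _ ⟩
      bin (suc n) (suc k′) + q ^ suc k′
        ≈⟨ +-congˡ (trans (reflexive (≡.cong (q ^_) k′≡)) q^m≈1) ⟩
      bin (suc n) (suc k′) + 1# ∎
      where
      k′≡ : suc k′ ≡ m
      k′≡ = ≡.trans eq (ℕ.+-identityʳ m)
    bin-high (suc n) (suc k) (suc k′) eq = begin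
      bin (n ℕ.+ m) k′ + q ^ suc k′ * bin (n ℕ.+ m) (suc k′)
        ≈⟨ +-cong (bin-high n k k′ (ℕ.suc-injective (≡.trans eq (ℕ.+-suc m k)))) (*-congˡ (bin-high n (suc k) (suc k′) eq)) ⟩
      (bin n k′ + bin n k) + q ^ suc k′ * (bin n (suc k′) + bin n (suc k))
        ≈⟨ solve 5 (λ x y z u v → (x :+ y) :+ z :* (u :+ v) := (x :+ z :* u) :+ (y :+ z :* v)) refl _ _ _ _ _ ⟩
      bin (suc n) (suc k′) + (bin n k + q ^ suc k′ * bin n (suc k))
        ≈⟨ +-congˡ (+-congˡ (*-congʳ period)) ⟩
      bin (suc n) (suc k′) + bin (suc n) (suc k) ∎
      where
      period : q ^ suc k′ ≈ q ^ suc k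
      period = trans (reflexive (≡.cong (q ^_) eq)) (trans (^-homo-* q m (suc k))
        (trans (*-congʳ q^m≈1) (*-identityˡ _)))

    -- Raising X by one passes from row n to row n + m. There `bin-high` becomes the ordinary Pascal
    -- rule for the quotients, while the residues a and b stay fixed.
    lucas : ∀ X Y a b → a < m → b < m →
      bin (X ℕ.* m ℕ.+ a) (Y ℕ.* m ℕ.+ b) ≈ ((X C Y) × 1#) * bin a b
    lucas zero zero a b a<m b<m = solve 1 (λ x → x := (con 1 :+ con 0) :* x) refl (bin a b)
    lucas zero (suc Y) a b a<m b<m = begin
      bin a (suc Y ℕ.* m ℕ.+ b)  ≈⟨ bin-above (ℕ.<-≤-trans a<m (ℕ.≤-trans (ℕ.m≤m+n m (Y ℕ.* m)) (ℕ.m≤m+n _ b))) ⟩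
      0#                         ≈⟨ zeroˡ _ ⟨
      0# * bin a b               ≡⟨ ≡.cong (λ z → (z × 1#) * bin a b) (k>n⇒nCk≡0 {0} {suc Y} (s≤s z≤n)) ⟨
      ((0 C suc Y) × 1#) * bin a b ∎
    lucas (suc X) zero a b a<m b<m = begin
      bin (suc X ℕ.* m ℕ.+ a) b          ≈⟨ bin-congˡ b (reorder X m a) ⟩
      bin ((X ℕ.* m ℕ.+ a) ℕ.+ m) b      ≈⟨ bin-low (X ℕ.* m ℕ.+ a) b b<m ⟩
      bin (X ℕ.* m ℕ.+ a) b              ≈⟨ lucas X zero a b a<m b<m ⟩
      ((X C 0) × 1#) * bin a b           ∎
      where
      reorder : ∀ X m a → suc X ℕ.* m ℕ.+ a ≡ (X ℕ.* m ℕ.+ a) ℕ.+ m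
      reorder = ℕ-solve-∀
    lucas (suc X) (suc Y) a b a<m b<m = begin
      bin (suc X ℕ.* m ℕ.+ a) (suc Y ℕ.* m ℕ.+ b)
        ≈⟨ bin-congˡ (suc Y ℕ.* m ℕ.+ b) (reorder X m a) ⟩
      bin ((X ℕ.* m ℕ.+ a) ℕ.+ m) (suc Y ℕ.* m ℕ.+ b)
        ≈⟨ bin-high (X ℕ.* m ℕ.+ a) (Y ℕ.* m ℕ.+ b) _ (ℕ.+-assoc m (Y ℕ.* m) b) ⟩
      bin (X ℕ.* m ℕ.+ a) (suc Y ℕ.* m ℕ.+ b) + bin (X ℕ.* m ℕ.+ a) (Y ℕ.* m ℕ.+ b)
        ≈⟨ +-cong (lucas X (suc Y) a b a<m b<m) (lucas X Y a b a<m b<m) ⟩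
      ((X C suc Y) × 1#) * bin a b + ((X C Y) × 1#) * bin a b
        ≈⟨ solve 3 (λ x y b → x :* b :+ y :* b := (y :+ x) :* b) refl ((X C suc Y) × 1#) ((X C Y) × 1#) (bin a b) ⟩
      ((X C Y) × 1# + (X C suc Y) × 1#) * bin a b
        ≈⟨ *-congʳ (×-homo-+ 1# (X C Y) (X C suc Y)) ⟨
      ((X C Y ℕ.+ X C suc Y) × 1#) * bin a b
        ≡⟨ ≡.cong (λ z → (z × 1#) * bin a b) (nCk+nC[k+1]≡[n+1]C[k+1] X Y) ⟩
      ((suc X C suc Y) × 1#) * bin a b ∎
      where
      reorder : ∀ X m a → suc X ℕ.* m ℕ.+ a ≡ (X ℕ.* m ℕ.+ a) ℕ.+ m
      reorder = ℕ-solve-∀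

  bin-cong : ∀ n k {n′ k′} → n ≡ n′ → k ≡ k′ → bin n k ≈ bin n′ k′
  bin-cong n k ≡.refl ≡.refl = refl

  module Evaluation (m′ : ℕ) (q^m≈1 : q ^ suc m′ ≈ 1#)
               (middle≈0 : ∀ j → 0 < j → j < suc m′ → bin (suc m′) j ≈ 0#) where
    open Lucas m′ q^m≈1 middle≈0

    1^ : ∀ n → 1# ^ n ≈ 1#
    1^ zero    = refl
    1^ (suc n) = trans (*-identityˡ _) (1^ n)

    power-period : ∀ X → q ^ (X ℕ.* m) ≈ 1#
    power-period X = begin
      q ^ (X ℕ.* m)   ≡⟨ ≡.cong (q ^_) (ℕ.*-comm X m) ⟩
      q ^ (m ℕ.* X)   ≈⟨ ^-assocʳ q m X ⟨
      (q ^ m) ^ X     ≈⟨ ^-congˡ X q^m≈1 ⟩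
      1# ^ X          ≈⟨ 1^ X ⟩
      1#              ∎

    -- The subtraction in the definition is moved to the other side, so that the evaluations below
    -- can be made with natural multiples of 1 and the solver for semirings.
    fₙₖ-split : ∀ a b → let n = suc a ℕ.+ suc b in
      fₙₖ (suc a) b + ((bin n (suc b) * (q ^ suc b + q ^ n)) * bin (top (suc a) b) a + (q * bin n b) * bin (top (suc a) b) a)
        ≈ bin n (suc b) * bin (top (suc a) b) (suc a)
    fₙₖ-split a b = x-y+y≈x _ _

    -- The residues are 0 above and y > 0 below, and `bin 0 y` is 0.
    lucas₀ : ∀ X Y y n k → n ≡ X ℕ.* m → k ≡ Y ℕ.* m ℕ.+ y → 0 < y → y < m → bin n k ≈ 0#
    lucas₀ X Y (suc y) n k n≡ k≡ _ y<m = begin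
      bin n k                                        ≈⟨ bin-cong n k (≡.trans n≡ (≡.sym (ℕ.+-identityʳ (X ℕ.* m)))) k≡ ⟩
      bin (X ℕ.* m ℕ.+ 0) (Y ℕ.* m ℕ.+ suc y)        ≈⟨ lucas X Y 0 (suc y) (s≤s z≤n) y<m ⟩
      ((X C Y) × 1#) * 0#                            ≈⟨ zeroʳ _ ⟩
      0#                                             ∎

    lucas₁ : ∀ X Y a b n k → n ≡ X ℕ.* m ℕ.+ a → k ≡ Y ℕ.* m ℕ.+ b → a < m → b < m → bin a b ≈ 1# →
      bin n k ≈ (X C Y) × 1#
    lucas₁ X Y a b n k n≡ k≡ a<m b<m one = begin
      bin n k                                        ≈⟨ bin-cong n k n≡ k≡ ⟩
      bin (X ℕ.* m ℕ.+ a) (Y ℕ.* m ℕ.+ b)            ≈⟨ lucas X Y a b a<m b<m ⟩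
      ((X C Y) × 1#) * bin a b                       ≈⟨ *-congˡ one ⟩
      ((X C Y) × 1#) * 1#                            ≈⟨ *-identityʳ _ ⟩
      (X C Y) × 1#                                   ∎

    -- Each term of the explicit formula has a factor `bin n b` or `bin n (suc b)`. Here m divides n
    -- but neither b nor b + 1, so both factors vanish.
    fₙₖ-vanishes : ∀ a b X Y y → a ℕ.+ suc b ≡ X ℕ.* m → b ≡ Y ℕ.* m ℕ.+ suc y → suc (suc y) < m → fₙₖ a b ≈ 0#
    -- For a = 0 the hypotheses on b + 1 contradict each other; the contradiction is used in the
    -- form 1 = `bin (suc b) (suc b)` = 0.
    fₙₖ-vanishes zero b X Y y n≡ b≡ y<m = begin
      1#                         ≈⟨ bin-diag (suc b) ⟨
      bin (suc b) (suc b)        ≈⟨ lucas₀ X Y (suc (suc y)) (suc b) (suc b) n≡ (≡.trans (≡.cong suc b≡) (≡.sym (ℕ.+-suc _ _))) (s≤s z≤n) y<m ⟩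
      0#                         ∎
    fₙₖ-vanishes (suc a) b X Y y n≡ b≡ y<m = +-cancelʳ _ _ _ (begin
      _ ≈⟨ fₙₖ-split a b ⟩
      bin n (suc b) * D₁ ≈⟨ trans (*-congʳ z₁) (zeroˡ _) ⟩
      0# ≈⟨ solve 3 (λ x y z → con 0 := con 0 :+ ((con 0 :* x) :* y :+ (z :* con 0) :* y)) refl (q ^ suc b + q ^ n) D₀ q ⟩
      0# + ((0# * (q ^ suc b + q ^ n)) * D₀ + (q * 0#) * D₀)
        ≈⟨ +-congˡ (+-cong (*-congʳ (*-congʳ z₁)) (*-congʳ (*-congˡ z₀))) ⟨
      _ ∎)
      where
      n = suc a ℕ.+ suc b
      D₀ = bin (top (suc a) b) a
      D₁ = bin (top (suc a) b) (suc a)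
      z₁ : bin n (suc b) ≈ 0#
      z₁ = lucas₀ X Y (suc (suc y)) n (suc b) n≡ (≡.trans (≡.cong suc b≡) (≡.sym (ℕ.+-suc _ _))) (s≤s z≤n) y<m
      z₀ : bin n b ≈ 0#
      z₀ = lucas₀ X Y (suc y) n b n≡ b≡ (s≤s z≤n) (ℕ.<-trans (ℕ.n<1+n _) y<m)

    -- The case k ≡ 1 modulo m ≥ 3, in which `bin n b` survives. The number n - k of edges is ≡ -1
    -- and b ≡ 0, so in the other factor the upper index has residue m - 3 and the lower one m - 2;
    -- hence that factor vanishes.
    fₙₖ-vanishes′ : ∀ Y Z m″ → m′ ≡ suc (suc m″) → fₙₖ (Z ℕ.* m ℕ.+ m′) (Y ℕ.* m) ≈ 0#
    fₙₖ-vanishes′ Y Z m″ ≡.refl = trans (reflexive (≡.cong (λ x → fₙₖ x (Y ℕ.* m)) (ℕ.+-suc (Z ℕ.* m) (suc m″)))) (+-cancelʳ _ _ _ (begin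
      _ ≈⟨ fₙₖ-split a b ⟩
      bin n (suc b) * D₁ ≈⟨ trans (*-congʳ z₁) (zeroˡ _) ⟩
      0# ≈⟨ solve 3 (λ x y z → con 0 := con 0 :+ ((con 0 :* x) :* con 0 :+ (z :* y) :* con 0)) refl (q ^ suc b + q ^ n) (bin n b) q ⟩
      0# + ((0# * (q ^ suc b + q ^ n)) * 0# + (q * bin n b) * 0#)
        ≈⟨ +-congˡ (+-cong (*-cong (*-congʳ z₁) z₀) (*-congˡ z₀)) ⟨
      _ ∎))
      where
      a = Z ℕ.* m ℕ.+ suc m″
      b = Y ℕ.* m
      n = suc a ℕ.+ suc b
      D₀ = bin (top (suc a) b) a
      D₁ = bin (top (suc a) b) (suc a)
      arith₁ : ∀ Y Z m″ → suc (Z ℕ.* suc (suc (suc m″)) ℕ.+ suc m″) ℕ.+ suc (Y ℕ.* suc (suc (suc m″))) ≡ (Y ℕ.+ suc Z) ℕ.* suc (suc (suc m″))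
      arith₁ = ℕ-solve-∀
      arith₂ : ∀ Y Z m″ → 3 ℕ.* suc (Z ℕ.* suc (suc (suc m″)) ℕ.+ suc m″) ℕ.+ Y ℕ.* suc (suc (suc m″)) ≡ (3 ℕ.* Z ℕ.+ Y ℕ.+ 2) ℕ.* suc (suc (suc m″)) ℕ.+ m″
      arith₂ = ℕ-solve-∀
      z₁ : bin n (suc b) ≈ 0#
      z₁ = lucas₀ (Y ℕ.+ suc Z) Y 1 n (suc b) (arith₁ Y Z m″) (≡.sym (ℕ.+-comm b 1)) (s≤s z≤n) (s≤s (s≤s z≤n))
      z₀ : D₀ ≈ 0#
      z₀ = begin
        bin (top (suc a) b) a   ≈⟨ bin-congˡ a (arith₂ Y Z m″) ⟩
        bin ((3 ℕ.* Z ℕ.+ Y ℕ.+ 2) ℕ.* m ℕ.+ m″) a  ≈⟨ lucas (3 ℕ.* Z ℕ.+ Y ℕ.+ 2) Z m″ (suc m″) (ℕ.≤-trans (ℕ.n≤1+n _) (ℕ.n≤1+n _)) (ℕ.n≤1+n _) ⟩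
        _ * bin m″ (suc m″)     ≈⟨ *-congˡ (bin-above (ℕ.n<1+n m″)) ⟩
        _ * 0#                  ≈⟨ zeroʳ _ ⟩
        0# ∎

    -- t is the contribution of the q-binomial with lower index k - 1; it is 0 unless m = 1.
    fₙₖ-value : ∀ A B a b t c → suc a ≡ suc A ℕ.* m → suc b ≡ suc B ℕ.* m →
      q * bin (suc a ℕ.+ suc b) b ≈ t × 1# →
      let n = suc A ℕ.+ suc B ; N = 3 ℕ.* suc A ℕ.+ B in
      c ℕ.+ (2 ℕ.* (n C suc B) ℕ.+ t) ℕ.* (N C A) ≡ (n C suc B) ℕ.* (N C suc A) →
      fₙₖ (suc a) b ≈ c × 1#
    fₙₖ-value A B a b t c a≡ b≡ n≈t c≡ = +-cancelʳ sub _ _ (begin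
      fₙₖ (suc a) b + sub                          ≈⟨ fₙₖ-split a b ⟩
      bin n (suc b) * bin (top (suc a) b) (suc a)  ≈⟨ *-cong B₁≈ D₁≈ ⟩
      (x × 1#) * (z × 1#)                          ≈⟨ ×1-homo-* x z ⟨
      (x ℕ.* z) × 1#                               ≡⟨ ≡.cong (_× 1#) c≡ ⟨
      (c ℕ.+ (2 ℕ.* x ℕ.+ t) ℕ.* y) × 1#           ≈⟨ ×-homo-+ 1# c ((2 ℕ.* x ℕ.+ t) ℕ.* y) ⟩
      c × 1# + ((2 ℕ.* x ℕ.+ t) ℕ.* y) × 1#        ≈⟨ +-congˡ (×1-homo-* (2 ℕ.* x ℕ.+ t) y) ⟩
      c × 1# + ((2 ℕ.* x ℕ.+ t) × 1#) * (y × 1#)   ≈⟨ +-congˡ (*-congʳ (trans (×-homo-+ 1# (2 ℕ.* x) t) (+-congʳ (×1-homo-* 2 x)))) ⟩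
      c × 1# + ((2 × 1#) * (x × 1#) + t × 1#) * (y × 1#)
        ≈⟨ solve 4 (λ c x t y → c :+ ((con 1 :+ (con 1 :+ con 0)) :* x :+ t) :* y := c :+ ((x :* (con 1 :+ con 1)) :* y :+ t :* y)) refl (c × 1#) (x × 1#) (t × 1#) (y × 1#) ⟩
      c × 1# + (((x × 1#) * (1# + 1#)) * (y × 1#) + (t × 1#) * (y × 1#))
        ≈⟨ +-congˡ (+-cong (*-cong (*-cong B₁≈ (+-cong qᵇ≈ qⁿ≈)) D₀≈) (*-cong n≈t D₀≈)) ⟨
      c × 1# + sub                                 ∎)
      where
      n = suc a ℕ.+ suc b
      sub = (bin n (suc b) * (q ^ suc b + q ^ n)) * bin (top (suc a) b) a + (q * bin n b) * bin (top (suc a) b) a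
      x = (suc A ℕ.+ suc B) C suc B
      y = (3 ℕ.* suc A ℕ.+ B) C A
      z = (3 ℕ.* suc A ℕ.+ B) C suc A
      pred : ∀ {a A} → suc a ≡ suc A ℕ.* m → a ≡ A ℕ.* m ℕ.+ m′
      pred {a} {A} e = ≡.trans (ℕ.suc-injective e) (ℕ.+-comm m′ (A ℕ.* m))
      n≡ : n ≡ (suc A ℕ.+ suc B) ℕ.* m
      n≡ = ≡.trans (≡.cong₂ ℕ._+_ a≡ b≡) (≡.sym (ℕ.*-distribʳ-+ m (suc A) (suc B)))
      arith : ∀ A B m′ → 3 ℕ.* (suc A ℕ.* suc m′) ℕ.+ (B ℕ.* suc m′ ℕ.+ m′) ≡ (3 ℕ.* suc A ℕ.+ B) ℕ.* suc m′ ℕ.+ m′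
      arith = ℕ-solve-∀
      -- The upper index has residue m - 1 because `suc a` ≡ 0 and b ≡ -1. The lower index a also
      -- has residue m - 1, so the residual binomial in `D₀≈` is 1.
      N≡ : top (suc a) b ≡ (3 ℕ.* suc A ℕ.+ B) ℕ.* m ℕ.+ m′
      N≡ = ≡.trans (≡.cong₂ (λ u v → 3 ℕ.* u ℕ.+ v) a≡ (pred {b} {B} b≡)) (arith A B m′)
      B₁≈ : bin n (suc b) ≈ x × 1#
      B₁≈ = lucas₁ (suc A ℕ.+ suc B) (suc B) 0 0 n (suc b) (≡.trans n≡ (≡.sym (ℕ.+-identityʳ _))) (≡.trans b≡ (≡.sym (ℕ.+-identityʳ _))) (s≤s z≤n) (s≤s z≤n) refl
      D₁≈ : bin (top (suc a) b) (suc a) ≈ z × 1#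
      D₁≈ = lucas₁ (3 ℕ.* suc A ℕ.+ B) (suc A) m′ 0 _ _ N≡ (≡.trans a≡ (≡.sym (ℕ.+-identityʳ _))) ℕ.≤-refl (s≤s z≤n) refl
      D₀≈ : bin (top (suc a) b) a ≈ y × 1#
      D₀≈ = lucas₁ (3 ℕ.* suc A ℕ.+ B) A m′ m′ _ _ N≡ (pred {a} {A} a≡) ℕ.≤-refl ℕ.≤-refl (bin-diag m′)
      qᵇ≈ : q ^ suc b ≈ 1#
      qᵇ≈ = trans (reflexive (≡.cong (q ^_) b≡)) (power-period (suc B))
      qⁿ≈ : q ^ n ≈ 1#
      qⁿ≈ = trans (reflexive (≡.cong (q ^_) n≡)) (power-period (suc A ℕ.+ suc B))

    -- For m > 1 the index b ≡ -1 is nonzero modulo m while m divides n, so the term with `bin n b`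
    -- drops out and t = 0.
    fₙₖ-value-divisible : ∀ A B a b c → 0 < m′ → suc a ≡ suc A ℕ.* m → suc b ≡ suc B ℕ.* m →
      let n = suc A ℕ.+ suc B ; N = 3 ℕ.* suc A ℕ.+ B in
      c ℕ.+ (2 ℕ.* (n C suc B) ℕ.+ 0) ℕ.* (N C A) ≡ (n C suc B) ℕ.* (N C suc A) →
      fₙₖ (suc a) b ≈ c × 1#
    fₙₖ-value-divisible A B a b c 0<m′ a≡ b≡ = fₙₖ-value A B a b 0 c a≡ b≡
      (trans (*-congˡ (lucas₀ (suc A ℕ.+ suc B) B m′ _ b
        (≡.trans (≡.cong₂ ℕ._+_ a≡ b≡) (≡.sym (ℕ.*-distribʳ-+ m (suc A) (suc B))))
        (≡.trans (ℕ.suc-injective b≡) (ℕ.+-comm m′ (B ℕ.* m))) 0<m′ ℕ.≤-refl)) (zeroʳ q))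

    -- For m = 1 the relation q^m = 1 reads q = 1, and all binomials become ordinary ones.
    fₙₖ-value-one : ∀ A B c → m′ ≡ 0 →
      let n = suc A ℕ.+ suc B ; N = 3 ℕ.* suc A ℕ.+ B in
      c ℕ.+ (2 ℕ.* (n C suc B) ℕ.+ (n C B)) ℕ.* (N C A) ≡ (n C suc B) ℕ.* (N C suc A) →
      fₙₖ (suc A) B ≈ c × 1#
    fₙₖ-value-one A B c ≡.refl = fₙₖ-value A B A B _ c (≡.sym (ℕ.*-identityʳ _)) (≡.sym (ℕ.*-identityʳ _))
      (trans (*-cong (trans (sym (*-identityʳ q)) q^m≈1) (lucas₁ (suc A ℕ.+ suc B) B 0 0 _ B (e (suc A ℕ.+ suc B)) (e B) (s≤s z≤n) (s≤s z≤n) refl))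
             (*-identityˡ _))
      where
      e : ∀ x → x ≡ x ℕ.* 1 ℕ.+ 0
      e = ℕ-solve-∀

    -- Since n is even and k odd, `bin n k` vanishes and only the term - q `bin n b` D₀ remains. The
    -- relation `bin 2 1` = 0 says 1 + q = 0, which removes the sign.
    fₙₖ-value-odd : ∀ Y Z → m′ ≡ 1 → fₙₖ (suc (Z ℕ.* 2)) (Y ℕ.* 2) ≈ (((Z ℕ.+ suc Y) C Y) ℕ.* ((3 ℕ.* Z ℕ.+ Y ℕ.+ 1) C Z)) × 1#
    fₙₖ-value-odd Y Z ≡.refl = +-cancelʳ (q * v) _ _ (begin
      fₙₖ (suc a) b + q * v
        ≈⟨ solve 4 (λ f q v x → f :+ q :* v := f :+ ((con 0 :* x) :* con 0 :+ q :* v)) refl _ q v (q ^ suc b + q ^ n) ⟩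
      fₙₖ (suc a) b + ((0# * (q ^ suc b + q ^ n)) * 0# + q * v)
        ≈⟨ +-congˡ (+-cong (trans (*-congʳ (trans (*-congʳ z₁) (zeroˡ _))) (trans (zeroˡ _) (sym (zeroʳ _))))
                           (trans (*-assoc q _ _) (*-congˡ v≈))) ⟨
      fₙₖ (suc a) b + ((bin n (suc b) * (q ^ suc b + q ^ n)) * bin (top (suc a) b) a + (q * bin n b) * bin (top (suc a) b) a)
        ≈⟨ fₙₖ-split a b ⟩
      bin n (suc b) * bin (top (suc a) b) (suc a) ≈⟨ trans (*-congʳ z₁) (zeroˡ _) ⟩
      0#                  ≈⟨ trans (*-congʳ (middle≈0 1 (s≤s z≤n) (s≤s (s≤s z≤n)))) (zeroˡ v) ⟨
      (1# + (q ^ 1) * (1# + q ^ 1 * 0#)) * v ≈⟨ solve 2 (λ q v → (con 1 :+ (q :* con 1) :* (con 1 :+ (q :* con 1) :* con 0)) :* v := v :+ q :* v) refl q v ⟩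
      v + q * v           ∎)
      where
      a = Z ℕ.* 2
      b = Y ℕ.* 2
      n = suc a ℕ.+ suc b
      v = (((Z ℕ.+ suc Y) C Y) ℕ.* ((3 ℕ.* Z ℕ.+ Y ℕ.+ 1) C Z)) × 1#
      arith₁ : ∀ Y Z → suc (Z ℕ.* 2) ℕ.+ suc (Y ℕ.* 2) ≡ (Z ℕ.+ suc Y) ℕ.* 2
      arith₁ = ℕ-solve-∀
      arith₂ : ∀ Y Z → 3 ℕ.* suc (Z ℕ.* 2) ℕ.+ Y ℕ.* 2 ≡ (3 ℕ.* Z ℕ.+ Y ℕ.+ 1) ℕ.* 2 ℕ.+ 1
      arith₂ = ℕ-solve-∀
      z₁ : bin n (suc b) ≈ 0#
      z₁ = lucas₀ (Z ℕ.+ suc Y) Y 1 n (suc b) (arith₁ Y Z) (≡.sym (ℕ.+-comm b 1)) (s≤s z≤n) (s≤s (s≤s z≤n))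
      v≈ : bin n b * bin (top (suc a) b) a ≈ v
      v≈ = trans (*-cong
        (lucas₁ (Z ℕ.+ suc Y) Y 0 0 n b (≡.trans (arith₁ Y Z) (≡.sym (ℕ.+-identityʳ _))) (≡.sym (ℕ.+-identityʳ _)) (s≤s z≤n) (s≤s z≤n) refl)
        (lucas₁ (3 ℕ.* Z ℕ.+ Y ℕ.+ 1) Z 1 0 _ a (arith₂ Y Z) (≡.sym (ℕ.+-identityʳ _)) (s≤s (s≤s z≤n)) (s≤s z≤n) refl))
        (sym (×1-homo-* ((Z ℕ.+ suc Y) C Y) _))

-- Evaluation at primitive roots of unity by divisibility.

module RootsOfUnity where
  open import Defs
  open PolynomialRing using (coef; _≋_; mk≋; at; ≋⇒≈; X∷; X∷-*; *-∷; coef--; polyRing)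

  open import Algebra.Bundles using (CommutativeRing)
  open import Data.Nat as ℕ using (ℕ; zero; suc; _<_; _≤_; s≤s; z≤n; _∸_)
  import Data.Nat.Properties as ℕ
  open import Data.Nat.Divisibility using (_∣_; divides; ∣⇒≤; ∣m∣n⇒∣m+n; ∣-refl; _∣0; _∣?_)
  open import Data.Integer as ℤ using (ℤ; +_)
  import Data.Integer.Properties as ℤ
  open import Data.List using ([]; _∷_; filter; upTo; foldr; drop)
  open import Data.List.Membership.Propositional using (_∈_)
  open import Data.List.Membership.Propositional.Properties using (∈-filter⁺; ∈-applyUpTo⁺)
  open import Data.List.Relation.Unary.Any using (here; there)
  open import Data.Product using (∃; _×_; _,_)
  open import Data.Sum using (inj₁; inj₂)
  open import Level using (_⊔_)
  open import Relation.Binary.PropositionalEquality as ≡ using (_≡_)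

  -- The quotient of R by the ideal { x | P divides x D }.
  module ColonIdeal {c ℓ} (R : CommutativeRing c ℓ) (P D : CommutativeRing.Carrier R) where
    open CommutativeRing R
    open import Algebra.Properties.Ring ring using (-‿distribʳ-*; -‿distribˡ-*; -‿+-comm)
    open import Algebra.Solver.Ring.NaturalCoefficients.Default commutativeSemiring
    open import Relation.Binary.Reasoning.Setoid setoid

    infix 4 _∼_
    -- The equation says that P divides (x - y) D. Written without subtraction it is accessible to
    -- the solver for commutative semirings.
    record _∼_ (x y : Carrier) : Set (c ⊔ ℓ) where
      constructor _by_
      field
        quotient : Carrier
        equation : P * quotient + y * D ≈ x * D

    ≈⇒∼ : ∀ {x y} → x ≈ y → x ∼ y
    ≈⇒∼ {x} {y} x≈y = 0# by (trans (solve 2 (λ p z → p :* con 0 :+ z := z) refl P (y * D)) (*-congʳ (sym x≈y)))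

    ∼-sym : ∀ {x y} → x ∼ y → y ∼ x
    ∼-sym {x} {y} (h by e) = (- h) by (begin
      P * (- h) + x * D                ≈⟨ +-cong (sym (-‿distribʳ-* P h)) (sym e) ⟩
      - (P * h) + (P * h + y * D)      ≈⟨ +-assoc _ _ _ ⟨
      (- (P * h) + P * h) + y * D      ≈⟨ trans (+-congʳ (-‿inverseˡ _)) (+-identityˡ _) ⟩
      y * D                            ∎)

    ∼-trans : ∀ {x y z} → x ∼ y → y ∼ z → x ∼ z
    ∼-trans {x} {y} {z} (h by e) (h′ by e′) = (h + h′) by (begin
      P * (h + h′) + z * D             ≈⟨ solve 4 (λ p h h′ z → p :* (h :+ h′) :+ z := p :* h :+ (p :* h′ :+ z)) refl P h h′ (z * D) ⟩
      P * h + (P * h′ + z * D)         ≈⟨ trans (+-congˡ e′) e ⟩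
      x * D                            ∎)

    ∼-+ : ∀ {x x′ y y′} → x ∼ x′ → y ∼ y′ → x + y ∼ x′ + y′
    ∼-+ {x} {x′} {y} {y′} (h by e) (k by e′) = (h + k) by (begin
      P * (h + k) + (x′ + y′) * D             ≈⟨ solve 6 (λ p h k x y d → p :* (h :+ k) :+ (x :+ y) :* d := (p :* h :+ x :* d) :+ (p :* k :+ y :* d)) refl P h k x′ y′ D ⟩
      (P * h + x′ * D) + (P * k + y′ * D)     ≈⟨ +-cong e e′ ⟩
      x * D + y * D                           ≈⟨ distribʳ D x y ⟨
      (x + y) * D                             ∎)

    ∼-* : ∀ {x x′ y y′} → x ∼ x′ → y ∼ y′ → x * y ∼ x′ * y′
    ∼-* {x} {x′} {y} {y′} (h by e) (k by e′) = (h * y + x′ * k) by (begin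
      P * (h * y + x′ * k) + (x′ * y′) * D
        ≈⟨ solve 7 (λ p h k x y z d → p :* (h :* y :+ x :* k) :+ (x :* z) :* d := p :* h :* y :+ x :* (p :* k :+ z :* d)) refl P h k x′ y y′ D ⟩
      P * h * y + x′ * (P * k + y′ * D)       ≈⟨ +-congˡ (*-congˡ e′) ⟩
      P * h * y + x′ * (y * D)                ≈⟨ solve 4 (λ a x y d → a :* y :+ x :* (y :* d) := (a :+ x :* d) :* y) refl (P * h) x′ y D ⟩
      (P * h + x′ * D) * y                    ≈⟨ *-congʳ e ⟩
      (x * D) * y                             ≈⟨ solve 3 (λ x y d → (x :* d) :* y := (x :* y) :* d) refl x y D ⟩
      (x * y) * D                             ∎)

    ∼-neg : ∀ {x y} → x ∼ y → - x ∼ - y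
    ∼-neg {x} {y} (h by e) = (- h) by (begin
      P * (- h) + (- y) * D            ≈⟨ +-cong (sym (-‿distribʳ-* P h)) (sym (-‿distribˡ-* y D)) ⟩
      - (P * h) + - (y * D)            ≈⟨ -‿+-comm _ _ ⟩
      - (P * h + y * D)                ≈⟨ -‿cong e ⟩
      - (x * D)                        ≈⟨ -‿distribˡ-* x D ⟩
      (- x) * D                        ∎)

    quotientRing : CommutativeRing c (c ⊔ ℓ)
    quotientRing = record
      { Carrier = Carrier ; _≈_ = _∼_ ; _+_ = _+_ ; _*_ = _*_ ; -_ = -_ ; 0# = 0# ; 1# = 1#
      ; isCommutativeRing = record
        { isRing = record
          { +-isAbelianGroup = record
            { isGroup = record
              { isMonoid = record
                { isSemigroup = record
                  { isMagma = record
                    { isEquivalence = record { refl = ≈⇒∼ refl ; sym = ∼-sym ; trans = ∼-trans }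
                    ; ∙-cong = ∼-+ }
                  ; assoc = λ x y z → ≈⇒∼ (+-assoc x y z) }
                ; identity = (λ x → ≈⇒∼ (+-identityˡ x)) , (λ x → ≈⇒∼ (+-identityʳ x)) }
              ; inverse = (λ x → ≈⇒∼ (-‿inverseˡ x)) , (λ x → ≈⇒∼ (-‿inverseʳ x))
              ; ⁻¹-cong = ∼-neg }
            ; comm = λ x y → ≈⇒∼ (+-comm x y) }
          ; *-cong = ∼-*
          ; *-assoc = λ x y z → ≈⇒∼ (*-assoc x y z)
          ; *-identity = (λ x → ≈⇒∼ (*-identityˡ x)) , (λ x → ≈⇒∼ (*-identityʳ x))
          ; distrib = (λ x y z → ≈⇒∼ (distribˡ x y z)) , (λ x y z → ≈⇒∼ (distribʳ x y z)) }
        ; *-comm = λ x y → ≈⇒∼ (*-comm x y) } }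

  module _ {c ℓ} (R : CommutativeRing c ℓ) (q : CommutativeRing.Carrier R) where
    open CommutativeRing R hiding (zero)
    open QBinomial R q
    open import Algebra.Properties.Ring ring using (+-cancelʳ)
    open import Algebra.Properties.Semiring.Exp semiring using (_^_)
    open import Algebra.Solver.Ring.NaturalCoefficients.Default commutativeSemiring
    open import Relation.Binary.Reasoning.Setoid setoid

    -- The Euclidean algorithm lifts to q-integers because [x + y] = [y] + q^y [x].
    bezout : ∀ fuel x y → x ℕ.+ y ≤ fuel → ∃ λ d → d ∣ x × d ∣ y × ∃ λ s → ∃ λ t → qi d ≈ s * qi x + t * qi y
    bezout fuel zero y _ = y , (y ∣0) , ∣-refl , 0# , 1# , solve 1 (λ z → z := con 0 :* con 0 :+ con 1 :* z) refl (qi y)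
    bezout fuel x@(suc _) zero _ = x , ∣-refl , (x ∣0) , 1# , 0# , solve 1 (λ z → z := con 1 :* z :+ con 0 :* con 0) refl (qi x)
    bezout (suc fuel) x@(suc x′) y@(suc y′) (s≤s x+y≤) with ℕ.≤-total x y
    ... | inj₁ x≤y with bezout fuel x (y ∸ x) (ℕ.≤-trans (ℕ.≤-reflexive (ℕ.m+[n∸m]≡n x≤y)) (ℕ.≤-trans (ℕ.m≤n+m y x′) x+y≤))
    ...   | d , d∣x , d∣z , s , t , e =
            d , d∣x , ≡.subst (d ∣_) (ℕ.m∸n+n≡m x≤y) (∣m∣n⇒∣m+n d∣z d∣x) , (s - t * q ^ (y ∸ x)) , t , (begin
              qi d                                                  ≈⟨ e ⟩
              s * qi x + t * qi (y ∸ x)                             ≈⟨ +-congʳ (*-congʳ (x-y+y≈x s (t * q ^ (y ∸ x)))) ⟨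
              (s - t * q ^ (y ∸ x) + t * q ^ (y ∸ x)) * qi x + t * qi (y ∸ x)
                ≈⟨ solve 5 (λ a t z x w → (a :+ t :* z) :* x :+ t :* w := a :* x :+ t :* (w :+ z :* x)) refl _ t _ _ _ ⟩
              (s - t * q ^ (y ∸ x)) * qi x + t * (qi (y ∸ x) + q ^ (y ∸ x) * qi x)
                ≈⟨ +-congˡ (*-congˡ (trans (sym (qi-+ (y ∸ x) x)) (reflexive (≡.cong qi (ℕ.m∸n+n≡m x≤y))))) ⟩
              (s - t * q ^ (y ∸ x)) * qi x + t * qi y               ∎)
    bezout (suc fuel) x@(suc x′) y@(suc y′) (s≤s x+y≤) | inj₂ y≤x
        with bezout fuel (x ∸ y) y (ℕ.≤-trans (ℕ.≤-reflexive (ℕ.m∸n+n≡m y≤x)) (ℕ.≤-trans (ℕ.≤-trans (ℕ.m≤m+n x y′) (ℕ.≤-reflexive (≡.sym (ℕ.+-suc x′ y′)))) x+y≤))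
    ...   | d , d∣z , d∣y , s , t , e =
            d , ≡.subst (d ∣_) (ℕ.m∸n+n≡m y≤x) (∣m∣n⇒∣m+n d∣z d∣y) , d∣y , s , (t - s * q ^ (x ∸ y)) , (begin
              qi d                                                  ≈⟨ e ⟩
              s * qi (x ∸ y) + t * qi y                             ≈⟨ +-congˡ (*-congʳ (x-y+y≈x t (s * q ^ (x ∸ y)))) ⟨
              s * qi (x ∸ y) + (t - s * q ^ (x ∸ y) + s * q ^ (x ∸ y)) * qi y
                ≈⟨ solve 5 (λ a t z x w → t :* w :+ (a :+ t :* z) :* x := t :* (w :+ z :* x) :+ a :* x) refl _ s _ _ _ ⟩
              s * (qi (x ∸ y) + q ^ (x ∸ y) * qi y) + (t - s * q ^ (x ∸ y)) * qi y
                ≈⟨ +-congʳ (*-congˡ (trans (sym (qi-+ (x ∸ y) y)) (reflexive (≡.cong qi (ℕ.m∸n+n≡m y≤x))))) ⟩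
              s * qi x + (t - s * q ^ (x ∸ y)) * qi y               ∎)

    qi-∣ : ∀ t d → ∃ λ H → qi (t ℕ.* d) ≈ qi d * H
    qi-∣ zero    d = 0# , sym (zeroʳ _)
    qi-∣ (suc t) d with qi-∣ t d
    ... | H , e = (1# + q ^ d * H) , trans (qi-+ d (t ℕ.* d)) (trans (+-congˡ (*-congˡ e))
      (solve 3 (λ x y z → x :+ y :* (x :* z) := x :* (con 1 :+ y :* z)) refl (qi d) (q ^ d) H))

    qi-power : ∀ n → (q - 1#) * qi n ≈ q ^ n - 1#
    qi-power n = +-cancelʳ 1# _ _ (trans (go n) (sym (x-y+y≈x (q ^ n) 1#)))
      where
      go : ∀ n → (q - 1#) * qi n + 1# ≈ q ^ n
      go zero    = trans (+-congʳ (zeroʳ _)) (+-identityˡ 1#)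
      go (suc n) = begin
        (q - 1#) * (1# + q * qi n) + 1#       ≈⟨ solve 3 (λ a q x → a :* (con 1 :+ q :* x) :+ con 1 := q :* (a :* x) :+ (a :+ con 1)) refl (q - 1#) q (qi n) ⟩
        q * ((q - 1#) * qi n) + (q - 1# + 1#) ≈⟨ +-congˡ (x-y+y≈x q 1#) ⟩
        q * ((q - 1#) * qi n) + q             ≈⟨ solve 2 (λ q x → q :* x :+ q := q :* (x :+ con 1)) refl q _ ⟩
        q * ((q - 1#) * qi n + 1#)            ≈⟨ *-congˡ (go n) ⟩
        q ^ suc n                             ∎

    power-factor : ∀ d H n → qi n ≈ qi d * H → (q ^ d - 1#) * H ≈ q ^ n - 1#
    power-factor d H n e = begin
      (q ^ d - 1#) * H        ≈⟨ *-congʳ (qi-power d) ⟨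
      (q - 1#) * qi d * H     ≈⟨ *-assoc _ _ _ ⟩
      (q - 1#) * (qi d * H)   ≈⟨ *-congˡ e ⟨
      (q - 1#) * qi n         ≈⟨ qi-power n ⟩
      q ^ n - 1#              ∎

  -- P plays q^m - 1 and D a common multiple of the q^d - 1 over the proper divisors d of m.
  module PrimitiveRoot {c ℓ} (R : CommutativeRing c ℓ) (q P D : CommutativeRing.Carrier R) (m′ : ℕ) where
    open CommutativeRing R hiding (zero)
    open QBinomial R q
    open import Algebra.Properties.Ring ring using (-‿distribˡ-*)
    open import Algebra.Properties.Semiring.Exp semiring using (_^_)
    open import Algebra.Properties.Semiring.Mult semiring using () renaming (_×_ to _·_)
    open import Algebra.Solver.Ring.NaturalCoefficients.Default commutativeSemiring
    open import Relation.Binary.Reasoning.Setoid setoid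
    open ColonIdeal R P D
    private
      m = suc m′
      module Q = CommutativeRing quotientRing
      module QB = QBinomial quotientRing q
    open import Algebra.Properties.Semiring.Exp Q.semiring using () renaming (_^_ to _^Q_)
    open import Algebra.Properties.Semiring.Mult Q.semiring using () renaming (_×_ to _×Q_)

    -- The quotient has the operations of R and only a coarser equality, so powers, multiples and
    -- binomials formed in either ring are the same elements.
    ^Q≡ : ∀ n → q ^Q n ≡ q ^ n
    ^Q≡ zero    = ≡.refl
    ^Q≡ (suc n) = ≡.cong (q *_) (^Q≡ n)

    ×Q≡ : ∀ n → n ×Q 1# ≡ n · 1#
    ×Q≡ zero    = ≡.refl
    ×Q≡ (suc n) = ≡.cong (λ x → 1# + x) (×Q≡ n)

    bin≡ : ∀ n k → QB.bin n k ≡ bin n k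
    bin≡ zero    zero    = ≡.refl
    bin≡ (suc n) zero    = ≡.refl
    bin≡ zero    (suc k) = ≡.refl
    bin≡ (suc n) (suc k) = ≡.cong₂ _+_ (bin≡ n k) (≡.cong₂ _*_ (^Q≡ (suc k)) (bin≡ n (suc k)))

    fₙₖ≡ : ∀ a b → QB.fₙₖ a b ≡ fₙₖ a b
    fₙₖ≡ zero    b = ≡.refl
    fₙₖ≡ (suc a) b rewrite bin≡ (suc a ℕ.+ suc b) (suc b) | bin≡ (suc a ℕ.+ suc b) b
      | bin≡ (top (suc a) b) (suc a) | bin≡ (top (suc a) b) a | ^Q≡ (suc b) | ^Q≡ (suc a ℕ.+ suc b) = ≡.refl

    module Eval (P≈ : P ≈ q ^ m - 1#)
             (qi-cancel : ∀ d x y → qi (suc d) * x ≈ qi (suc d) * y → x ≈ y)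
             (divisor-factor : ∀ d → 0 < d → d < m → d ∣ m → ∃ λ D′ → D ≈ (q ^ d - 1#) * D′) where

      q^m∼1 : q ^Q m ∼ 1#
      q^m∼1 = D by (begin
        P * D + 1# * D                ≈⟨ distribʳ D P 1# ⟨
        (P + 1#) * D                  ≈⟨ *-congʳ (+-congʳ P≈) ⟩
        ((q ^ m - 1#) + 1#) * D       ≈⟨ *-congʳ (x-y+y≈x (q ^ m) 1#) ⟩
        q ^ m * D                     ≡⟨ ≡.cong (_* D) (^Q≡ m) ⟨
        q ^Q m * D                    ∎)

      -- Let d be the common divisor of m and the lower index given by `bezout`. Writing [d] as a
      -- combination of both q-integers and absorbing gives [d] `bin m j` = [m] Z = [d] H Z, and [d]
      -- cancels. As d ≤ j < m is a proper divisor, D has a factor q^d - 1, and (q^d - 1) H = q^m -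
      -- 1 = P.
      middle∼0 : ∀ j → 0 < j → j < m → QB.bin m j ∼ 0#
      middle∼0 (suc j) _ j<m with bezout R q _ m (suc j) ℕ.≤-refl
      ... | zero , _ , divides t j≡ , _ with () ← ≡.trans j≡ (ℕ.*-zeroʳ t)
      ... | d@(suc d′) , d∣m@(divides t m≡) , d∣j , s , u , e
        with qi-∣ R q t d | divisor-factor d (s≤s z≤n) (ℕ.≤-<-trans (∣⇒≤ d∣j) j<m) d∣m
      ... | H , t≈ | D′ , D≈ = (Z * D′) by (begin
        P * (Z * D′) + 0# * D                ≈⟨ trans (+-congˡ (zeroˡ D)) (+-identityʳ _) ⟩
        P * (Z * D′)                         ≈⟨ *-congʳ (trans P≈ (sym (power-factor R q d H m m≈))) ⟩
        ((q ^ d - 1#) * H) * (Z * D′)        ≈⟨ solve 4 (λ x h z y → (x :* h) :* (z :* y) := (h :* z) :* (x :* y)) refl (q ^ d - 1#) H Z D′ ⟩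
        (H * Z) * ((q ^ d - 1#) * D′)        ≈⟨ *-cong (qi-cancel d′ (bin m (suc j)) (H * Z) dbin) D≈ ⟨
        bin m (suc j) * D                    ≡⟨ ≡.cong (_* D) (bin≡ m (suc j)) ⟨
        QB.bin m (suc j) * D                 ∎)
        where
        m≈ : qi m ≈ qi d * H
        m≈ = trans (reflexive (≡.cong qi m≡)) t≈
        Z = s * bin m (suc j) + u * bin m′ j
        dbin : qi d * bin m (suc j) ≈ qi d * (H * Z)
        dbin = begin
          qi d * bin m (suc j)                                         ≈⟨ *-congʳ e ⟩
          (s * qi m + u * qi (suc j)) * bin m (suc j)                  ≈⟨ solve 5 (λ s x u y b → (s :* x :+ u :* y) :* b := s :* x :* b :+ u :* (y :* b)) refl s (qi m) u (qi (suc j)) (bin m (suc j)) ⟩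
          s * qi m * bin m (suc j) + u * (qi (suc j) * bin m (suc j))  ≈⟨ +-congˡ (*-congˡ (absorption m′ j)) ⟩
          s * qi m * bin m (suc j) + u * (qi m * bin m′ j)             ≈⟨ solve 5 (λ s x b u c → s :* x :* b :+ u :* (x :* c) := x :* (s :* b :+ u :* c)) refl s (qi m) (bin m (suc j)) u (bin m′ j) ⟩
          qi m * Z                                                     ≈⟨ *-congʳ m≈ ⟩
          (qi d * H) * Z                                               ≈⟨ *-assoc (qi d) H Z ⟩
          qi d * (H * Z)                                               ∎

      open QBinomial.Evaluation quotientRing q m′ q^m∼1 middle∼0 public

    divides-difference : ∀ a b c → QB.fₙₖ a b ∼ (c ×Q 1#) → ∃ λ h → P * h ≈ (fₙₖ a b - c · 1#) * D
    divides-difference a b c (h by e) = h , (begin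
      P * h                                         ≈⟨ +-identityʳ _ ⟨
      P * h + 0#                                    ≈⟨ +-congˡ (-‿inverseʳ (k * D)) ⟨
      P * h + (k * D - k * D)                       ≈⟨ +-assoc (P * h) _ _ ⟨
      (P * h + k * D) - k * D                       ≡⟨ ≡.cong (λ k′ → (P * h + k′ * D) - k * D) (×Q≡ c) ⟨
      (P * h + (c ×Q 1#) * D) - k * D               ≈⟨ +-congʳ e ⟩
      QB.fₙₖ a b * D - k * D                        ≡⟨ ≡.cong (λ f → f * D - k * D) (fₙₖ≡ a b) ⟩
      fₙₖ a b * D - k * D                           ≈⟨ +-congˡ (-‿distribˡ-* k D) ⟩
      fₙₖ a b * D + (- k) * D                       ≈⟨ distribʳ D (fₙₖ a b) (- k) ⟨
      (fₙₖ a b - k) * D                             ∎)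
      where k = c · 1#

  module S = CommutativeRing polyRing
  open import Algebra.Properties.Semiring.Exp S.semiring using (_^_)
  open import Algebra.Properties.Semiring.Mult S.semiring using () renaming (_×_ to _×ₚ_)
  open import Relation.Binary.Reasoning.Setoid S.setoid

  𝐪 : Poly
  𝐪 = X∷ oneₚ

  open QBinomial polyRing 𝐪

  X∷-cong : ∀ {p r} → p ≋ r → X∷ p ≋ X∷ r
  X∷-cong h = mk≋ λ { zero → ≡.refl ; (suc i) → at h i }

  𝐪* : ∀ p → 𝐪 *ₚ p ≋ X∷ p
  𝐪* p = S.trans (X∷-* oneₚ p) (X∷-cong (S.*-identityˡ p))

  shift≋ : ∀ e p → shiftₚ e p ≋ 𝐪 ^ e *ₚ p
  shift≋ zero    p = S.sym (S.*-identityˡ p)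
  shift≋ (suc e) p = S.trans (X∷-cong (shift≋ e p)) (S.trans (S.sym (𝐪* (𝐪 ^ e *ₚ p))) (S.sym (S.*-assoc 𝐪 (𝐪 ^ e) p)))

  qpow≋ : ∀ e → qpowMinusOne e ≋ 𝐪 ^ e S.- oneₚ
  qpow≋ e = S.+-congʳ { -ₚ oneₚ} {shiftₚ e oneₚ} {𝐪 ^ e} (S.trans (shift≋ e oneₚ) (S.*-identityʳ (𝐪 ^ e)))

  qint≋ : ∀ n → qint n ≋ qi n
  qint≋ zero    = S.refl
  qint≋ (suc n) = S.trans {j = oneₚ +ₚ X∷ (qi n)} (mk≋ λ { zero → ≡.refl ; (suc i) → at (qint≋ n) i })
    (S.+-congˡ {oneₚ} {X∷ (qi n)} {𝐪 *ₚ qi n} (S.sym (𝐪* (qi n))))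

  qbinom≋ : ∀ n k → qbinom n k ≋ bin n k
  qbinom≋ zero    zero    = S.refl
  qbinom≋ (suc n) zero    = S.refl
  qbinom≋ zero    (suc k) = S.refl
  qbinom≋ (suc n) (suc k) = S.+-cong {qbinom n k} {bin n k} {shiftₚ (suc k) (qbinom n (suc k))} {𝐪 ^ suc k *ₚ bin n (suc k)}
    (qbinom≋ n k)
    (S.trans (shift≋ (suc k) (qbinom n (suc k))) (S.*-congˡ {𝐪 ^ suc k} {qbinom n (suc k)} {bin n (suc k)} (qbinom≋ n (suc k))))

  -- The coefficient 1 is the one of lowest degree, so the coefficients of x vanish one after the
  -- other, as for power series.
  cancel-monic : ∀ p x → (∀ i → coef ((ℤ.1ℤ ∷ p) *ₚ x) i ≡ ℤ.0ℤ) → ∀ i → coef x i ≡ ℤ.0ℤ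
  cancel-monic p []      h i = ≡.refl
  cancel-monic p (a ∷ x) h = go
    where
    a≡0 : a ≡ ℤ.0ℤ
    a≡0 = ≡.trans (≡.sym (≡.trans (ℤ.+-identityʳ _) (ℤ.*-identityˡ a))) (h 0)
    go : ∀ i → coef (a ∷ x) i ≡ ℤ.0ℤ
    go zero    = a≡0
    go (suc i) = cancel-monic p x (λ j → ≡.trans (≡.sym (≡.trans (*-∷ (ℤ.1ℤ ∷ p) a x (suc j))
      (≡.trans (≡.cong (λ z → z ℤ.* coef p j ℤ.+ coef ((ℤ.1ℤ ∷ p) *ₚ x) j) a≡0) (ℤ.+-identityˡ _)))) (h (suc j))) i

  open import Algebra.Properties.Ring S.ring using (-‿distribʳ-*)

  qi-cancel : ∀ d x y → qi (suc d) *ₚ x ≋ qi (suc d) *ₚ y → x ≋ y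
  qi-cancel d x y e = mk≋ λ i → ℤ.i-j≡0⇒i≡j _ _ (≡.trans (≡.sym (coef-- x y i))
    (cancel-monic (qint d) (x -ₚ y) (at vanish) i))
    where
    [d] = qi (suc d)
    vanish : qint (suc d) *ₚ (x -ₚ y) ≋ []
    vanish = begin
      qint (suc d) *ₚ (x -ₚ y)     ≈⟨ S.*-congʳ {x -ₚ y} {qint (suc d)} {[d]} (qint≋ (suc d)) ⟩
      [d] *ₚ (x -ₚ y)              ≈⟨ S.distribˡ [d] x (-ₚ y) ⟩
      [d] *ₚ x +ₚ [d] *ₚ (-ₚ y)    ≈⟨ S.+-cong {[d] *ₚ x} {[d] *ₚ y} {[d] *ₚ (-ₚ y)} { -ₚ ([d] *ₚ y)} e (S.sym (-‿distribʳ-* [d] y)) ⟩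
      [d] *ₚ y +ₚ -ₚ ([d] *ₚ y)    ≈⟨ S.-‿inverseʳ ([d] *ₚ y) ⟩
      []                           ∎

  foldr-factor : ∀ d xs → d ∈ xs → ∃ λ D′ →
    foldr (λ e acc → qpowMinusOne e *ₚ acc) oneₚ xs ≋ (𝐪 ^ d S.- oneₚ) *ₚ D′
  foldr-factor d (x ∷ xs) (here ≡.refl) = acc , S.*-congʳ {acc} {qpowMinusOne d} {𝐪 ^ d S.- oneₚ} (qpow≋ d)
    where acc = foldr (λ e acc → qpowMinusOne e *ₚ acc) oneₚ xs
  foldr-factor d (x ∷ xs) (there d∈xs) with foldr-factor d xs d∈xs
  ... | D′ , e = (y *ₚ D′) , (begin
    y *ₚ foldr (λ e acc → qpowMinusOne e *ₚ acc) oneₚ xs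
                       ≈⟨ S.*-congˡ {y} {_} {z *ₚ D′} e ⟩
    y *ₚ (z *ₚ D′)     ≈⟨ S.*-assoc y z D′ ⟨
    (y *ₚ z) *ₚ D′     ≈⟨ S.*-congʳ {D′} {y *ₚ z} {z *ₚ y} (S.*-comm y z) ⟩
    (z *ₚ y) *ₚ D′     ≈⟨ S.*-assoc z y D′ ⟩
    z *ₚ (y *ₚ D′)     ∎)
    where
    y = qpowMinusOne x
    z = 𝐪 ^ d S.- oneₚ

  divisor-factor : ∀ m d → 0 < d → d < m → d ∣ m → ∃ λ D′ → properDivisorProduct m ≋ (𝐪 ^ d S.- oneₚ) *ₚ D′
  divisor-factor (suc m) (suc d) _ (s≤s d<m) d∣m =
    foldr-factor (suc d) (filter (λ e → e ∣? suc m) (drop 1 (upTo (suc m)))) (∈-filter⁺ (λ e → e ∣? suc m) (∈-applyUpTo⁺ suc d<m) d∣m)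

  constant : ∀ c → c ×ₚ oneₚ ≋ constₚ (+ c)
  constant zero    = mk≋ λ { zero → ≡.refl ; (suc _) → ≡.refl }
  constant (suc c) = S.+-congˡ {oneₚ} {c ×ₚ oneₚ} {constₚ (+ c)} (constant c)

  module AtPrimitiveRoot (m′ : ℕ) where
    private
      m = suc m′
      D = properDivisorProduct m
    open PrimitiveRoot polyRing 𝐪 (qpowMinusOne m) D m′ public
    open ColonIdeal polyRing (qpowMinusOne m) D using (_∼_; quotientRing) public
    open import Algebra.Properties.Semiring.Mult (CommutativeRing.semiring quotientRing) using () renaming (_×_ to _×Q_)

    evalAtPrimRoot : ∀ a b c → QBinomial.fₙₖ quotientRing 𝐪 a b ∼ (c ×Q oneₚ) → EvalAtPrimRootIs m (fₙₖ a b) (+ c)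
    evalAtPrimRoot a b c f∼c with divides-difference a b c f∼c
    ... | h , e = h , ≋⇒≈ (qpowMinusOne m *ₚ h) ((fₙₖ a b -ₚ constₚ (+ c)) *ₚ D) (S.trans e
      (S.*-congʳ {D} {fₙₖ a b S.- c ×ₚ oneₚ} {fₙₖ a b -ₚ constₚ (+ c)}
        (S.+-congˡ {fₙₖ a b} { -ₚ (c ×ₚ oneₚ)} { -ₚ constₚ (+ c)} (S.-‿cong {c ×ₚ oneₚ} {constₚ (+ c)} (constant c)))))

    module Value = Eval (qpow≋ m) qi-cancel (divisor-factor m)

-- Trees encoding non-crossing forests, and the recurrences of their numbers.

module Pieces where
  open import Data.Fin using (zero; suc)
  open import Data.Integer as ℤ using (ℤ; +_; 0ℤ; 1ℤ)
  import Data.Integer.Properties as ℤ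
  open import Data.Integer.Tactic.RingSolver using (solve-∀)
  open import Data.List using (List; []; _∷_; _++_; map; length)
  open import Data.List.Membership.Propositional using (_∈_)
  open import Data.List.Membership.Propositional.Properties using (∈-map⁺; ∈-map⁻; ∈-++⁺ˡ; ∈-++⁺ʳ)
  open import Data.List.Relation.Unary.All as All using (All; []; _∷_)
  import Data.List.Relation.Unary.All.Properties as All
  open import Data.List.Relation.Unary.AllPairs using ([]; _∷_)
  open import Data.List.Relation.Unary.Any using (here)
  open import Data.List.Relation.Unary.Unique.Propositional using (Unique)
  import Data.List.Relation.Unary.Unique.Propositional.Properties as Unique
  open import Data.Nat as ℕ using (ℕ; zero; suc; _+_; _*_; s≤s; z≤n)
  open import Data.Nat.Combinatorics using (_C_; nCk+nC[k+1]≡[n+1]C[k+1]; k>n⇒nCk≡0)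
  import Data.Nat.Properties as ℕ
  import Data.Nat.Tactic.RingSolver as ℕ
  open import Data.Product using (_×_; _,_)
  open import Data.Vec using (Vec; []; _∷_)
  open import Function using (_∘_)
  open import Relation.Binary.PropositionalEquality

  -- A non-crossing forest on an interval whose end points are connected.  It is either a single
  -- vertex, or its first vertex o has a largest neighbour x; then `node i ms j r` records the
  -- pieces i, ms, j into which the interval [o, x] falls apart when the edge {o, x} is removed,
  -- and the piece r starting at x.
  data Piece : Set where
    leaf : Piece
    node : Piece → List Piece → Piece → Piece → Piece

  mutual
    -- number of vertices minus one
    width : Piece → ℕ
    width leaf            = 0
    width (node i ms j r) = suc (width i + order ms + width j) + width r

    order : List Piece → ℕ
    order []       = 0
    order (i ∷ f) = suc (width i) + order f

  mutual
    edges : Piece → ℕ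
    edges leaf            = 0
    edges (node i ms j r) = suc (edges i + (edges j + (edges r + edges* ms)))

    edges* : List Piece → ℕ
    edges* []      = 0
    edges* (i ∷ f) = edges i + edges* f

  mutual
    -- number of components minus one
    inner : Piece → ℕ
    inner leaf            = 0
    inner (node i ms j r) = inner i + (inner j + (inner r + comps ms))

    comps : List Piece → ℕ
    comps []      = 0
    comps (i ∷ f) = suc (inner i + comps f)

  mutual
    width≡ : ∀ i → width i ≡ edges i + inner i
    width≡ leaf            = refl
    width≡ (node i ms j r) rewrite width≡ i | order≡ ms | width≡ j | width≡ r =
      shuffle (edges i) (inner i) (edges* ms) (comps ms) (edges j) (inner j) (edges r) (inner r)
      where
      shuffle : ∀ a b c d e f g h → suc (a + b + (c + d) + (e + f)) + (g + h) ≡ suc (a + (e + (g + c))) + (b + (f + (h + d)))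
      shuffle = ℕ.solve-∀

    order≡ : ∀ f → order f ≡ edges* f + comps f
    order≡ []      = refl
    order≡ (i ∷ f) rewrite width≡ i | order≡ f = shuffle (edges i) (inner i) (edges* f) (comps f)
      where
      shuffle : ∀ a b c d → suc (a + b) + (c + d) ≡ (a + c) + suc (b + d)
      shuffle = ℕ.solve-∀

  -- A stack of p pieces and q forests is a term of I^p F^q. Taking its first member apart by I = 1
  -- + z I³ F or F = 1 + y I F gives again a stack, so that stacks have a linear recursion where
  -- single pieces have a cubic one.
  Stack : ℕ → ℕ → Set
  Stack p q = Vec Piece p × Vec (List Piece) q

  total : ∀ {A : Set} {p} → (A → ℕ) → Vec A p → ℕ
  total g []       = 0
  total g (x ∷ xs) = g x + total g xs

  edgesˢ compsˢ : ∀ {p q} → Stack p q → ℕ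
  edgesˢ (is , fs) = total edges is + total edges* fs
  compsˢ (is , fs) = total inner is + total comps fs

  push-nil : ∀ {p q} → Stack p q → Stack p (suc q)
  push-nil (is , fs) = is , [] ∷ fs

  push-cons : ∀ {p q} → Stack (suc p) (suc q) → Stack p (suc q)
  push-cons (i ∷ is , f ∷ fs) = is , (i ∷ f) ∷ fs

  push-leaf : ∀ {p q} → Stack p q → Stack (suc p) q
  push-leaf (is , fs) = leaf ∷ is , fs

  push-node : ∀ {p q} → Stack (3 + p) (suc q) → Stack (suc p) q
  push-node (i ∷ j ∷ r ∷ is , ms ∷ fs) = node i ms j r ∷ is , fs

  -- All stacks with a edges and b components in total.
  stacks : (p q a b : ℕ) → List (Stack p q)
  stacks zero    zero    zero    zero    = ([] , []) ∷ []
  stacks zero    zero    zero    (suc b) = []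
  stacks zero    zero    (suc a) b       = []
  stacks zero    (suc q) a       zero    = map push-nil (stacks zero q a zero)
  stacks zero    (suc q) a       (suc b) = map push-nil (stacks zero q a (suc b)) ++ map push-cons (stacks 1 (suc q) a b)
  stacks (suc p) q       zero    b       = map push-leaf (stacks p q zero b)
  -- A node uses up one edge and frees three pieces and a forest, so p and q grow while a drops. The
  -- recursion is well-founded for the lexicographic order of (a, b, p, q).
  stacks (suc p) q       (suc a) b       = map push-leaf (stacks p q (suc a) b) ++ map push-node (stacks (3 + p) (suc q) a b)

  edges-cons : ∀ {p q} (s : Stack (suc p) (suc q)) → edgesˢ (push-cons s) ≡ edgesˢ s
  edges-cons (i ∷ is , f ∷ fs) = shuffle (edges i) (total edges is) (edges* f) (total edges* fs)
    where
    shuffle : ∀ a b c d → b + (a + c + d) ≡ a + b + (c + d)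
    shuffle = ℕ.solve-∀

  comps-cons : ∀ {p q} (s : Stack (suc p) (suc q)) → compsˢ (push-cons s) ≡ suc (compsˢ s)
  comps-cons (i ∷ is , f ∷ fs) = shuffle (inner i) (total inner is) (comps f) (total comps fs)
    where
    shuffle : ∀ a b c d → b + (suc (a + c) + d) ≡ suc (a + b + (c + d))
    shuffle = ℕ.solve-∀

  edges-node : ∀ {p q} (s : Stack (3 + p) (suc q)) → edgesˢ (push-node s) ≡ suc (edgesˢ s)
  edges-node (i ∷ j ∷ r ∷ is , ms ∷ fs) = shuffle (edges i) (edges j) (edges r) (total edges is) (edges* ms) (total edges* fs)
    where
    shuffle : ∀ a b c d e f → suc (a + (b + (c + e))) + d + f ≡ suc (a + (b + (c + d)) + (e + f))
    shuffle = ℕ.solve-∀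

  comps-node : ∀ {p q} (s : Stack (3 + p) (suc q)) → compsˢ (push-node s) ≡ compsˢ s
  comps-node (i ∷ j ∷ r ∷ is , ms ∷ fs) = shuffle (inner i) (inner j) (inner r) (total inner is) (comps ms) (total comps fs)
    where
    shuffle : ∀ a b c d e f → a + (b + (c + e)) + d + f ≡ a + (b + (c + d)) + (e + f)
    shuffle = ℕ.solve-∀

  ∈-stacks⁺ : ∀ p q a b (s : Stack p q) → edgesˢ s ≡ a → compsˢ s ≡ b → s ∈ stacks p q a b
  ∈-stacks⁺ zero zero zero    zero    ([] , []) e c = here refl
  ∈-stacks⁺ zero zero zero    (suc b) ([] , []) e ()
  ∈-stacks⁺ zero zero (suc a) b       ([] , []) () c
  ∈-stacks⁺ zero (suc q) a zero    (is , [] ∷ fs) e c = ∈-map⁺ push-nil (∈-stacks⁺ zero q a zero (is , fs) e c)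
  ∈-stacks⁺ zero (suc q) a zero    ([] , (i ∷ f) ∷ fs) e ()
  ∈-stacks⁺ zero (suc q) a (suc b) (is , [] ∷ fs) e c = ∈-++⁺ˡ (∈-map⁺ push-nil (∈-stacks⁺ zero q a (suc b) (is , fs) e c))
  ∈-stacks⁺ zero (suc q) a (suc b) (is , (i ∷ f) ∷ fs) e c = ∈-++⁺ʳ _ (∈-map⁺ push-cons (∈-stacks⁺ 1 (suc q) a b s
      (trans (sym (edges-cons s)) e) (ℕ.suc-injective (trans (sym (comps-cons s)) c))))
    where s = i ∷ is , f ∷ fs
  ∈-stacks⁺ (suc p) q zero    b (leaf ∷ is , fs) e c = ∈-map⁺ push-leaf (∈-stacks⁺ p q zero b (is , fs) e c)
  ∈-stacks⁺ (suc p) q zero    b (node i ms j r ∷ is , fs) () c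
  ∈-stacks⁺ (suc p) q (suc a) b (leaf ∷ is , fs) e c = ∈-++⁺ˡ (∈-map⁺ push-leaf (∈-stacks⁺ p q (suc a) b (is , fs) e c))
  ∈-stacks⁺ (suc p) q (suc a) b (node i ms j r ∷ is , fs) e c = ∈-++⁺ʳ _ (∈-map⁺ push-node (∈-stacks⁺ (3 + p) (suc q) a b s
      (ℕ.suc-injective (trans (sym (edges-node s)) e)) (trans (sym (comps-node s)) c)))
    where s = i ∷ j ∷ r ∷ is , ms ∷ fs

  stacks-sound : ∀ p q a b → All (λ s → edgesˢ s ≡ a × compsˢ s ≡ b) (stacks p q a b)
  stacks-sound zero    zero    zero    zero    = (refl , refl) ∷ []
  stacks-sound zero    zero    zero    (suc b) = []
  stacks-sound zero    zero    (suc a) b       = []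
  stacks-sound zero    (suc q) a       zero    = All.map⁺ (stacks-sound zero q a zero)
  stacks-sound zero    (suc q) a       (suc b) = All.++⁺ (All.map⁺ (stacks-sound zero q a (suc b)))
    (All.map⁺ (All.map (λ {s} (e , c) → trans (edges-cons s) e , trans (comps-cons s) (cong suc c)) (stacks-sound 1 (suc q) a b)))
  stacks-sound (suc p) q       zero    b       = All.map⁺ (stacks-sound p q zero b)
  stacks-sound (suc p) q       (suc a) b       = All.++⁺ (All.map⁺ (stacks-sound p q (suc a) b))
    (All.map⁺ (All.map (λ {s} (e , c) → trans (edges-node s) (cong suc e) , trans (comps-node s) c) (stacks-sound (3 + p) (suc q) a b)))

  push-nil-injective : ∀ {p q} {s t : Stack p q} → push-nil s ≡ push-nil t → s ≡ t
  push-nil-injective refl = refl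

  push-leaf-injective : ∀ {p q} {s t : Stack p q} → push-leaf s ≡ push-leaf t → s ≡ t
  push-leaf-injective refl = refl

  push-cons-injective : ∀ {p q} {s t : Stack (suc p) (suc q)} → push-cons s ≡ push-cons t → s ≡ t
  push-cons-injective {s = i ∷ is , f ∷ fs} {i′ ∷ is′ , f′ ∷ fs′} refl = refl

  push-node-injective : ∀ {p q} {s t : Stack (3 + p) (suc q)} → push-node s ≡ push-node t → s ≡ t
  push-node-injective {s = _ ∷ _ ∷ _ ∷ _ , _ ∷ _} {_ ∷ _ ∷ _ ∷ _ , _ ∷ _} refl = refl

  stacks-unique : ∀ p q a b → Unique (stacks p q a b)
  stacks-unique zero    zero    zero    zero    = [] ∷ []
  stacks-unique zero    zero    zero    (suc b) = []
  stacks-unique zero    zero    (suc a) b       = []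
  stacks-unique zero    (suc q) a       zero    = Unique.map⁺ push-nil-injective (stacks-unique zero q a zero)
  stacks-unique zero    (suc q) a       (suc b) = Unique.++⁺
    (Unique.map⁺ push-nil-injective (stacks-unique zero q a (suc b)))
    (Unique.map⁺ push-cons-injective (stacks-unique 1 (suc q) a b)) disjoint
    where
    disjoint : ∀ {s} → s ∈ map push-nil (stacks zero q a (suc b)) × s ∈ map push-cons (stacks 1 (suc q) a b) → _
    disjoint (s∈ , s∈′) with ∈-map⁻ push-nil s∈ | ∈-map⁻ push-cons s∈′
    ... | _ , _ , refl | (_ ∷ _ , _ ∷ _) , _ , ()
  stacks-unique (suc p) q       zero    b       = Unique.map⁺ push-leaf-injective (stacks-unique p q zero b)
  stacks-unique (suc p) q       (suc a) b       = Unique.++⁺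
    (Unique.map⁺ push-leaf-injective (stacks-unique p q (suc a) b))
    (Unique.map⁺ push-node-injective (stacks-unique (3 + p) (suc q) a b)) disjoint
    where
    disjoint : ∀ {s} → s ∈ map push-leaf (stacks p q (suc a) b) × s ∈ map push-node (stacks (3 + p) (suc q) a b) → _
    disjoint (s∈ , s∈′) with ∈-map⁻ push-leaf s∈ | ∈-map⁻ push-node s∈′
    ... | _ , _ , refl | (_ ∷ _ ∷ _ ∷ _ , _ ∷ _) , _ , ()

  sumOver : ∀ {A : Set} → (A → ℤ) → List A → ℤ
  sumOver g []       = 0ℤ
  sumOver g (x ∷ xs) = g x ℤ.+ sumOver g xs

  module _ {A : Set} where
    sumOver-++ : ∀ (g : A → ℤ) xs ys → sumOver g (xs ++ ys) ≡ sumOver g xs ℤ.+ sumOver g ys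
    sumOver-++ g []       ys = sym (ℤ.+-identityˡ _)
    sumOver-++ g (x ∷ xs) ys = trans (cong (λ z → g x ℤ.+ z) (sumOver-++ g xs ys)) (sym (ℤ.+-assoc (g x) _ _))

    sumOver-map : ∀ {B : Set} (g : B → ℤ) (h : A → B) xs → sumOver g (map h xs) ≡ sumOver (g ∘ h) xs
    sumOver-map g h []       = refl
    sumOver-map g h (x ∷ xs) = cong (λ z → g (h x) ℤ.+ z) (sumOver-map g h xs)

    sumOver-cong : ∀ {g h : A → ℤ} → (∀ x → g x ≡ h x) → ∀ xs → sumOver g xs ≡ sumOver h xs
    sumOver-cong g≗h []       = refl
    sumOver-cong g≗h (x ∷ xs) = cong₂ ℤ._+_ (g≗h x) (sumOver-cong g≗h xs)

    sumOver-+ : ∀ (g h : A → ℤ) xs → sumOver (λ x → g x ℤ.+ h x) xs ≡ sumOver g xs ℤ.+ sumOver h xs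
    sumOver-+ g h []       = refl
    sumOver-+ g h (x ∷ xs) = trans (cong (λ z → (g x ℤ.+ h x) ℤ.+ z) (sumOver-+ g h xs)) (swap (g x) (h x) _ _)
      where
      swap : ∀ a b c d → (a ℤ.+ b) ℤ.+ (c ℤ.+ d) ≡ (a ℤ.+ c) ℤ.+ (b ℤ.+ d)
      swap = solve-∀

    sumOver-0 : ∀ (g : A → ℤ) → (∀ x → g x ≡ 0ℤ) → ∀ xs → sumOver g xs ≡ 0ℤ
    sumOver-0 g g≗0 []       = refl
    sumOver-0 g g≗0 (x ∷ xs) = cong₂ ℤ._+_ (g≗0 x) (sumOver-0 g g≗0 xs)

    sumOver-1 : ∀ (xs : List A) → sumOver (λ _ → 1ℤ) xs ≡ + length xs
    sumOver-1 []       = refl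
    sumOver-1 (x ∷ xs) = cong (λ z → 1ℤ ℤ.+ z) (sumOver-1 xs)

  Numbers : Set
  Numbers = ℕ → ℕ → ℕ → ℕ → ℤ

  -- The coefficients of z^a y^b in I^p F^q G, where I = 1 + z I³ F and F = 1 + y I F are the
  -- generating functions of pieces and forests and G is any power series, satisfy these
  -- recurrences; u and v below multiply by u = z I² F and v = y I.
  record Recurrent (X : Numbers) : Set where
    field
      I₀ : ∀ p q b → X (suc p) q zero b ≡ X p q zero b
      I₁ : ∀ p q a b → X (suc p) q (suc a) b ≡ X p q (suc a) b ℤ.+ X (3 + p) (suc q) a b
      F₀ : ∀ p q a → X p (suc q) a zero ≡ X p q a zero
      F₁ : ∀ p q a b → X p (suc q) a (suc b) ≡ X p q a (suc b) ℤ.+ X (suc p) (suc q) a b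
  open Recurrent

  u v : Numbers → Numbers
  u X p q zero    b = 0ℤ
  u X p q (suc a) b = X (2 + p) (suc q) a b
  v X p q a zero    = 0ℤ
  v X p q a (suc b) = X (suc p) q a b

  u-recurrent : ∀ {X} → Recurrent X → Recurrent (u X)
  u-recurrent R .I₀ p q b = refl
  u-recurrent R .I₁ p q zero    b = trans (R .I₀ (2 + p) (suc q) b) (sym (ℤ.+-identityʳ _))
  u-recurrent R .I₁ p q (suc a) b = R .I₁ (2 + p) (suc q) a b
  u-recurrent R .F₀ p q zero    = refl
  u-recurrent R .F₀ p q (suc a) = R .F₀ (2 + p) (suc q) a
  u-recurrent R .F₁ p q zero    b = refl
  u-recurrent R .F₁ p q (suc a) b = R .F₁ (2 + p) (suc q) a b

  v-recurrent : ∀ {X} → Recurrent X → Recurrent (v X)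
  v-recurrent R .I₀ p q zero    = refl
  v-recurrent R .I₀ p q (suc b) = R .I₀ (suc p) q b
  v-recurrent R .I₁ p q a zero    = refl
  v-recurrent R .I₁ p q a (suc b) = R .I₁ (suc p) q a b
  v-recurrent R .F₀ p q a = refl
  v-recurrent R .F₁ p q a zero    = trans (R .F₀ (suc p) q a) (sym (ℤ.+-identityʳ _))
  v-recurrent R .F₁ p q a (suc b) = R .F₁ (suc p) q a b

  -- F (1 - v) = 1
  F-v : ∀ {X} → Recurrent X → ∀ p q a b → X p (suc q) a b ≡ X p q a b ℤ.+ v X p (suc q) a b
  F-v R p q a zero    = trans (R .F₀ p q a) (sym (ℤ.+-identityʳ _))
  F-v R p q a (suc b) = R .F₁ p q a b

  -- With s = I - 1 and t = F - 1 one has s = z (1+s)³ (1+t) and t = y (1+s) (1+t). Lagrange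
  -- inversion in two variables identifies the coefficient of s^a t^b in (1+s)^(p+3a+b)
  -- (1+t)^(q+a+b) with that of z^a y^b in I^p F^q divided by a Jacobian. This is the origin of the
  -- formula; the proof checks the recurrences, by Pascal's rule.
  W : Numbers
  W p q a b = + (((p + 3 * a + b) C a) * ((q + a + b) C b))

  W-recurrent : Recurrent W
  W-recurrent .I₀ p q b = refl
  W-recurrent .I₁ p q a b = cong +_ (begin
    (suc (p + 3 * suc a + b) C suc a) * ((q + suc a + b) C b)
      ≡⟨ cong (_* ((q + suc a + b) C b)) (nCk+nC[k+1]≡[n+1]C[k+1] (p + 3 * suc a + b) a) ⟨
    ((p + 3 * suc a + b) C a + (p + 3 * suc a + b) C suc a) * ((q + suc a + b) C b)
      ≡⟨ swap ((p + 3 * suc a + b) C a) _ _ ⟩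
    ((p + 3 * suc a + b) C suc a) * ((q + suc a + b) C b) + ((p + 3 * suc a + b) C a) * ((q + suc a + b) C b)
      ≡⟨ cong₂ (λ m n → ((p + 3 * suc a + b) C suc a) * ((q + suc a + b) C b) + (m C a) * (n C b)) (e₁ p a b) (e₂ q a b) ⟩
    ((p + 3 * suc a + b) C suc a) * ((q + suc a + b) C b) + ((3 + p + 3 * a + b) C a) * ((suc q + a + b) C b) ∎)
    where
    open ≡-Reasoning
    swap : ∀ x y z → (x + y) * z ≡ y * z + x * z
    swap = ℕ.solve-∀
    e₁ : ∀ p a b → p + 3 * suc a + b ≡ 3 + p + 3 * a + b
    e₁ = ℕ.solve-∀
    e₂ : ∀ q a b → q + suc a + b ≡ suc q + a + b
    e₂ = ℕ.solve-∀
  W-recurrent .F₀ p q a = refl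
  W-recurrent .F₁ p q a b = cong +_ (begin
    ((p + 3 * a + suc b) C a) * (suc (q + a + suc b) C suc b)
      ≡⟨ cong (((p + 3 * a + suc b) C a) *_) (nCk+nC[k+1]≡[n+1]C[k+1] (q + a + suc b) b) ⟨
    ((p + 3 * a + suc b) C a) * ((q + a + suc b) C b + (q + a + suc b) C suc b)
      ≡⟨ swap ((q + a + suc b) C b) ((q + a + suc b) C suc b) ((p + 3 * a + suc b) C a) ⟩
    ((p + 3 * a + suc b) C a) * ((q + a + suc b) C suc b) + ((p + 3 * a + suc b) C a) * ((q + a + suc b) C b)
      ≡⟨ cong₂ (λ m n → ((p + 3 * a + suc b) C a) * ((q + a + suc b) C suc b) + (m C a) * (n C b)) (e₁ p a b) (e₂ q a b) ⟩
    ((p + 3 * a + suc b) C a) * ((q + a + suc b) C suc b) + ((suc p + 3 * a + b) C a) * ((suc q + a + b) C b) ∎)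
    where
    open ≡-Reasoning
    swap : ∀ x y z → z * (x + y) ≡ z * y + z * x
    swap = ℕ.solve-∀
    e₁ : ∀ p a b → p + 3 * a + suc b ≡ suc p + 3 * a + b
    e₁ = ℕ.solve-∀
    e₂ : ∀ q a b → q + a + suc b ≡ suc q + a + b
    e₂ = ℕ.solve-∀

  infixl 6 _⊕_
  infixr 7 _⊛_
  _⊕_ : Numbers → Numbers → Numbers
  (X ⊕ Y) p q a b = X p q a b ℤ.+ Y p q a b

  _⊛_ : ℤ → Numbers → Numbers
  (k ⊛ X) p q a b = k ℤ.* X p q a b

  ⊕-recurrent : ∀ {X Y} → Recurrent X → Recurrent Y → Recurrent (X ⊕ Y)
  ⊕-recurrent {X} {Y} R S = record
    { I₀ = λ p q b → cong₂ ℤ._+_ (R .I₀ p q b) (S .I₀ p q b)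
    ; I₁ = λ p q a b → trans (cong₂ ℤ._+_ (R .I₁ p q a b) (S .I₁ p q a b))
        (swap (X p q (suc a) b) (X (3 + p) (suc q) a b) (Y p q (suc a) b) (Y (3 + p) (suc q) a b))
    ; F₀ = λ p q a → cong₂ ℤ._+_ (R .F₀ p q a) (S .F₀ p q a)
    ; F₁ = λ p q a b → trans (cong₂ ℤ._+_ (R .F₁ p q a b) (S .F₁ p q a b))
        (swap (X p q a (suc b)) (X (suc p) (suc q) a b) (Y p q a (suc b)) (Y (suc p) (suc q) a b)) }
    where
    swap : ∀ a b c d → (a ℤ.+ b) ℤ.+ (c ℤ.+ d) ≡ (a ℤ.+ c) ℤ.+ (b ℤ.+ d)
    swap = solve-∀

  ⊛-recurrent : ∀ k {X} → Recurrent X → Recurrent (k ⊛ X)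
  ⊛-recurrent k {X} R = record
    { I₀ = λ p q b → cong (k ℤ.*_) (R .I₀ p q b)
    ; I₁ = λ p q a b → trans (cong (k ℤ.*_) (R .I₁ p q a b)) (ℤ.*-distribˡ-+ k _ _)
    ; F₀ = λ p q a → cong (k ℤ.*_) (R .F₀ p q a)
    ; F₁ = λ p q a b → trans (cong (k ℤ.*_) (R .F₁ p q a b)) (ℤ.*-distribˡ-+ k _ _) }

  -- The multiple (1 - v - 3u + 2uv) W; the factor is the Jacobian of Lagrange inversion.
  K : Numbers
  K = W ⊕ ℤ.- 1ℤ ⊛ v W ⊕ ℤ.- + 3 ⊛ u W ⊕ + 2 ⊛ u (v W)

  -- Scale z and y by a common parameter and let J be the factor in `K`. The logarithmic derivatives
  -- of I and F in this parameter are u / J and v (1 - 2u) / J. They weight a piece by its width and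
  -- a forest by its order, which leads to `u W` and `V`.
  V : Numbers
  V = v W ⊕ ℤ.- + 2 ⊛ u (v W)

  uW-recurrent : Recurrent (u W)
  uW-recurrent = u-recurrent W-recurrent

  vW-recurrent : Recurrent (v W)
  vW-recurrent = v-recurrent W-recurrent

  uvW-recurrent : Recurrent (u (v W))
  uvW-recurrent = u-recurrent vW-recurrent

  K-recurrent : Recurrent K
  K-recurrent = ⊕-recurrent (⊕-recurrent (⊕-recurrent W-recurrent (⊛-recurrent (ℤ.- 1ℤ) vW-recurrent))
    (⊛-recurrent (ℤ.- + 3) uW-recurrent)) (⊛-recurrent (+ 2) uvW-recurrent)

  V-recurrent : Recurrent V
  V-recurrent = ⊕-recurrent vW-recurrent (⊛-recurrent (ℤ.- + 2) uvW-recurrent)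

  pascal : ∀ n k → suc n C suc k ≡ n C k + n C suc k
  pascal n k = sym (nCk+nC[k+1]≡[n+1]C[k+1] n k)

  C-absorption : ∀ n k → suc k * (suc n C suc k) ≡ suc n * (n C k)
  C-absorption zero zero = refl
  C-absorption zero (suc k) = trans (cong (suc (suc k) *_) (k>n⇒nCk≡0 {1} {suc (suc k)} (s≤s (s≤s z≤n)))) (ℕ.*-zeroʳ (suc (suc k)))
  C-absorption (suc n) zero = begin
    1 * (suc (suc n) C 1)           ≡⟨ cong (1 *_) (pascal (suc n) 0) ⟩
    1 * (1 + (suc n C 1))           ≡⟨ split (suc n C 1) ⟩
    1 + 1 * (suc n C 1)             ≡⟨ cong suc (C-absorption n 0) ⟩
    1 + suc n * 1                   ≡⟨⟩
    suc (suc n) * 1                 ∎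
    where
    open ≡-Reasoning
    split : ∀ x → 1 * (1 + x) ≡ 1 + 1 * x
    split = ℕ.solve-∀
  C-absorption (suc n) (suc k) = begin
    suc (suc k) * (suc (suc n) C suc (suc k))   ≡⟨ cong (suc (suc k) *_) (pascal (suc n) (suc k)) ⟩
    suc (suc k) * (x + y)                       ≡⟨ split k x y ⟩
    x + suc k * x + suc (suc k) * y             ≡⟨ cong₂ (λ a b → x + a + b) (C-absorption n k) (C-absorption n (suc k)) ⟩
    x + suc n * (n C k) + suc n * (n C suc k)   ≡⟨ merge n x (n C k) (n C suc k) ⟩
    x + suc n * (n C k + n C suc k)             ≡⟨ cong (λ z → x + suc n * z) (pascal n k) ⟨
    suc (suc n) * x                             ∎
    where
    open ≡-Reasoning
    x = suc n C suc k
    y = suc n C suc (suc k)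
    split : ∀ k x y → suc (suc k) * (x + y) ≡ x + suc k * x + suc (suc k) * y
    split = ℕ.solve-∀
    merge : ∀ n x a b → x + suc n * a + suc n * b ≡ x + suc n * (a + b)
    merge = ℕ.solve-∀

-- Counting stacks, plainly and with a marked vertex.

module PieceCounts where
  open Pieces
  open import Data.Fin using (Fin; zero; suc)
  open import Data.Integer as ℤ using (ℤ; +_; 0ℤ; 1ℤ)
  import Data.Integer.Properties as ℤ
  open import Data.Integer.Tactic.RingSolver using (solve-∀)
  open import Data.List using (_∷_; map)
  open import Data.Nat as ℕ using (ℕ; zero; suc; _+_; _*_)
  open import Data.Nat.Combinatorics using (_C_; nCn≡1)
  import Data.Nat.Properties as ℕ
  import Data.Nat.Tactic.RingSolver as ℕ
  open import Data.Product using (_,_)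
  open import Data.Vec using (_∷_; lookup)
  open import Function using (_∘_)
  open import Relation.Binary.PropositionalEquality
  open Recurrent
  open ≡-Reasoning

  -- Moves the negative terms of `K` to the other side, which reduces its evaluation to an equation
  -- between natural numbers.
  K-combination : ∀ {x y z w : ℤ} (x′ y′ z′ w′ t : ℕ) → x ≡ + x′ → y ≡ + y′ → z ≡ + z′ → w ≡ + w′ →
    x′ + 2 * w′ ≡ t + (y′ + 3 * z′) → x ℤ.+ ℤ.- 1ℤ ℤ.* y ℤ.+ ℤ.- + 3 ℤ.* z ℤ.+ + 2 ℤ.* w ≡ + t
  K-combination x y z w t refl refl refl refl e = begin
    + x ℤ.+ ℤ.- 1ℤ ℤ.* + y ℤ.+ ℤ.- + 3 ℤ.* + z ℤ.+ + 2 ℤ.* + w  ≡⟨ regroup (+ x) (+ y) (+ z) (+ w) ⟩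
    (+ x ℤ.+ + 2 ℤ.* + w) ℤ.- (+ y ℤ.+ + 3 ℤ.* + z)   ≡⟨ cong₂ (λ s r → (+ x ℤ.+ s) ℤ.- (+ y ℤ.+ r)) (ℤ.pos-* 2 w) (ℤ.pos-* 3 z) ⟨
    + (x + 2 * w) ℤ.- + (y + 3 * z)                   ≡⟨ cong (λ s → + s ℤ.- + (y + 3 * z)) e ⟩
    (+ t ℤ.+ + (y + 3 * z)) ℤ.- + (y + 3 * z)         ≡⟨ cancel (+ t) (+ (y + 3 * z)) ⟩
    + t                                               ∎
    where
    regroup : ∀ x y z w → x ℤ.+ ℤ.- 1ℤ ℤ.* y ℤ.+ ℤ.- + 3 ℤ.* z ℤ.+ + 2 ℤ.* w ≡ (x ℤ.+ + 2 ℤ.* w) ℤ.- (y ℤ.+ + 3 ℤ.* z)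
    regroup = solve-∀
    cancel : ∀ x y → (x ℤ.+ y) ℤ.- y ≡ x
    cancel = solve-∀

  -- Put x = A + 1 and y = B + 1 and multiply by x y. The hypotheses then express c and d through c₁
  -- and d₁, and what remains is (3x + y)(x + y) + 2xy = (3x + y) y + 3x (x + y).
  K-base : ∀ A B c d c₁ d₁ → suc A * c ≡ (3 * suc A + suc B) * c₁ → suc B * d ≡ (suc A + suc B) * d₁ →
    c * d + 2 * (c₁ * d₁) ≡ c * d₁ + 3 * (c₁ * d)
  K-base A B c d c₁ d₁ ac bd = ℕ.*-cancelˡ-≡ _ _ (suc A * suc B) (begin
    suc A * suc B * (c * d + 2 * (c₁ * d₁))                                           ≡⟨ left A B c d c₁ d₁ ⟩
    (suc A * c) * (suc B * d) + 2 * (suc A * suc B * (c₁ * d₁))                       ≡⟨ cong₂ (λ x y → x * y + 2 * (suc A * suc B * (c₁ * d₁))) ac bd ⟩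
    ((3 * suc A + suc B) * c₁) * ((suc A + suc B) * d₁) + 2 * (suc A * suc B * (c₁ * d₁)) ≡⟨ middle A B c₁ d₁ ⟩
    ((3 * suc A + suc B) * c₁) * (suc B * d₁) + 3 * (suc A * c₁ * ((suc A + suc B) * d₁)) ≡⟨ cong₂ (λ x y → x * (suc B * d₁) + 3 * (suc A * c₁ * y)) ac bd ⟨
    (suc A * c) * (suc B * d₁) + 3 * (suc A * c₁ * (suc B * d))                       ≡⟨ right A B c d c₁ d₁ ⟩
    suc A * suc B * (c * d₁ + 3 * (c₁ * d))                                           ∎)
    where
    left : ∀ A B c d c₁ d₁ → suc A * suc B * (c * d + 2 * (c₁ * d₁)) ≡ (suc A * c) * (suc B * d) + 2 * (suc A * suc B * (c₁ * d₁))
    left = ℕ.solve-∀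
    middle : ∀ A B c₁ d₁ → ((3 * suc A + suc B) * c₁) * ((suc A + suc B) * d₁) + 2 * (suc A * suc B * (c₁ * d₁))
      ≡ ((3 * suc A + suc B) * c₁) * (suc B * d₁) + 3 * (suc A * c₁ * ((suc A + suc B) * d₁))
    middle = ℕ.solve-∀
    right : ∀ A B c d c₁ d₁ → (suc A * c) * (suc B * d₁) + 3 * (suc A * c₁ * (suc B * d)) ≡ suc A * suc B * (c * d₁ + 3 * (c₁ * d))
    right = ℕ.solve-∀

  W-≡ : ∀ {x x′ y y′} a b → x ≡ x′ → y ≡ y′ → + ((x C a) * (y C b)) ≡ + ((x′ C a) * (y′ C b))
  W-≡ a b refl refl = refl

  -- Since I⁰ F⁰ = 1, all its coefficients but the constant one must vanish. These initial values,
  -- here and in `K₁`, single out `K` among the solutions of the recurrences.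
  K₀ : ∀ b → K 0 0 0 (suc b) ≡ 0ℤ
  K₀ b = K-combination 1 1 0 0 0 (cong +_ (cong (1 *_) (nCn≡1 (suc b)))) (cong +_ (cong (1 *_) (nCn≡1 b))) refl refl refl

  K₁ : ∀ a b → K 0 0 (suc a) b ≡ 0ℤ
  K₁ a zero = K-combination (c * 1) 0 (c₁ * 1) 0 0
    (cong (λ x → + ((x C suc a) * 1)) (e₁ a)) refl (cong (λ x → + ((x C a) * 1)) (e₂ a)) refl
    (trans (ℕ.+-identityʳ (c * 1)) (trans (ℕ.*-identityʳ c) (trans tri (cong (3 *_) (sym (ℕ.*-identityʳ c₁))))))
    where
    c = suc (2 + 3 * a) C suc a
    c₁ = (2 + 3 * a) C a
    e₁ : ∀ a → 0 + 3 * suc a + 0 ≡ suc (2 + 3 * a)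
    e₁ = ℕ.solve-∀
    e₂ : ∀ a → 2 + 3 * a + 0 ≡ 2 + 3 * a
    e₂ = ℕ.solve-∀
    e₃ : ∀ a c → suc (2 + 3 * a) * c ≡ suc a * (3 * c)
    e₃ = ℕ.solve-∀
    tri : c ≡ 3 * c₁
    tri = ℕ.*-cancelˡ-≡ c (3 * c₁) (suc a) (trans (C-absorption (2 + 3 * a) a) (e₃ a c₁))
  K₁ a (suc b) = K-combination (c * d) (c * d₁) (c₁ * d) (c₁ * d₁) 0
    (W-≡ (suc a) (suc b) (e₁ a b) (e₈ a b)) (W-≡ (suc a) b (e₂ a b) (e₃ a b)) (W-≡ a (suc b) (e₄ a b) (e₈ a b)) (W-≡ a b (e₅ a b) (e₆ a b))
    (K-base a b c d c₁ d₁ (trans (C-absorption (3 * suc a + b) a) (cong (_* c₁) (e₇ a b))) (trans (C-absorption (suc a + b) b) (cong (_* d₁) (sym (ℕ.+-suc (suc a) b)))))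
    where
    c = suc (3 * suc a + b) C suc a
    c₁ = (3 * suc a + b) C a
    d = suc (suc a + b) C suc b
    d₁ = (suc a + b) C b
    e₁ : ∀ a b → 0 + 3 * suc a + suc b ≡ suc (3 * suc a + b)
    e₁ = ℕ.solve-∀
    e₂ : ∀ a b → 1 + 3 * suc a + b ≡ suc (3 * suc a + b)
    e₂ = ℕ.solve-∀
    e₃ : ∀ a b → 0 + suc a + b ≡ suc a + b
    e₃ = ℕ.solve-∀
    e₄ : ∀ a b → 2 + 3 * a + suc b ≡ 3 * suc a + b
    e₄ = ℕ.solve-∀
    e₅ : ∀ a b → 3 + 3 * a + b ≡ 3 * suc a + b
    e₅ = ℕ.solve-∀
    e₆ : ∀ a b → 1 + a + b ≡ suc a + b
    e₆ = ℕ.solve-∀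
    e₈ : ∀ a b → suc a + suc b ≡ suc (suc a + b)
    e₈ = ℕ.solve-∀
    e₇ : ∀ a b → suc (3 * suc a + b) ≡ 3 * suc a + suc b
    e₇ = ℕ.solve-∀

  count : ∀ p q a b → sumOver (λ _ → 1ℤ) (stacks p q a b) ≡ K p q a b
  count zero zero zero    zero    = refl
  count zero zero zero    (suc b) = sym (K₀ b)
  count zero zero (suc a) b       = sym (K₁ a b)
  count zero (suc q) a zero       = trans (sumOver-map (λ _ → 1ℤ) push-nil (stacks zero q a zero))
    (trans (count zero q a zero) (sym (K-recurrent .F₀ zero q a)))
  count zero (suc q) a (suc b)    = trans (sumOver-++ (λ _ → 1ℤ) (map push-nil (stacks zero q a (suc b))) (map push-cons (stacks 1 (suc q) a b)))
    (trans (cong₂ ℤ._+_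
      (trans (sumOver-map (λ _ → 1ℤ) push-nil (stacks zero q a (suc b))) (count zero q a (suc b)))
      (trans (sumOver-map (λ _ → 1ℤ) push-cons (stacks 1 (suc q) a b)) (count 1 (suc q) a b)))
      (sym (K-recurrent .F₁ zero q a b)))
  count (suc p) q zero b          = trans (sumOver-map (λ _ → 1ℤ) push-leaf (stacks p q zero b))
    (trans (count p q zero b) (sym (K-recurrent .I₀ p q b)))
  count (suc p) q (suc a) b       = trans (sumOver-++ (λ _ → 1ℤ) (map push-leaf (stacks p q (suc a) b)) (map push-node (stacks (3 + p) (suc q) a b)))
    (trans (cong₂ ℤ._+_
      (trans (sumOver-map (λ _ → 1ℤ) push-leaf (stacks p q (suc a) b)) (count p q (suc a) b))
      (trans (sumOver-map (λ _ → 1ℤ) push-node (stacks (3 + p) (suc q) a b)) (count (3 + p) (suc q) a b)))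
      (sym (K-recurrent .I₁ p q a b)))

  widthAt : ∀ {p q} → Fin p → Stack p q → ℤ
  widthAt x (is , fs) = + width (lookup is x)

  orderAt : ∀ {p q} → Fin q → Stack p q → ℤ
  orderAt x (is , fs) = + order (lookup fs x)

  sum-nil-cons : ∀ q a b (g : Stack zero (suc q) → ℤ) x y → sumOver (g ∘ push-nil) (stacks zero q a (suc b)) ≡ x →
    sumOver (g ∘ push-cons) (stacks 1 (suc q) a b) ≡ y → sumOver g (stacks zero (suc q) a (suc b)) ≡ x ℤ.+ y
  sum-nil-cons q a b g x y ex ey = trans (sumOver-++ g (map push-nil (stacks zero q a (suc b))) (map push-cons (stacks 1 (suc q) a b)))
    (cong₂ ℤ._+_ (trans (sumOver-map g push-nil (stacks zero q a (suc b))) ex) (trans (sumOver-map g push-cons (stacks 1 (suc q) a b)) ey))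

  sum-leaf-node : ∀ p q a b (g : Stack (suc p) q → ℤ) x y → sumOver (g ∘ push-leaf) (stacks p q (suc a) b) ≡ x →
    sumOver (g ∘ push-node) (stacks (3 + p) (suc q) a b) ≡ y → sumOver g (stacks (suc p) q (suc a) b) ≡ x ℤ.+ y
  sum-leaf-node p q a b g x y ex ey = trans (sumOver-++ g (map push-leaf (stacks p q (suc a) b)) (map push-node (stacks (3 + p) (suc q) a b)))
    (cong₂ ℤ._+_ (trans (sumOver-map g push-leaf (stacks p q (suc a) b)) ex) (trans (sumOver-map g push-node (stacks (3 + p) (suc q) a b)) ey))

  uv-shift : ∀ p q a b → u (v W) p q a (suc b) ≡ u W (suc p) q a b
  uv-shift p q zero    b = refl
  uv-shift p q (suc a) b = refl

  V-zero : ∀ p q a → V p q a zero ≡ 0ℤ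
  V-zero p q zero    = refl
  V-zero p q (suc a) = refl

  node-weight : ∀ {p q} (s : Stack (3 + p) (suc q)) → widthAt zero (push-node s) ≡
    1ℤ ℤ.+ (widthAt zero s ℤ.+ (widthAt (suc zero) s ℤ.+ (widthAt (suc (suc zero)) s ℤ.+ orderAt zero s)))
  node-weight (i ∷ j ∷ r ∷ is , ms ∷ fs) = cong +_ (shuffle (width i) (order ms) (width j) (width r))
    where
    shuffle : ∀ a b c d → suc (a + b + c) + d ≡ 1 + (a + (c + (d + b)))
    shuffle = ℕ.solve-∀

  cons-weight : ∀ {p q} (s : Stack (suc p) (suc q)) → orderAt zero (push-cons s) ≡ 1ℤ ℤ.+ (widthAt zero s ℤ.+ orderAt zero s)
  cons-weight (i ∷ is , f ∷ fs) = refl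

  mutual
    -- Taking the marked member apart spreads its weight. A node weighs 1 plus the weights of three
    -- pieces and a forest, which sums to K + 3 u W + V = W; this is `u W` before the node was
    -- removed. For a marked forest the sum is K + u W + V = W - 2 u W, in the same way a shift of
    -- `V`.
    sum-width : ∀ p q a b (x : Fin p) → sumOver (widthAt x) (stacks p q a b) ≡ u W p q a b
    sum-width (suc p) q zero b zero =
      trans (sumOver-map (widthAt zero) push-leaf (stacks p q zero b)) (sumOver-0 _ (λ _ → refl) (stacks p q zero b))
    sum-width (suc p) q (suc a) b zero = trans
      (sum-leaf-node p q a b (widthAt zero) 0ℤ (W (3 + p) (suc q) a b) (sumOver-0 _ (λ _ → refl) (stacks p q (suc a) b)) (begin
        sumOver (widthAt zero ∘ push-node) st
          ≡⟨ sumOver-cong node-weight st ⟩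
        sumOver (λ s → 1ℤ ℤ.+ (widthAt zero s ℤ.+ (widthAt (suc zero) s ℤ.+ (widthAt (suc (suc zero)) s ℤ.+ orderAt zero s)))) st
          ≡⟨ trans (sumOver-+ _ _ st) (cong₂ ℤ._+_ (count (3 + p) (suc q) a b) (trans (sumOver-+ _ _ st) (cong₂ ℤ._+_ (sum-width (3 + p) (suc q) a b zero)
             (trans (sumOver-+ _ _ st) (cong₂ ℤ._+_ (sum-width (3 + p) (suc q) a b (suc zero)) (trans (sumOver-+ _ _ st)
               (cong₂ ℤ._+_ (sum-width (3 + p) (suc q) a b (suc (suc zero))) (sum-order (3 + p) (suc q) a b zero)))))))) ⟩
        K (3 + p) (suc q) a b ℤ.+ (u W (3 + p) (suc q) a b ℤ.+ (u W (3 + p) (suc q) a b ℤ.+ (u W (3 + p) (suc q) a b ℤ.+ V (3 + p) (suc q) a b)))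
          ≡⟨ collect (W (3 + p) (suc q) a b) (v W (3 + p) (suc q) a b) (u W (3 + p) (suc q) a b) (u (v W) (3 + p) (suc q) a b) ⟩
        W (3 + p) (suc q) a b ∎)) (ℤ.+-identityˡ _)
      where
      st = stacks (3 + p) (suc q) a b
      collect : ∀ w v u uv → (w ℤ.+ ℤ.- 1ℤ ℤ.* v ℤ.+ ℤ.- + 3 ℤ.* u ℤ.+ + 2 ℤ.* uv) ℤ.+ (u ℤ.+ (u ℤ.+ (u ℤ.+ (v ℤ.+ ℤ.- + 2 ℤ.* uv)))) ≡ w
      collect = solve-∀
    sum-width (suc p) q zero b (suc x) =
      trans (sumOver-map (widthAt (suc x)) push-leaf (stacks p q zero b)) (trans (sum-width p q zero b x) (sym (uW-recurrent .I₀ p q b)))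
    sum-width (suc p) q (suc a) b (suc x) = trans
      (sum-leaf-node p q a b (widthAt (suc x)) _ _ (sum-width p q (suc a) b x)
        (trans (sumOver-cong {h = widthAt (suc (suc (suc x)))} (λ { (_ ∷ _ ∷ _ ∷ _ , _ ∷ _) → refl }) (stacks (3 + p) (suc q) a b))
               (sum-width (3 + p) (suc q) a b (suc (suc (suc x))))))
      (sym (uW-recurrent .I₁ p q a b))

    sum-order : ∀ p q a b (x : Fin q) → sumOver (orderAt x) (stacks p q a b) ≡ V p q a b
    sum-order zero (suc q) a zero zero =
      trans (sumOver-map (orderAt zero) push-nil (stacks zero q a zero)) (trans (sumOver-0 _ (λ _ → refl) (stacks zero q a zero)) (sym (V-zero zero (suc q) a)))
    sum-order zero (suc q) a zero (suc x) =
      trans (sumOver-map (orderAt (suc x)) push-nil (stacks zero q a zero)) (trans (sum-order zero q a zero x) (sym (V-recurrent .F₀ zero q a)))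
    sum-order zero (suc q) a (suc b) zero = trans
      (sum-nil-cons q a b (orderAt zero) 0ℤ (V zero (suc q) a (suc b)) (sumOver-0 _ (λ _ → refl) (stacks zero q a (suc b))) (begin
        sumOver (orderAt zero ∘ push-cons) st
          ≡⟨ sumOver-cong cons-weight st ⟩
        sumOver (λ s → 1ℤ ℤ.+ (widthAt zero s ℤ.+ orderAt zero s)) st
          ≡⟨ trans (sumOver-+ _ _ st) (cong₂ ℤ._+_ (count 1 (suc q) a b) (trans (sumOver-+ _ _ st) (cong₂ ℤ._+_ (sum-width 1 (suc q) a b zero) (sum-order 1 (suc q) a b zero)))) ⟩
        K 1 (suc q) a b ℤ.+ (u W 1 (suc q) a b ℤ.+ V 1 (suc q) a b)
          ≡⟨ collect (W 1 (suc q) a b) (v W 1 (suc q) a b) (u W 1 (suc q) a b) (u (v W) 1 (suc q) a b) ⟩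
        W 1 (suc q) a b ℤ.+ ℤ.- + 2 ℤ.* u W 1 (suc q) a b
          ≡⟨ cong (λ z → W 1 (suc q) a b ℤ.+ ℤ.- + 2 ℤ.* z) (uv-shift zero (suc q) a b) ⟨
        V zero (suc q) a (suc b) ∎)) (ℤ.+-identityˡ _)
      where
      st = stacks 1 (suc q) a b
      collect : ∀ w v u uv → (w ℤ.+ ℤ.- 1ℤ ℤ.* v ℤ.+ ℤ.- + 3 ℤ.* u ℤ.+ + 2 ℤ.* uv) ℤ.+ (u ℤ.+ (v ℤ.+ ℤ.- + 2 ℤ.* uv)) ≡ w ℤ.+ ℤ.- + 2 ℤ.* u
      collect = solve-∀
    sum-order zero (suc q) a (suc b) (suc x) = trans
      (sum-nil-cons q a b (orderAt (suc x)) _ _ (sum-order zero q a (suc b) x)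
        (trans (sumOver-cong {h = orderAt (suc x)} (λ { (_ ∷ _ , _ ∷ _) → refl }) (stacks 1 (suc q) a b)) (sum-order 1 (suc q) a b (suc x))))
      (sym (V-recurrent .F₁ zero q a b))
    sum-order (suc p) q zero b x =
      trans (sumOver-map (orderAt x) push-leaf (stacks p q zero b)) (trans (sum-order p q zero b x) (sym (V-recurrent .I₀ p q b)))
    sum-order (suc p) q (suc a) b x = trans
      (sum-leaf-node p q a b (orderAt x) _ _ (sum-order p q (suc a) b x)
        (trans (sumOver-cong {h = orderAt (suc x)} (λ { (_ ∷ _ ∷ _ ∷ _ , _ ∷ _) → refl }) (stacks (3 + p) (suc q) a b))
               (sum-order (3 + p) (suc q) a b (suc x))))
      (sym (V-recurrent .I₁ p q a b))

-- The three counts in the form in which the polynomial is evaluated.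

module ClosedForms where
  open Pieces
  open PieceCounts
  open import Data.Fin using (zero; suc)
  open import Data.Integer as ℤ using (ℤ; +_; 0ℤ; 1ℤ)
  import Data.Integer.Properties as ℤ
  open import Data.Integer.Tactic.RingSolver using (solve-∀)
  open import Data.List using (length)
  open import Data.Nat as ℕ using (ℕ; zero; suc; _+_; _*_)
  open import Data.Nat.Combinatorics using (_C_; nCn≡1)
  import Data.Nat.Properties as ℕ
  import Data.Nat.Tactic.RingSolver as ℕ
  open import Relation.Binary.PropositionalEquality
  open ≡-Reasoning

  C-step : ∀ n k r → n ≡ k + r → suc k * (n C suc k) ≡ r * (n C k)
  C-step n k r refl = ℕ.+-cancelˡ-≡ (suc k * x) (suc k * y) (r * x) (begin
    suc k * x + suc k * y        ≡⟨ ℕ.*-distribˡ-+ (suc k) x y ⟨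
    suc k * (x + y)              ≡⟨ cong (suc k *_) (pascal (k + r) k) ⟨
    suc k * (suc (k + r) C suc k) ≡⟨ C-absorption (k + r) k ⟩
    (suc k + r) * x              ≡⟨ ℕ.*-distribʳ-+ x (suc k) r ⟩
    suc k * x + r * x            ∎)
    where
    x = (k + r) C k
    y = (k + r) C suc k

  C-absorption′ : ∀ a b → suc a * (suc (a + b) C b) ≡ suc (a + b) * ((a + b) C b)
  C-absorption′ a zero    = cong (_* 1) (cong suc (sym (ℕ.+-identityʳ a)))
  C-absorption′ a (suc b) = ℕ.+-cancelˡ-≡ (suc b * c) _ _ (begin
    suc b * c + suc a * c                    ≡⟨ collect a b c ⟩
    suc (a + suc b) * c                      ≡⟨ cong (suc (a + suc b) *_) (pascal (a + suc b) b) ⟩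
    suc (a + suc b) * (x + y)                ≡⟨ ℕ.*-distribˡ-+ (suc (a + suc b)) x y ⟩
    suc (a + suc b) * x + suc (a + suc b) * y ≡⟨ cong (_+ suc (a + suc b) * y) (C-absorption (a + suc b) b) ⟨
    suc b * c + suc (a + suc b) * y          ∎)
    where
    c = suc (a + suc b) C suc b
    x = (a + suc b) C b
    y = (a + suc b) C suc b
    collect : ∀ a b c → suc b * c + suc a * c ≡ suc (a + suc b) * c
    collect = ℕ.solve-∀

  K-split : ∀ {x y z w} (l x′ y′ z′ w′ : ℕ) → + l ≡ x ℤ.+ ℤ.- 1ℤ ℤ.* y ℤ.+ ℤ.- + 3 ℤ.* z ℤ.+ + 2 ℤ.* w →
    x ≡ + x′ → y ≡ + y′ → z ≡ + z′ → w ≡ + w′ → l + (y′ + 3 * z′) ≡ x′ + 2 * w′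
  K-split l x y z w e refl refl refl refl = ℤ.+-injective (begin
    + l ℤ.+ (+ y ℤ.+ + (3 * z))                    ≡⟨ cong₂ (λ s t → s ℤ.+ (+ y ℤ.+ t)) e (ℤ.pos-* 3 z) ⟩
    (+ x ℤ.+ ℤ.- 1ℤ ℤ.* + y ℤ.+ ℤ.- + 3 ℤ.* + z ℤ.+ + 2 ℤ.* + w) ℤ.+ (+ y ℤ.+ + 3 ℤ.* + z)  ≡⟨ cancel (+ x) (+ y) (+ z) (+ w) ⟩
    + x ℤ.+ + 2 ℤ.* + w                            ≡⟨ cong (λ t → + x ℤ.+ t) (ℤ.pos-* 2 w) ⟨
    + (x + 2 * w)                                  ∎)
    where
    cancel : ∀ x y z w → (x ℤ.+ ℤ.- 1ℤ ℤ.* y ℤ.+ ℤ.- + 3 ℤ.* z ℤ.+ + 2 ℤ.* w) ℤ.+ (y ℤ.+ + 3 ℤ.* z) ≡ x ℤ.+ + 2 ℤ.* w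
    cancel = solve-∀

  length-stacks : ∀ p q a b → + length (stacks p q a b) ≡ K p q a b
  length-stacks p q a b = trans (sym (sumOver-1 (stacks p q a b))) (count p q a b)

  forest-count₀ : ∀ b → length (stacks 0 1 0 (suc b)) ≡ 1
  forest-count₀ b = ℕ.+-cancelʳ-≡ (suc b C b) _ _ (begin
    length (stacks 0 1 0 (suc b)) + (suc b C b)                      ≡⟨ pad (length (stacks 0 1 0 (suc b))) (suc b C b) ⟩
    length (stacks 0 1 0 (suc b)) + (1 * (suc b C b) + 3 * 0)       ≡⟨ K-split (length (stacks 0 1 0 (suc b))) (1 * (suc (suc b) C suc b)) (1 * (suc b C b)) 0 0 (length-stacks 0 1 0 (suc b)) refl refl refl refl ⟩
    1 * (suc (suc b) C suc b) + 2 * 0                                ≡⟨ unpad (suc (suc b) C suc b) ⟩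
    suc (suc b) C suc b                                              ≡⟨ pascal (suc b) b ⟩
    (suc b C b) + (suc b C suc b)                                    ≡⟨ cong (λ c → (suc b C b) + c) (nCn≡1 (suc b)) ⟩
    (suc b C b) + 1                                                  ≡⟨ ℕ.+-comm (suc b C b) 1 ⟩
    1 + (suc b C b)                                                  ∎)
    where
    pad : ∀ l x → l + x ≡ l + (1 * x + 3 * 0)
    pad = ℕ.solve-∀
    unpad : ∀ x → 1 * x + 2 * 0 ≡ x
    unpad = ℕ.solve-∀

  -- The shape is that of the hypothesis of `fₙₖ-value-one`, so that nothing has to be divided.
  -- Expanding the four binomials of `K` by Pascal's rule into entries of the rows n and N leaves a
  -- polynomial identity.
  forest-count : ∀ A B → let n = suc A + suc B ; N = 3 * suc A + B in
    length (stacks 0 1 (suc A) (suc B)) + (2 * (n C suc B) + (n C B)) * (N C A) ≡ (n C suc B) * (N C suc A)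
  forest-count A B = ℕ.+-cancelʳ-≡ (z * t + x * y + 3 * (y * t)) _ _ (begin
    l + (2 * x + t) * y + (z * t + x * y + 3 * (y * t))    ≡⟨ left l x t y z ⟩
    l + ((z + y) * t + 3 * (y * (x + t)))                  ≡⟨ K-split l ((z + y) * (x + t)) ((z + y) * t) (y * (x + t)) (y * t) (length-stacks 0 1 (suc A) (suc B))
         (trans (W-≡ (suc A) (suc B) (e₁ A B) (refl {x = suc n})) (cong +_ (cong₂ _*_ (trans (pascal N A) (ℕ.+-comm y z)) (trans (pascal n B) (ℕ.+-comm t x)))))
         (trans (W-≡ (suc A) B (e₂ A B) (e₃ A B)) (cong +_ (cong (_* t) (trans (pascal N A) (ℕ.+-comm y z)))))
         (trans (W-≡ A (suc B) (e₄ A B) (refl {x = suc n})) (cong +_ (cong (y *_) (trans (pascal n B) (ℕ.+-comm t x)))))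
         (W-≡ A B (e₅ A B) (e₆ A B)) ⟩
    (z + y) * (x + t) + 2 * (y * t)                        ≡⟨ right x t y z ⟩
    x * z + (z * t + x * y + 3 * (y * t))                  ∎)
    where
    n = suc A + suc B
    N = 3 * suc A + B
    l = length (stacks 0 1 (suc A) (suc B))
    x = n C suc B
    t = n C B
    y = N C A
    z = N C suc A
    e₁ : ∀ a b → 3 * suc a + suc b ≡ suc (3 * suc a + b)
    e₁ = ℕ.solve-∀
    e₂ : ∀ a b → 1 + 3 * suc a + b ≡ suc (3 * suc a + b)
    e₂ = ℕ.solve-∀
    e₃ : ∀ a b → 1 + suc a + b ≡ suc a + suc b
    e₃ = ℕ.solve-∀
    e₄ : ∀ a b → 2 + 3 * a + suc b ≡ 3 * suc a + b
    e₄ = ℕ.solve-∀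
    e₅ : ∀ a b → 3 + 3 * a + b ≡ 3 * suc a + b
    e₅ = ℕ.solve-∀
    e₆ : ∀ a b → 2 + a + b ≡ suc a + suc b
    e₆ = ℕ.solve-∀
    left : ∀ l x t y z → l + (2 * x + t) * y + (z * t + x * y + 3 * (y * t)) ≡ l + ((z + y) * t + 3 * (y * (x + t)))
    left = ℕ.solve-∀
    right : ∀ x t y z → (z + y) * (x + t) + 2 * (y * t) ≡ x * z + (z * t + x * y + 3 * (y * t))
    right = ℕ.solve-∀

  vu≡uv : ∀ p q a b → v (u W) p q a b ≡ u (v W) p q a b
  vu≡uv p q zero    zero    = refl
  vu≡uv p q (suc a) zero    = refl
  vu≡uv p q zero    (suc b) = refl
  vu≡uv p q (suc a) (suc b) = refl

  -- (1 - v) F = 1 removes one factor F.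
  K-reduce : ∀ p q a b → K p (suc q) a b ≡ W p q a b ℤ.- + 2 ℤ.* u W p q a b ℤ.- u W p (suc q) a b
  K-reduce p q a b = begin
    K p (suc q) a b
      ≡⟨ cong₂ (λ w uv → w ℤ.+ ℤ.- 1ℤ ℤ.* v W p (suc q) a b ℤ.+ ℤ.- + 3 ℤ.* u W p (suc q) a b ℤ.+ + 2 ℤ.* uv)
           (F-v W-recurrent p q a b) (sym (vu≡uv p (suc q) a b)) ⟩
    (W p q a b ℤ.+ v W p (suc q) a b) ℤ.+ ℤ.- 1ℤ ℤ.* v W p (suc q) a b ℤ.+ ℤ.- + 3 ℤ.* u W p (suc q) a b ℤ.+ + 2 ℤ.* v (u W) p (suc q) a b
      ≡⟨ cong (λ z → (W p q a b ℤ.+ v W p (suc q) a b) ℤ.+ ℤ.- 1ℤ ℤ.* v W p (suc q) a b ℤ.+ ℤ.- + 3 ℤ.* z ℤ.+ + 2 ℤ.* v (u W) p (suc q) a b) (F-v uW-recurrent p q a b) ⟩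
    (W p q a b ℤ.+ v W p (suc q) a b) ℤ.+ ℤ.- 1ℤ ℤ.* v W p (suc q) a b ℤ.+ ℤ.- + 3 ℤ.* (u W p q a b ℤ.+ v (u W) p (suc q) a b) ℤ.+ + 2 ℤ.* v (u W) p (suc q) a b
      ≡⟨ collect (W p q a b) (v W p (suc q) a b) (u W p q a b) (v (u W) p (suc q) a b) ⟩
    W p q a b ℤ.- + 2 ℤ.* u W p q a b ℤ.- (u W p q a b ℤ.+ v (u W) p (suc q) a b)
      ≡⟨ cong (λ z → W p q a b ℤ.- + 2 ℤ.* u W p q a b ℤ.- z) (F-v uW-recurrent p q a b) ⟨
    W p q a b ℤ.- + 2 ℤ.* u W p q a b ℤ.- u W p (suc q) a b ∎
    where
    collect : ∀ w v u vu → (w ℤ.+ v) ℤ.+ ℤ.- 1ℤ ℤ.* v ℤ.+ ℤ.- + 3 ℤ.* (u ℤ.+ vu) ℤ.+ + 2 ℤ.* vu ≡ w ℤ.- + 2 ℤ.* u ℤ.- (u ℤ.+ vu)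
    collect = solve-∀

  -- Each stack counts once for every vertex of its piece, which has one vertex more than its width.
  pointedCount : ℕ → ℕ → ℤ
  pointedCount a b = sumOver (λ s → 1ℤ ℤ.+ widthAt zero s) (stacks 1 1 a b)

  pointedCount≡ : ∀ a b → pointedCount a b ≡ W 1 0 a b ℤ.- + 2 ℤ.* u W 1 0 a b
  pointedCount≡ a b = begin
    pointedCount a b                           ≡⟨ sumOver-+ (λ _ → 1ℤ) (widthAt zero) (stacks 1 1 a b) ⟩
    sumOver (λ _ → 1ℤ) (stacks 1 1 a b) ℤ.+ sumOver (widthAt zero) (stacks 1 1 a b)
                                               ≡⟨ cong₂ ℤ._+_ (trans (count 1 1 a b) (K-reduce 1 0 a b)) (sum-width 1 1 a b zero) ⟩
    (W 1 0 a b ℤ.- + 2 ℤ.* u W 1 0 a b ℤ.- u W 1 1 a b) ℤ.+ u W 1 1 a b ≡⟨ cancel (W 1 0 a b) (u W 1 0 a b) (u W 1 1 a b) ⟩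
    W 1 0 a b ℤ.- + 2 ℤ.* u W 1 0 a b          ∎
    where
    cancel : ∀ x y z → (x ℤ.- + 2 ℤ.* y ℤ.- z) ℤ.+ z ≡ x ℤ.- + 2 ℤ.* y
    cancel = solve-∀

  pointed-count₀ : ∀ b → pointedCount 0 b ≡ 1ℤ
  pointed-count₀ b = trans (pointedCount≡ 0 b) (cong (λ c → + (1 * c) ℤ.- 0ℤ) (nCn≡1 b))

  -- By `pointedCount≡` the number is (z - y) d. After multiplication by (A+1)(B+1), the relations
  -- for (A+1) z and (B+1) x turn both sides into multiples of d y. The extra summand y d on both
  -- sides is there because l is known through l + y d = z d.
  pointed-count : ∀ A B l → + l ≡ pointedCount (suc A) B → let n = suc A + suc B ; N = 3 * suc A + B in
    l + (2 * (n C suc B) + 0) * (N C A) ≡ (n C suc B) * (N C suc A)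
  pointed-count A B l e = ℕ.*-cancelˡ-≡ _ _ (suc A * suc B) (ℕ.+-cancelʳ-≡ (suc A * suc B * (y * d)) _ _ (begin
    suc A * suc B * (l + (2 * x + 0) * y) + suc A * suc B * (y * d)  ≡⟨ r₁ A B l x y d ⟩
    suc A * suc B * (l + y * d) + 2 * (suc A * (suc B * x) * y)      ≡⟨ cong₂ (λ s t → suc A * suc B * s + 2 * (suc A * t * y)) ld xB ⟩
    suc A * suc B * (z * d) + 2 * (suc A * (n * d) * y)              ≡⟨ r₂ A B z d y ⟩
    suc B * d * (suc A * z) + 2 * (suc A * (n * d) * y)              ≡⟨ cong (λ s → suc B * d * s + 2 * (suc A * (n * d) * y)) zA ⟩
    suc B * d * ((2 * suc A + suc B) * y) + 2 * (suc A * (n * d) * y) ≡⟨ r₃ A B d y ⟩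
    n * d * ((2 * suc A + suc B) * y) + suc A * suc B * (y * d)      ≡⟨ cong₂ (λ s t → s * t + suc A * suc B * (y * d)) xB zA ⟨
    suc B * x * (suc A * z) + suc A * suc B * (y * d)                ≡⟨ r₄ A B x z (y * d) ⟩
    suc A * suc B * (x * z) + suc A * suc B * (y * d)                ∎))
    where
    n = suc A + suc B
    N = 3 * suc A + B
    x = n C suc B
    y = N C A
    z = N C suc A
    d = (suc A + B) C B
    e₁ : ∀ a b → 1 + 3 * suc a + b ≡ suc (3 * suc a + b)
    e₁ = ℕ.solve-∀
    e₂ : ∀ a b → 3 + 3 * a + b ≡ 3 * suc a + b
    e₂ = ℕ.solve-∀
    e₃ : ∀ a b → 3 * suc a + b ≡ a + (2 * suc a + suc b)
    e₃ = ℕ.solve-∀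
    zA : suc A * z ≡ (2 * suc A + suc B) * y
    zA = C-step N A (2 * suc A + suc B) (e₃ A B)
    xB : suc B * x ≡ n * d
    xB = trans (cong (λ m → suc B * (m C suc B)) (ℕ.+-suc (suc A) B)) (trans (C-absorption (suc A + B) B) (cong (_* d) (sym (ℕ.+-suc (suc A) B))))
    ld : l + y * d ≡ z * d
    ld = ℕ.+-cancelʳ-≡ (y * d) _ _ (ℤ.+-injective (begin
      + (l + y * d + y * d)                              ≡⟨ cong (λ s → s ℤ.+ + (y * d) ℤ.+ + (y * d)) (trans e (pointedCount≡ (suc A) B)) ⟩
      (W 1 0 (suc A) B ℤ.- + 2 ℤ.* u W 1 0 (suc A) B) ℤ.+ + (y * d) ℤ.+ + (y * d)
        ≡⟨ cong₂ (λ s t → (s ℤ.- + 2 ℤ.* t) ℤ.+ + (y * d) ℤ.+ + (y * d))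
             (trans (W-≡ (suc A) B (e₁ A B) refl) (cong (λ c → + (c * d)) (trans (pascal N A) (ℕ.+-comm y z)))) (W-≡ A B (e₂ A B) refl) ⟩
      (+ ((z + y) * d) ℤ.- + 2 ℤ.* + (y * d)) ℤ.+ + (y * d) ℤ.+ + (y * d) ≡⟨ cancel (+ ((z + y) * d)) (+ (y * d)) ⟩
      + ((z + y) * d)                                    ≡⟨ cong +_ (ℕ.*-distribʳ-+ d z y) ⟩
      + (z * d + y * d)                                  ∎))
      where
      cancel : ∀ x y → (x ℤ.- + 2 ℤ.* y) ℤ.+ y ℤ.+ y ≡ x
      cancel = solve-∀
    r₁ : ∀ A B l x y d → suc A * suc B * (l + (2 * x + 0) * y) + suc A * suc B * (y * d) ≡ suc A * suc B * (l + y * d) + 2 * (suc A * (suc B * x) * y)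
    r₁ = ℕ.solve-∀
    r₂ : ∀ A B z d y → suc A * suc B * (z * d) + 2 * (suc A * ((suc A + suc B) * d) * y) ≡ suc B * d * (suc A * z) + 2 * (suc A * ((suc A + suc B) * d) * y)
    r₂ = ℕ.solve-∀
    r₃ : ∀ A B d y → suc B * d * ((2 * suc A + suc B) * y) + 2 * (suc A * ((suc A + suc B) * d) * y) ≡ (suc A + suc B) * d * ((2 * suc A + suc B) * y) + suc A * suc B * (y * d)
    r₃ = ℕ.solve-∀
    r₄ : ∀ A B x z w → suc B * x * (suc A * z) + suc A * suc B * w ≡ suc A * suc B * (x * z) + suc A * suc B * w
    r₄ = ℕ.solve-∀

  -- The left side is the number a + b + 1 = n / 2 of positions of a diameter times the number of
  -- halves; it has to agree with the value in `fₙₖ-value-odd`.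
  diameter-count : ∀ a b → (a + suc b) * length (stacks 2 1 a b) ≡ ((a + suc b) C b) * ((3 * a + b + 1) C a)
  diameter-count zero b = begin
    suc b * l                        ≡⟨ cong (suc b *_) (ℤ.+-injective (trans (length-stacks 2 1 0 b) (trans (K-reduce 2 0 0 b) (cong (λ c → + (1 * c) ℤ.- 0ℤ ℤ.- 0ℤ) (nCn≡1 b))))) ⟩
    suc b * 1                        ≡⟨ cong (suc b *_) (nCn≡1 b) ⟨
    suc b * (b C b)                  ≡⟨ C-absorption′ 0 b ⟨
    1 * (suc b C b)                  ≡⟨ ℕ.*-comm 1 (suc b C b) ⟩
    (suc b C b) * 1                  ∎
    where l = length (stacks 2 1 0 b)
  diameter-count a@(suc A) b = begin
    (a + suc b) * l                  ≡⟨ cong (_* l) (ℕ.+-suc a b) ⟩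
    s * l                            ≡⟨ ℕ.+-cancelʳ-≡ (e′ * (a * P₀)) _ _ main ⟩
    e′ * P₀                          ≡⟨ cong₂ (λ x y → (x C b) * (y C a)) (sym (ℕ.+-suc a b)) (m≡ A b) ⟩
    ((a + suc b) C b) * ((3 * a + b + 1) C a) ∎
    where
    l = length (stacks 2 1 a b)
    M = 1 + 3 * a + b
    s = suc (a + b)
    P₀ = M C a
    P₁ = M C A
    e = (a + b) C b
    e′ = s C b
    m≡ : ∀ A b → 1 + 3 * suc A + b ≡ 3 * suc A + b + 1
    m≡ = ℕ.solve-∀
    e₁ : ∀ A b → 2 + 3 * suc A + b ≡ suc (1 + 3 * suc A + b)
    e₁ = ℕ.solve-∀
    e₂ : ∀ A b → 4 + 3 * A + b ≡ 1 + 3 * suc A + b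
    e₂ = ℕ.solve-∀
    e₃ : ∀ A b → 1 + 3 * suc A + b ≡ A + (2 + 2 * suc A + b)
    e₃ = ℕ.solve-∀
    P-step : a * P₀ ≡ (2 + 2 * a + b) * P₁
    P-step = C-step M A (2 + 2 * a + b) (e₃ A b)
    e-step : suc a * e′ ≡ s * e
    e-step = C-absorption′ a b
    l≡ : l + (P₁ * e + P₁ * e′) ≡ P₀ * e
    l≡ = ℕ.+-cancelʳ-≡ (P₁ * e) _ _ (ℤ.+-injective (begin
      + l ℤ.+ (+ (P₁ * e) ℤ.+ + (P₁ * e′)) ℤ.+ + (P₁ * e)
        ≡⟨ cong (λ z → z ℤ.+ (+ (P₁ * e) ℤ.+ + (P₁ * e′)) ℤ.+ + (P₁ * e)) (trans (length-stacks 2 1 a b) (K-reduce 2 0 a b)) ⟩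
      (W 2 0 a b ℤ.- + 2 ℤ.* u W 2 0 a b ℤ.- u W 2 1 a b) ℤ.+ (+ (P₁ * e) ℤ.+ + (P₁ * e′)) ℤ.+ + (P₁ * e)
        ≡⟨ cong₂ (λ x y → (x ℤ.- + 2 ℤ.* y ℤ.- u W 2 1 a b) ℤ.+ (+ (P₁ * e) ℤ.+ + (P₁ * e′)) ℤ.+ + (P₁ * e))
             (trans (W-≡ a b (e₁ A b) refl) (cong (λ c → + (c * e)) (trans (pascal M A) (ℕ.+-comm P₁ P₀)))) (W-≡ A b (e₂ A b) refl) ⟩
      (+ ((P₀ + P₁) * e) ℤ.- + 2 ℤ.* + (P₁ * e) ℤ.- u W 2 1 a b) ℤ.+ (+ (P₁ * e) ℤ.+ + (P₁ * e′)) ℤ.+ + (P₁ * e)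
        ≡⟨ cong (λ y → (+ ((P₀ + P₁) * e) ℤ.- + 2 ℤ.* + (P₁ * e) ℤ.- y) ℤ.+ (+ (P₁ * e) ℤ.+ + (P₁ * e′)) ℤ.+ + (P₁ * e)) (W-≡ A b (e₂ A b) refl) ⟩
      (+ ((P₀ + P₁) * e) ℤ.- + 2 ℤ.* + (P₁ * e) ℤ.- + (P₁ * e′)) ℤ.+ (+ (P₁ * e) ℤ.+ + (P₁ * e′)) ℤ.+ + (P₁ * e)
        ≡⟨ cancel (+ ((P₀ + P₁) * e)) (+ (P₁ * e)) (+ (P₁ * e′)) ⟩
      + ((P₀ + P₁) * e) ≡⟨ cong +_ (ℕ.*-distribʳ-+ e P₀ P₁) ⟩
      + (P₀ * e + P₁ * e) ∎))
      where
      cancel : ∀ x y z → (x ℤ.- + 2 ℤ.* y ℤ.- z) ℤ.+ (y ℤ.+ z) ℤ.+ y ≡ x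
      cancel = solve-∀
    main : s * l + e′ * (a * P₀) ≡ e′ * P₀ + e′ * (a * P₀)
    main = begin
      s * l + e′ * (a * P₀)                            ≡⟨ cong (λ z → s * l + e′ * z) P-step ⟩
      s * l + e′ * ((2 + 2 * a + b) * P₁)              ≡⟨ r₁ a b l e′ P₁ ⟩
      s * l + (P₁ * (suc a * e′) + s * (P₁ * e′))      ≡⟨ cong (λ z → s * l + (P₁ * z + s * (P₁ * e′))) e-step ⟩
      s * l + (P₁ * (s * e) + s * (P₁ * e′))           ≡⟨ r₂ s l P₁ e e′ ⟩
      s * (l + (P₁ * e + P₁ * e′))                     ≡⟨ cong (s *_) l≡ ⟩
      s * (P₀ * e)                                     ≡⟨ r₃ s P₀ e ⟩
      P₀ * (s * e)                                     ≡⟨ cong (P₀ *_) e-step ⟨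
      P₀ * (suc a * e′)                                ≡⟨ r₄ a e′ P₀ ⟩
      e′ * P₀ + e′ * (a * P₀)                          ∎
      where
      r₁ : ∀ a b l e P → suc (a + b) * l + e * ((2 + 2 * a + b) * P) ≡ suc (a + b) * l + (P * (suc a * e) + suc (a + b) * (P * e))
      r₁ = ℕ.solve-∀
      r₂ : ∀ s l P e e′ → s * l + (P * (s * e) + s * (P * e′)) ≡ s * (l + (P * e + P * e′))
      r₂ = ℕ.solve-∀
      r₃ : ∀ s P e → s * (P * e) ≡ P * (s * e)
      r₃ = ℕ.solve-∀
      r₄ : ∀ a e P → P * (suc a * e) ≡ e * P + e * (a * P)
      r₄ = ℕ.solve-∀

-- Edge lists of pieces, and the conditions that make them forests.

module Links where
  open Pieces using (Piece; leaf; node; width; order; edges; edges*)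
  open import Data.Empty using (⊥; ⊥-elim)
  open import Data.List using (List; []; _∷_; _++_; [_]; map; length; _∷ʳ_)
  open import Data.List.Membership.Propositional using (_∈_)
  open import Data.List.Membership.Propositional.Properties using (∈-++⁺ʳ; ∈-++⁻)
  open import Data.List.Properties using (++-assoc; ++-identityʳ; length-++; map-++; ∷-injective)
  open import Data.List.Relation.Unary.All as All using (All; []; _∷_)
  import Data.List.Relation.Unary.All.Properties as All
  open import Data.List.Relation.Unary.Any using (here; there)
  open import Data.Nat using (ℕ; suc; _+_; _≤_; _<_; s≤s; z≤n)
  open import Data.Nat.Properties hiding (_≟_)
  import Data.Nat.Tactic.RingSolver as ℕS
  open import Data.Product using (∃; ∃₂; _×_; _,_; proj₁; proj₂)
  open import Data.Sum using (_⊎_; inj₁; inj₂)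
  open import Data.Unit using (⊤; tt)
  open import Relation.Binary.PropositionalEquality hiding ([_])
  open import Relation.Nullary using (yes; no)

  Edge : Set
  Edge = ℕ × ℕ

  span : Piece → List Piece → Piece → ℕ
  span i ms j = suc (width i + order ms + width j)

  mutual
    -- The edge to the largest neighbour stands before the edges whose components it joins, as
    -- `Gaps` expects. The final `[]` makes the part below it the edge list of a forest, which
    -- `links-node` exploits.
    links : ℕ → Piece → List Edge
    links o leaf            = []
    links o (node i ms j r) = (o , o + span i ms j) ∷
      (links o i ++ (links* (o + suc (width i)) ms ++ (links (o + suc (width i) + order ms) j ++ [])))
      ++ links (o + span i ms j) r

    links* : ℕ → List Piece → List Edge
    links* o []      = []
    links* o (i ∷ f) = links o i ++ links* (o + suc (width i)) f

  order-++ : ∀ f g → order (f ++ g) ≡ order f + order g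
  order-++ []      g = refl
  order-++ (i ∷ f) g = trans (cong (suc (width i) +_) (order-++ f g)) (sym (+-assoc (suc (width i)) (order f) (order g)))

  links*-++ : ∀ o f g → links* o (f ++ g) ≡ links* o f ++ links* (o + order f) g
  links*-++ o []      g = cong (λ x → links* x g) (sym (+-identityʳ o))
  links*-++ o (i ∷ f) g = trans (cong (links o i ++_) (trans (links*-++ (o + suc (width i)) f g)
      (cong (λ x → links* (o + suc (width i)) f ++ links* x g) (+-assoc o (suc (width i)) (order f)))))
    (sym (++-assoc (links o i) _ _))

  under : Piece → List Piece → Piece → List Piece
  under i ms j = i ∷ ms ∷ʳ j

  links-node : ∀ o i ms j r → links o (node i ms j r) ≡ (o , o + span i ms j) ∷ links* o (under i ms j) ++ links (o + span i ms j) r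
  links-node o i ms j r = cong (λ z → (o , o + span i ms j) ∷ (links o i ++ z) ++ links (o + span i ms j) r)
    (sym (links*-++ (o + suc (width i)) ms [ j ]))

  order-under : ∀ i ms j → order (under i ms j) ≡ suc (span i ms j)
  order-under i ms j = trans (cong (suc (width i) +_) (order-++ ms [ j ])) (shuffle (width i) (order ms) (width j))
    where
    shuffle : ∀ a b c → suc a + (b + (suc c + 0)) ≡ suc (suc (a + b + c))
    shuffle = ℕS.solve-∀

  module _ (P : Piece → Set) (base : P leaf)
           (step : ∀ i ms j r → All P (under i ms j) → P r → P (node i ms j r)) where
    mutual
      -- The pieces i, ms, j below an edge are treated as one list with one induction hypothesis;
      -- the nested recursion through lists is done here once and for all.
      piece-ind : ∀ i → P i
      piece-ind leaf            = base
      piece-ind (node i ms j r) = step i ms j r (piece-ind i ∷ All.++⁺ (pieces-ind ms) (piece-ind j ∷ [])) (piece-ind r)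

      pieces-ind : ∀ f → All P f
      pieces-ind []      = []
      pieces-ind (i ∷ f) = piece-ind i ∷ pieces-ind f

  mutual
    length-links : ∀ o i → length (links o i) ≡ edges i
    length-links o leaf            = refl
    length-links o (node i ms j r) = cong suc (begin
      length ((li ++ (lms ++ (lj ++ []))) ++ lr)              ≡⟨ length-++ (li ++ (lms ++ (lj ++ []))) ⟩
      length (li ++ (lms ++ (lj ++ []))) + length lr          ≡⟨ cong (_+ length lr) (trans (length-++ li) (cong (length li +_)
                                                                   (trans (length-++ lms) (cong (λ z → length lms + length z) (++-identityʳ lj))))) ⟩
      length li + (length lms + length lj) + length lr        ≡⟨ cong₂ _+_ (cong₂ _+_ (length-links o i) (cong₂ _+_ (length-links* _ ms) (length-links _ j))) (length-links _ r) ⟩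
      edges i + (edges* ms + edges j) + edges r               ≡⟨ shuffle (edges i) (edges* ms) (edges j) (edges r) ⟩
      edges i + (edges j + (edges r + edges* ms))             ∎)
      where
      open ≡-Reasoning
      li = links o i
      lms = links* (o + suc (width i)) ms
      lj = links (o + suc (width i) + order ms) j
      lr = links (o + span i ms j) r
      shuffle : ∀ a b c d → a + (b + c) + d ≡ a + (c + (d + b))
      shuffle = ℕS.solve-∀

    length-links* : ∀ o f → length (links* o f) ≡ edges* f
    length-links* o []      = refl
    length-links* o (i ∷ f) = trans (length-++ (links o i)) (cong₂ _+_ (length-links o i) (length-links* _ f))

  shiftE : ℕ → Edge → Edge
  shiftE d (a , b) = d + a , d + b

  mutual
    links-shift : ∀ d o i → links (d + o) i ≡ map (shiftE d) (links o i)
    links-shift d o leaf = refl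
    links-shift d o (node i ms j r) = trans (links-node (d + o) i ms j r) (cong₂ _∷_ (cong (d + o ,_) (+-assoc d o t)) (begin
      links* (d + o) (under i ms j) ++ links (d + o + t) r      ≡⟨ cong₂ _++_ inner (trans (cong (λ z → links z r) (+-assoc d o t)) (links-shift d (o + t) r)) ⟩
      map (shiftE d) (links* o (under i ms j)) ++ map (shiftE d) (links (o + t) r) ≡⟨ map-++ (shiftE d) (links* o (under i ms j)) _ ⟨
      map (shiftE d) (links* o (under i ms j) ++ links (o + t) r) ≡⟨ cong (map (shiftE d)) (proj₂ (∷-injective (links-node o i ms j r))) ⟨
      map (shiftE d) ((links o i ++ (links* (o + suc (width i)) ms ++ (links (o + suc (width i) + order ms) j ++ []))) ++ links (o + t) r) ∎))
      where
      open ≡-Reasoning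
      t = span i ms j
      eᵢ : ∀ x → d + o + x ≡ d + (o + x)
      eᵢ = +-assoc d o
      inner : links* (d + o) (under i ms j) ≡ map (shiftE d) (links* o (under i ms j))
      inner = begin
        links (d + o) i ++ links* (d + o + suc (width i)) (ms ∷ʳ j)
          ≡⟨ cong₂ _++_ (links-shift d o i) (trans (cong (λ z → links* z (ms ∷ʳ j)) (eᵢ (suc (width i)))) (links*-++ (d + (o + suc (width i))) ms [ j ])) ⟩
        map (shiftE d) (links o i) ++ (links* (d + (o + suc (width i))) ms ++ (links (d + (o + suc (width i)) + order ms) j ++ []))
          ≡⟨ cong (map (shiftE d) (links o i) ++_) (cong₂ _++_ (links*-shift d (o + suc (width i)) ms)
               (trans (++-identityʳ _) (trans (cong (λ z → links z j) (+-assoc d (o + suc (width i)) (order ms))) (links-shift d (o + suc (width i) + order ms) j)))) ⟩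
        map (shiftE d) (links o i) ++ (map (shiftE d) (links* (o + suc (width i)) ms) ++ map (shiftE d) (links (o + suc (width i) + order ms) j))
          ≡⟨ cong (map (shiftE d) (links o i) ++_) (map-++ (shiftE d) (links* (o + suc (width i)) ms) _) ⟨
        map (shiftE d) (links o i) ++ map (shiftE d) (links* (o + suc (width i)) ms ++ links (o + suc (width i) + order ms) j)
          ≡⟨ map-++ (shiftE d) (links o i) _ ⟨
        map (shiftE d) (links o i ++ (links* (o + suc (width i)) ms ++ links (o + suc (width i) + order ms) j))
          ≡⟨ cong (λ z → map (shiftE d) (links o i ++ (links* (o + suc (width i)) ms ++ z))) (++-identityʳ _) ⟨
        map (shiftE d) (links o i ++ (links* (o + suc (width i)) ms ++ (links (o + suc (width i) + order ms) j ++ [])))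
          ≡⟨ cong (λ z → map (shiftE d) (links o i ++ z)) (links*-++ (o + suc (width i)) ms [ j ]) ⟨
        map (shiftE d) (links* o (under i ms j)) ∎

    links*-shift : ∀ d o f → links* (d + o) f ≡ map (shiftE d) (links* o f)
    links*-shift d o []      = refl
    links*-shift d o (i ∷ f) = trans (cong₂ _++_ (links-shift d o i)
        (trans (cong (λ z → links* z f) (+-assoc d o (suc (width i)))) (links*-shift d (o + suc (width i)) f)))
      (sym (map-++ (shiftE d) (links o i) _))

  Within : ℕ → ℕ → Edge → Set
  Within lo hi (a , b) = lo ≤ a × a < b × b < hi

  -- The position h is the place between the vertices h and h + 1.
  Misses : ℕ → Edge → Set
  Misses h (a , b) = h < a ⊎ b ≤ h

  NonCrossingList : List Edge → Set
  NonCrossingList L = ∀ {a b c d} → (a , b) ∈ L → (c , d) ∈ L → a < c → c < b → b < d → ⊥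

  -- A list with this property is a forest: read backwards, each edge joins two components,
  -- which the position h separates.
  Gaps : List Edge → Set
  Gaps []            = ⊤
  Gaps ((a , b) ∷ L) = (∃ λ h → a ≤ h × h < b × All (Misses h) L) × Gaps L

  record Good (lo hi : ℕ) (L : List Edge) : Set where
    field
      within      : All (Within lo hi) L
      noncrossing : NonCrossingList L
      gaps        : Gaps L
  open Good public

  Good-[] : ∀ {lo hi} → Good lo hi []
  Good-[] = record { within = [] ; noncrossing = λ () ; gaps = tt }

  Gaps-++ : ∀ {mid} xs ys → All (λ e → proj₂ e ≤ mid) xs → All (λ e → mid ≤ proj₁ e) ys → Gaps xs → Gaps ys → Gaps (xs ++ ys)
  Gaps-++ []            ys _       _ _ gs = gs
  Gaps-++ ((a , b) ∷ xs) ys (b≤ ∷ xs≤) ≤ys ((h , a≤h , h<b , m) , gs) gs′ =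
    (h , a≤h , h<b , All.++⁺ m (All.map (λ mid≤ → inj₁ (<-≤-trans h<b (≤-trans b≤ mid≤))) ≤ys)) , Gaps-++ xs ys xs≤ ≤ys gs gs′

  -- The two ranges may share one vertex, as the forest below an edge and the piece starting at its
  -- right end do; hence the bound by `suc mid′`.
  Good-++ : ∀ {lo mid mid′ hi xs ys} → mid ≤ suc mid′ → lo ≤ mid′ → mid ≤ hi → Good lo mid xs → Good mid′ hi ys → Good lo hi (xs ++ ys)
  Good-++ {mid′ = mid′} {xs = xs} {ys} mid≤ lo≤ ≤hi G H = record
    { within = All.++⁺ (All.map (λ (x , y , z) → x , y , <-≤-trans z ≤hi) (G .within)) (All.map (λ (x , y , z) → ≤-trans lo≤ x , y , z) (H .within))
    ; noncrossing = nc
    ; gaps = Gaps-++ xs ys xs≤ ≤ys (G .gaps) (H .gaps) }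
    where
    xs≤ : All (λ e → proj₂ e ≤ mid′) xs
    xs≤ = All.map (λ (_ , _ , z) → ≤-pred (≤-trans z mid≤)) (G .within)
    ≤ys : All (λ e → mid′ ≤ proj₁ e) ys
    ≤ys = All.map proj₁ (H .within)
    nc : NonCrossingList (xs ++ ys)
    nc e∈ f∈ a<c c<b b<d with ∈-++⁻ xs e∈ | ∈-++⁻ xs f∈
    ... | inj₁ p | inj₁ q = G .noncrossing p q a<c c<b b<d
    ... | inj₂ p | inj₂ q = H .noncrossing p q a<c c<b b<d
    ... | inj₁ p | inj₂ q = <⇒≱ c<b (≤-trans (All.lookup xs≤ p) (All.lookup ≤ys q))
    ... | inj₂ p | inj₁ q = <⇒≱ (<-trans a<c (<-trans c<b b<d)) (≤-trans (All.lookup xs≤ q) (All.lookup ≤ys p))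

  GoodPiece : Piece → Set
  GoodPiece i = ∀ o → Good o (o + suc (width i)) (links o i)

  good-pieces : ∀ {f} → All GoodPiece f → ∀ o → Good o (o + order f) (links* o f)
  good-pieces [] o = Good-[]
  good-pieces {i ∷ f} (g ∷ gs) o = Good-++ (n≤1+n _) (m≤m+n o _) (≤-trans (m≤m+n _ (order f)) (≤-reflexive (+-assoc o (suc (width i)) (order f))))
    (g o) (subst (λ z → Good (o + suc (width i)) z (links* (o + suc (width i)) f)) (+-assoc o (suc (width i)) (order f)) (good-pieces gs (o + suc (width i))))

  inner-misses : ∀ o i f → All GoodPiece (i ∷ f) → All (Misses (o + width i)) (links* o (i ∷ f))
  inner-misses o i f (g ∷ gs) = All.++⁺
    (All.map (λ (_ , _ , z) → inj₂ (≤-pred (≤-trans z (≤-reflexive (+-suc o (width i)))))) (g o .within))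
    (All.map (λ (x , _ , _) → inj₁ (≤-trans (≤-reflexive (sym (+-suc o (width i)))) x)) (good-pieces gs (o + suc (width i)) .within))

  -- The gap of the new edge is the position just behind i: no edge of i, ms or j spans it, and all
  -- edges of r start at or beyond the right end.
  good-node : ∀ i ms j r → All GoodPiece (under i ms j) → GoodPiece r → GoodPiece (node i ms j r)
  good-node i ms j r gs g o = subst (Good o (o + suc (t + width r))) (sym (links-node o i ms j r)) (record
    { within = (≤-refl , m<m+n o (s≤s z≤n) , +-monoʳ-< o (s≤s (m≤m+n t (width r)))) ∷ rest .within
    ; noncrossing = nc
    ; gaps = (o + width i , m≤m+n o (width i) , h<x , All.++⁺ (inner-misses o i (ms ∷ʳ j) gs)
        (All.map (λ (x≤ , _) → inj₁ (<-≤-trans h<x x≤)) (outer .within))) , rest .gaps })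
    where
    t = span i ms j
    x = o + t
    h<x : o + width i < x
    h<x = +-monoʳ-< o (s≤s (≤-trans (m≤m+n (width i) (order ms)) (m≤m+n _ (width j))))
    innerG : Good o (suc x) (links* o (under i ms j))
    innerG = subst (λ z → Good o z (links* o (under i ms j))) (trans (cong (o +_) (order-under i ms j)) (+-suc o t)) (good-pieces gs o)
    outer : Good x (o + suc (t + width r)) (links x r)
    outer = subst (λ z → Good x z (links x r)) (trans (+-suc x (width r)) (trans (cong suc (+-assoc o t (width r))) (sym (+-suc o (t + width r))))) (g x)
    rest : Good o (o + suc (t + width r)) (links* o (under i ms j) ++ links x r)
    rest = Good-++ ≤-refl (m≤m+n o t) (≤-trans (≤-reflexive (sym (+-suc o t))) (+-monoʳ-≤ o (s≤s (m≤m+n t (width r))))) innerG outer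
    nc : NonCrossingList ((o , x) ∷ links* o (under i ms j) ++ links x r)
    nc (here refl) (here refl) a<c _ _ = <-irrefl refl a<c
    nc (here refl) (there q) a<c c<b b<d with ∈-++⁻ (links* o (under i ms j)) q
    ... | inj₁ q′ = <⇒≱ b<d (≤-pred (proj₂ (proj₂ (All.lookup (innerG .within) q′))))
    ... | inj₂ q′ = <⇒≱ c<b (proj₁ (All.lookup (outer .within) q′))
    nc (there p) (here refl) a<c _ _ = <⇒≱ a<c (proj₁ (All.lookup (rest .within) p))
    nc (there p) (there q) = rest .noncrossing p q

  abstract
    good-piece : ∀ i → GoodPiece i
    good-piece = piece-ind GoodPiece (λ o → Good-[]) good-node

    good-forest : ∀ f o → Good o (o + order f) (links* o f)
    good-forest f = good-pieces {f} (All.tabulate (λ {i} _ → good-piece i))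

  -- The edge from o to its largest neighbour x, followed by the same for the piece at x, passes
  -- over every position inside the piece. This tells the inside of a piece from the positions
  -- between pieces.
  covered : ∀ i o h → o ≤ h → h < o + width i → ∃₂ λ a b → (a , b) ∈ links o i × a ≤ h × h < b
  covered leaf            o h o≤h h< = ⊥-elim (<⇒≱ h< (≤-trans (≤-reflexive (+-identityʳ o)) o≤h))
  covered (node i ms j r) o h o≤h h< with h <? o + span i ms j
  ... | yes h<x = o , o + span i ms j , here refl , o≤h , h<x
  ... | no  h≮x with covered r (o + span i ms j) h (≮⇒≥ h≮x) (subst (h <_) (sym (+-assoc o (span i ms j) (width r))) h<)
  ...   | a , b , e∈ , a≤h , h<b = a , b , there (∈-++⁺ʳ _ e∈) , a≤h , h<b

-- Uniqueness and existence of the encoding of a set of edges.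

module Encoding where
  open Pieces using (Piece; leaf; node; width; order)
  open Links
  open import Data.Empty using (⊥; ⊥-elim)
  open import Data.List using (List; []; _∷_; _++_; [_]; _∷ʳ_; initLast; _∷ʳ′_)
  open import Data.List.Membership.Propositional using (_∈_)
  open import Data.List.Membership.Propositional.Properties using (∈-++⁺ˡ; ∈-++⁺ʳ; ∈-++⁻)
  open import Data.List.Properties using (++-assoc; ∷-injective; ∷ʳ-injective)
  open import Data.List.Relation.Unary.All as All using (All; []; _∷_)
  open import Data.List.Relation.Unary.Any using (here; there)
  open import Data.Nat using (ℕ; zero; suc; _+_; _∸_; _≤_; _<_; s≤s; z≤n)
  open import Data.Nat.Properties hiding (_≟_)
  open import Data.Product using (∃; _×_; _,_; proj₁; proj₂)
  open import Data.Sum using (_⊎_; inj₁; inj₂)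
  open import Relation.Binary.PropositionalEquality hiding ([_])
  open import Relation.Nullary using (¬_; yes; no; Dec)

  infix 4 _⊆_
  _⊆_ : List Edge → List Edge → Set
  L ⊆ M = ∀ {a b} → (a , b) ∈ L → (a , b) ∈ M

  abstract
    within-piece : ∀ {a b} o i → (a , b) ∈ links o i → o ≤ a × a < b × b ≤ o + width i
    within-piece o i e∈ with All.lookup (good-piece i o .within) e∈
    ... | o≤a , a<b , b< = o≤a , a<b , ≤-pred (≤-trans b< (≤-reflexive (+-suc o (width i))))

    within-forest : ∀ {a b} o f → (a , b) ∈ links* o f → o ≤ a × a < b × b < o + order f
    within-forest o f = All.lookup (good-forest f o .within)

    misses-first : ∀ {a b} o i f → (a , b) ∈ links* o (i ∷ f) → Misses (o + width i) (a , b)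
    misses-first o i f = All.lookup (inner-misses o i f (All.tabulate (λ {i} _ → good-piece i)))

  -- If i′ were wider, the position behind i would lie inside i′ and be spanned by one of its edges;
  -- but this position separates i from f.
  first-width≤ : ∀ o i f i′ f′ → links* o (i′ ∷ f′) ⊆ links* o (i ∷ f) → width i′ ≤ width i
  first-width≤ o i f i′ f′ sup with width i′ ≤? width i
  ... | yes w≤ = w≤
  ... | no  w≰ with covered i′ o (o + width i) (m≤m+n o _) (+-monoʳ-< o (≰⇒> w≰))
  ...   | a , b , e∈ , a≤h , h<b with misses-first o i f (sup (∈-++⁺ˡ e∈))
  ...     | inj₁ h<a = ⊥-elim (<⇒≱ h<a a≤h)
  ...     | inj₂ b≤h = ⊥-elim (<⇒≱ h<b b≤h)

  head-⊆ : ∀ o i f i′ f′ → width i ≡ width i′ → links* o (i ∷ f) ⊆ links* o (i′ ∷ f′) → links o i ⊆ links o i′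
  head-⊆ o i f i′ f′ w≡ sub e∈ with ∈-++⁻ (links o i′) (sub (∈-++⁺ˡ e∈))
  ... | inj₁ e∈′ = e∈′
  ... | inj₂ e∈′ with within-piece o i e∈ | within-forest (o + suc (width i′)) f′ e∈′
  ...   | _ , a<b , b≤ | ≤a , _ = ⊥-elim (<⇒≱ (≤-<-trans ≤a a<b)
          (≤-trans b≤ (+-monoʳ-≤ o (≤-trans (≤-reflexive w≡) (n≤1+n _)))))

  tail-⊆ : ∀ o i f i′ f′ → width i ≡ width i′ → links* o (i ∷ f) ⊆ links* o (i′ ∷ f′) →
    links* (o + suc (width i)) f ⊆ links* (o + suc (width i)) f′
  tail-⊆ o i f i′ f′ w≡ sub {a} {b} e∈ with ∈-++⁻ (links o i′) (sub (∈-++⁺ʳ (links o i) e∈))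
  ... | inj₂ e∈′ = subst (λ w → (a , b) ∈ links* (o + suc w) f′) (sym w≡) e∈′
  ... | inj₁ e∈′ with within-piece o i′ e∈′ | within-forest (o + suc (width i)) f e∈
  ...   | _ , a<b , b≤ | ≤a , _ = ⊥-elim (<⇒≱ (≤-<-trans ≤a a<b)
          (≤-trans b≤ (+-monoʳ-≤ o (≤-trans (≤-reflexive (sym w≡)) (n≤1+n _)))))

  -- Equality of graphs yields equal sets of edges, not equal lists, hence the two inclusions.
  Determined : Piece → Set
  Determined i = ∀ o i′ → width i ≡ width i′ → links o i ⊆ links o i′ → links o i′ ⊆ links o i → i ≡ i′

  forest-determined : ∀ {f} → All Determined f → ∀ o f′ → order f ≡ order f′ →
    links* o f ⊆ links* o f′ → links* o f′ ⊆ links* o f → f ≡ f′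
  forest-determined {[]} [] o [] _ _ _ = refl
  forest-determined {i ∷ f} (d ∷ ds) o (i′ ∷ f′) order≡ sub sup = cong₂ _∷_
    (d o i′ w≡ (head-⊆ o i f i′ f′ w≡ sub) (head-⊆ o i′ f′ i f (sym w≡) sup))
    (forest-determined ds (o + suc (width i)) f′ (+-cancelˡ-≡ (suc (width i)) _ _ (trans order≡ (cong (λ w → suc w + order f′) (sym w≡))))
      (tail-⊆ o i f i′ f′ w≡ sub)
      (subst (λ w → links* (o + suc w) f′ ⊆ links* (o + suc w) f) (sym w≡) (tail-⊆ o i′ f′ i f (sym w≡) sup)))
    where
    w≡ : width i ≡ width i′
    w≡ = ≤-antisym (first-width≤ o i′ f′ i f sub) (first-width≤ o i f i′ f′ sup)

  data NodeLink (o : ℕ) (i : Piece) (ms : List Piece) (j r : Piece) (a b : ℕ) : Set where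
    top   : a ≡ o → b ≡ o + span i ms j → NodeLink o i ms j r a b
    below : (a , b) ∈ links* o (under i ms j) → NodeLink o i ms j r a b
    after : (a , b) ∈ links (o + span i ms j) r → NodeLink o i ms j r a b

  nodeLink⁻ : ∀ {a b} o i ms j r → (a , b) ∈ links o (node i ms j r) → NodeLink o i ms j r a b
  nodeLink⁻ {a} {b} o i ms j r e∈ with subst ((a , b) ∈_) (links-node o i ms j r) e∈
  ... | here refl = top refl refl
  ... | there e∈′ with ∈-++⁻ (links* o (under i ms j)) e∈′
  ...   | inj₁ p = below p
  ...   | inj₂ p = after p

  nodeLink⁺ : ∀ {a b} o i ms j r → NodeLink o i ms j r a b → (a , b) ∈ links o (node i ms j r)
  nodeLink⁺ {a} {b} o i ms j r l = subst ((a , b) ∈_) (sym (links-node o i ms j r)) (go l)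
    where
    go : ∀ {a b} → NodeLink o i ms j r a b → (a , b) ∈ (o , o + span i ms j) ∷ links* o (under i ms j) ++ links (o + span i ms j) r
    go (top refl refl) = here refl
    go (below p)       = there (∈-++⁺ˡ p)
    go (after p)       = there (∈-++⁺ʳ _ p)

  within-below : ∀ {a b} o i ms j → (a , b) ∈ links* o (under i ms j) → o ≤ a × a < b × b ≤ o + span i ms j
  within-below o i ms j e∈ with within-forest o (under i ms j) e∈
  ... | o≤a , a<b , b< = o≤a , a<b , ≤-pred (≤-trans b< (≤-reflexive (trans (cong (o +_) (order-under i ms j)) (+-suc o _))))

  -- The edge to the largest neighbour spans the position behind i, which all edges below it miss.
  not-top : ∀ o i ms j → ¬ (o , o + span i ms j) ∈ links* o (under i ms j)
  not-top o i ms j e∈ with misses-first o i (ms ∷ʳ j) e∈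
  ... | inj₁ h<o = <⇒≱ h<o (m≤m+n o (width i))
  ... | inj₂ x≤h = <⇒≱ (+-monoʳ-< o (s≤s (≤-trans (m≤m+n (width i) (order ms)) (m≤m+n _ (width j))))) x≤h

  -- In the other node the edge (o, o + span) is either the first one or below it, because the edges
  -- of the piece behind start beyond o.
  span≤ : ∀ o i ms j r i′ ms′ j′ r′ → links o (node i ms j r) ⊆ links o (node i′ ms′ j′ r′) → o + span i ms j ≤ o + span i′ ms′ j′
  span≤ o i ms j r i′ ms′ j′ r′ sub with nodeLink⁻ o i′ ms′ j′ r′ (sub (nodeLink⁺ o i ms j r (top refl refl)))
  ... | top _ e = ≤-reflexive e
  ... | below p = proj₂ (proj₂ (within-below o i′ ms′ j′ p))
  ... | after p = ⊥-elim (<⇒≱ (m<m+n o (s≤s z≤n)) (proj₁ (within-piece _ r′ p)))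

  below-⊆ : ∀ o i ms j r i′ ms′ j′ r′ → span i ms j ≡ span i′ ms′ j′ → links o (node i ms j r) ⊆ links o (node i′ ms′ j′ r′) →
    links* o (under i ms j) ⊆ links* o (under i′ ms′ j′)
  below-⊆ o i ms j r i′ ms′ j′ r′ s≡ sub {a} {b} e∈ with nodeLink⁻ o i′ ms′ j′ r′ (sub (nodeLink⁺ o i ms j r (below e∈)))
  ... | top a≡ b≡ = ⊥-elim (not-top o i ms j (subst₂ (λ a b → (a , b) ∈ links* o (under i ms j)) a≡ (trans b≡ (cong (o +_) (sym s≡))) e∈))
  ... | below p = p
  ... | after p with within-below o i ms j e∈ | within-piece _ r′ p
  ...   | _ , a<b , b≤ | ≤a , _ = ⊥-elim (<⇒≱ (≤-<-trans ≤a a<b) (≤-trans b≤ (≤-reflexive (cong (o +_) s≡))))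

  after-⊆ : ∀ o i ms j r i′ ms′ j′ r′ → span i ms j ≡ span i′ ms′ j′ → links o (node i ms j r) ⊆ links o (node i′ ms′ j′ r′) →
    links (o + span i ms j) r ⊆ links (o + span i ms j) r′
  after-⊆ o i ms j r i′ ms′ j′ r′ s≡ sub {a} {b} e∈ with nodeLink⁻ o i′ ms′ j′ r′ (sub (nodeLink⁺ o i ms j r (after e∈)))
  ... | top refl _ = ⊥-elim (<⇒≱ (m<m+n o (s≤s z≤n)) (proj₁ (within-piece _ r e∈)))
  ... | below p with within-below o i′ ms′ j′ p | within-piece _ r e∈
  ...   | _ , a<b , b≤ | ≤a , _ = ⊥-elim (<⇒≱ (≤-<-trans ≤a a<b) (≤-trans b≤ (≤-reflexive (cong (o +_) (sym s≡)))))
  after-⊆ o i ms j r i′ ms′ j′ r′ s≡ sub {a} {b} e∈ | after p = subst (λ s → (a , b) ∈ links (o + s) r′) (sym s≡) p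

  determined : ∀ i → Determined i
  determined = piece-ind Determined base step
    where
    base : Determined leaf
    base o leaf _ _ _ = refl
    base o (node i ms j r) () _ _
    step : ∀ i ms j r → All Determined (under i ms j) → Determined r → Determined (node i ms j r)
    step i ms j r ds d o leaf () _ _
    step i ms j r ds d o (node i′ ms′ j′ r′) w≡ sub sup = assemble (∷-injective unders) (d (o + span i ms j) r′
        (+-cancelˡ-≡ (span i ms j) _ _ (trans w≡ (cong (_+ width r′) (sym s≡))))
        (after-⊆ o i ms j r i′ ms′ j′ r′ s≡ sub)
        (subst (λ s → links (o + s) r′ ⊆ links (o + s) r) (sym s≡) (after-⊆ o i′ ms′ j′ r′ i ms j r (sym s≡) sup)))
      where
      s≡ : span i ms j ≡ span i′ ms′ j′
      s≡ = +-cancelˡ-≡ o _ _ (≤-antisym (span≤ o i ms j r i′ ms′ j′ r′ sub) (span≤ o i′ ms′ j′ r′ i ms j r sup))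
      unders : under i ms j ≡ under i′ ms′ j′
      unders = forest-determined ds o (under i′ ms′ j′) (trans (order-under i ms j) (trans (cong suc s≡) (sym (order-under i′ ms′ j′))))
        (below-⊆ o i ms j r i′ ms′ j′ r′ s≡ sub) (below-⊆ o i′ ms′ j′ r′ i ms j r (sym s≡) sup)
      assemble : i ≡ i′ × ms ∷ʳ j ≡ ms′ ∷ʳ j′ → r ≡ r′ → node i ms j r ≡ node i′ ms′ j′ r′
      assemble (refl , e) refl with ∷ʳ-injective ms ms′ e
      ... | refl , refl = refl

  links*-injective : ∀ o f f′ → order f ≡ order f′ → links* o f ⊆ links* o f′ → links* o f′ ⊆ links* o f → f ≡ f′
  links*-injective o f f′ = forest-determined {f} (All.tabulate (λ {i} _ → determined i)) o f′

  largest : ∀ {P : ℕ → Set} → (∀ x → Dec (P x)) → ∀ e →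
    (∃ λ x → x < e × P x × (∀ {y} → y < e → P y → y ≤ x)) ⊎ (∀ {y} → y < e → ¬ P y)
  largest P? zero = inj₂ λ ()
  largest P? (suc e) with P? e
  ... | yes p = inj₁ (e , ≤-refl , p , λ y< _ → ≤-pred y<)
  ... | no ¬p with largest P? e
  ...   | inj₁ (x , x<e , p , max) = inj₁ (x , m<n⇒m<1+n x<e , p , λ y< q → max (≤∧≢⇒< (≤-pred y<) (λ { refl → ¬p q })) q)
  ...   | inj₂ none = inj₂ (λ y< q → none (≤∧≢⇒< (≤-pred y<) (λ { refl → ¬p q })) q)

  -- The hypothesis `gap` is acyclicity in a form fit for cutting: some position is spanned by {a,
  -- b} and by no other edge inside [a, b]. Each of the codes below covers an interval, since
  -- besides the whole line single blocks and halves get encoded.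
  module Encode (R : ℕ → ℕ → Set) (R? : ∀ a b → Dec (R a b)) (R⇒< : ∀ {a b} → R a b → a < b)
    (nc : ∀ {a b c d} → R a b → R c d → a < c → c < b → b < d → ⊥)
    (gap : ∀ {a b} → R a b → ∃ λ h → a ≤ h × h < b × (∀ {c d} → R c d → a ≤ c → d ≤ b → c ≤ h → h < d → c ≡ a × d ≡ b)) where

    record Represents (lo hi : ℕ) (L : List Edge) : Set where
      constructor represents
      field
        to   : ∀ {a b} → R a b → lo ≤ a → b < hi → (a , b) ∈ L
        from : ∀ {a b} → (a , b) ∈ L → R a b
    open Represents public

    EdgeCode : ℕ → ℕ → Set
    EdgeCode o x = ∃ λ i → ∃ λ ms → ∃ λ j → o + span i ms j ≡ x × Represents o (suc x) (links o (node i ms j leaf))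

    -- The last condition makes the piece maximal: no edge leaves it inside the window ending at e,
    -- so the next piece starts right behind it.
    PieceCode : ℕ → ℕ → Set
    PieceCode o e = ∃ λ i → o + width i < e × Represents o (suc (o + width i)) (links o i)
      × (∀ {a b} → R a b → o ≤ a → a ≤ o + width i → b < e → b ≤ o + width i)

    ForestCode : ℕ → ℕ → Set
    ForestCode o l = ∃ λ f → order f ≡ l × Represents o (o + l) (links* o f)

    -- The gap h cuts the interval in two. The forest on [o, h] begins with the piece i of o, the
    -- one on [h + 1, x] ends with the piece j of x, and the remaining pieces of both form `ms`.
    join-edge : ∀ o x h → R o x → o ≤ h → h < x →
      (∀ {c d} → R c d → o ≤ c → d ≤ x → c ≤ h → h < d → c ≡ o × d ≡ x) →
      ForestCode o (suc h ∸ o) → ForestCode (suc h) (x ∸ h) → EdgeCode o x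
    join-edge o x h r o≤h h<x only (f , f≡ , repf) (g , g≡ , repg) = go f g f≡ g≡ repf repg
      where
      o+≡ : o + (suc h ∸ o) ≡ suc h
      o+≡ = m+[n∸m]≡n (≤-trans o≤h (n≤1+n h))
      h+≡ : suc h + (x ∸ h) ≡ suc x
      h+≡ = cong suc (m+[n∸m]≡n (<⇒≤ h<x))
      go : ∀ f g → order f ≡ suc h ∸ o → order g ≡ x ∸ h → Represents o (o + (suc h ∸ o)) (links* o f) →
        Represents (suc h) (suc h + (x ∸ h)) (links* (suc h) g) → EdgeCode o x
      go [] g f≡ _ _ _ = ⊥-elim (<-irrefl f≡ (m<n⇒0<n∸m (s≤s o≤h)))
      go (i ∷ f) g f≡ g≡ repf repg with initLast g
      ... | [] = ⊥-elim (<-irrefl g≡ (m<n⇒0<n∸m h<x))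
      ... | g′ ∷ʳ′ j = i , f ++ g′ , j , x≡ , represents t f′
        where
        u≡ : under i (f ++ g′) j ≡ (i ∷ f) ++ (g′ ∷ʳ j)
        u≡ = cong (i ∷_) (++-assoc f g′ [ j ])
        x≡ : o + span i (f ++ g′) j ≡ x
        x≡ = suc-injective (begin
          suc (o + span i (f ++ g′) j)               ≡⟨ +-suc o _ ⟨
          o + suc (span i (f ++ g′) j)               ≡⟨ cong (o +_) (order-under i (f ++ g′) j) ⟨
          o + order (under i (f ++ g′) j)            ≡⟨ cong (λ z → o + order z) u≡ ⟩
          o + order ((i ∷ f) ++ (g′ ∷ʳ j))           ≡⟨ cong (o +_) (trans (order-++ (i ∷ f) (g′ ∷ʳ j)) (cong₂ _+_ f≡ g≡)) ⟩
          o + (suc h ∸ o + (x ∸ h))                  ≡⟨ +-assoc o _ _ ⟨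
          o + (suc h ∸ o) + (x ∸ h)                  ≡⟨ cong (_+ (x ∸ h)) o+≡ ⟩
          suc h + (x ∸ h)                            ≡⟨ h+≡ ⟩
          suc x                                      ∎)
          where open ≡-Reasoning
        l≡ : links* o (under i (f ++ g′) j) ≡ links* o (i ∷ f) ++ links* (suc h) (g′ ∷ʳ j)
        l≡ = trans (cong (links* o) u≡) (trans (links*-++ o (i ∷ f) (g′ ∷ʳ j))
          (cong (λ z → links* o (i ∷ f) ++ links* z (g′ ∷ʳ j)) (trans (cong (o +_) f≡) o+≡)))
        t : ∀ {a b} → R a b → o ≤ a → b < suc x → (a , b) ∈ links o (node i (f ++ g′) j leaf)
        t {a} {b} rab o≤a b<x with a ≤? h | h <? b
        ... | no a≰h | _ = nodeLink⁺ o i (f ++ g′) j leaf (below (subst (_ ∈_) (sym l≡) (∈-++⁺ʳ (links* o (i ∷ f)) (repg .to rab (≰⇒> a≰h) (subst (b <_) (sym h+≡) b<x)))))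
        ... | yes a≤h | no h≮b = nodeLink⁺ o i (f ++ g′) j leaf (below (subst (_ ∈_) (sym l≡) (∈-++⁺ˡ (repf .to rab o≤a (subst (b <_) (sym o+≡) (s≤s (≮⇒≥ h≮b)))))))
        ... | yes a≤h | yes h<b with only rab o≤a (≤-pred b<x) a≤h h<b
        ...   | refl , refl = nodeLink⁺ o i (f ++ g′) j leaf (top refl (sym x≡))
        f′ : ∀ {a b} → (a , b) ∈ links o (node i (f ++ g′) j leaf) → R a b
        f′ {a} {b} e∈ with nodeLink⁻ o i (f ++ g′) j leaf e∈
        ... | top refl refl = subst (R o) (sym x≡) r
        ... | below p with ∈-++⁻ (links* o (i ∷ f)) (subst ((a , b) ∈_) l≡ p)
        ...   | inj₁ q = repf .from q
        ...   | inj₂ q = repg .from q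

    -- An edge that starts before x and ends beyond x would cross {o, x}, or start at o and
    -- contradict the choice of x as largest neighbour.
    join-piece : ∀ o x e → R o x → x < e → (∀ {y} → y < e → R o y → y ≤ x) → EdgeCode o x → PieceCode x e → PieceCode o e
    join-piece o x e r x<e max (i , ms , j , refl , repE) (p , w< , repP , closed) =
      node i ms j p , subst (_< e) (+-assoc o s (width p)) w< , represents t f , c
      where
      s = span i ms j
      t : ∀ {a b} → R a b → o ≤ a → b < suc (o + (s + width p)) → (a , b) ∈ links o (node i ms j p)
      t {a} {b} rab o≤a b< with x ≤? a | b ≤? x
      ... | yes x≤a | _ = nodeLink⁺ o i ms j p (after (repP .to rab x≤a (subst (λ z → b < suc z) (sym (+-assoc o s (width p))) b<)))
      ... | no _ | yes b≤x with nodeLink⁻ o i ms j leaf (repE .to rab o≤a (s≤s b≤x))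
      ...   | top a≡ b≡ = nodeLink⁺ o i ms j p (top a≡ b≡)
      ...   | below q   = nodeLink⁺ o i ms j p (below q)
      t {a} {b} rab o≤a b< | no x≰a | no b≰x with m≤n⇒m<n∨m≡n o≤a
      ...   | inj₁ o<a  = ⊥-elim (nc r rab o<a (≰⇒> x≰a) (≰⇒> b≰x))
      ...   | inj₂ refl = ⊥-elim (b≰x (max (≤-trans b< (≤-trans (s≤s (≤-reflexive (sym (+-assoc o s (width p))))) w<)) rab))
      f : ∀ {a b} → (a , b) ∈ links o (node i ms j p) → R a b
      f e∈ with nodeLink⁻ o i ms j p e∈
      ... | top refl refl = r
      ... | below q = repE .from (nodeLink⁺ o i ms j leaf (below q))
      ... | after q = repP .from q
      c : ∀ {a b} → R a b → o ≤ a → a ≤ o + (s + width p) → b < e → b ≤ o + (s + width p)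
      c {a} {b} rab o≤a a≤ b<e with x ≤? a
      ... | yes x≤a = subst (b ≤_) (+-assoc o s (width p)) (closed rab x≤a (subst (a ≤_) (sym (+-assoc o s (width p))) a≤) b<e)
      ... | no x≰a with b ≤? x
      ...   | yes b≤x = ≤-trans b≤x (+-monoʳ-≤ o (m≤m+n s (width p)))
      ...   | no b≰x with m≤n⇒m<n∨m≡n o≤a
      ...     | inj₁ o<a  = ⊥-elim (nc r rab o<a (≰⇒> x≰a) (≰⇒> b≰x))
      ...     | inj₂ refl = ⊥-elim (b≰x (max b<e rab))

    join-forest : ∀ o l → ((i , _) : PieceCode o (o + suc l)) → ForestCode (o + suc (width i)) (l ∸ width i) → ForestCode o (suc l)
    join-forest o l (i , w< , repI , closed) (f , f≡ , repF) = i ∷ f , order≡ , represents t fr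
      where
      w≤l : width i ≤ l
      w≤l = ≤-pred (+-cancelˡ-< o (width i) (suc l) w<)
      order≡ : suc (width i) + order f ≡ suc l
      order≡ = cong suc (trans (cong (width i +_) f≡) (m+[n∸m]≡n w≤l))
      hi≡ : o + suc (width i) + (l ∸ width i) ≡ o + suc l
      hi≡ = trans (+-assoc o _ _) (cong (λ z → o + suc z) (m+[n∸m]≡n w≤l))
      t : ∀ {a b} → R a b → o ≤ a → b < o + suc l → (a , b) ∈ links* o (i ∷ f)
      t {a} {b} rab o≤a b< with a ≤? o + width i
      ... | yes a≤ = ∈-++⁺ˡ (repI .to rab o≤a (s≤s (closed rab o≤a a≤ b<)))
      ... | no a≰ = ∈-++⁺ʳ (links o i) (repF .to rab (≤-trans (≤-reflexive (+-suc o (width i))) (≰⇒> a≰)) (subst (b <_) (sym hi≡) b<))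
      fr : ∀ {a b} → (a , b) ∈ links* o (i ∷ f) → R a b
      fr e∈ with ∈-++⁻ (links o i) e∈
      ... | inj₁ p = repI .from p
      ... | inj₂ p = repF .from p

    abstract
      mutual
        -- The fuel bounds the length of the interval. An edge is cut at its gap into two shorter
        -- intervals, and a piece is continued at a neighbour x > o.
        encode-edge : ∀ fuel o x → R o x → x ≤ o + fuel → EdgeCode o x
        encode-edge fuel o x r x≤ with gap r
        ... | h , o≤h , h<x , only = join-edge o x h r o≤h h<x only
          (encode-forest fuel o (suc h ∸ o) (≤-trans (∸-monoˡ-≤ o h<x) x∸o≤))
          (encode-forest fuel (suc h) (x ∸ h) (≤-trans (∸-monoʳ-≤ x o≤h) x∸o≤))
          where
          x∸o≤ : x ∸ o ≤ fuel
          x∸o≤ = ≤-trans (∸-monoˡ-≤ o x≤) (≤-reflexive (m+n∸m≡n o fuel))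

        encode-piece : ∀ fuel o e → o < e → e ≤ o + fuel → PieceCode o e
        encode-piece zero o e o<e e≤ = ⊥-elim (<⇒≱ o<e (≤-trans e≤ (≤-reflexive (+-identityʳ o))))
        encode-piece (suc fuel) o e o<e e≤ with largest (R? o) e
        ... | inj₁ (x , x<e , r , max) = join-piece o x e r x<e max
          (encode-edge fuel o x r (≤-pred (≤-trans x<e (≤-trans e≤ (≤-reflexive (+-suc o fuel))))))
          (encode-piece fuel x e x<e (≤-trans e≤ (≤-trans (≤-reflexive (+-suc o fuel)) (+-monoˡ-≤ fuel (R⇒< r)))))
        ... | inj₂ none = leaf , subst (_< e) (sym (+-identityʳ o)) o<e
          , represents (λ {a} {b} rab o≤a b< → ⊥-elim (<⇒≱ (R⇒< rab) (≤-trans (≤-pred (subst (λ z → b < suc z) (+-identityʳ o) b<)) o≤a))) (λ ())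
          , λ {a} {b} rab o≤a a≤ b<e → ⊥-elim (none b<e (subst (λ z → R z b) (≤-antisym (subst (a ≤_) (+-identityʳ o) a≤) o≤a) rab))

        encode-forest : ∀ fuel o l → l ≤ fuel → ForestCode o l
        encode-forest fuel o zero _ = [] , refl
          , represents (λ rab o≤a b< → ⊥-elim (<⇒≱ (R⇒< rab) (≤-trans (<⇒≤ b<) (≤-trans (≤-reflexive (+-identityʳ o)) o≤a)))) (λ ())
        encode-forest (suc fuel) o (suc l) (s≤s l≤) with encode-piece (suc fuel) o (o + suc l) (m<m+n o (s≤s z≤n)) (+-monoʳ-≤ o (s≤s l≤))
        ... | pc = join-forest o l pc (encode-forest fuel _ (l ∸ width (proj₁ pc)) (≤-trans (m∸n≤m l (width (proj₁ pc))) l≤))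

-- Graphs on a circle with vertices modulo n.

module Circles where
  open import Defs
  open Links using (Edge; shiftE)
  open import Data.Bool using (Bool; true; false)
  open import Data.Fin using (Fin; toℕ; fromℕ<)
  open import Data.Fin.Properties using (toℕ-injective; toℕ-fromℕ<; toℕ<n)
  open import Data.List using (List; map)
  open import Data.List.Relation.Unary.Any as Any using (Any; any?)
  import Data.List.Relation.Unary.Any.Properties as Any
  open import Data.Nat using (ℕ; zero; suc; _+_; _*_; _≟_)
  open import Data.Nat.DivMod using (_%_; m%n<n; m%n%n≡m%n; m<n⇒m%n≡m; %-distribˡ-+; [m+kn]%n≡m%n; [m+n]%n≡m%n)
  open import Data.Nat.Properties using (+-comm; +-suc)
  import Data.Nat.Tactic.RingSolver as ℕS
  open import Data.Product using (_×_; _,_)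
  open import Data.Sum as Sum using (_⊎_)
  open import Data.Vec using (lookup; tabulate)
  open import Data.Vec.Properties using (lookup∘tabulate; tabulate∘lookup; tabulate-cong)
  open import Function using (_∘_)
  open import Relation.Binary.PropositionalEquality hiding ([_])
  open import Relation.Nullary using (Dec; yes; no; does; _×-dec_; _⊎-dec_)
  open import Relation.Nullary.Decidable using (dec-true; map′)

  module Circle (n′ : ℕ) where
    n = suc n′

    infix 4 _≅_
    record _≅_ (x y : ℕ) : Set where
      constructor mod
      field rem : x % n ≡ y % n
    open _≅_ public

    ≅-refl : ∀ {x} → x ≅ x
    ≅-refl = mod refl

    ≅-reflexive : ∀ {x y} → x ≡ y → x ≅ y
    ≅-reflexive refl = mod refl

    ≅-sym : ∀ {x y} → x ≅ y → y ≅ x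
    ≅-sym (mod e) = mod (sym e)

    ≅-trans : ∀ {x y z} → x ≅ y → y ≅ z → x ≅ z
    ≅-trans (mod e) (mod f) = mod (trans e f)

    ≅? : ∀ x y → Dec (x ≅ y)
    ≅? x y = map′ mod rem (x % n ≟ y % n)

    ≅-+ˡ : ∀ d {x y} → x ≅ y → d + x ≅ d + y
    ≅-+ˡ d {x} {y} (mod x≅y) = mod (trans (%-distribˡ-+ d x n) (trans (cong (λ z → (d % n + z) % n) x≅y) (sym (%-distribˡ-+ d y n))))

    ≅-+kn : ∀ x k → x + k * n ≅ x
    ≅-+kn x k = mod ([m+kn]%n≡m%n x k n)

    ≅-n+ : ∀ x → n + x ≅ x
    ≅-n+ x = mod (trans (cong (_% n) (+-comm n x)) ([m+n]%n≡m%n x n))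

    -- d n′ acts as -d.
    undo : ∀ d x → d + (d * n′ + x) ≅ x
    undo d x = ≅-trans (≅-reflexive (arith d n′ x)) (≅-+kn x d)
      where
      arith : ∀ d n′ x → d + (d * n′ + x) ≡ x + d * suc n′
      arith = ℕS.solve-∀

    ≅-cancelˡ : ∀ d {x y} → d + x ≅ d + y → x ≅ y
    ≅-cancelˡ d {x} {y} e = ≅-trans (≅-sym (flip x)) (≅-trans (≅-+ˡ (d * n′) e) (flip y))
      where
      arith : ∀ d n′ x → d * n′ + (d + x) ≡ x + d * suc n′
      arith = ℕS.solve-∀
      flip : ∀ x → d * n′ + (d + x) ≅ x
      flip x = ≅-trans (≅-reflexive (arith d n′ x)) (≅-+kn x d)

    res : ℕ → Fin n
    res x = fromℕ< (m%n<n x n)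

    toℕ-res : ∀ x → toℕ (res x) ≡ x % n
    toℕ-res x = toℕ-fromℕ< (m%n<n x n)

    res-cong : ∀ {x y} → x ≅ y → res x ≡ res y
    res-cong {x} {y} (mod e) = toℕ-injective (trans (toℕ-res x) (trans e (sym (toℕ-res y))))

    res-toℕ : ∀ i → res (toℕ i) ≡ i
    res-toℕ i = toℕ-injective (trans (toℕ-res (toℕ i)) (m<n⇒m%n≡m (toℕ<n i)))

    rotBy-res : ∀ d x → rotBy d (res x) ≡ res (d + x)
    rotBy-res d x = trans (cong (λ z → res (z + d)) (toℕ-res x)) (res-cong (≅-trans (≅-reflexive (+-comm (x % n) d)) (≅-+ˡ d (mod (m%n%n≡m%n x n)))))

    -- Indexing by natural numbers modulo n turns rotation into addition, without a case distinction
    -- at the wrap-around.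
    at : Graph n → ℕ → ℕ → Bool
    at A x y = lookup (lookup A (res x)) (res y)

    record At (A : Graph n) (x y : ℕ) : Set where
      constructor mkAt
      field isTrue : at A x y ≡ true
    open At public

    at-cong : ∀ A {x x′ y y′} → x ≅ x′ → y ≅ y′ → at A x y ≡ at A x′ y′
    at-cong A e e′ = cong₂ (λ i j → lookup (lookup A i) j) (res-cong e) (res-cong e′)

    graph-ext : ∀ {A B : Graph n} → (∀ x y → at A x y ≡ at B x y) → A ≡ B
    graph-ext {A} {B} h = trans (sym (tabulate∘lookup A)) (trans (tabulate-cong row) (tabulate∘lookup B))
      where
      entry : ∀ i j → lookup (lookup A i) j ≡ lookup (lookup B i) j
      entry i j = subst₂ (λ i j → lookup (lookup A i) j ≡ lookup (lookup B i) j) (res-toℕ i) (res-toℕ j) (h (toℕ i) (toℕ j))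
      row : ∀ i → lookup A i ≡ lookup B i
      row i = trans (sym (tabulate∘lookup (lookup A i))) (trans (tabulate-cong (entry i)) (tabulate∘lookup (lookup B i)))

    shift-ext : ∀ d {A B : Graph n} → (∀ x y → at A (d + x) (d + y) ≡ at B (d + x) (d + y)) → A ≡ B
    shift-ext d {A} {B} h = graph-ext λ x y →
      trans (sym (at-cong A (undo d x) (undo d y))) (trans (h (d * n′ + x) (d * n′ + y)) (at-cong B (undo d x) (undo d y)))

    at-tabulate : ∀ (g : Fin n → Fin n → Bool) i j → lookup (lookup (tabulate λ i → tabulate (g i)) i) j ≡ g i j
    at-tabulate g i j = trans (cong (λ v → lookup v j) (lookup∘tabulate (λ i → tabulate (g i)) i)) (lookup∘tabulate (g i) j)

    at-ρ : ∀ A x y → at (ρ A) (suc x) (suc y) ≡ at A x y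
    at-ρ A x y = trans (at-tabulate (λ i j → lookup (lookup A (rotBy n′ i)) (rotBy n′ j)) (res (suc x)) (res (suc y)))
      (cong₂ (λ i j → lookup (lookup A i) j) (back x) (back y))
      where
      back : ∀ x → rotBy n′ (res (suc x)) ≡ res x
      back x = trans (rotBy-res n′ (suc x)) (res-cong (≅-trans (≅-reflexive (+-suc n′ x)) (≅-n+ x)))

    at-ρ^ : ∀ d A x y → at (ρ^ d A) (d + x) (d + y) ≡ at A x y
    at-ρ^ zero    A x y = refl
    at-ρ^ (suc d) A x y = trans (at-ρ (ρ^ d A) (d + x) (d + y)) (at-ρ^ d A x y)

    ρ^-+ : ∀ d e (A : Graph n) → ρ^ (d + e) A ≡ ρ^ d (ρ^ e A)
    ρ^-+ zero    e A = refl
    ρ^-+ (suc d) e A = cong ρ (ρ^-+ d e A)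

    ρ^-comm : ∀ d e (A : Graph n) → ρ^ d (ρ^ e A) ≡ ρ^ e (ρ^ d A)
    ρ^-comm d e A = trans (sym (ρ^-+ d e A)) (trans (cong (λ z → ρ^ z A) (+-comm d e)) (ρ^-+ e d A))

    ρ^-period : ∀ k (A : Graph n) → ρ^ (k * n) A ≡ A
    ρ^-period k A = shift-ext (k * n) λ x y → trans (at-ρ^ (k * n) A x y)
      (sym (at-cong A (kn+ x) (kn+ y)))
      where
      kn+ : ∀ x → k * n + x ≅ x
      kn+ x = ≅-trans (≅-reflexive (+-comm (k * n) x)) (≅-+kn x k)

    ρ^-injective : ∀ d {A B : Graph n} → ρ^ d A ≡ ρ^ d B → A ≡ B
    ρ^-injective d {A} {B} e = graph-ext λ x y → trans (sym (at-ρ^ d A x y)) (trans (cong (λ C → at C (d + x) (d + y)) e) (at-ρ^ d B x y))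

    -- A list stores an edge once and possibly with ends beyond n, whereas adjacency is symmetric
    -- and concerns residues.
    Joins : ℕ → ℕ → Edge → Set
    Joins x y (a , b) = (a ≅ x × b ≅ y) ⊎ (a ≅ y × b ≅ x)

    Link : List Edge → ℕ → ℕ → Set
    Link L x y = Any (Joins x y) L

    joins? : ∀ x y e → Dec (Joins x y e)
    joins? x y (a , b) = (≅? a x ×-dec ≅? b y) ⊎-dec (≅? a y ×-dec ≅? b x)

    link? : ∀ L x y → Dec (Link L x y)
    link? L x y = any? (joins? x y) L

    Link-cong : ∀ {L x x′ y y′} → x ≅ x′ → y ≅ y′ → Link L x y → Link L x′ y′
    Link-cong e e′ = Any.map (Sum.map (λ (p , q) → ≅-trans p e , ≅-trans q e′) (λ (p , q) → ≅-trans p e′ , ≅-trans q e))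

    Link-sym : ∀ {L x y} → Link L x y → Link L y x
    Link-sym = Any.map Sum.swap

    abstract
      fromLinks : List Edge → Graph n
      fromLinks L = tabulate λ i → tabulate λ j → does (link? L (toℕ i) (toℕ j))

      at-fromLinks : ∀ L x y → at (fromLinks L) x y ≡ does (link? L (toℕ (res x)) (toℕ (res y)))
      at-fromLinks L x y = at-tabulate (λ i j → does (link? L (toℕ i) (toℕ j))) (res x) (res y)

    res-≅ : ∀ x → toℕ (res x) ≅ x
    res-≅ x = ≅-trans (≅-reflexive (toℕ-res x)) (mod (m%n%n≡m%n x n))

    At⇒Link : ∀ L x y → At (fromLinks L) x y → Link L x y
    At⇒Link L x y (mkAt h) with link? L (toℕ (res x)) (toℕ (res y)) | at-fromLinks L x y
    ... | yes l | _ = Link-cong (res-≅ x) (res-≅ y) l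
    ... | no  _ | e with () ← trans (sym h) e

    Link⇒At : ∀ L x y → Link L x y → At (fromLinks L) x y
    Link⇒At L x y l = mkAt (trans (at-fromLinks L x y) (dec-true (link? L (toℕ (res x)) (toℕ (res y))) (Link-cong (≅-sym (res-≅ x)) (≅-sym (res-≅ y)) l)))

    bool-ext : ∀ {b c : Bool} → (b ≡ true → c ≡ true) → (c ≡ true → b ≡ true) → b ≡ c
    bool-ext {false} {false} f g = refl
    bool-ext {false} {true}  f g = g refl
    bool-ext {true}  {c}     f g = sym (f refl)

    ≡fromLinks : ∀ {A L} → (∀ x y → At A x y → Link L x y) → (∀ x y → Link L x y → At A x y) → A ≡ fromLinks L
    ≡fromLinks {L = L} to from = graph-ext λ x y → bool-ext (isTrue ∘ Link⇒At L x y ∘ to x y ∘ mkAt) (isTrue ∘ from x y ∘ At⇒Link L x y ∘ mkAt)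

    fromLinks-cong : ∀ {L M} → (∀ x y → Link L x y → Link M x y) → (∀ x y → Link M x y → Link L x y) → fromLinks L ≡ fromLinks M
    fromLinks-cong {L} {M} to from = ≡fromLinks {L = M} (λ x y → to x y ∘ At⇒Link L x y) (λ x y → Link⇒At L x y ∘ from x y)

    Link-shift⁺ : ∀ d {L x y} → Link L x y → Link (map (shiftE d) L) (d + x) (d + y)
    Link-shift⁺ d l = Any.map⁺ (Any.map (Sum.map (λ (p , q) → ≅-+ˡ d p , ≅-+ˡ d q) (λ (p , q) → ≅-+ˡ d p , ≅-+ˡ d q)) l)

    Link-shift⁻ : ∀ d {L x y} → Link (map (shiftE d) L) (d + x) (d + y) → Link L x y
    Link-shift⁻ d {L} {x} {y} l = Any.map {P = λ e → Joins (d + x) (d + y) (shiftE d e)} {Q = Joins x y} (Sum.map (λ (p , q) → ≅-cancelˡ d p , ≅-cancelˡ d q) (λ (p , q) → ≅-cancelˡ d p , ≅-cancelˡ d q)) (Any.map⁻ l)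

    ρ^-fromLinks : ∀ d L → ρ^ d (fromLinks L) ≡ fromLinks (map (shiftE d) L)
    ρ^-fromLinks d L = shift-ext d λ x y → trans (at-ρ^ d (fromLinks L) x y)
      (bool-ext (isTrue ∘ Link⇒At L′ (d + x) (d + y) ∘ Link-shift⁺ d ∘ At⇒Link L x y ∘ mkAt)
                (isTrue ∘ Link⇒At L x y ∘ Link-shift⁻ d ∘ At⇒Link L′ (d + x) (d + y) ∘ mkAt))
      where L′ = map (shiftE d) L

    At-ρ^⁺ : ∀ d A {x y} → At A x y → At (ρ^ d A) (d + x) (d + y)
    At-ρ^⁺ d A {x} {y} (mkAt h) = mkAt (trans (at-ρ^ d A x y) h)

    At-ρ^⁻ : ∀ d A {x y} → At (ρ^ d A) (d + x) (d + y) → At A x y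
    At-ρ^⁻ d A {x} {y} (mkAt h) = mkAt (trans (sym (at-ρ^ d A x y)) h)

    At-cong : ∀ A {x x′ y y′} → x ≅ x′ → y ≅ y′ → At A x y → At A x′ y′
    At-cong A e e′ (mkAt h) = mkAt (trans (sym (at-cong A e e′)) h)

-- Edge lists with gaps are forests with the expected number of components.

module Forests where
  open import Defs
  open Links using (Edge; Good; Within; Misses; Gaps; within; noncrossing; gaps)
  open Circles
  open import Data.Empty using (⊥; ⊥-elim)
  open import Data.Fin using (Fin; zero; suc; toℕ; fromℕ<; punchIn; punchOut)
  open import Data.Fin.Properties using (toℕ-injective; toℕ-fromℕ<; toℕ<n; _≟_; punchOut-cong; punchIn-punchOut; punchOut-punchIn; punchInᵢ≢i)
  open import Data.List using (List; []; _∷_; length)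
  open import Data.List.Membership.Propositional using (_∈_; find; lose)
  open import Data.List.Relation.Unary.All as All using (All; []; _∷_)
  open import Data.List.Relation.Unary.Any using (here; there)
  open import Data.Nat as ℕ using (ℕ; zero; suc; _+_; _≤_; _<_; s≤s; z≤n)
  open import Data.Nat.DivMod using (m<n⇒m%n≡m)
  open import Data.Nat.Properties as ℕ using (<⇒≱; <⇒≤; ≤-trans; <-irrefl; <-trans; ≤-refl; +-suc; +-comm; +-identityʳ)
  open import Data.Product using (∃; _×_; _,_; proj₁; proj₂)
  open import Data.Sum as Sum using (_⊎_; inj₁; inj₂)
  open import Function.Definitions using (Injective)
  open import Relation.Binary.Construct.Closure.ReflexiveTransitive as Star using (Star; ε; _◅_; _◅◅_)
  open import Relation.Binary.PropositionalEquality hiding ([_])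
  open import Relation.Nullary using (yes; no; ¬_)

  Joined : ∀ {n} → List Edge → Fin n → Fin n → Set
  Joined L i j = (toℕ i , toℕ j) ∈ L ⊎ (toℕ j , toℕ i) ∈ L

  Joined-sym : ∀ {n L} {i j : Fin n} → Joined L i j → Joined L j i
  Joined-sym = Sum.swap

  Joined-there : ∀ {n e L} {i j : Fin n} → Joined L i j → Joined (e ∷ L) i j
  Joined-there = Sum.map there there

  Ordered : List Edge → Set
  Ordered = All (λ (a , b) → a < b)

  separated : ∀ {n h L} {i j : Fin n} → Ordered L → All (Misses h) L → Star (Joined L) i j → toℕ i ≤ h → toℕ j ≤ h
  separated o m ε i≤ = i≤
  separated o m (inj₁ e ◅ s) i≤ with All.lookup m e
  ... | inj₁ h<i = ⊥-elim (<⇒≱ h<i i≤)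
  ... | inj₂ j≤  = separated o m s j≤
  separated o m (inj₂ e ◅ s) i≤ = separated o m s (≤-trans (<⇒≤ (All.lookup o e)) i≤)

  -- Components are given as a map onto `Fin k` with representatives, so that an additional edge can
  -- merge two of them by deleting one element of `Fin (suc k)`.
  record Classes {n} (L : List Edge) (k : ℕ) : Set where
    field
      class : Fin n → Fin k
      sound : ∀ {i j} → Joined L i j → class i ≡ class j
      rep   : Fin k → Fin n
      class-rep : ∀ c → class (rep c) ≡ c
      reach : ∀ i → Star (Joined L) i (rep (class i))

  -- Before {a, b} is added, its ends lie in different classes because h separates them. The class
  -- of b is sent to that of a, and its number is then removed by `punchOut`.
  module Merge {n k a b h L} (C : Classes {n} L (suc k)) (ordered : Ordered ((a , b) ∷ L)) (a<n : a < n) (b<n : b < n)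
    (a≤h : a ≤ h) (h<b : h < b) (misses : All (Misses h) L) where
    open Classes C
    α β : Fin n
    α = fromℕ< a<n
    β = fromℕ< b<n

    α≢β : class β ≢ class α
    α≢β e = <⇒≱ h<b (subst (_≤ h) (toℕ-fromℕ< b<n) (separated (All.tail ordered) misses path (subst (_≤ h) (sym (toℕ-fromℕ< a<n)) a≤h)))
      where
      path : Star (Joined L) α β
      path = reach α ◅◅ subst (λ c → Star (Joined L) (rep c) β) e (Star.reverse Joined-sym (reach β))

    merged : Fin n → Fin (suc k)
    merged i with class i ≟ class β
    ... | yes _ = class α
    ... | no  _ = class i

    merged≢ : ∀ i → class β ≢ merged i
    merged≢ i with class i ≟ class β
    ... | yes _ = α≢β
    ... | no  ≢ = λ e → ≢ (sym e)

    merged-cong : ∀ {i j} → class i ≡ class j → merged i ≡ merged j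
    merged-cong {i} {j} e with class i ≟ class β | class j ≟ class β
    ... | yes _ | yes _ = refl
    ... | no  _ | no  _ = e
    ... | yes p | no  ¬p = ⊥-elim (¬p (trans (sym e) p))
    ... | no ¬p | yes p = ⊥-elim (¬p (trans e p))

    merged-other : ∀ i → class β ≢ class i → merged i ≡ class i
    merged-other i ≢ with class i ≟ class β
    ... | yes p = ⊥-elim (≢ (sym p))
    ... | no  _ = refl

    merged-β : merged β ≡ class α
    merged-β with class β ≟ class β
    ... | yes _ = refl
    ... | no ¬p = ⊥-elim (¬p refl)

    head-sound : ∀ {i j} → (toℕ i , toℕ j) ≡ (a , b) → merged i ≡ merged j
    head-sound {i} {j} e = trans (cong merged i≡) (trans (merged-other α α≢β) (trans (sym merged-β) (cong merged (sym j≡))))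
      where
      i≡ : i ≡ α
      i≡ = toℕ-injective (trans (cong proj₁ e) (sym (toℕ-fromℕ< a<n)))
      j≡ : j ≡ β
      j≡ = toℕ-injective (trans (cong proj₂ e) (sym (toℕ-fromℕ< b<n)))

    merged-sound : ∀ {i j} → Joined ((a , b) ∷ L) i j → merged i ≡ merged j
    merged-sound (inj₁ (here e))  = head-sound e
    merged-sound (inj₂ (here e))  = sym (head-sound e)
    merged-sound (inj₁ (there e)) = merged-cong (sound (inj₁ e))
    merged-sound (inj₂ (there e)) = merged-cong (sound (inj₂ e))

    lift : ∀ {i j : Fin n} → Star (Joined L) i j → Star (Joined ((a , b) ∷ L)) i j
    lift = Star.map (λ {i} {j} → Joined-there {i = i} {j})

    merged-reach : ∀ i → Star (Joined ((a , b) ∷ L)) i (rep (merged i))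
    merged-reach i with class i ≟ class β
    ... | no  _ = lift (reach i)
    ... | yes e = lift (subst (λ c → Star (Joined L) i (rep c)) e (reach i))
      ◅◅ (lift (Star.reverse Joined-sym (reach β))
      ◅◅ (inj₂ (here (cong₂ _,_ (toℕ-fromℕ< a<n) (toℕ-fromℕ< b<n))) ◅ lift (reach α)))

    merge : Classes {n} ((a , b) ∷ L) k
    merge = record
      { class = λ i → punchOut (merged≢ i)
      ; sound = λ e → punchOut-cong (class β) (merged-sound e)
      ; rep = λ c → rep (punchIn (class β) c)
      ; class-rep = λ c → trans (punchOut-cong (class β) {i≢k = λ e → punchInᵢ≢i (class β) c (sym e)}
          (trans (merged-other _ (λ e → punchInᵢ≢i (class β) c (trans (sym (class-rep _)) (sym e)))) (class-rep _)))
          (punchOut-punchIn (class β))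
      ; reach = λ i → subst (λ c → Star (Joined ((a , b) ∷ L)) i (rep c)) (sym (punchIn-punchOut (merged≢ i))) (merged-reach i) }

  classes : ∀ {n} L → All (Within 0 n) L → Gaps L → ∃ λ k → k + length L ≡ n × Classes {n} L k
  classes {n} [] [] _ = n , +-identityʳ n , record
    { class = λ i → i ; sound = λ { (inj₁ ()) ; (inj₂ ()) } ; rep = λ c → c ; class-rep = λ _ → refl ; reach = λ _ → ε }
  classes {n} ((a , b) ∷ L) ((_ , a<b , b<n) ∷ w) ((h , a≤h , h<b , m) , g) with classes L w g
  ... | zero , _ , C with () ← Classes.class C (fromℕ< b<n)
  ... | suc k , e , C = k , trans (+-suc k (length L)) e , Merge.merge C (a<b ∷ All.map (λ (_ , x , _) → x) w) (<-trans a<b b<n) b<n a≤h h<b m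

  module Walk {n} (l : ℕ) (w : Fin (3 + l) → Fin n) (w-inj : Injective _≡_ _≡_ w) where
    open Circle (2 + l) using (res; res-cong; rotBy-res; _≅_; mod; ≅-cancelˡ; ≅-n+; ≅-reflexive; ≅-trans; toℕ-res; res-toℕ)
    N = 3 + l

    at′ : ℕ → Fin n
    at′ t = w (res t)

    at′-step : ∀ L → (∀ i → Joined L (w i) (w (rotBy 1 i))) → ∀ t → Joined L (at′ t) (at′ (suc t))
    at′-step L st t = subst (λ i → Joined L (at′ t) (w i)) (rotBy-res 1 t) (st (res t))

    at′-injective : ∀ {s t} → at′ s ≡ at′ t → s ≅ t
    at′-injective {s} {t} e = mod (trans (sym (toℕ-res s)) (trans (cong toℕ (w-inj e)) (toℕ-res t)))

    distinct : ∀ s d → 0 < d → d < N → ¬ s + d ≅ s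
    distinct s d 0<d d<N e with ≅-cancelˡ s {d} {0} (≅-trans e (≅-reflexive (sym (+-identityʳ s))))
    ... | mod d≡ = <-irrefl (sym (trans (sym (m<n⇒m%n≡m d<N)) d≡)) 0<d

    module _ (a b h : ℕ) (L : List Edge) (ordered : Ordered L) (a≤h : a ≤ h) (h<b : h < b) (misses : All (Misses h) L)
      (st : ∀ i → Joined ((a , b) ∷ L) (w i) (w (rotBy 1 i))) where

      Uses : Fin n → Fin n → Set
      Uses i j = (toℕ i ≡ a × toℕ j ≡ b) ⊎ (toℕ j ≡ a × toℕ i ≡ b)

      avoids : ∀ {i j} → Joined ((a , b) ∷ L) i j → ¬ Uses i j → Joined L i j
      avoids (inj₁ (here e))  ¬u = ⊥-elim (¬u (inj₁ (cong proj₁ e , cong proj₂ e)))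
      avoids (inj₂ (here e))  ¬u = ⊥-elim (¬u (inj₂ (cong proj₁ e , cong proj₂ e)))
      avoids (inj₁ (there e)) ¬u = inj₁ e
      avoids (inj₂ (there e)) ¬u = inj₂ e

      -- If step s of the closed walk uses {a, b}, then by `once` the other steps lead from one end
      -- to the other within L, although h separates the two ends.
      no-use : ∀ s → ¬ Uses (at′ s) (at′ (suc s))
      no-use s u = impossible u
        where
        -- The edge is used again in the opposite direction. For d = 0 the walk would turn back at
        -- once, which its length of at least 3 excludes; for d > 0 it would repeat a vertex.
        crossed : ∀ d → suc d < N → ¬ (at′ (suc s + d) ≡ at′ (suc s) × at′ (suc (suc s + d)) ≡ at′ s)
        crossed zero     d< (e , e′) = distinct s 2 (s≤s z≤n) (s≤s (s≤s (s≤s z≤n))) (≅-trans (≅-reflexive (trans (+-comm s 2) (cong (λ z → suc (suc z)) (sym (+-identityʳ s))))) (at′-injective e′))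
        crossed (suc d′) d< (e , e′) = distinct (suc s) (suc d′) (s≤s z≤n) (<-trans (ℕ.n<1+n (suc d′)) d<) (at′-injective e)
        -- an edge used twice by the closed walk would make two of its vertices coincide
        once : ∀ d → suc d < N → ¬ Uses (at′ (suc s + d)) (at′ (suc (suc s + d)))
        once d d< u′ = clash u u′
          where
          same : ∀ {x y : Fin n} {c} → toℕ x ≡ c → toℕ y ≡ c → x ≡ y
          same p q = toℕ-injective (trans p (sym q))
          straight : ¬ at′ (suc s + d) ≡ at′ s
          straight e = distinct s (suc d) (s≤s z≤n) d< (≅-trans (≅-reflexive (+-suc s d)) (at′-injective e))
          clash : Uses (at′ s) (at′ (suc s)) → Uses (at′ (suc s + d)) (at′ (suc (suc s + d))) → ⊥
          clash (inj₁ (p , q)) (inj₁ (p′ , q′)) = straight (same p′ p)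
          clash (inj₁ (p , q)) (inj₂ (p′ , q′)) = crossed d d< (same q′ q , same p′ p)
          clash (inj₂ (p , q)) (inj₁ (p′ , q′)) = crossed d d< (same p′ p , same q′ q)
          clash (inj₂ (p , q)) (inj₂ (p′ , q′)) = straight (same q′ q)

        around : ∀ d → d < N → Star (Joined L) (at′ (suc s)) (at′ (suc s + d))
        around zero    _  = subst (λ t → Star (Joined L) (at′ (suc s)) (at′ t)) (sym (+-identityʳ (suc s))) ε
        around (suc d) d< = around d (<-trans (ℕ.n<1+n d) d<) ◅◅
          (subst (λ t → Joined L (at′ (suc s + d)) (at′ t)) (cong suc (sym (+-suc s d))) (avoids (at′-step _ st (suc s + d)) (once d d<)) ◅ ε)

        home : at′ (suc s + (2 + l)) ≡ at′ s
        home = cong w (res-cong (≅-trans (≅-reflexive (trans (sym (+-suc s (2 + l))) (+-comm s N))) (≅-n+ s)))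

        round : Star (Joined L) (at′ (suc s)) (at′ s)
        round = subst (Star (Joined L) (at′ (suc s))) home (around (2 + l) ≤-refl)

        impossible : Uses (at′ s) (at′ (suc s)) → ⊥
        impossible (inj₁ (p , q)) = <⇒≱ h<b (subst (_≤ h) q (separated ordered misses (Star.reverse Joined-sym round) (subst (_≤ h) (sym p) a≤h)))
        impossible (inj₂ (p , q)) = <⇒≱ h<b (subst (_≤ h) q (separated ordered misses round (subst (_≤ h) (sym p) a≤h)))

      avoid-all : ∀ i → Joined L (w i) (w (rotBy 1 i))
      avoid-all i = avoids (st i) (λ u → no-use (toℕ i) (subst₂ Uses (cong w (sym (res-toℕ i))) (cong w (trans (cong (rotBy 1) (sym (res-toℕ i))) (rotBy-res 1 (toℕ i)))) u))

  no-cycle : ∀ {n} L → All (Within 0 n) L → Gaps L → ∀ l (w : Fin (3 + l) → Fin n) → Injective _≡_ _≡_ w → ¬ (∀ i → Joined L (w i) (w (rotBy 1 i)))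
  no-cycle [] _ _ l w inj st with st zero
  ... | inj₁ ()
  ... | inj₂ ()
  no-cycle ((a , b) ∷ L) (_ ∷ wi) ((h , a≤h , h<b , m) , g) l w inj st =
    no-cycle L wi g l w inj (Walk.avoid-all l w inj a b h L (All.map (λ (_ , x , _) → x) wi) a≤h h<b m st)

  module ForestOf (n′ : ℕ) (L : List Edge) (G : Good 0 (suc n′) L) where
    open Circle n′

    small : ∀ {a b} → (a , b) ∈ L → a < b × b < n
    small e∈ with All.lookup (G .within) e∈
    ... | _ , a<b , b<n = a<b , b<n

    ≅⇒≡ : ∀ {x y} → x < n → y < n → x ≅ y → x ≡ y
    ≅⇒≡ x< y< (mod e) = trans (sym (m<n⇒m%n≡m x<)) (trans e (m<n⇒m%n≡m y<))

    Link⇒∈ : ∀ {x y} → x < n → y < n → Link L x y → (x , y) ∈ L ⊎ (y , x) ∈ L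
    Link⇒∈ {x} {y} x< y< l with find l
    ... | (a , b) , e∈ , inj₁ (p , q) with small e∈
    ...   | a<b , b<n = inj₁ (subst₂ (λ a b → (a , b) ∈ L) (≅⇒≡ (<-trans a<b b<n) x< p) (≅⇒≡ b<n y< q) e∈)
    Link⇒∈ {x} {y} x< y< l | (a , b) , e∈ , inj₂ (p , q) with small e∈
    ...   | a<b , b<n = inj₂ (subst₂ (λ a b → (a , b) ∈ L) (≅⇒≡ (<-trans a<b b<n) y< p) (≅⇒≡ b<n x< q) e∈)

    Adj⇒At : ∀ A i j → Adj A i j → At A (toℕ i) (toℕ j)
    Adj⇒At A i j h = mkAt (subst₂ (λ i j → Adj A i j) (sym (res-toℕ i)) (sym (res-toℕ j)) h)

    Adj⇒Joined : ∀ i j → Adj (fromLinks L) i j → Joined L i j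
    Adj⇒Joined i j h = Link⇒∈ (toℕ<n i) (toℕ<n j) (At⇒Link L (toℕ i) (toℕ j) (Adj⇒At (fromLinks L) i j h))

    Joined⇒Adj : ∀ i j → Joined L i j → Adj (fromLinks L) i j
    Joined⇒Adj i j h = subst₂ (Adj (fromLinks L)) (res-toℕ i) (res-toℕ j) (isTrue (Link⇒At L (toℕ i) (toℕ j) (go h)))
      where
      go : Joined L i j → Link L (toℕ i) (toℕ j)
      go (inj₁ e) = lose e (inj₁ (≅-refl , ≅-refl))
      go (inj₂ e) = lose e (inj₂ (≅-refl , ≅-refl))

    Joined-< : ∀ (i j : Fin n) → Joined L i j → toℕ i < toℕ j → (toℕ i , toℕ j) ∈ L
    Joined-< i j (inj₁ e) _  = e
    Joined-< i j (inj₂ e) lt = ⊥-elim (ℕ.<-asym lt (proj₁ (small e)))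

    isForest : ∀ k → k + length L ≡ n → NCForest n k (fromLinks L)
    isForest k k≡ = (irreflexive , λ i j h → Joined⇒Adj j i (Joined-sym {i = i} {j} (Adj⇒Joined i j h))) , noncross , acyclic , components
      where
      irreflexive : ∀ i → ¬ Adj (fromLinks L) i i
      irreflexive i h with Adj⇒Joined i i h
      ... | inj₁ e = <-irrefl refl (proj₁ (small e))
      ... | inj₂ e = <-irrefl refl (proj₁ (small e))
      noncross : NonCrossing (fromLinks L)
      noncross a b c d h h′ a<c c<b b<d = G .noncrossing (Joined-< a b (Adj⇒Joined a b h) (<-trans a<c c<b)) (Joined-< c d (Adj⇒Joined c d h′) (<-trans c<b b<d)) a<c c<b b<d
      acyclic : Acyclic (fromLinks L)
      acyclic (l , w , inj , st) = no-cycle L (G .within) (G .gaps) l w inj (λ i → Adj⇒Joined (w i) (w (rotBy 1 i)) (st i))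
      components : HasComponents k (fromLinks L)
      components with classes {n} L (G .within) (G .gaps)
      ... | k₁ , e , C with ℕ.+-cancelʳ-≡ (length L) k₁ k (trans e (sym k≡))
      ...   | refl = rep , (λ a b s → trans (sym (class-rep a)) (trans (same (Star.map (λ {i} {j} → Adj⇒Joined i j) s)) (class-rep b)))
                   , λ v → class v , Star.map (λ {i} {j} → Joined⇒Adj i j) (reach v)
        where
        open Classes C
        same : ∀ {i j} → Star (Joined L) i j → class i ≡ class j
        same ε       = refl
        same {i} (_◅_ {j = j} x s) = trans (sound {i} {j} x) (same s)

-- Rotating forests, and gaps in forests cut open.

module Rotations where
  open import Defs
  open Encoding using (largest)
  open Circles
  open import Data.Bool.Properties using () renaming (_≟_ to _≟ᵇ_)
  open import Data.Bool using (true)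
  open import Data.Empty using (⊥; ⊥-elim)
  open import Data.Fin using (Fin; zero; suc; toℕ)
  open import Data.Fin.Properties using (toℕ-injective; toℕ-fromℕ<; toℕ<n; injective⇒≤)
  open import Data.Nat as ℕ using (ℕ; zero; suc; _+_; _≤_; _<_; s≤s; z≤n; _≤?_; _<?_)
  open import Data.Nat.DivMod using (_%_; m%n<n; m<n⇒m%n≡m; n%n≡0)
  open import Data.Nat.Properties as ℕ using (<⇒≱; <⇒≤; ≤-trans; <-irrefl; <-trans; ≤-refl; ≤-antisym; ≤-pred; +-suc; +-comm; +-identityʳ; ≤-reflexive; anyUpTo?; m≤n⇒m<n∨m≡n)
  open import Data.Product using (∃; _×_; _,_; proj₁; proj₂)
  open import Data.Sum using (inj₁; inj₂)
  open import Data.Vec using (lookup)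
  open import Function using (_∘_)
  open import Relation.Binary.Definitions using (tri<; tri≈; tri>)
  open import Relation.Binary.Construct.Closure.ReflexiveTransitive as Star using (Star; _◅◅_)
  open import Relation.Binary.PropositionalEquality hiding ([_])
  open import Relation.Nullary using (Dec; yes; no; ¬_; ¬?; _×-dec_; map′)
  open import Relation.Nullary.Decidable using (decidable-stable)

  -- Sending each representative to the class containing it injects either system of representatives
  -- into the other.
  components-unique : ∀ {n k k′} {A : Graph n} → (∀ i j → Adj A i j → Adj A j i) → HasComponents k A → HasComponents k′ A → k ≡ k′
  components-unique {A = A} symm H H′ = ≤-antisym (≤ H H′) (≤ H′ H)
    where
    ≤ : ∀ {k k′} → HasComponents k A → HasComponents k′ A → k ℕ.≤ k′
    ≤ {k} {k′} (r , inj , _) (r′ , _ , cover′) = injective⇒≤ {f = λ a → proj₁ (cover′ (r a))} λ {a} {b} e →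
      inj a b (proj₂ (cover′ (r a)) ◅◅ subst (λ c → Star (Adj A) (r′ c) (r b)) (sym e) (Star.reverse (λ {i} {j} → symm i j) (proj₂ (cover′ (r b)))))

  module Rotation (n′ : ℕ) where
    open Circle n′

    σ τ : Fin n → Fin n
    σ = rotBy n′
    τ = rotBy 1

    rot-toℕ : ∀ d i → rotBy d i ≡ res (d + toℕ i)
    rot-toℕ d i = trans (cong (rotBy d) (sym (res-toℕ i))) (rotBy-res d (toℕ i))

    στ : ∀ i → σ (τ i) ≡ i
    στ i = trans (cong σ (rot-toℕ 1 i)) (trans (rotBy-res n′ (suc (toℕ i))) (trans (res-cong (≅-trans (≅-reflexive (+-suc n′ (toℕ i))) (≅-n+ (toℕ i)))) (res-toℕ i)))

    τσ : ∀ i → τ (σ i) ≡ i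
    τσ i = trans (cong τ (rot-toℕ n′ i)) (trans (rotBy-res 1 (n′ + toℕ i)) (trans (res-cong (≅-n+ (toℕ i))) (res-toℕ i)))

    toℕ-σ-suc : ∀ i x → toℕ i ≡ suc x → toℕ (σ i) ≡ x
    toℕ-σ-suc i x e = trans (cong toℕ (trans (rot-toℕ n′ i) (res-cong (≅-trans (≅-reflexive (trans (cong (n′ +_) e) (+-suc n′ x))) (≅-n+ x)))))
      (trans (toℕ-res x) (m<n⇒m%n≡m (<-trans (ℕ.n<1+n x) (subst (_< n) e (toℕ<n i)))))

    toℕ-σ-zero : ∀ i → toℕ i ≡ 0 → toℕ (σ i) ≡ n′
    toℕ-σ-zero i e = trans (cong toℕ (trans (rot-toℕ n′ i) (cong (λ z → res (n′ + z)) e)))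
      (trans (toℕ-res (n′ + 0)) (trans (cong (_% n) (+-identityʳ n′)) (m<n⇒m%n≡m (ℕ.n<1+n n′))))

    Adj-ρ⁻ : ∀ A i j → Adj (ρ A) i j → Adj A (σ i) (σ j)
    Adj-ρ⁻ A i j = trans (sym (at-tabulate (λ i j → lookup (lookup A (σ i)) (σ j)) i j))

    Adj-ρ⁺ : ∀ A i j → Adj A (σ i) (σ j) → Adj (ρ A) i j
    Adj-ρ⁺ A i j = trans (at-tabulate (λ i j → lookup (lookup A (σ i)) (σ j)) i j)

    ρ-forest : ∀ {k} A → NCForest n k A → NCForest n k (ρ A)
    ρ-forest {k} A ((irr , symm) , nc , ac , (r , inj , cover)) =
      ((λ i h → irr (σ i) (Adj-ρ⁻ A i i h)) , λ i j h → Adj-ρ⁺ A j i (symm (σ i) (σ j) (Adj-ρ⁻ A i j h)))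
      , nc′ , ac′ , (λ a → τ (r a)) , inj′ , cover′
      where
      nc′ : NonCrossing (ρ A)
      nc′ a b c d h h′ a<c c<b b<d with toℕ a in ea | toℕ c in ec | toℕ b in eb | toℕ d in ed
      nc′ a b c d h h′ (s≤s a<c) (s≤s c<b) (s≤s b<d) | suc x | suc y | suc z | suc w =
        nc (σ a) (σ b) (σ c) (σ d) (Adj-ρ⁻ A a b h) (Adj-ρ⁻ A c d h′)
          (subst₂ _<_ (sym (toℕ-σ-suc a x ea)) (sym (toℕ-σ-suc c y ec)) a<c)
          (subst₂ _<_ (sym (toℕ-σ-suc c y ec)) (sym (toℕ-σ-suc b z eb)) c<b)
          (subst₂ _<_ (sym (toℕ-σ-suc b z eb)) (sym (toℕ-σ-suc d w ed)) b<d)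
      -- Of the four vertices only a can be 0. Before the rotation it was n - 1, so the crossing
      -- occurred there in the order c, b, d, a.
      nc′ a b c d h h′ _ (s≤s c<b) (s≤s b<d) | zero | suc y | suc z | suc w =
        nc (σ c) (σ d) (σ b) (σ a) (Adj-ρ⁻ A c d h′) (symm (σ a) (σ b) (Adj-ρ⁻ A a b h))
          (subst₂ _<_ (sym (toℕ-σ-suc c y ec)) (sym (toℕ-σ-suc b z eb)) c<b)
          (subst₂ _<_ (sym (toℕ-σ-suc b z eb)) (sym (toℕ-σ-suc d w ed)) b<d)
          (subst₂ _<_ (sym (toℕ-σ-suc d w ed)) (sym (toℕ-σ-zero a ea)) (≤-pred (subst (_< n) ed (toℕ<n d))))
      ac′ : Acyclic (ρ A)
      ac′ (l , w , w-inj , st) = ac (l , σ ∘ w , (λ {i} {j} e → w-inj (trans (sym (τσ (w i))) (trans (cong τ e) (τσ (w j))))) , λ i → Adj-ρ⁻ A (w i) (w (rotBy 1 i)) (st i))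
      inj′ : ∀ a b → Connected (ρ A) (τ (r a)) (τ (r b)) → a ≡ b
      inj′ a b s = inj a b (subst₂ (Star (Adj A)) (στ (r a)) (στ (r b)) (Star.gmap σ (λ {i} {j} → Adj-ρ⁻ A i j) s))
      cover′ : ∀ v → ∃ λ a → Connected (ρ A) v (τ (r a))
      cover′ v with cover (σ v)
      ... | a , s = a , subst (λ x → Star (Adj (ρ A)) x (τ (r a))) (τσ v) (Star.gmap τ
        (λ {i} {j} h → Adj-ρ⁺ A (τ i) (τ j) (subst₂ (Adj A) (sym (στ i)) (sym (στ j)) h)) s)

    ρ^-forest : ∀ {k} d A → NCForest n k A → NCForest n k (ρ^ d A)
    ρ^-forest zero    A F = F
    ρ^-forest (suc d) A F = ρ-forest (ρ^ d A) (ρ^-forest d A F)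

  module Linear (n′ : ℕ) (A : Graph (suc n′)) (k : ℕ) (F : NCForest (suc n′) k A) where
    open Circle n′

    R : ℕ → ℕ → Set
    R a b = a < b × b < n × At A a b

    R? : ∀ a b → Dec (R a b)
    R? a b = (a <? b) ×-dec (b <? n) ×-dec map′ mkAt isTrue (at A a b ≟ᵇ true)

    toℕ-res< : ∀ {x} → x < n → toℕ (res x) ≡ x
    toℕ-res< {x} x< = trans (toℕ-res x) (m<n⇒m%n≡m x<)

    At-sym : ∀ {x y} → At A x y → At A y x
    At-sym {x} {y} (mkAt h) = mkAt (proj₂ (proj₁ F) (res x) (res y) h)

    R-nc : ∀ {a b c d} → R a b → R c d → a < c → c < b → b < d → ⊥
    R-nc {a} {b} {c} {d} (_ , b< , h) (_ , d< , h′) a<c c<b b<d = proj₁ (proj₂ F) (res a) (res b) (res c) (res d) (isTrue h) (isTrue h′)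
      (subst₂ _<_ (sym (toℕ-res< (<-trans a<c (<-trans c<b b<)))) (sym (toℕ-res< (<-trans c<b b<))) a<c)
      (subst₂ _<_ (sym (toℕ-res< (<-trans c<b b<))) (sym (toℕ-res< b<)) c<b)
      (subst₂ _<_ (sym (toℕ-res< b<)) (sym (toℕ-res< d<)) b<d)

    module _ {a b : ℕ} (r : R a b) where
      Inner : ℕ → ℕ → Set
      Inner c d = R c d × a ≤ c × d ≤ b × ¬ (c ≡ a × d ≡ b)

      Inner? : ∀ c d → Dec (Inner c d)
      Inner? c d = R? c d ×-dec (a ≤? c) ×-dec (d ≤? b) ×-dec ¬? ((c ℕ.≟ a) ×-dec (d ℕ.≟ b))

      Covered : ℕ → Set
      Covered h = ∃ λ c → c < suc h × (∃ λ d → d < suc b × (h < d × Inner c d))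

      Covered? : ∀ h → Dec (Covered h)
      Covered? h = anyUpTo? (λ c → anyUpTo? (λ d → (h <? d) ×-dec Inner? c d) (suc b)) (suc h)

      -- These are the candidates for the vertices of the chain of maximal edges below {a, b}.
      Exposed : ℕ → Set
      Exposed x = ∀ {c d} → Inner c d → c < x → x < d → ⊥

      Chain : ℕ → Set
      Chain x = ∃ λ l → ∃ λ (w : ℕ → ℕ) → w 0 ≡ x × w l ≡ b × (∀ i → i < l → Inner (w i) (w (suc i)))

      -- An inner edge spanning position x starts at x because x is exposed; let the longest one
      -- lead to y. An inner edge passing over y would pass over x, be longer than {x, y}, or cross
      -- it.
      next : ∀ x → Covered x → Exposed x → ∃ λ y → Inner x y × Exposed y
      next x (c , c≤x , d , _ , x<d , inn) ex with m≤n⇒m<n∨m≡n (≤-pred c≤x)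
      ... | inj₁ c<x = ⊥-elim (ex inn c<x x<d)
      ... | inj₂ refl with largest (Inner? x) (suc b)
      ...   | inj₂ none = ⊥-elim (none (s≤s (proj₁ (proj₂ (proj₂ inn)))) inn)
      ...   | inj₁ (y , _ , inn′ , max) = y , inn′ , ex′
        where
        ex′ : Exposed y
        ex′ {c} {d} i c<y y<d with ℕ.<-cmp c x
        ... | tri< c<x _ _ = ex i c<x (<-trans (proj₁ (proj₁ inn′)) y<d)
        ... | tri≈ _ refl _ = <⇒≱ y<d (max (s≤s (proj₁ (proj₂ (proj₂ i)))) i)
        ... | tri> _ _ x<c = R-nc (proj₁ inn′) (proj₁ i) x<c c<y y<d

      chain : (∀ h → a ≤ h → h < b → Covered h) → ∀ fuel x → a ≤ x → x ≤ b → b ≤ x + fuel → Exposed x → Chain x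
      chain full fuel x a≤x x≤b b≤ ex with m≤n⇒m<n∨m≡n x≤b
      ... | inj₂ refl = 0 , (λ _ → x) , refl , refl , λ _ ()
      chain full zero x a≤x x≤b b≤ ex | inj₁ x<b = ⊥-elim (<⇒≱ x<b (≤-trans b≤ (≤-reflexive (+-identityʳ x))))
      chain full (suc fuel) x a≤x x≤b b≤ ex | inj₁ x<b with next x (full x a≤x x<b) ex
      ... | y , inn , ex′ with chain full fuel y (≤-trans a≤x (<⇒≤ (proj₁ (proj₁ inn)))) (proj₁ (proj₂ (proj₂ inn)))
                                (≤-trans b≤ (≤-trans (≤-reflexive (+-suc x fuel)) (ℕ.+-monoˡ-≤ fuel (proj₁ (proj₁ inn))))) ex′
      ...   | l , w , w0 , wl , st = suc l , w′ , refl , wl , st′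
        where
        w′ : ℕ → ℕ
        w′ zero    = x
        w′ (suc i) = w i
        st′ : ∀ i → i < suc l → Inner (w′ i) (w′ (suc i))
        st′ zero    _        = subst (Inner x) (sym w0) inn
        st′ (suc i) (s≤s i<) = st i i<

      -- A chain of a single edge would be {a, b} itself, which is not an inner edge; a longer one
      -- closes up with {a, b} to a cycle.
      no-chain : ¬ Chain a
      no-chain (zero , w , w0 , wl , st) = <-irrefl (trans (sym w0) wl) (proj₁ r)
      no-chain (suc zero , w , w0 , wl , st) = proj₂ (proj₂ (proj₂ (st 0 (s≤s z≤n)))) (w0 , wl)
      no-chain (suc (suc l) , w , w0 , wl , st) = proj₁ (proj₂ (proj₂ F)) (l , vertex , injective , adjacent)
        where
        ascend : ∀ i j → i < j → j < 3 + l → w i < w j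
        ascend i (suc j) (s≤s i≤j) (s≤s j<) with m≤n⇒m<n∨m≡n i≤j
        ... | inj₂ refl = proj₁ (proj₁ (st i j<))
        ... | inj₁ i<j  = <-trans (ascend i j i<j (<-trans j< (ℕ.n<1+n _))) (proj₁ (proj₁ (st j j<)))
        w<n : ∀ i → i < 3 + l → w i < n
        w<n i i< with m≤n⇒m<n∨m≡n (≤-pred i<)
        ... | inj₁ i<′  = <-trans (proj₁ (proj₁ (st i i<′))) (proj₁ (proj₂ (proj₁ (st i i<′))))
        ... | inj₂ refl = subst (_< n) (sym wl) (proj₁ (proj₂ r))
        vertex : Fin (3 + l) → Fin n
        vertex i = res (w (toℕ i))
        injective : ∀ {i j} → vertex i ≡ vertex j → i ≡ j
        injective {i} {j} e with ℕ.<-cmp (toℕ i) (toℕ j)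
        ... | tri≈ _ i≡j _ = toℕ-injective i≡j
        ... | tri< i<j _ _ = ⊥-elim (<-irrefl (trans (sym (toℕ-res< (w<n _ (toℕ<n i)))) (trans (cong toℕ e) (toℕ-res< (w<n _ (toℕ<n j))))) (ascend _ _ i<j (toℕ<n j)))
        ... | tri> _ _ j<i = ⊥-elim (<-irrefl (trans (sym (toℕ-res< (w<n _ (toℕ<n j)))) (trans (cong toℕ (sym e)) (toℕ-res< (w<n _ (toℕ<n i))))) (ascend _ _ j<i (toℕ<n i)))
        adjacent : ∀ i → Adj A (vertex i) (vertex (rotBy 1 i))
        adjacent i with m≤n⇒m<n∨m≡n (≤-pred (toℕ<n i))
        ... | inj₁ i< = subst (λ t → Adj A (vertex i) (res (w t))) (sym rot≡) (isTrue (proj₂ (proj₂ (proj₁ (st (toℕ i) i<)))))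
          where
          rot≡ : toℕ (rotBy 1 i) ≡ suc (toℕ i)
          rot≡ = trans (toℕ-fromℕ< (m%n<n (toℕ i + 1) (3 + l))) (trans (cong (_% (3 + l)) (+-comm (toℕ i) 1)) (m<n⇒m%n≡m (s≤s i<)))
        ... | inj₂ i≡ = subst₂ (λ s t → Adj A (res s) (res t)) (sym (trans (cong w i≡) wl)) (sym (trans (cong w rot≡) w0))
            (isTrue (At-sym (proj₂ (proj₂ r))))
          where
          rot≡ : toℕ (rotBy 1 i) ≡ 0
          rot≡ = trans (toℕ-fromℕ< (m%n<n (toℕ i + 1) (3 + l))) (trans (cong (_% (3 + l)) (trans (+-comm (toℕ i) 1) (cong suc i≡))) (n%n≡0 (3 + l)))

      -- If every position below the edge were covered by another edge inside [a, b], the maximal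
      -- such edges would form a cycle together with {a, b}.
      gap : ∃ λ h → a ≤ h × h < b × (∀ {c d} → R c d → a ≤ c → d ≤ b → c ≤ h → h < d → c ≡ a × d ≡ b)
      gap with anyUpTo? (λ h → (a ≤? h) ×-dec ¬? (Covered? h)) b
      ... | yes (h , h<b , a≤h , ¬cov) = h , a≤h , h<b , λ {c} {d} rcd a≤c d≤b c≤h h<d →
        decidable-stable ((c ℕ.≟ a) ×-dec (d ℕ.≟ b)) λ ≢ → ¬cov (c , s≤s c≤h , d , s≤s d≤b , h<d , rcd , a≤c , d≤b , ≢)
      ... | no ¬gap = ⊥-elim (no-chain (chain
        (λ h a≤h h<b → decidable-stable (Covered? h) (λ ¬cov → ¬gap (h , h<b , a≤h , ¬cov)))
        b a ≤-refl (<⇒≤ (proj₁ r)) (ℕ.m≤n+m b a) (λ i c<a → ⊥-elim (<⇒≱ c<a (proj₁ (proj₂ i))))))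

-- Forests invariant under a rotation whose edges all stay within blocks.

module Windows where
  open import Defs
  open Pieces using (Piece; order)
  open Links using (shiftE; links*; links*-++; links*-shift; order-++)
  open Encoding
  open Circles
  open Rotations
  open import Data.Empty using (⊥; ⊥-elim)
  open import Data.Fin using (Fin; toℕ)
  open import Data.Fin.Properties using (toℕ-injective; toℕ-fromℕ<; toℕ<n)
  open import Data.List using (List; []; _++_)
  open import Data.List.Membership.Propositional using (_∈_; find; lose)
  open import Data.List.Membership.Propositional.Properties using (∈-++⁺ˡ; ∈-++⁺ʳ; ∈-++⁻; ∈-map⁺; ∈-map⁻)
  open import Data.Nat using (ℕ; zero; suc; _+_; _*_; _∸_; _≤_; _<_; s≤s; z≤n; _<?_; NonZero; >-nonZero)
  open import Data.Nat.DivMod using (_%_; _/_; m%n<n; m<n⇒m%n≡m; m≡m%n+[m/n]*n)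
  open import Data.Nat.Properties
  import Data.Nat.Tactic.RingSolver as ℕS
  open import Data.Product using (∃; ∃₂; _×_; _,_; proj₁; proj₂)
  open import Data.Sum using (_⊎_; inj₁; inj₂)
  open import Relation.Binary.Definitions using (tri<; tri≈; tri>)
  open import Relation.Binary.PropositionalEquality hiding ([_])
  open import Relation.Nullary using (Dec; yes; no; ¬_)

  copies : ℕ → List Piece → List Piece
  copies zero    f = []
  copies (suc t) f = f ++ copies t f

  order-copies : ∀ t f → order (copies t f) ≡ t * order f
  order-copies zero    f = refl
  order-copies (suc t) f = trans (order-++ f (copies t f)) (cong (order f +_) (order-copies t f))

  ∈-copies⁺ : ∀ t f o s {a b} → s < t → (a , b) ∈ links* 0 f → (s * order f + (o + a) , s * order f + (o + b)) ∈ links* o (copies t f)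
  ∈-copies⁺ (suc t) f o zero {a} {b} _ e∈ = subst ((o + a , o + b) ∈_) (sym (links*-++ o f (copies t f)))
    (∈-++⁺ˡ (subst (λ z → (o + a , o + b) ∈ links* z f) (+-identityʳ o) (subst ((o + a , o + b) ∈_) (sym (links*-shift o 0 f)) (∈-map⁺ (shiftE o) e∈))))
  ∈-copies⁺ (suc t) f o (suc s) {a} {b} (s≤s s<t) e∈ = subst (_ ∈_) (sym (links*-++ o f (copies t f)))
    (∈-++⁺ʳ (links* o f) (subst₂ (λ x y → (x , y) ∈ links* (o + order f) (copies t f)) (arith (order f) s o a) (arith (order f) s o b)
      (∈-copies⁺ t f (o + order f) s s<t e∈)))
    where
    arith : ∀ g s o a → s * g + (o + g + a) ≡ (g + s * g) + (o + a)
    arith = ℕS.solve-∀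

  ∈-copies⁻ : ∀ t f o {a b} → (a , b) ∈ links* o (copies t f) →
    ∃ λ s → s < t × ∃₂ λ a′ b′ → (a′ , b′) ∈ links* 0 f × a ≡ s * order f + (o + a′) × b ≡ s * order f + (o + b′)
  ∈-copies⁻ (suc t) f o {a} {b} e∈ with ∈-++⁻ (links* o f) (subst ((a , b) ∈_) (links*-++ o f (copies t f)) e∈)
  ... | inj₁ p with ∈-map⁻ (shiftE o) (subst ((a , b) ∈_) (trans (cong (λ z → links* z f) (sym (+-identityʳ o))) (links*-shift o 0 f)) p)
  ...   | (a′ , b′) , q , refl = 0 , s≤s z≤n , a′ , b′ , q , refl , refl
  ∈-copies⁻ (suc t) f o {a} {b} e∈ | inj₂ p with ∈-copies⁻ t f (o + order f) p
  ... | s , s<t , a′ , b′ , q , refl , refl = suc s , s≤s s<t , a′ , b′ , q , arith (order f) s o a′ , arith (order f) s o b′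
    where
    arith : ∀ g s o a → s * g + (o + g + a) ≡ (g + s * g) + (o + a)
    arith = ℕS.solve-∀

  least : ∀ {P : ℕ → Set} → (∀ x → Dec (P x)) → ∀ fuel e → e < fuel → P e → ∃ λ x → P x × (∀ {y} → y < x → ¬ P y)
  least P? (suc fuel) e (s≤s e≤) p with anyUpTo? P? e
  ... | yes (y , y<e , q) = least P? fuel y (<-≤-trans y<e e≤) q
  ... | no ¬q             = e , p , λ y< q → ¬q (_ , y< , q)

  module Assemble (n′ : ℕ) (A : Graph (suc n′)) (k : ℕ) (F : NCForest (suc n′) k A) where
    open Circle n′
    open Linear n′ A k F using (R; R?; At-sym; R-nc; gap)

    At-irrefl : ∀ {x y} → x ≅ y → ¬ At A x y
    At-irrefl {x} {y} e h = proj₁ (proj₁ F) (res x) (isTrue (At-cong A ≅-refl (≅-sym e) h))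

    %≅ : ∀ x → x % n ≅ x
    %≅ x = subst (_≅ x) (toℕ-res x) (res-≅ x)

    assemble : ∀ L → (∀ {a b} → R a b → Link L a b) → (∀ {a b} → (a , b) ∈ L → At A a b) → A ≡ fromLinks L
    assemble L to from = ≡fromLinks {L = L} t f
      where
      t : ∀ x y → At A x y → Link L x y
      t x y h with <-cmp (x % n) (y % n)
      ... | tri≈ _ e _ = ⊥-elim (At-irrefl (mod e) h)
      ... | tri< lt _ _ = Link-cong (%≅ x) (%≅ y) (to (lt , m%n<n y n , At-cong A (≅-sym (%≅ x)) (≅-sym (%≅ y)) h))
      ... | tri> _ _ gt = Link-cong (%≅ x) (%≅ y) (Link-sym (to (gt , m%n<n x n , At-cong A (≅-sym (%≅ y)) (≅-sym (%≅ x)) (At-sym h))))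
      f : ∀ x y → Link L x y → At A x y
      f x y l with find l
      ... | (a , b) , e∈ , inj₁ (p , q) = At-cong A p q (from e∈)
      ... | (a , b) , e∈ , inj₂ (p , q) = At-sym (At-cong A p q (from e∈))

    open Encode R R? proj₁ R-nc gap public

    ∈⇒Link : ∀ {L a b} → (a , b) ∈ L → Link L a b
    ∈⇒Link e∈ = lose e∈ (inj₁ (≅-refl , ≅-refl))

    linear-code : ∃ λ f → order f ≡ n × A ≡ fromLinks (links* 0 f)
    linear-code with encode-forest n 0 n ≤-refl
    ... | f , f≡ , rep = f , f≡ , assemble (links* 0 f) (λ r → ∈⇒Link (rep .to r z≤n (proj₁ (proj₂ r)))) (λ e∈ → proj₂ (proj₂ (rep .from e∈)))

  -- Here g is the number of vertices in one period. Writing the order of the rotation as 2 + l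
  -- builds in that it is at least 2, hence 2g ≤ n.
  module Periodic (n′ g l : ℕ) (n≡ : suc n′ ≡ (2 + l) * g) where
    open Circle n′
    m = 2 + l

    0<g : 0 < g
    0<g = positive g n≡
      where
      positive : ∀ g → n ≡ m * g → 0 < g
      positive (suc _) _ = s≤s z≤n
      positive zero    e with () ← trans e (*-zeroʳ m)

    instance
      g≢0 : NonZero g
      g≢0 = >-nonZero 0<g

    2g≤n : g + g ≤ n
    2g≤n = ≤-trans (+-monoʳ-≤ g (m≤m+n g (l * g))) (≤-reflexive (sym n≡))

    g<n : g < n
    g<n = <-≤-trans (m<m+n g 0<g) 2g≤n

    module Inv (A : Graph n) (k : ℕ) (F : NCForest n k A) (inv : ρ^ g A ≡ A) where
      open Linear n′ A k F using (R; R?; At-sym; R-nc; gap) public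
      open Assemble n′ A k F public

      At-g : ∀ {x y} → At A x y → At A (g + x) (g + y)
      At-g {x} {y} h = subst (λ B → At B (g + x) (g + y)) inv (At-ρ^⁺ g A h)

      At-g⁻ : ∀ {x y} → At A (g + x) (g + y) → At A x y
      At-g⁻ {x} {y} h = At-ρ^⁻ g A (subst (λ B → At B (g + x) (g + y)) (sym inv) h)

      At-tg : ∀ t {x y} → At A x y → At A (t * g + x) (t * g + y)
      At-tg zero    h = h
      At-tg (suc t) {x} {y} h = subst₂ (At A) (sym (+-assoc g (t * g) x)) (sym (+-assoc g (t * g) y)) (At-g (At-tg t h))

      At-tg⁻ : ∀ t {x y} → At A (t * g + x) (t * g + y) → At A x y
      At-tg⁻ zero    h = h
      At-tg⁻ (suc t) {x} {y} h = At-tg⁻ t (At-g⁻ (subst₂ (At A) (+-assoc g (t * g) x) (+-assoc g (t * g) y) h))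

      -- For m ≥ 3 the images of such an edge form an m-gon, which is a cycle.
      no-polygon : ∀ {l′} → l ≡ suc l′ → ∀ x → ¬ At A x (g + x)
      no-polygon {l′} refl x h = proj₁ (proj₂ (proj₂ F)) (l′ , vertex , injective , adjacent)
        where
        vertex : Fin (3 + l′) → Fin n
        vertex i = res (x + toℕ i * g)
        injective : ∀ {i j} → vertex i ≡ vertex j → i ≡ j
        injective {i} {j} e = toℕ-injective (*-cancelʳ-≡ (toℕ i) (toℕ j) g (trans (sym (m<n⇒m%n≡m (small i))) (trans (rem (≅-cancelˡ x {toℕ i * g} {toℕ j * g}
            (mod (trans (sym (toℕ-res (x + toℕ i * g))) (trans (cong toℕ e) (toℕ-res (x + toℕ j * g))))))) (m<n⇒m%n≡m (small j)))))
          where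
          small : ∀ i → toℕ i * g < n
          small i = <-≤-trans (*-monoˡ-< g (toℕ<n i)) (≤-reflexive (sym n≡))
        step : ∀ t → Adj A (res (x + t * g)) (res (x + suc t * g))
        step t = isTrue (At-cong A (≅-reflexive (+-comm (t * g) x)) (≅-reflexive (arith t g x)) (At-tg t h))
          where
          arith : ∀ t g x → t * g + (g + x) ≡ x + suc t * g
          arith = ℕS.solve-∀
        adjacent : ∀ i → Adj A (vertex i) (vertex (rotBy 1 i))
        adjacent i = subst (Adj A (vertex i)) next (step (toℕ i))
          where
          rot≡ : toℕ (rotBy 1 i) ≡ suc (toℕ i) % (3 + l′)
          rot≡ = trans (toℕ-fromℕ< (m%n<n (toℕ i + 1) (3 + l′))) (cong (_% (3 + l′)) (+-comm (toℕ i) 1))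
          arith : ∀ r d m g → (r + d * m) * g ≡ r * g + d * (m * g)
          arith = ℕS.solve-∀
          next : res (x + suc (toℕ i) * g) ≡ res (x + toℕ (rotBy 1 i) * g)
          next = res-cong (≅-+ˡ x (≅-trans (≅-reflexive (trans (cong (_* g) (m≡m%n+[m/n]*n (suc (toℕ i)) (3 + l′)))
              (trans (arith (suc (toℕ i) % (3 + l′)) (suc (toℕ i) / (3 + l′)) (3 + l′) g) (cong (λ z → suc (toℕ i) % (3 + l′) * g + suc (toℕ i) / (3 + l′) * z) (sym n≡)))))
            (≅-trans (≅-+kn _ (suc (toℕ i) / (3 + l′))) (≅-reflexive (cong (_* g) (sym rot≡))))))

      module NoDiameter (nd : ∀ x → ¬ At A x (g + x)) where
        -- If both arcs between a and b are longer than g, the image of the edge under rotation by g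
        -- has one end inside each arc and crosses it. Arcs of length exactly g are excluded by
        -- `nd`.
        short-or-long : ∀ {a b} → R a b → b < g + a ⊎ a + n < g + b
        short-or-long {a} {b} r@(a<b , b<n , h) with <-cmp b (g + a) | <-cmp (a + n) (g + b)
        ... | tri< b< _ _ | _ = inj₁ b<
        ... | _ | tri< <b _ _ = inj₂ <b
        ... | tri≈ _ refl _ | _ = ⊥-elim (nd a h)
        ... | _ | tri≈ _ e _ = ⊥-elim (nd b (At-cong A ≅-refl (≅-trans (≅-sym (≅-n+ a)) (≅-reflexive (trans (+-comm n a) e))) (At-sym h)))
        ... | tri> _ _ ga<b | tri> _ _ gb< with g + b <? n
        ...   | yes gb<n = ⊥-elim (R-nc r (+-monoʳ-< g a<b , gb<n , At-g h) (m<n+m a 0<g) ga<b (m<n+m b 0<g))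
        -- The image wraps around: its end g + b is represented by e < a, so the image comes first
        -- in the crossing.
        ...   | no  gb≮n = ⊥-elim (R-nc {e} {g + a} {a} {b} (<-trans e<a (m<n+m a 0<g) , <-trans ga<b b<n , At-sym (At-cong A ≅-refl (≅-trans (≅-reflexive (sym e≡)) (≅-n+ e)) (At-g h))) r
                  e<a (m<n+m a 0<g) ga<b)
          where
          e = g + b ∸ n
          e≡ : n + e ≡ g + b
          e≡ = m+[n∸m]≡n (≮⇒≥ gb≮n)
          e<a : e < a
          e<a = +-cancelˡ-< n e a (subst₂ _<_ (sym e≡) (+-comm a n) gb<)

        OnlyShort : Set
        OnlyShort = ∀ {a b} → R a b → b < g + a

        module Blocks (short : OnlyShort) where
          -- An edge over the end of block t is rotated by a multiple of g until this end comes to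
          -- n. Its ends then lie on both sides of the cut, and their difference is n - (b - a) > n
          -- - g ≥ g, so the rotated edge is not short.
          same-block : ∀ t {a b} → t < m → R a b → a < suc t * g → b < suc t * g
          same-block t {a} {b} t<m r@(a<b , b<n , h) a< with b <? suc t * g
          ... | yes b< = b<
          ... | no b≮ = ⊥-elim contradiction
            where
            s = m ∸ suc t
            b′ = b ∸ suc t * g
            b≡ : suc t * g + b′ ≡ b
            b≡ = m+[n∸m]≡n (≮⇒≥ b≮)
            s≡ : s * g + suc t * g ≡ n
            s≡ = trans (sym (*-distribʳ-+ g s (suc t))) (trans (cong (_* g) (m∸n+n≡m t<m)) (sym n≡))
            sb≡ : s * g + b ≡ n + b′
            sb≡ = trans (cong (s * g +_) (sym b≡)) (trans (sym (+-assoc (s * g) _ b′)) (cong (_+ b′) s≡))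
            a′ = s * g + a
            a′<n : a′ < n
            a′<n = <-≤-trans (+-monoʳ-< (s * g) a<) (≤-reflexive s≡)
            b′<g : b′ < g
            b′<g = +-cancelˡ-< (suc t * g) b′ g (subst₂ _<_ (sym b≡) (+-comm g (suc t * g)) (<-trans (short r) (+-monoʳ-< g a<)))
            h′ : At A a′ b′
            h′ = At-cong A ≅-refl (≅-trans (≅-reflexive sb≡) (≅-n+ b′)) (At-tg s h)
            0<s : 0 < s
            0<s with s | s≡
            ... | suc _ | _ = s≤s z≤n
            ... | zero  | e = ⊥-elim (<⇒≱ b<n (≤-trans (≤-reflexive (sym e)) (≮⇒≥ b≮)))
            b′<a′ : b′ < a′
            b′<a′ = <-≤-trans b′<g (≤-trans (≤-trans (≤-reflexive (sym (+-identityʳ g))) (*-monoˡ-≤ g 0<s)) (m≤m+n (s * g) a))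
            contradiction : ⊥
            contradiction = <⇒≱ (+-cancelˡ-< (suc t * g) a′ (g + b′) (subst (suc t * g + a′ <_) refl (+-monoʳ-< (suc t * g) (short (b′<a′ , a′<n , At-sym h′)))))
              (+-cancelˡ-≤ (suc t * g) (g + b′) a′ (begin
                suc t * g + (g + b′)   ≡⟨ swap (suc t * g) g b′ ⟩
                g + (suc t * g + b′)   ≡⟨ cong (g +_) b≡ ⟩
                g + b                  ≤⟨ +-monoʳ-≤ g (<⇒≤ (short r)) ⟩
                g + (g + a)            ≡⟨ +-assoc g g a ⟨
                g + g + a              ≤⟨ +-monoˡ-≤ a 2g≤n ⟩
                n + a                  ≡⟨ cong (_+ a) (trans (sym s≡) (+-comm (s * g) (suc t * g))) ⟩
                suc t * g + s * g + a  ≡⟨ +-assoc (suc t * g) (s * g) a ⟩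
                suc t * g + a′         ∎))
              where
              open ≤-Reasoning
              swap : ∀ x y z → x + (y + z) ≡ y + (x + z)
              swap = ℕS.solve-∀

          code : ∃ λ f → order f ≡ g × A ≡ fromLinks (links* 0 (copies m f))
          code with encode-forest g 0 g ≤-refl
          ... | f , refl , rep = f , refl , assemble (links* 0 (copies m f)) t fr
            where
            t : ∀ {a b} → R a b → Link (links* 0 (copies m f)) a b
            t {a} {b} r@(a<b , b<n , h) = ∈⇒Link (subst₂ (λ x y → (x , y) ∈ links* 0 (copies m f)) (sym a≡) (b≡)
                (∈-copies⁺ m f 0 q q<m (rep .to (a′<b′ , <-trans b′<g g<n , At-tg⁻ q (subst₂ (At A) a≡ (sym b≡) h)) z≤n b′<g)))
              where
              q = a / g
              a′ = a % g
              b′ = b ∸ q * g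
              a≡ : a ≡ q * g + a′
              a≡ = trans (m≡m%n+[m/n]*n a g) (+-comm a′ (q * g))
              b≡ : q * g + b′ ≡ b
              b≡ = m+[n∸m]≡n (≤-trans (m≤m+n (q * g) a′) (≤-trans (≤-reflexive (sym a≡)) (<⇒≤ a<b)))
              q<m : q < m
              q<m = *-cancelʳ-< g q m (≤-<-trans (≤-trans (m≤m+n (q * g) a′) (≤-reflexive (sym a≡))) (<-trans a<b (<-≤-trans b<n (≤-reflexive n≡))))
              a< : a < suc q * g
              a< = subst₂ _<_ (sym a≡) (+-comm (q * g) g) (+-monoʳ-< (q * g) (m%n<n a g))
              b′<g : b′ < g
              b′<g = +-cancelˡ-< (q * g) b′ g (subst₂ _<_ (sym b≡) (+-comm g (q * g)) (same-block q q<m r a<))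
              a′<b′ : a′ < b′
              a′<b′ = +-cancelˡ-< (q * g) a′ b′ (subst₂ _<_ a≡ (sym b≡) a<b)
            fr : ∀ {a b} → (a , b) ∈ links* 0 (copies m f) → At A a b
            fr e∈ with ∈-copies⁻ m f 0 e∈
            ... | s , _ , a′ , b′ , q , refl , refl = At-tg s (proj₂ (proj₂ (rep .from q)))

-- Choosing a cut that suits the symmetry.

module FixedForests where
  open import Defs
  open Pieces using (leaf; node; order)
  open Links using (shiftE; links; links*; links-shift; span)
  open Encoding
  open Circles
  open Rotations
  open Windows
  open import Data.Empty using (⊥; ⊥-elim)
  open import Data.List using (_++_)
  open import Data.List.Membership.Propositional using (_∈_; lose)
  open import Data.List.Membership.Propositional.Properties using (∈-++⁺ˡ; ∈-++⁺ʳ; ∈-++⁻; ∈-map⁺; ∈-map⁻)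
  open import Data.Nat using (ℕ; zero; suc; _+_; _*_; _∸_; _≤_; _<_; s≤s; z≤n; _≤?_; _<?_)
  open import Data.Nat.Properties
  import Data.Nat.Tactic.RingSolver as ℕS
  open import Data.Product using (∃; _×_; _,_; proj₁; proj₂)
  open import Data.Sum using (inj₁; inj₂)
  open import Relation.Binary.Definitions using (tri<; tri≈; tri>)
  open import Relation.Binary.PropositionalEquality hiding ([_])
  open import Relation.Nullary using (Dec; yes; no; ¬_; _×-dec_)

  module Window (n′ g l : ℕ) (n≡ : suc n′ ≡ (2 + l) * g) (A : Graph (suc n′)) (k : ℕ) (F : NCForest (suc n′) k A) (inv : ρ^ g A ≡ A) where
    open Circle n′
    open Periodic n′ g l n≡
    open Inv A k F inv
    open Rotation n′ using (ρ^-forest)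

    -- Vertex x of B is vertex p + x of A, since s and p are inverse to each other modulo n.
    module Rotated (s p : ℕ) (s+p≅0 : ∀ x → s + (p + x) ≅ x) where
      B : Graph n
      B = ρ^ s A

      B-forest : NCForest n k B
      B-forest = ρ^-forest s A F

      B-inv : ρ^ g B ≡ B
      B-inv = trans (ρ^-comm g s A) (cong (ρ^ s) inv)

      toA : ∀ {x y} → At B x y → At A (p + x) (p + y)
      toA {x} {y} h = At-ρ^⁻ s A (At-cong B (≅-sym (s+p≅0 x)) (≅-sym (s+p≅0 y)) h)

      toB : ∀ {x y} → At A (p + x) (p + y) → At B x y
      toB {x} {y} h = At-cong B (s+p≅0 x) (s+p≅0 y) (At-ρ^⁺ s A h)

    module _ (nd : ∀ x → ¬ At A x (g + x)) where
      open NoDiameter nd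

      -- The difference of the ends exceeds n - g, so the short arc of the edge runs over the cut
      -- between n - 1 and 0.
      Long : ℕ → ℕ → Set
      Long a b = R a b × a + n < g + b

      Long? : ∀ a b → Dec (Long a b)
      Long? a b = R? a b ×-dec (a + n <? g + b)

      n<2g : ∀ {z} → z + n < g + (g + z) → ⊥
      n<2g {z} lt = <⇒≱ (+-cancelˡ-< z n (g + g) (subst (z + n <_) (swap g z) lt)) 2g≤n
        where
        swap : ∀ g z → g + (g + z) ≡ z + (g + g)
        swap = ℕS.solve-∀

      -- Among the edges whose short arc runs over the cut, the one with x - y smallest is nearest
      -- to the centre. The new cut is placed at its gap h.
      module Shortest (y x : ℕ) (ry : R y x) (long : y + n < g + x)
        (shortest : ∀ {c d} → Long c d → x + c ≤ d + y)
        (h : ℕ) (y≤h : y ≤ h) (h<x : h < x)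
        (only : ∀ {c d} → R c d → y ≤ c → d ≤ x → c ≤ h → h < d → c ≡ y × d ≡ x) where

        p : ℕ
        p = suc h
        x<n : x < n
        x<n = proj₁ (proj₂ ry)
        p≤n : p ≤ n
        p≤n = ≤-trans h<x (<⇒≤ x<n)
        y<g : y < g
        y<g = +-cancelʳ-< n y g (<-trans long (+-monoʳ-< g x<n))
        g<x : g < x
        g<x = +-cancelˡ-< g g x (≤-<-trans 2g≤n (≤-<-trans (m≤n+m n y) long))

        s+p : ∀ x → n ∸ p + (p + x) ≅ x
        s+p x = ≅-trans (≅-reflexive (trans (sym (+-assoc (n ∸ p) p x)) (cong (_+ x) (m∸n+n≡m p≤n)))) (≅-n+ x)

        open Rotated (n ∸ p) p s+p
        module IB = Inv B k B-forest B-inv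

        nd′ : ∀ x → ¬ At B x (g + x)
        nd′ x h = nd (p + x) (At-cong A ≅-refl (≅-reflexive (swap p g x)) (toA h))
          where
          swap : ∀ p g x → p + (g + x) ≡ g + (p + x)
          swap = ℕS.solve-∀

        -- The cases are distinguished by the number of ends that wrap around when p is added. If
        -- none or both do, the edge is long in A too, and it crosses {y, x} or is shorter. If one
        -- does, the edge is {z, U} with z ≤ h < U and U - z < g: it crosses {y, x}, lies inside it
        -- against the choice of h, or contains it, although x - y > n - g ≥ g.
        not-long : ∀ {a b} → IB.R a b → ¬ a + n < g + b
        not-long {a} {b} (a<b , b<n , hB) lng with p + b <? n | p + a <? n
        ... | yes V<n | _ with p + b ≤? x
        ...   | yes V≤x = <⇒≱ (≤-<-trans (≤-trans (≤-reflexive (+-comm (p + b) y)) (+-monoʳ-≤ y V≤x)) (subst₂ _<_ (+-comm x y) refl (+-monoʳ-< x (<-≤-trans (s≤s y≤h) (m≤m+n p a)))))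
                            (shortest ((+-monoʳ-< p a<b , V<n , toA hB) , long-shift))
          where
          long-shift : p + a + n < g + (p + b)
          long-shift = subst₂ _<_ (sym (+-assoc p a n)) (swap p g b) (+-monoʳ-< p lng)
            where
            swap : ∀ p g b → p + (g + b) ≡ g + (p + b)
            swap = ℕS.solve-∀
        ...   | no V≰x = R-nc ry (+-monoʳ-< p a<b , V<n , toA hB) (<-≤-trans (s≤s y≤h) (m≤m+n p a)) U<x (≰⇒> V≰x)
          where
          U<x : p + a < x
          U<x = <-trans (+-cancelʳ-< n (p + a) g (<-trans (subst₂ _<_ (sym (+-assoc p a n)) (swap p g b) (+-monoʳ-< p lng)) (+-monoʳ-< g V<n))) g<x
            where
            swap : ∀ p g b → p + (g + b) ≡ g + (p + b)
            swap = ℕS.solve-∀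
        not-long {a} {b} (a<b , b<n , hB) lng | no V≮n | yes U<n = cases
          where
          z = p + b ∸ n
          U = p + a
          z≡ : n + z ≡ p + b
          z≡ = m+[n∸m]≡n (≮⇒≥ V≮n)
          z<p : z < p
          z<p = +-cancelˡ-< n z p (subst₂ _<_ (sym z≡) (+-comm p n) (+-monoʳ-< p b<n))
          z≤h : z ≤ h
          z≤h = ≤-pred z<p
          h<U : h < U
          h<U = m≤m+n p a
          rz : R z U
          rz = <-≤-trans z<p (m≤m+n p a) , U<n , At-sym (At-cong A ≅-refl (≅-trans (≅-reflexive (sym z≡)) (≅-n+ z)) (toA hB))
          U<g+z : U < g + z
          U<g+z = +-cancelʳ-< n U (g + z) (begin-strict
            U + n          ≡⟨ +-assoc p a n ⟩
            p + (a + n)    <⟨ +-monoʳ-< p lng ⟩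
            p + (g + b)    ≡⟨ swap p g b ⟩
            g + (p + b)    ≡⟨ cong (g +_) (sym z≡) ⟩
            g + (n + z)    ≡⟨ swap′ g n z ⟩
            g + z + n      ∎)
            where
            open ≤-Reasoning
            swap : ∀ p g b → p + (g + b) ≡ g + (p + b)
            swap = ℕS.solve-∀
            swap′ : ∀ g n z → g + (n + z) ≡ g + z + n
            swap′ = ℕS.solve-∀
          too-short : z ≤ y → x ≤ U → ⊥
          too-short z≤y x≤U = n<2g {y} (<-≤-trans long (+-monoʳ-≤ g (≤-trans x≤U (≤-trans (<⇒≤ U<g+z) (+-monoʳ-≤ g z≤y)))))
          cases : ⊥
          cases with <-cmp z y
          ... | tri< z<y _ _ with U <? x
          ...   | yes U<x = R-nc rz ry z<y (≤-<-trans y≤h h<U) U<x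
          ...   | no U≮x  = too-short (<⇒≤ z<y) (≮⇒≥ U≮x)
          cases | tri≈ _ z≡y _ with U ≤? x
          ...   | no U≰x  = too-short (≤-reflexive z≡y) (<⇒≤ (≰⇒> U≰x))
          ...   | yes U≤x with only rz (≤-reflexive (sym z≡y)) U≤x z≤h h<U
          ...     | _ , U≡x = too-short (≤-reflexive z≡y) (≤-reflexive (sym U≡x))
          cases | tri> _ _ y<z with U ≤? x
          ...   | no U≰x  = R-nc ry rz y<z (≤-<-trans z≤h h<x) (≰⇒> U≰x)
          ...   | yes U≤x with only rz (<⇒≤ y<z) U≤x z≤h h<U
          ...     | z≡y , _ = <-irrefl (sym z≡y) y<z
        not-long {a} {b} (a<b , b<n , hB) lng | no V≮n | no U≮n = cases
          where
          U′ = p + a ∸ n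
          V′ = p + b ∸ n
          U≡ : n + U′ ≡ p + a
          U≡ = m+[n∸m]≡n (≮⇒≥ U≮n)
          V≡ : n + V′ ≡ p + b
          V≡ = m+[n∸m]≡n (≮⇒≥ V≮n)
          V′<p : V′ < p
          V′<p = +-cancelˡ-< n V′ p (subst₂ _<_ (sym V≡) (+-comm p n) (+-monoʳ-< p b<n))
          V′<x : V′ < x
          V′<x = <-≤-trans V′<p h<x
          U′<V′ : U′ < V′
          U′<V′ = +-cancelˡ-< n U′ V′ (subst₂ _<_ (sym U≡) (sym V≡) (+-monoʳ-< p a<b))
          r′ : R U′ V′
          r′ = U′<V′ , <-trans V′<x x<n , At-cong A (≅-trans (≅-reflexive (sym U≡)) (≅-n+ U′)) (≅-trans (≅-reflexive (sym V≡)) (≅-n+ V′)) (toA hB)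
          long′ : U′ + n < g + V′
          long′ = +-cancelˡ-< n (U′ + n) (g + V′) (begin-strict
            n + (U′ + n)   ≡⟨ trans (sym (+-assoc n U′ n)) (cong (_+ n) U≡) ⟩
            p + a + n      ≡⟨ +-assoc p a n ⟩
            p + (a + n)    <⟨ +-monoʳ-< p lng ⟩
            p + (g + b)    ≡⟨ swap p g b ⟩
            g + (p + b)    ≡⟨ cong (g +_) (sym V≡) ⟩
            g + (n + V′)   ≡⟨ swap g n V′ ⟩
            n + (g + V′)   ∎)
            where
            open ≤-Reasoning
            swap : ∀ p g b → p + (g + b) ≡ g + (p + b)
            swap = ℕS.solve-∀
          g<V′ : g < V′
          g<V′ = +-cancelˡ-< g g V′ (≤-<-trans 2g≤n (≤-<-trans (m≤n+m n U′) long′))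
          cases : ⊥
          cases with U′ <? y
          ... | yes U′<y = R-nc r′ ry U′<y (<-trans y<g g<V′) V′<x
          ... | no U′≮y  = <⇒≱ (+-mono-<-≤ V′<x (≮⇒≥ U′≮y)) (shortest (r′ , long′))

        result : ∃ λ s → ∃ λ f → order f ≡ g × ρ^ s A ≡ fromLinks (links* 0 (copies m f))
        result = n ∸ p , IB.NoDiameter.Blocks.code nd′ short
          where
          short : IB.NoDiameter.OnlyShort nd′
          short r with IB.NoDiameter.short-or-long nd′ r
          ... | inj₁ s = s
          ... | inj₂ lng = ⊥-elim (not-long r lng)

      window : ∃ λ s → ∃ λ f → order f ≡ g × ρ^ s A ≡ fromLinks (links* 0 (copies m f))
      window with anyUpTo? (λ d → anyUpTo? (λ a → Long? a (d + a)) n) n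
      ... | no none = 0 , Blocks.code short
        where
        short : OnlyShort
        short {a} {b} r@(a<b , b<n , _) with short-or-long r
        ... | inj₁ s = s
        ... | inj₂ lng = ⊥-elim (none (b ∸ a , ≤-<-trans (m∸n≤m b a) b<n , a , <-trans a<b b<n ,
                subst (Long a) (sym (m∸n+n≡m (<⇒≤ a<b))) (r , lng)))
      ... | yes (d , d<n , q) with least (λ d → anyUpTo? (λ a → Long? a (d + a)) n) n d d<n q
      ...   | e , (y , _ , ry , lng) , min = Shortest.result y (e + y) ry lng shortest (proj₁ (gap ry)) (proj₁ (proj₂ (gap ry))) (proj₁ (proj₂ (proj₂ (gap ry)))) (proj₂ (proj₂ (proj₂ (gap ry))))
        where
        shortest : ∀ {c d} → Long c d → e + y + c ≤ d + y
        shortest {c} {d} (r@(c<d , d<n , _) , lng′) with d <? e + c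
        ... | no d≮ = ≤-trans (≤-reflexive (swap e y c)) (+-monoˡ-≤ y (≮⇒≥ d≮))
          where
          swap : ∀ e y c → e + y + c ≡ e + c + y
          swap = ℕS.solve-∀
        ... | yes d< = ⊥-elim (min (+-cancelʳ-< c (d ∸ c) e (subst (_< e + c) (sym (m∸n+n≡m (<⇒≤ c<d))) d<))
                (c , <-trans c<d d<n , subst (Long c) (sym (m∸n+n≡m (<⇒≤ c<d))) (r , lng′)))

  module Diameter (n′ g : ℕ) (n≡ : suc n′ ≡ 2 * g) (A : Graph (suc n′)) (k : ℕ) (F : NCForest (suc n′) k A) (inv : ρ^ g A ≡ A)
    (p : ℕ) (p<n : p < suc n′) where
    open Circle n′
    open Periodic n′ g 0 n≡
    open Window n′ g 0 n≡ A k F inv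

    s+p : ∀ x → n ∸ p + (p + x) ≅ x
    s+p x = ≅-trans (≅-reflexive (trans (sym (+-assoc (n ∸ p) p x)) (cong (_+ x) (m∸n+n≡m (<⇒≤ p<n))))) (≅-n+ x)

    open Rotated (n ∸ p) p s+p
    open Inv B k B-forest B-inv

    g+g≡n : g + g ≡ n
    g+g≡n = trans (cong (g +_) (sym (+-identityʳ g))) (sym n≡)

    -- After the rotation the diameter is {0, g}, and its lower half is encoded as an edge with all
    -- that lies below it. The copy at g lists the diameter a second time, as {g, 2g}, which is the
    -- same pair modulo n.
    halves : At A p (g + p) → ∃ λ i → ∃ λ ms → ∃ λ j → span i ms j ≡ g ×
      ρ^ (n ∸ p) A ≡ fromLinks (links 0 (node i ms j leaf) ++ links g (node i ms j leaf))
    halves h with encode-edge g 0 g r ≤-refl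
      where
      r : R 0 g
      r = 0<g , g<n , toB (At-cong A (≅-reflexive (sym (+-identityʳ p))) (≅-reflexive (+-comm g p)) h)
    ... | i , ms , j , span≡ , rep = i , ms , j , span≡ , assemble (links 0 T ++ links g T) t f
      where
      T = node i ms j leaf
      r : R 0 g
      r = 0<g , g<n , toB (At-cong A (≅-reflexive (sym (+-identityʳ p))) (≅-reflexive (+-comm g p)) h)
      shifted : ∀ {a b} → (a , b) ∈ links 0 T → (g + a , g + b) ∈ links g T
      shifted {a} {b} e∈ = subst (λ z → (g + a , g + b) ∈ links z T) (+-identityʳ g) (subst ((g + a , g + b) ∈_) (sym (links-shift g 0 T)) (∈-map⁺ (shiftE g) e∈))
      t : ∀ {a b} → R a b → Link (links 0 T ++ links g T) a b
      t {a} {b} rab@(a<b , b<n , hab) with b ≤? g | g ≤? a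
      ... | yes b≤g | _ = ∈⇒Link (∈-++⁺ˡ (rep .to rab z≤n (s≤s b≤g)))
      ... | no _ | yes g≤a = ∈⇒Link (∈-++⁺ʳ (links 0 T) (subst₂ (λ x y → (x , y) ∈ links g T) a≡ b≡
          (shifted (rep .to (a′<b′ , <-trans b′<g g<n , At-g⁻ (subst₂ (At B) (sym a≡) (sym b≡) hab)) z≤n (<-trans b′<g (n<1+n g))))))
        where
        a≡ : g + (a ∸ g) ≡ a
        a≡ = m+[n∸m]≡n g≤a
        b≡ : g + (b ∸ g) ≡ b
        b≡ = m+[n∸m]≡n (≤-trans g≤a (<⇒≤ a<b))
        a′<b′ : a ∸ g < b ∸ g
        a′<b′ = +-cancelˡ-< g _ _ (subst₂ _<_ (sym a≡) (sym b≡) a<b)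
        b′<g : b ∸ g < g
        b′<g = +-cancelˡ-< g _ _ (subst₂ _<_ (sym b≡) (sym g+g≡n) b<n)
      -- An edge from 0 into the second half appears in the copy with 2g in place of 0.
      t {zero} {b} rab@(a<b , b<n , hab) | no b≰g | no _ = lose (∈-++⁺ʳ (links 0 T) (subst₂ (λ x y → (x , y) ∈ links g T) b≡ g+g≡n
          (shifted (rep .to (b′<g , g<n , At-g⁻ (At-cong B (≅-reflexive (sym b≡)) (≅-trans (≅-sym (≅-n+ 0)) (≅-reflexive (trans (+-identityʳ n) (sym g+g≡n)))) (At-sym hab))) z≤n ≤-refl))))
          (inj₂ (≅-refl , ≅-trans (≅-reflexive (sym (+-identityʳ n))) (≅-n+ 0)))
        where
        b≡ : g + (b ∸ g) ≡ b
        b≡ = m+[n∸m]≡n (<⇒≤ (≰⇒> b≰g))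
        b′<g : b ∸ g < g
        b′<g = +-cancelˡ-< g _ _ (subst₂ _<_ (sym b≡) (sym g+g≡n) b<n)
      t {suc a} {b} rab | no b≰g | no g≰a = ⊥-elim (R-nc r rab (s≤s z≤n) (≰⇒> g≰a) (≰⇒> b≰g))
      f : ∀ {a b} → (a , b) ∈ links 0 T ++ links g T → At B a b
      f {a} {b} e∈ with ∈-++⁻ (links 0 T) e∈
      ... | inj₁ q = proj₂ (proj₂ (rep .from q))
      ... | inj₂ q with ∈-map⁻ (shiftE g) (subst ((a , b) ∈_) (trans (cong (λ z → links z T) (sym (+-identityʳ g))) (links-shift g 0 T)) q)
      ...   | (a′ , b′) , q′ , refl = At-g (proj₂ (proj₂ (rep .from q′)))

-- Lists of codes and the set of fixed forests.

module Enumerations where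
  open import Defs
  open Pieces
  open Links using (shiftE; links*; links*-++; links*-shift; Good; good-forest; length-links*)
  open Encoding
  open Circles
  open Forests using (module ForestOf)
  open Rotations
  open Windows using (copies)
  open import Data.Bool.Properties using () renaming (_≟_ to _≟ᵇ_)
  open import Data.Empty using (⊥; ⊥-elim)
  open import Data.Fin using (Fin; zero; suc)
  open import Data.List using (List; []; _∷_; _++_; map; length; lookup)
  open import Data.List.Membership.Propositional using (_∈_; lose)
  open import Data.List.Membership.Propositional.Properties using (∈-lookup)
  open import Data.List.Relation.Unary.All as All using (All; []; _∷_)
  open import Data.List.Relation.Unary.AllPairs using ([]; _∷_)
  open import Data.List.Relation.Unary.Any as Any using (Any; any?; index)
  open import Data.List.Relation.Unary.Any.Properties as Any using (lookup-index)
  open import Data.List.Relation.Unary.Unique.Propositional using (Unique)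
  open import Data.Nat as ℕ using (ℕ; zero; suc; _+_; _*_)
  open import Data.Nat.Divisibility using (divides)
  open import Data.Nat.GCD using (gcd; gcd-GCD; gcd[m,n]∣n; module Bézout)
  open import Data.Nat.Properties as ℕ using (+-assoc; +-comm; +-identityʳ)
  open import Data.Product using (∃; _×_; _,_; proj₁; proj₂)
  open import Data.Sum using (inj₁; inj₂)
  open import Data.Vec.Properties using (≡-dec)
  open import Function.Bundles using (_↔_; mk↔ₛ′)
  open import Relation.Binary.PropositionalEquality hiding ([_])
  open import Relation.Nullary using (Dec)
  open import Relation.Nullary.Decidable using (recompute)

  lookup-injective : ∀ {A : Set} {xs : List A} → Unique xs → ∀ i j → lookup xs i ≡ lookup xs j → i ≡ j
  lookup-injective (_ ∷ _)  zero    zero    _ = refl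
  lookup-injective (x∉ ∷ _) zero    (suc j) e = ⊥-elim (All.lookup x∉ (∈-lookup j) e)
  lookup-injective (x∉ ∷ _) (suc i) zero    e = ⊥-elim (All.lookup x∉ (∈-lookup i) (sym e))
  lookup-injective (_ ∷ u)  (suc i) (suc j) e = cong suc (lookup-injective u i j e)

  -- The conditions concern listed codes only, which allows codes to be plain data without proofs
  -- inside.
  record Enumeration (n k d : ℕ) : Set₁ where
    field
      Code     : Set
      codes    : List Code
      unique   : Unique codes
      decode   : Code → Graph n
      forest   : ∀ {c} → c ∈ codes → NCForest n k (decode c)
      fixed    : ∀ {c} → c ∈ codes → ρ^ d (decode c) ≡ decode c
      injective : ∀ {c c′} → c ∈ codes → c′ ∈ codes → decode c ≡ decode c′ → c ≡ c′
      complete : ∀ A → NCForest n k A → ρ^ d A ≡ A → ∃ λ c → c ∈ codes × A ≡ decode c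

  module _ {n k d} (E : Enumeration n k d) where
    open Enumeration E

    private
      mkFix-cong : ∀ {A B : Graph n} .{f g} .{x y} → A ≡ B → mkFix {n} {k} {d} A f x ≡ mkFix B g y
      mkFix-cong refl = refl

      coded? : ∀ A → Dec (Any (λ c → A ≡ decode c) codes)
      coded? A = any? (λ c → ≡-dec (≡-dec _≟ᵇ_) A (decode c)) codes

      coded : ∀ A → NCForest n k A → ρ^ d A ≡ A → Any (λ c → A ≡ decode c) codes
      coded A F x with complete A F x
      ... | c , c∈ , e = lose c∈ e

      to : Fin (length codes) → Fix n k d
      to i = mkFix (decode (lookup codes i)) (forest (∈-lookup i)) (fixed (∈-lookup i))

      -- The proofs stored in `Fix` are irrelevant and cannot be taken apart; the code is recovered
      -- by a decidable search through the list.
      position : (A : Graph n) → .(NCForest n k A) → .(ρ^ d A ≡ A) → Any (λ c → A ≡ decode c) codes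
      position A F x = recompute (coded? A) (coded A F x)

      from : Fix n k d → Fin (length codes)
      from (mkFix A F x) = index (position A F x)

    fixed-points : Fin (length codes) ↔ Fix n k d
    fixed-points = mk↔ₛ′ to from
      (λ { (mkFix A F x) → mkFix-cong (sym (lookup-index (position A F x))) })
      (λ i → sym (lookup-injective unique i _ (injective (∈-lookup i) (∈-lookup _) (lookup-index (position (decode (lookup codes i)) (forest (∈-lookup i)) (fixed (∈-lookup i)))))))

  empty : ∀ {n k d} → (∀ A → NCForest n k A → ρ^ d A ≡ A → ⊥) → Enumeration n k d
  empty none = record
    { Code = ⊥ ; codes = [] ; unique = [] ; decode = λ () ; forest = λ () ; fixed = λ () ; injective = λ ()
    ; complete = λ A F x → ⊥-elim (none A F x) }

  module FixedBy (n′ : ℕ) where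
    open Circle n′

    iterate : ∀ t d (A : Graph n) → ρ^ d A ≡ A → ρ^ (t * d) A ≡ A
    iterate zero    d A x = refl
    iterate (suc t) d A x = trans (ρ^-+ d (t * d) A) (trans (cong (ρ^ d) (iterate t d A x)) x)

    fixed-gcd⁺ : ∀ d (A : Graph n) → ρ^ d A ≡ A → ρ^ (gcd n d) A ≡ A
    fixed-gcd⁺ d A x with Bézout.identity (gcd-GCD n d)
    ... | Bézout.+- s t e = begin
      ρ^ (gcd n d) A                    ≡⟨ cong (ρ^ (gcd n d)) (iterate t d A x) ⟨
      ρ^ (gcd n d) (ρ^ (t * d) A)       ≡⟨ ρ^-+ (gcd n d) (t * d) A ⟨
      ρ^ (gcd n d + t * d) A            ≡⟨ cong (λ z → ρ^ z A) e ⟩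
      ρ^ (s * n) A                      ≡⟨ ρ^-period s A ⟩
      A                                 ∎
      where open ≡-Reasoning
    ... | Bézout.-+ s t e = begin
      ρ^ (gcd n d) A                    ≡⟨ cong (ρ^ (gcd n d)) (ρ^-period s A) ⟨
      ρ^ (gcd n d) (ρ^ (s * n) A)       ≡⟨ ρ^-+ (gcd n d) (s * n) A ⟨
      ρ^ (gcd n d + s * n) A            ≡⟨ cong (λ z → ρ^ z A) e ⟩
      ρ^ (t * d) A                      ≡⟨ iterate t d A x ⟩
      A                                 ∎
      where open ≡-Reasoning

    fixed-gcd⁻ : ∀ d (A : Graph n) → ρ^ (gcd n d) A ≡ A → ρ^ d A ≡ A
    fixed-gcd⁻ d A x with gcd[m,n]∣n n d
    ... | divides t e = trans (cong (λ z → ρ^ z A) e) (iterate t (gcd n d) A x)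

    reduce : ∀ {k} d → Enumeration n k (gcd n d) → Enumeration n k d
    reduce d E = record
      { Code = Code ; codes = codes ; unique = unique ; decode = decode ; forest = forest
      ; fixed = λ c∈ → fixed-gcd⁻ d _ (fixed c∈) ; injective = injective
      ; complete = λ A F x → complete A F (fixed-gcd⁺ d A x) }
      where open Enumeration E

  edges*-++ : ∀ f g → edges* (f ++ g) ≡ edges* f + edges* g
  edges*-++ []      g = refl
  edges*-++ (i ∷ f) g = trans (cong (edges i +_) (edges*-++ f g)) (sym (+-assoc (edges i) _ _))

  comps-++ : ∀ f g → comps (f ++ g) ≡ comps f + comps g
  comps-++ []      g = refl
  comps-++ (i ∷ f) g = cong suc (trans (cong (inner i +_) (comps-++ f g)) (sym (+-assoc (inner i) _ _)))

  comps-copies : ∀ t f → comps (copies t f) ≡ t * comps f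
  comps-copies zero    f = refl
  comps-copies (suc t) f = trans (comps-++ f (copies t f)) (cong (comps f +_) (comps-copies t f))

  module Decode (n′ : ℕ) where
    open Circle n′

    good : ∀ f → order f ≡ n → Good 0 n (links* 0 f)
    good f f≡ = subst (λ z → Good 0 z (links* 0 f)) f≡ (good-forest f 0)

    graphOf : List Piece → Graph n
    graphOf f = fromLinks (links* 0 f)

    graphOf-forest : ∀ f → order f ≡ n → NCForest n (comps f) (graphOf f)
    graphOf-forest f f≡ = ForestOf.isForest n′ (links* 0 f) (good f f≡) (comps f)
      (trans (cong (comps f +_) (length-links* 0 f)) (trans (+-comm (comps f) (edges* f)) (trans (sym (order≡ f)) f≡)))

    graphOf-components : ∀ {k} f → order f ≡ n → NCForest n k (graphOf f) → k ≡ comps f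
    graphOf-components f f≡ F with graphOf-forest f f≡
    ... | (_ , symm) , _ , _ , H = components-unique {A = graphOf f} symm (proj₂ (proj₂ (proj₂ F))) H

    links-⊆ : ∀ L M → Good 0 n L → Good 0 n M → fromLinks L ≡ fromLinks M → L ⊆ M
    links-⊆ L M G H e {a} {b} e∈ with ForestOf.small n′ L G e∈
    ... | a<b , b<n with ForestOf.Link⇒∈ n′ M H (ℕ.<-trans a<b b<n) b<n
                           (At⇒Link M a b (subst (λ C → At C a b) e (Link⇒At L a b (lose e∈ (inj₁ (≅-refl , ≅-refl))))))
    ...   | inj₁ p = p
    ...   | inj₂ p = ⊥-elim (ℕ.<-asym a<b (proj₁ (ForestOf.small n′ M H p)))

    graphOf-injective : ∀ f f′ → order f ≡ n → order f′ ≡ n → graphOf f ≡ graphOf f′ → f ≡ f′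
    graphOf-injective f f′ f≡ f′≡ e = links*-injective 0 f f′ (trans f≡ (sym f′≡))
      (links-⊆ _ _ (good f f≡) (good f′ f′≡) e) (links-⊆ _ _ (good f′ f′≡) (good f f≡) (sym e))

    Link-n+ : ∀ {L x y} → Link (map (shiftE n) L) x y → Link L x y
    Link-n+ {L} {x} {y} l = Link-shift⁻ n {L} (Link-cong (≅-sym (≅-n+ x)) (≅-sym (≅-n+ y)) l)

    Link-n+⁻ : ∀ {L x y} → Link L x y → Link (map (shiftE n) L) x y
    Link-n+⁻ {L} {x} {y} l = Link-cong (≅-n+ x) (≅-n+ y) (Link-shift⁺ n l)

    -- On the circle only the cyclic order of the pieces matters: moving f behind g adds n to the
    -- positions of its vertices.
    graphOf-rotate : ∀ f g → order f + order g ≡ n → graphOf (f ++ g) ≡ ρ^ (order f) (graphOf (g ++ f))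
    graphOf-rotate f g e = trans (fromLinks-cong {links* 0 (f ++ g)} {map (shiftE (order f)) (links* 0 (g ++ f))} t r)
        (sym (ρ^-fromLinks (order f) (links* 0 (g ++ f))))
      where
      left : links* 0 (f ++ g) ≡ links* 0 f ++ links* (order f) g
      left = links*-++ 0 f g
      right : map (shiftE (order f)) (links* 0 (g ++ f)) ≡ links* (order f) g ++ map (shiftE n) (links* 0 f)
      right = trans (sym (links*-shift (order f) 0 (g ++ f))) (trans (cong (λ z → links* z (g ++ f)) (+-identityʳ (order f)))
        (trans (links*-++ (order f) g f) (cong (links* (order f) g ++_) (trans (cong (λ z → links* z f) (trans e (sym (+-identityʳ n)))) (links*-shift n 0 f)))))
      t : ∀ x y → Link (links* 0 (f ++ g)) x y → Link (map (shiftE (order f)) (links* 0 (g ++ f))) x y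
      t x y l with Any.++⁻ (links* 0 f) (subst (λ L → Link L x y) left l)
      ... | inj₁ p = subst (λ L → Link L x y) (sym right) (Any.++⁺ʳ (links* (order f) g) (Link-n+⁻ p))
      ... | inj₂ p = subst (λ L → Link L x y) (sym right) (Any.++⁺ˡ p)
      r : ∀ x y → Link (map (shiftE (order f)) (links* 0 (g ++ f))) x y → Link (links* 0 (f ++ g)) x y
      r x y l with Any.++⁻ (links* (order f) g) (subst (λ L → Link L x y) right l)
      ... | inj₁ p = subst (λ L → Link L x y) (sym left) (Any.++⁺ʳ (links* 0 f) p)
      ... | inj₂ p = subst (λ L → Link L x y) (sym left) (Any.++⁺ˡ (Link-n+ p))

-- Fixed forests that leave the centre in a region.

module CentralRegions where
  open import Defs
  open Pieces
  open PieceCounts using (widthAt)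
  open Links using (links*; order-++; covered)
  open Encoding
  open Circles
  open Forests using (module ForestOf)
  open Rotations
  open Windows
  open Enumerations
  open import Data.Empty using (⊥; ⊥-elim)
  open import Data.Fin using (zero)
  open import Data.Integer as ℤ using (ℤ; 1ℤ)
  open import Data.List using (List; []; _∷_; _++_; map; length; _∷ʳ_; [_]; upTo)
  open import Data.List.Membership.Propositional using (_∈_; lose)
  open import Data.List.Membership.Propositional.Properties using (∈-++⁺ˡ; ∈-++⁺ʳ; ∈-++⁻; ∈-map⁺; ∈-map⁻; ∈-upTo⁺; ∈-upTo⁻)
  open import Data.List.Properties using (++-assoc; ++-identityʳ; length-++; length-map; length-upTo)
  open import Data.List.Relation.Unary.All as All using (All; []; _∷_)
  open import Data.List.Relation.Unary.AllPairs using ([]; _∷_)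
  open import Data.List.Relation.Unary.Any using (here; there)
  open import Data.List.Relation.Unary.Unique.Propositional using (Unique)
  import Data.List.Relation.Unary.Unique.Propositional.Properties as Unique
  open import Data.Nat using (ℕ; zero; suc; _+_; _*_; _∸_; _≤_; _<_; s≤s; z≤n; _≤?_)
  open import Data.Nat.Properties
  open import Data.Product using (∃; _×_; _,_; proj₁; proj₂)
  open import Data.Sum using (inj₁; inj₂)
  open import Data.Vec using ([]; _∷_)
  open import Relation.Binary.Definitions using (tri<; tri≈; tri>)
  open import Relation.Binary.PropositionalEquality hiding ([_])
  open import Relation.Nullary using (yes; no; ¬_)

  -- This is the trivial rotation, m = 1, under which every forest is fixed.
  module LinearCase (n′ a b : ℕ) (n≡ : suc n′ ≡ a + b) where
    open Circle n′
    open Decode n′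

    private
      forestOf : Stack 0 1 → List Piece
      forestOf (_ , f ∷ []) = f

      sizes : ∀ {s} → s ∈ stacks 0 1 a b → order (forestOf s) ≡ n × comps (forestOf s) ≡ b
      sizes {[] , f ∷ []} s∈ with All.lookup (stacks-sound 0 1 a b) s∈
      ... | e , c = trans (order≡ f) (trans (cong₂ _+_ (trans (sym (+-identityʳ (edges* f))) e) c′) (sym n≡)) , c′
        where
        c′ : comps f ≡ b
        c′ = trans (sym (+-identityʳ (comps f))) c

    enumeration : Enumeration n b n
    enumeration = record
      { Code = Stack 0 1
      ; codes = stacks 0 1 a b
      ; unique = stacks-unique 0 1 a b
      ; decode = λ s → graphOf (forestOf s)
      ; forest = λ {s} s∈ → subst (λ k → NCForest n k (graphOf (forestOf s))) (proj₂ (sizes s∈)) (graphOf-forest (forestOf s) (proj₁ (sizes s∈)))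
      ; fixed = λ {s} s∈ → trans (cong (λ z → ρ^ z (graphOf (forestOf s))) (sym (+-identityʳ n))) (ρ^-period 1 (graphOf (forestOf s)))
      ; injective = λ {s} {s′} s∈ s′∈ e → inj s s′ (graphOf-injective (forestOf s) (forestOf s′) (proj₁ (sizes s∈)) (proj₁ (sizes s′∈)) e)
      ; complete = comp }
      where
      inj : ∀ s s′ → forestOf s ≡ forestOf s′ → s ≡ s′
      inj ([] , f ∷ []) ([] , .f ∷ []) refl = refl
      comp : ∀ A → NCForest n b A → ρ^ n A ≡ A → ∃ λ s → s ∈ stacks 0 1 a b × A ≡ graphOf (forestOf s)
      comp A F _ = build (Assemble.linear-code n′ A b F)
        where
        build : (∃ λ f → order f ≡ n × A ≡ graphOf f) → ∃ λ s → s ∈ stacks 0 1 a b × A ≡ graphOf (forestOf s)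
        build (f , f≡ , A≡) = ([] , f ∷ []) , ∈-stacks⁺ 0 1 a b ([] , f ∷ []) e (trans (+-identityʳ (comps f)) (sym b≡)) , A≡
          where
          b≡ : b ≡ comps f
          b≡ = graphOf-components f f≡ (subst (NCForest n b) A≡ F)
          e : edges* f + 0 ≡ a
          e = trans (+-identityʳ (edges* f)) (+-cancelʳ-≡ b (edges* f) a (trans (cong (edges* f +_) b≡) (trans (sym (order≡ f)) (trans f≡ n≡))))

  copies-rotate : ∀ t i f → copies t (i ∷ f) ∷ʳ i ≡ i ∷ copies t (f ∷ʳ i)
  copies-rotate zero    i f = refl
  copies-rotate (suc t) i f = cong (i ∷_) (begin
    (f ++ copies t (i ∷ f)) ∷ʳ i         ≡⟨ ++-assoc f (copies t (i ∷ f)) [ i ] ⟩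
    f ++ (copies t (i ∷ f) ∷ʳ i)         ≡⟨ cong (f ++_) (copies-rotate t i f) ⟩
    f ++ (i ∷ copies t (f ∷ʳ i))         ≡⟨ ++-assoc f [ i ] (copies t (f ∷ʳ i)) ⟨
    (f ∷ʳ i) ++ copies t (f ∷ʳ i)        ∎)
    where open ≡-Reasoning

  copies-snoc : ∀ t f → copies t f ++ f ≡ f ++ copies t f
  copies-snoc zero    f = sym (++-identityʳ f)
  copies-snoc (suc t) f = trans (++-assoc f (copies t f) f) (cong (f ++_) (copies-snoc t f))

  -- The number is the place of vertex 0 in the first piece. It takes one value more than the width
  -- of this piece, which is the weight summed in `pointedCount`.
  pointed : List (Stack 1 1) → List (ℕ × Stack 1 1)
  pointed []                          = []
  pointed (t@(i ∷ [] , f ∷ []) ∷ ts) = map (_, t) (upTo (suc (width i))) ++ pointed ts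

  firstWidth : Stack 1 1 → ℕ
  firstWidth (i ∷ [] , _) = width i

  ∈-pointed⁺ : ∀ {s t ts} → t ∈ ts → s ≤ firstWidth t → (s , t) ∈ pointed ts
  ∈-pointed⁺ {t = t@(i ∷ [] , f ∷ [])} (here refl) s≤ = ∈-++⁺ˡ (∈-map⁺ (_, t) (∈-upTo⁺ (s≤s s≤)))
  ∈-pointed⁺ {ts = t′@(i ∷ [] , f ∷ []) ∷ ts} (there t∈) s≤ = ∈-++⁺ʳ (map (_, t′) (upTo (suc (width i)))) (∈-pointed⁺ t∈ s≤)

  ∈-pointed⁻ : ∀ {s t} ts → (s , t) ∈ pointed ts → t ∈ ts × s ≤ firstWidth t
  ∈-pointed⁻ (t′@(i ∷ [] , f ∷ []) ∷ ts) p∈ with ∈-++⁻ (map (_, t′) (upTo (suc (width i)))) p∈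
  ... | inj₂ q with ∈-pointed⁻ ts q
  ...   | t∈ , s≤ = there t∈ , s≤
  ∈-pointed⁻ (t′@(i ∷ [] , f ∷ []) ∷ ts) p∈ | inj₁ q with ∈-map⁻ (_, t′) q
  ...   | s′ , s′∈ , refl = here refl , ≤-pred (∈-upTo⁻ s′∈)

  pointed-unique : ∀ {ts} → Unique ts → Unique (pointed ts)
  pointed-unique [] = []
  pointed-unique {t@(i ∷ [] , f ∷ []) ∷ ts} (t∉ ∷ u) = Unique.++⁺ (Unique.map⁺ (cong proj₁) (Unique.upTo⁺ (suc (width i)))) (pointed-unique u) disjoint
    where
    disjoint : ∀ {p} → p ∈ map (_, t) (upTo (suc (width i))) × p ∈ pointed ts → ⊥
    disjoint (p∈ , p∈′) with ∈-map⁻ (_, t) p∈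
    ... | s , _ , refl = All.lookup t∉ (proj₁ (∈-pointed⁻ ts p∈′)) refl

  length-pointed : ∀ ts → ℤ.+ length (pointed ts) ≡ sumOver (λ s → 1ℤ ℤ.+ widthAt zero s) ts
  length-pointed [] = refl
  length-pointed (t@(i ∷ [] , f ∷ []) ∷ ts) = trans (cong ℤ.+_ (trans (length-++ (map (_, t) (upTo (suc (width i)))))
      (cong (_+ length (pointed ts)) (trans (length-map (_, t) (upTo (suc (width i)))) (length-upTo (suc (width i)))))))
    (cong (λ z → (1ℤ ℤ.+ (ℤ.+ width i)) ℤ.+ z) (length-pointed ts))

  module CentralRegion (n′ g l : ℕ) (n≡ : suc n′ ≡ (2 + l) * g) where
    open Circle n′
    open Decode n′
    open Periodic n′ g l n≡

    order-m : ∀ {f} → order f ≡ g → order (copies m f) ≡ n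
    order-m {f} f≡ = trans (order-copies m f) (trans (cong (m *_) f≡) (sym n≡))

    graphᵐ : List Piece → Graph n
    graphᵐ f = graphOf (copies m f)

    graphᵐ-fixed : ∀ f → order f ≡ g → ρ^ g (graphᵐ f) ≡ graphᵐ f
    graphᵐ-fixed f refl = sym (trans (graphOf-rotate f (copies (suc l) f) (trans (sym (order-++ f (copies (suc l) f))) (order-m {f} refl)))
      (cong (λ h → ρ^ (order f) (graphOf h)) (copies-snoc (suc l) f)))

    graphᵐ-rotate : ∀ i f → order (i ∷ f) ≡ g → graphᵐ (i ∷ f) ≡ ρ^ (suc (width i)) (graphᵐ (f ∷ʳ i))
    graphᵐ-rotate i f f≡ = trans (graphOf-rotate [ i ] Y ord) (cong₂ (λ d h → ρ^ d (graphOf h)) (+-identityʳ (suc (width i))) Y≡)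
      where
      Y = f ++ copies (suc l) (i ∷ f)
      ord : order [ i ] + order Y ≡ n
      ord = trans (cong (_+ order Y) (+-identityʳ (suc (width i)))) (order-m {i ∷ f} f≡)
      Y≡ : Y ++ [ i ] ≡ copies m (f ∷ʳ i)
      Y≡ = trans (++-assoc f (copies (suc l) (i ∷ f)) [ i ]) (trans (cong (f ++_) (copies-rotate (suc l) i f)) (sym (++-assoc f [ i ] (copies (suc l) (f ∷ʳ i)))))

    -- Cutting elsewhere, one may assume that vertex 0, which ρ^ s moves to s, lies in the first piece.
    normalise : ∀ A fuel s f → s < fuel → order f ≡ g → ρ^ s A ≡ graphᵐ f →
      ∃ λ i → ∃ λ f′ → ∃ λ s′ → s′ ≤ width i × order (i ∷ f′) ≡ g × ρ^ s′ A ≡ graphᵐ (i ∷ f′)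
    normalise A fuel s [] _ f≡ _ = ⊥-elim (<-irrefl f≡ 0<g)
    normalise A (suc fuel) s (i ∷ f) (s≤s s≤) f≡ e with s ≤? width i
    ... | yes s≤w = i , f , s , s≤w , f≡ , e
    ... | no s≰w = normalise A fuel s′ (f ∷ʳ i) (<-≤-trans s′<s s≤) f′≡ (ρ^-injective (suc (width i))
          (trans (sym (ρ^-+ (suc (width i)) s′ A)) (trans (cong (λ z → ρ^ z A) s≡) (trans e (graphᵐ-rotate i f f≡)))))
      where
      s′ = s ∸ suc (width i)
      s≡ : suc (width i) + s′ ≡ s
      s≡ = m+[n∸m]≡n (≰⇒> s≰w)
      s′<s : s′ < s
      s′<s = subst (s′ <_) s≡ (m<n+m s′ (s≤s z≤n))
      f′≡ : order (f ∷ʳ i) ≡ g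
      f′≡ = trans (order-++ f [ i ]) (trans (cong (order f +_) (+-identityʳ (suc (width i)))) (trans (+-comm (order f) (suc (width i))) f≡))

    -- As ρ^n is the identity, this undoes the rotation that brings vertex 0 to place s.
    decodeᵐ : ℕ → List Piece → Graph n
    decodeᵐ s f = ρ^ (n ∸ s) (graphᵐ f)

    undecode : ∀ s f → s ≤ n → ρ^ s (decodeᵐ s f) ≡ graphᵐ f
    undecode s f s≤n = trans (sym (ρ^-+ s (n ∸ s) (graphᵐ f))) (trans (cong (λ z → ρ^ z (graphᵐ f)) (trans (m+[n∸m]≡n s≤n) (sym (+-identityʳ n)))) (ρ^-period 1 (graphᵐ f)))

    decodeᵐ-unique : ∀ A s f → s ≤ n → ρ^ s A ≡ graphᵐ f → A ≡ decodeᵐ s f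
    decodeᵐ-unique A s f s≤n e = ρ^-injective s (trans e (sym (undecode s f s≤n)))

    first-width : ∀ i f → order (i ∷ f) ≡ g → width i < g
    first-width i f f≡ = ≤-trans (m≤m+n (suc (width i)) (order f)) (≤-reflexive f≡)

    -- An edge of i over the position δ would come from an edge between two copies of f.
    no-later-start : ∀ f i f′ δ → order f ≡ g → order (i ∷ f′) ≡ g → 0 < δ → δ ≤ width i → ¬ ρ^ δ (graphᵐ f) ≡ graphᵐ (i ∷ f′)
    no-later-start f i f′ δ@(suc δ′) f≡ f′≡ _ δ≤ e with covered i 0 δ′ z≤n δ≤
    ... | a , b , e∈ , a≤ , b> with within-piece 0 i e∈
    ...   | _ , a<b , b≤w = impossible
      where
      a′ = n + a ∸ δ
      b′ = b ∸ δ
      δ≤n+a : δ ≤ n + a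
      δ≤n+a = ≤-trans (≤-trans δ≤ (<⇒≤ (<-trans (first-width i f′ f′≡) g<n))) (m≤m+n n a)
      a≡ : δ + a′ ≡ n + a
      a≡ = m+[n∸m]≡n δ≤n+a
      b≡ : δ + b′ ≡ b
      b≡ = m+[n∸m]≡n b>
      b<g : b < g
      b<g = ≤-<-trans b≤w (first-width i f′ f′≡)
      a′<n : a′ < n
      a′<n = +-cancelˡ-< δ a′ n (subst₂ _<_ (sym a≡) (+-comm n δ) (+-monoʳ-< n (s≤s a≤)))
      b′<a′ : b′ < a′
      b′<a′ = +-cancelˡ-< δ b′ a′ (subst₂ _<_ (sym b≡) (sym a≡) (<-≤-trans (<-trans b<g g<n) (m≤m+n n a)))
      there-edge : At (graphᵐ (i ∷ f′)) a b
      there-edge = Link⇒At _ a b (lose (∈-++⁺ˡ e∈) (inj₁ (≅-refl , ≅-refl)))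
      here-edge : Link (links* 0 (copies m f)) a′ b′
      here-edge = At⇒Link _ a′ b′ (At-ρ^⁻ δ (graphᵐ f) (subst (λ C → At C (δ + a′) (δ + b′)) (sym e)
        (At-cong (graphᵐ (i ∷ f′)) (≅-trans (≅-sym (≅-n+ a)) (≅-reflexive (sym a≡))) (≅-reflexive (sym b≡)) there-edge)))
      impossible : ⊥
      impossible with ForestOf.Link⇒∈ n′ _ (good (copies m f) (order-m {f} f≡)) a′<n (<-trans b′<a′ a′<n) here-edge
      ... | inj₁ p = <-asym b′<a′ (proj₁ (ForestOf.small n′ _ (good (copies m f) (order-m {f} f≡)) p))
      ... | inj₂ p with ∈-copies⁻ m f 0 p
      ...   | t , _ , b₁ , a₁ , q , b′≡ , a′≡ with within-forest 0 f q
      ...     | _ , _ , a₁< = <⇒≱ (+-cancelˡ-< (t * order f) a₁ g (<-≤-trans (+-monoʳ-< (t * order f) (<-≤-trans a₁< (≤-reflexive f≡))) ≤-refl))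
                (+-cancelˡ-≤ (t * order f) g a₁ (≤-trans far (≤-reflexive a′≡)))
        where
        -- The ends of the edge are at least g apart, because b < g and 2g ≤ n, so they cannot lie
        -- in one copy of f.
        far : t * order f + g ≤ a′
        far = ≤-trans (+-monoˡ-≤ g (≤-trans (m≤m+n (t * order f) b₁) (≤-reflexive (sym b′≡)))) (+-cancelˡ-≤ δ (b′ + g) a′ (begin
          δ + (b′ + g)   ≡⟨ +-assoc δ b′ g ⟨
          δ + b′ + g     ≡⟨ cong (_+ g) b≡ ⟩
          b + g          ≤⟨ +-monoˡ-≤ g (<⇒≤ b<g) ⟩
          g + g          ≤⟨ 2g≤n ⟩
          n              ≤⟨ m≤m+n n a ⟩
          n + a          ≡⟨ a≡ ⟨
          δ + a′         ∎))
          where open ≤-Reasoning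

    -- Applying ρ^ s′ to the common graph leaves the two periodic graphs differing by a rotation
    -- through s′ - s, which is positive and at most the width of i′.
    later : ∀ s i f s′ i′ f′ → s < s′ → s ≤ width i → s′ ≤ width i′ → order (i ∷ f) ≡ g → order (i′ ∷ f′) ≡ g → ¬ decodeᵐ s (i ∷ f) ≡ decodeᵐ s′ (i′ ∷ f′)
    later s i f s′ i′ f′ s<s′ s≤ s′≤ f≡ f′≡ e = no-later-start (i ∷ f) i′ f′ (s′ ∸ s) f≡ f′≡ (m<n⇒0<n∸m s<s′) (≤-trans (m∸n≤m s′ s) s′≤) (begin
      ρ^ (s′ ∸ s) (graphᵐ (i ∷ f))                ≡⟨ cong (ρ^ (s′ ∸ s)) (undecode s (i ∷ f) (≤-trans s≤ (<⇒≤ (<-trans (first-width i f f≡) g<n)))) ⟨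
      ρ^ (s′ ∸ s) (ρ^ s (decodeᵐ s (i ∷ f)))      ≡⟨ ρ^-+ (s′ ∸ s) s (decodeᵐ s (i ∷ f)) ⟨
      ρ^ (s′ ∸ s + s) (decodeᵐ s (i ∷ f))         ≡⟨ cong₂ ρ^ (m∸n+n≡m (<⇒≤ s<s′)) e ⟩
      ρ^ s′ (decodeᵐ s′ (i′ ∷ f′))                ≡⟨ undecode s′ (i′ ∷ f′) (≤-trans s′≤ (<⇒≤ (<-trans (first-width i′ f′ f′≡) g<n))) ⟩
      graphᵐ (i′ ∷ f′)                            ∎)
      where open ≡-Reasoning

    decodeᵐ-injective : ∀ s i f s′ i′ f′ → s ≤ width i → s′ ≤ width i′ → order (i ∷ f) ≡ g → order (i′ ∷ f′) ≡ g →
      decodeᵐ s (i ∷ f) ≡ decodeᵐ s′ (i′ ∷ f′) → s ≡ s′ × i ∷ f ≡ i′ ∷ f′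
    decodeᵐ-injective s i f s′ i′ f′ s≤ s′≤ f≡ f′≡ e with <-cmp s s′
    ... | tri≈ _ refl _ = refl , prefix (i ∷ f) (i′ ∷ f′) f≡ f′≡ (graphOf-injective (copies m (i ∷ f)) (copies m (i′ ∷ f′)) (order-m {i ∷ f} f≡) (order-m {i′ ∷ f′} f′≡)
          (ρ^-injective (n ∸ s) e))
      where
      prefix : ∀ f f′ → order f ≡ g → order f′ ≡ g → copies m f ≡ copies m f′ → f ≡ f′
      prefix f f′ f≡ f′≡ e = go f f′ (copies (suc l) f) (copies (suc l) f′) (trans f≡ (sym f′≡)) e
        where
        go : ∀ f f′ x y → order f ≡ order f′ → f ++ x ≡ f′ ++ y → f ≡ f′
        go []      []        x y _ _ = refl
        go (i ∷ f) (i′ ∷ f′) x y o e with refl ← cong (λ { (i ∷ _) → i ; [] → leaf }) e = cong (i ∷_) (go f f′ x y (+-cancelˡ-≡ (suc (width i)) _ _ o) (cong (λ { (_ ∷ f) → f ; [] → [] }) e))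
    ... | tri< s<s′ _ _ = ⊥-elim (later s i f s′ i′ f′ s<s′ s≤ s′≤ f≡ f′≡ e)
    ... | tri> _ _ s′<s = ⊥-elim (later s′ i′ f′ s i f s′<s s′≤ s≤ f′≡ f≡ (sym e))

    graphᵐ-forest : ∀ f → order f ≡ g → NCForest n (m * comps f) (graphᵐ f)
    graphᵐ-forest f f≡ = subst (λ k → NCForest n k (graphᵐ f)) (comps-copies m f) (graphOf-forest (copies m f) (order-m {f} f≡))

    graphᵐ-components : ∀ {k} A s f → order f ≡ g → NCForest n k A → ρ^ s A ≡ graphᵐ f → k ≡ m * comps f
    graphᵐ-components {k} A s f f≡ F e = trans (graphOf-components (copies m f) (order-m {f} f≡)
      (subst (NCForest n k) e (Rotation.ρ^-forest n′ s A F))) (comps-copies m f)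

    -- The existence of a suitable cut is a hypothesis here: for m = 2 it is established only after
    -- the parity of the number of components has excluded diameters.
    module _ (a b : ℕ) (g≡ : g ≡ a + suc b)
      (window : ∀ A → NCForest n (m * suc b) A → ρ^ g A ≡ A → ∃ λ s → ∃ λ f → order f ≡ g × ρ^ s A ≡ graphᵐ f) where

      forestOf : Stack 1 1 → List Piece
      forestOf (i ∷ [] , f ∷ []) = i ∷ f

      sizes : ∀ {t} → t ∈ stacks 1 1 a b → order (forestOf t) ≡ g × comps (forestOf t) ≡ suc b
      sizes {i ∷ [] , f ∷ []} t∈ with All.lookup (stacks-sound 1 1 a b) t∈
      ... | e , c = trans (order≡ (i ∷ f)) (trans (cong₂ _+_ e′ c′) (sym g≡)) , c′
        where
        c′ : suc (inner i + comps f) ≡ suc b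
        c′ = cong suc (trans (sym (cong₂ _+_ (+-identityʳ (inner i)) (+-identityʳ (comps f)))) c)
        e′ : edges i + edges* f ≡ a
        e′ = trans (sym (cong₂ _+_ (+-identityʳ (edges i)) (+-identityʳ (edges* f)))) e

      sizesᵖ : ∀ {s t} → (s , t) ∈ pointed (stacks 1 1 a b) → s ≤ firstWidth t × order (forestOf t) ≡ g × comps (forestOf t) ≡ suc b
      sizesᵖ p∈ with ∈-pointed⁻ (stacks 1 1 a b) p∈
      ... | t∈ , s≤ = s≤ , sizes t∈

      enumeration : Enumeration n (m * suc b) g
      enumeration = record
        { Code = ℕ × Stack 1 1
        ; codes = pointed (stacks 1 1 a b)
        ; unique = pointed-unique (stacks-unique 1 1 a b)
        ; decode = λ (s , t) → decodeᵐ s (forestOf t)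
        ; forest = λ { {s , t} p∈ → Rotation.ρ^-forest n′ (n ∸ s) (graphᵐ (forestOf t)) (subst (λ k → NCForest n (m * k) (graphᵐ (forestOf t)))
              (proj₂ (proj₂ (sizesᵖ p∈))) (graphᵐ-forest (forestOf t) (proj₁ (proj₂ (sizesᵖ p∈))))) }
        ; fixed = λ { {s , t} p∈ → trans (ρ^-comm g (n ∸ s) (graphᵐ (forestOf t))) (cong (ρ^ (n ∸ s)) (graphᵐ-fixed (forestOf t) (proj₁ (proj₂ (sizesᵖ p∈))))) }
        ; injective = λ { {s , (i ∷ [] , f ∷ [])} {s′ , (i′ ∷ [] , f′ ∷ [])} p∈ p∈′ e →
              same (decodeᵐ-injective s i f s′ i′ f′ (proj₁ (sizesᵖ p∈)) (proj₁ (sizesᵖ p∈′)) (proj₁ (proj₂ (sizesᵖ p∈))) (proj₁ (proj₂ (sizesᵖ p∈′))) e) }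
        ; complete = comp }
        where
        same : ∀ {s s′ : ℕ} {i i′ : Piece} {f f′ : List Piece} → s ≡ s′ × i ∷ f ≡ i′ ∷ f′ → _≡_ {A = ℕ × Stack 1 1} (s , (i ∷ [] , f ∷ [])) (s′ , (i′ ∷ [] , f′ ∷ []))
        same (refl , refl) = refl
        comp : ∀ A → NCForest n (m * suc b) A → ρ^ g A ≡ A → ∃ λ p → p ∈ pointed (stacks 1 1 a b) × A ≡ decodeᵐ (proj₁ p) (forestOf (proj₂ p))
        comp A F x = start (window A F x)
          where
          Result = ∃ λ p → p ∈ pointed (stacks 1 1 a b) × A ≡ decodeᵐ (proj₁ p) (forestOf (proj₂ p))
          build : (∃ λ i → ∃ λ f′ → ∃ λ s′ → s′ ≤ width i × order (i ∷ f′) ≡ g × ρ^ s′ A ≡ graphᵐ (i ∷ f′)) → Result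
          start : (∃ λ s → ∃ λ f → order f ≡ g × ρ^ s A ≡ graphᵐ f) → Result
          start (s₀ , f₀ , f₀≡ , e₀) = build (normalise A (suc s₀) s₀ f₀ ≤-refl f₀≡ e₀)
          build (i , f , s , s≤ , f≡ , e) = (s , t) , ∈-pointed⁺ (∈-stacks⁺ 1 1 a b t e′ c′) s≤ , decodeᵐ-unique A s (i ∷ f) (≤-trans s≤ (<⇒≤ (<-trans (first-width i f f≡) g<n))) e
            where
            t : Stack 1 1
            t = i ∷ [] , f ∷ []
            c≡ : suc b ≡ suc (inner i + comps f)
            c≡ = *-cancelˡ-≡ (suc b) (comps (i ∷ f)) m (graphᵐ-components A s (i ∷ f) f≡ F e)
            c′ : inner i + 0 + (comps f + 0) ≡ b
            c′ = trans (cong₂ _+_ (+-identityʳ (inner i)) (+-identityʳ (comps f))) (suc-injective (sym c≡))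
            e′ : edges i + 0 + (edges* f + 0) ≡ a
            e′ = trans (cong₂ _+_ (+-identityʳ (edges i)) (+-identityʳ (edges* f))) (+-cancelʳ-≡ (suc b) (edges i + edges* f) a
              (trans (cong (edges i + edges* f +_) c≡) (trans (sym (order≡ (i ∷ f))) (trans f≡ g≡))))

-- Fixed forests with a diameter.

module Diameters where
  open import Defs
  open Pieces
  open Links
  open Encoding
  open Circles
  open Forests using (module ForestOf)
  open Rotations
  open Windows
  open FixedForests
  open Enumerations
  open import Data.Bool using (true)
  open import Data.Bool.Properties using () renaming (_≟_ to _≟ᵇ_)
  open import Data.Empty using (⊥; ⊥-elim)
  open import Data.List using (List; []; _∷_; _++_; map; length; upTo; cartesianProduct)
  open import Data.List.Membership.Propositional using (_∈_; find; lose)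
  open import Data.List.Membership.Propositional.Properties using (∈-++⁻; ∈-upTo⁺; ∈-upTo⁻; ∈-cartesianProduct⁺; ∈-cartesianProduct⁻)
  open import Data.List.Properties using (map-++; ++-assoc; ++-identityʳ; length-++; length-map; length-upTo)
  open import Data.List.Relation.Unary.All as All using (All; []; _∷_)
  import Data.List.Relation.Unary.All.Properties as All
  open import Data.List.Relation.Unary.Any as Any using (here; there)
  import Data.List.Relation.Unary.Any.Properties as Any
  open import Data.List.Relation.Unary.Unique.Propositional using (Unique)
  import Data.List.Relation.Unary.Unique.Propositional.Properties as Unique
  open import Data.Nat using (ℕ; zero; suc; pred; _+_; _*_; _∸_; _≤_; _<_; s≤s; z≤n; _<?_)
  open import Data.Nat.DivMod using (_%_; m<n⇒m%n≡m; m%n<n)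
  open import Data.Nat.Properties
  import Data.Nat.Tactic.RingSolver as ℕS
  open import Data.Product using (∃; _×_; _,_; proj₁; proj₂)
  open import Data.Sum using (_⊎_; inj₁; inj₂)
  open import Data.Vec using ([]; _∷_)
  open import Relation.Binary.PropositionalEquality hiding ([_]; J)
  open import Relation.Nullary using (Dec; yes; no; ¬_; map′)

  infixr 5 _⋆_
  -- Two pieces are glued at a vertex, the last of the first and the first of the second. At each
  -- end of the diameter the piece j of one half meets the piece i of the other in this way.
  _⋆_ : Piece → Piece → Piece
  leaf            ⋆ k = k
  (node i ms j r) ⋆ k = node i ms j (r ⋆ k)

  width-⋆ : ∀ i k → width (i ⋆ k) ≡ width i + width k
  width-⋆ leaf            k = refl
  width-⋆ (node i ms j r) k = trans (cong (span i ms j +_) (width-⋆ r k)) (sym (+-assoc (span i ms j) (width r) (width k)))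

  edges-⋆ : ∀ i k → edges (i ⋆ k) ≡ edges i + edges k
  edges-⋆ leaf            k = refl
  edges-⋆ (node i ms j r) k = trans (cong (λ z → suc (edges i + (edges j + (z + edges* ms)))) (edges-⋆ r k)) (shuffle (edges i) (edges j) (edges r) (edges k) (edges* ms))
    where
    shuffle : ∀ a b c d e → suc (a + (b + (c + d + e))) ≡ suc (a + (b + (c + e)) + d)
    shuffle = ℕS.solve-∀

  links-⋆ : ∀ o i k → links o (i ⋆ k) ≡ links o i ++ links (o + width i) k
  links-⋆ o leaf            k = cong (λ z → links z k) (sym (+-identityʳ o))
  links-⋆ o (node i ms j r) k = cong ((o , x) ∷_) (trans (cong (inn ++_) (trans (links-⋆ x r k) (cong (λ z → links x r ++ links z k) (+-assoc o (span i ms j) (width r)))))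
      (sym (++-assoc inn (links x r) _)))
    where
    x = o + span i ms j
    inn = links o i ++ (links* (o + suc (width i)) ms ++ (links (o + suc (width i) + order ms) j ++ []))

  length-cartesianProduct : ∀ {A B : Set} (xs : List A) (ys : List B) → length (cartesianProduct xs ys) ≡ length xs * length ys
  length-cartesianProduct []       ys = refl
  length-cartesianProduct (x ∷ xs) ys = trans (length-++ (map (x ,_) ys)) (cong₂ _+_ (length-map (x ,_) ys) (length-cartesianProduct xs ys))

  -- The two copies of T overlap in both ends of the diameter, so their union is not an edge list on
  -- one interval of n vertices. Cutting between ms and j, where the diameter is the only edge in
  -- the way of a separation into equal blocks, gives a list to which `Good` applies.
  module Half (n′ g : ℕ) (n≡ : suc n′ ≡ 2 * g) (i : Piece) (ms : List Piece) (j : Piece) (g≡ : span i ms j ≡ g) where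
    open Circle n′
    open Decode n′
    open Periodic n′ g 0 n≡

    T : Piece
    T = node i ms j leaf

    J : Piece
    J = j ⋆ i

    F : List Piece
    F = J ∷ ms

    s : ℕ
    s = suc (width i) + order ms

    both : List Edge
    both = links 0 T ++ links g T

    -- The symmetric graph cut open just before the piece j, with its diameter listed first.
    opened : List Edge
    opened = (width j , g + width j) ∷ links* 0 (F ++ F)

    s+wj : s + width j ≡ g
    s+wj = g≡

    g+g≡n : g + g ≡ n
    g+g≡n = trans (cong (g +_) (sym (+-identityʳ g))) (sym n≡)

    order-F : order F ≡ g
    order-F = trans (cong (λ z → suc z + order ms) (width-⋆ j i)) (trans (shuffle (width i) (width j) (order ms)) g≡)
      where
      shuffle : ∀ a b c → suc (b + a) + c ≡ suc (a + c + b)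
      shuffle = ℕS.solve-∀

    order-FF : order (F ++ F) ≡ n
    order-FF = trans (order-++ F F) (trans (cong₂ _+_ order-F order-F) g+g≡n)

    wj<g : width j < g
    wj<g = ≤-trans (s≤s (m≤n+m (width j) (width i + order ms))) (≤-reflexive g≡)

    FF≡ : links* 0 (F ++ F) ≡ links* 0 F ++ links* g F
    FF≡ = trans (links*-++ 0 F F) (cong (λ z → links* 0 F ++ links* z F) order-F)

    -- The pieces j and i share only the vertex o + `width j`, an end of the diameter, and no edge
    -- of either passes over it.
    junction : ∀ o {a b} → (a , b) ∈ links* o F → a < o + width j → o + width j < b → ⊥
    junction o {a} {b} e∈ a< <b with ∈-++⁻ (links o J) e∈
    ... | inj₂ p = <⇒≱ a< (≤-trans (+-monoʳ-≤ o (≤-trans (m≤m+n (width j) (width i)) (≤-trans (≤-reflexive (sym (width-⋆ j i))) (n≤1+n _)))) (proj₁ (within-forest (o + suc (width J)) ms p)))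
    ... | inj₁ p with ∈-++⁻ (links o j) (subst ((a , b) ∈_) (links-⋆ o j i) p)
    ...   | inj₁ q = <⇒≱ <b (proj₂ (proj₂ (within-piece o j q)))
    ...   | inj₂ q = <⇒≱ a< (proj₁ (within-piece (o + width j) i q))

    opened-good : Good 0 n opened
    opened-good = record
      { within = (z≤n , m<n+m (width j) 0<g , subst (g + width j <_) g+g≡n (+-monoʳ-< g wj<g)) ∷ rest .within
      ; noncrossing = nc
      -- The position `pred g` lies between the two copies of F and is spanned by the diameter
      -- alone.
      ; gaps = (pred g , <⇒≤pred wj<g , <-≤-trans pred<g (m≤m+n g (width j))
          , subst (All (Misses (pred g))) (sym FF≡) (All.++⁺ (All.tabulate (λ p → inj₂ (<⇒≤pred (block₁ p)))) (All.tabulate (λ p → inj₁ (<-≤-trans pred<g (block₂ p))))))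
          , rest .gaps }
      where
      pred<g : pred g < g
      pred<g = ≤-reflexive (suc-pred g)
      rest : Good 0 n (links* 0 (F ++ F))
      rest = good (F ++ F) order-FF
      block₁ : ∀ {a b} → (a , b) ∈ links* 0 F → b < g
      block₁ p = <-≤-trans (proj₂ (proj₂ (within-forest 0 F p))) (≤-reflexive order-F)
      block₂ : ∀ {a b} → (a , b) ∈ links* g F → g ≤ a
      block₂ p = proj₁ (within-forest g F p)
      nc : NonCrossingList opened
      nc (here refl) (here refl) a<c _ _ = <-irrefl refl a<c
      nc {c = c} {d} (here refl) (there q) a<c c<b b<d with ∈-++⁻ (links* 0 F) (subst ((c , d) ∈_) FF≡ q)
      ... | inj₁ p = <⇒≱ (<-trans (block₁ p) (≤-<-trans (m≤m+n g (width j)) b<d)) ≤-refl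
      ... | inj₂ p = junction g p c<b b<d
      nc {a} {b} (there q) (here refl) a<c c<b b<d with ∈-++⁻ (links* 0 F) (subst ((a , b) ∈_) FF≡ q)
      ... | inj₁ p = junction 0 p a<c c<b
      ... | inj₂ p = <⇒≱ a<c (≤-trans (<⇒≤ wj<g) (block₂ p))
      nc (there p) (there q) = rest .noncrossing p q

    -- Two copies of F have 2 (b + 1) components, and the diameter joins two of them.
    opened-forest : ∀ a b → edges i + (edges j + 0) + (edges* ms + 0) ≡ a → g ≡ a + suc b → NCForest n (suc (2 * b)) (fromLinks opened)
    opened-forest a b refl g≡′ = ForestOf.isForest n′ opened opened-good (suc (2 * b)) (begin
      suc (2 * b) + suc (length (links* 0 (F ++ F)))           ≡⟨ cong (λ z → suc (2 * b) + suc z) (trans (length-links* 0 (F ++ F)) (edges*-++ F F)) ⟩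
      suc (2 * b) + suc (edges* F + edges* F)                   ≡⟨ cong (λ z → suc (2 * b) + suc (z + edges* ms + (z + edges* ms))) (edges-⋆ j i) ⟩
      suc (2 * b) + suc (edges j + edges i + edges* ms + (edges j + edges i + edges* ms)) ≡⟨ arith b (edges i) (edges j) (edges* ms) ⟩
      (a + suc b) + (a + suc b)                                 ≡⟨ cong₂ _+_ (sym g≡′) (sym g≡′) ⟩
      g + g                                                     ≡⟨ g+g≡n ⟩
      n                                                         ∎)
      where
      open ≡-Reasoning
      arith : ∀ b x y z → suc (2 * b) + suc (y + x + z + (y + x + z)) ≡ (x + (y + 0) + (z + 0) + suc b) + (x + (y + 0) + (z + 0) + suc b)
      arith = ℕS.solve-∀

    -- A common normal form for the links of `both` and of the rotated `opened`; the subscript tells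
    -- the copy of T to which a part belongs.
    data Part (x y : ℕ) : Set where
      diameter : Joins x y (0 , g) → Part x y
      i₀ : Link (links 0 i) x y → Part x y
      i₁ : Link (links g i) x y → Part x y
      m₀ : Link (links* (suc (width i)) ms) x y → Part x y
      m₁ : Link (links* (g + suc (width i)) ms) x y → Part x y
      j₀ : Link (links s j) x y → Part x y
      j₁ : Link (links (g + s) j) x y → Part x y

    2g≅0 : g + g ≅ 0
    2g≅0 = ≅-trans (≅-reflexive (trans g+g≡n (sym (+-identityʳ n)))) (≅-n+ 0)

    other-diameter : ∀ {x y} → Joins x y (g , g + g) → Joins x y (0 , g)
    other-diameter (inj₁ (p , q)) = inj₂ (≅-trans (≅-sym 2g≅0) q , p)
    other-diameter (inj₂ (p , q)) = inj₁ (≅-trans (≅-sym 2g≅0) q , p)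

    other-diameter⁻ : ∀ {x y} → Joins x y (0 , g) → Joins x y (g , g + g)
    other-diameter⁻ (inj₁ (p , q)) = inj₂ (q , ≅-trans 2g≅0 p)
    other-diameter⁻ (inj₂ (p , q)) = inj₁ (q , ≅-trans 2g≅0 p)

    cast : ∀ {L M x y} → L ≡ M → Link L x y → Link M x y
    cast refl l = l

    T-link⁻ : ∀ o {x y} → Link (links o T) x y → Joins x y (o , o + g) ⊎ (Link (links o i) x y ⊎ (Link (links* (o + suc (width i)) ms) x y ⊎ Link (links (o + suc (width i) + order ms) j) x y))
    T-link⁻ o {x} {y} (here p) = inj₁ (subst (λ z → Joins x y (o , o + z)) g≡ p)
    T-link⁻ o (there p) with Any.++⁻ (links o i) (cast (++-identityʳ _) p)
    ... | inj₁ q = inj₂ (inj₁ q)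
    ... | inj₂ q with Any.++⁻ (links* (o + suc (width i)) ms) q
    ...   | inj₁ q′ = inj₂ (inj₂ (inj₁ q′))
    ...   | inj₂ q′ = inj₂ (inj₂ (inj₂ (cast (++-identityʳ _) q′)))

    T-link⁺ : ∀ o {x y} → Joins x y (o , o + g) ⊎ (Link (links o i) x y ⊎ (Link (links* (o + suc (width i)) ms) x y ⊎ Link (links (o + suc (width i) + order ms) j) x y)) → Link (links o T) x y
    T-link⁺ o {x} {y} (inj₁ p) = here (subst (λ z → Joins x y (o , o + z)) (sym g≡) p)
    T-link⁺ o (inj₂ (inj₁ q)) = there (cast (sym (++-identityʳ _)) (Any.++⁺ˡ q))
    T-link⁺ o (inj₂ (inj₂ (inj₁ q))) = there (cast (sym (++-identityʳ _)) (Any.++⁺ʳ (links o i) (Any.++⁺ˡ q)))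
    T-link⁺ o (inj₂ (inj₂ (inj₂ q))) = there (cast (sym (++-identityʳ _)) (Any.++⁺ʳ (links o i) (Any.++⁺ʳ (links* (o + suc (width i)) ms) (cast (sym (++-identityʳ _)) q))))

    both⁻ : ∀ {x y} → Link both x y → Part x y
    both⁻ l with Any.++⁻ (links 0 T) l
    ... | inj₁ p with T-link⁻ 0 p
    ...   | inj₁ q = diameter q
    ...   | inj₂ (inj₁ q) = i₀ q
    ...   | inj₂ (inj₂ (inj₁ q)) = m₀ q
    ...   | inj₂ (inj₂ (inj₂ q)) = j₀ q
    both⁻ l | inj₂ p with T-link⁻ g p
    ...   | inj₁ q = diameter (other-diameter q)
    ...   | inj₂ (inj₁ q) = i₁ q
    ...   | inj₂ (inj₂ (inj₁ q)) = m₁ q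
    ...   | inj₂ (inj₂ (inj₂ q)) = j₁ (cast (cong (λ z → links z j) (+-assoc g (suc (width i)) (order ms))) q)

    both⁺ : ∀ {x y} → Part x y → Link both x y
    both⁺ (diameter q) = Any.++⁺ˡ (T-link⁺ 0 (inj₁ q))
    both⁺ (i₀ q) = Any.++⁺ˡ (T-link⁺ 0 (inj₂ (inj₁ q)))
    both⁺ (m₀ q) = Any.++⁺ˡ (T-link⁺ 0 (inj₂ (inj₂ (inj₁ q))))
    both⁺ (j₀ q) = Any.++⁺ˡ (T-link⁺ 0 (inj₂ (inj₂ (inj₂ q))))
    both⁺ (i₁ q) = Any.++⁺ʳ (links 0 T) (T-link⁺ g (inj₂ (inj₁ q)))
    both⁺ (m₁ q) = Any.++⁺ʳ (links 0 T) (T-link⁺ g (inj₂ (inj₂ (inj₁ q))))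
    both⁺ (j₁ q) = Any.++⁺ʳ (links 0 T) (T-link⁺ g (inj₂ (inj₂ (inj₂ (cast (cong (λ z → links z j) (sym (+-assoc g (suc (width i)) (order ms)))) q)))))

    F-links : ∀ o → links* (o + s) F ≡ (links (o + s) j ++ links (o + g) i) ++ links* (o + (g + suc (width i))) ms
    F-links o = cong₂ _++_ (trans (links-⋆ (o + s) j i) (cong (λ z → links (o + s) j ++ links z i) (trans (+-assoc o s (width j)) (cong (o +_) s+wj))))
      (cong (λ z → links* z ms) (trans (cong (λ z → o + s + suc z) (width-⋆ j i)) (trans (shuffle o s (width j) (width i)) (cong (λ z → o + (z + suc (width i))) s+wj))))
      where
      shuffle : ∀ o s a b → o + s + suc (a + b) ≡ o + (s + a + suc b)
      shuffle = ℕS.solve-∀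

    shifted≡ : map (shiftE s) (links* 0 (F ++ F)) ≡ links* s F ++ links* (g + s) F
    shifted≡ = trans (sym (links*-shift s 0 (F ++ F))) (trans (cong (λ z → links* z (F ++ F)) (+-identityʳ s))
      (trans (links*-++ s F F) (cong (λ z → links* s F ++ links* z F) (trans (cong (s +_) order-F) (+-comm s g)))))

    links-n+ : ∀ o k → links (g + (g + o)) k ≡ map (shiftE n) (links o k)
    links-n+ o k = trans (cong (λ z → links z k) (trans (sym (+-assoc g g o)) (cong (_+ o) g+g≡n))) (links-shift n o k)

    links*-n+ : ∀ o f → links* (g + (g + o)) f ≡ map (shiftE n) (links* o f)
    links*-n+ o f = trans (cong (λ z → links* z f) (trans (sym (+-assoc g g o)) (cong (_+ o) g+g≡n))) (links*-shift n o f)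

    2g+0 : g + g ≡ g + (g + 0)
    2g+0 = cong (g +_) (sym (+-identityʳ g))

    opened⁻ : ∀ {x y} → Link (map (shiftE s) opened) x y → Part x y
    opened⁻ {x} {y} (here p) = diameter (other-diameter (subst₂ (λ a b → Joins x y (a , b)) s+wj (trans (swap s g (width j)) (cong (g +_) s+wj)) p))
      where
      swap : ∀ s g w → s + (g + w) ≡ g + (s + w)
      swap = ℕS.solve-∀
    opened⁻ (there p) with Any.++⁻ (links* s F) (cast shifted≡ p)
    ... | inj₁ q with Any.++⁻ (links s j ++ links g i) (cast (F-links 0) q)
    ...   | inj₂ r = m₁ r
    ...   | inj₁ r with Any.++⁻ (links s j) r
    ...     | inj₁ t = j₀ t
    ...     | inj₂ t = i₁ t
    opened⁻ (there p) | inj₂ q with Any.++⁻ (links (g + s) j ++ links (g + g) i) (cast (F-links g) q)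
    ...   | inj₂ r = m₀ (Link-n+ (cast (links*-n+ (suc (width i)) ms) r))
    ...   | inj₁ r with Any.++⁻ (links (g + s) j) r
    ...     | inj₁ t = j₁ t
    ...     | inj₂ t = i₀ (Link-n+ (cast (trans (cong (λ z → links z i) 2g+0) (links-n+ 0 i)) t))

    opened⁺ : ∀ {x y} → Part x y → Link (map (shiftE s) opened) x y
    opened⁺ {x} {y} (diameter p) = here (subst₂ (λ a b → Joins x y (a , b)) (sym s+wj) (sym (trans (swap s g (width j)) (cong (g +_) s+wj))) (other-diameter⁻ p))
      where
      swap : ∀ s g w → s + (g + w) ≡ g + (s + w)
      swap = ℕS.solve-∀
    opened⁺ (j₀ t) = there (cast (sym shifted≡) (Any.++⁺ˡ (cast (sym (F-links 0)) (Any.++⁺ˡ (Any.++⁺ˡ t)))))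
    opened⁺ (i₁ t) = there (cast (sym shifted≡) (Any.++⁺ˡ (cast (sym (F-links 0)) (Any.++⁺ˡ (Any.++⁺ʳ (links s j) t)))))
    opened⁺ (m₁ t) = there (cast (sym shifted≡) (Any.++⁺ˡ (cast (sym (F-links 0)) (Any.++⁺ʳ (links s j ++ links g i) t))))
    opened⁺ (j₁ t) = there (cast (sym shifted≡) (Any.++⁺ʳ (links* s F) (cast (sym (F-links g)) (Any.++⁺ˡ (Any.++⁺ˡ t)))))
    opened⁺ (i₀ t) = there (cast (sym shifted≡) (Any.++⁺ʳ (links* s F) (cast (sym (F-links g)) (Any.++⁺ˡ (Any.++⁺ʳ (links (g + s) j)
      (cast (sym (trans (cong (λ z → links z i) 2g+0) (links-n+ 0 i))) (Link-n+⁻ t)))))))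
    opened⁺ (m₀ t) = there (cast (sym shifted≡) (Any.++⁺ʳ (links* s F) (cast (sym (F-links g)) (Any.++⁺ʳ (links (g + s) j ++ links (g + g) i)
      (cast (sym (links*-n+ (suc (width i)) ms)) (Link-n+⁻ t))))))

    both≡ : fromLinks both ≡ ρ^ s (fromLinks opened)
    both≡ = trans (fromLinks-cong {both} {map (shiftE s) opened} (λ x y l → opened⁺ (both⁻ l)) (λ x y l → both⁺ (opened⁻ l))) (sym (ρ^-fromLinks s opened))

    both-forest : ∀ a b → edges i + (edges j + 0) + (edges* ms + 0) ≡ a → g ≡ a + suc b → NCForest n (suc (2 * b)) (fromLinks both)
    both-forest a b e g≡′ = subst (NCForest n (suc (2 * b))) (sym both≡) (Rotation.ρ^-forest n′ s (fromLinks opened) (opened-forest a b e g≡′))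

    links-g : links g T ≡ map (shiftE g) (links 0 T)
    links-g = trans (cong (λ z → links z T) (sym (+-identityʳ g))) (links-shift g 0 T)

    both-fixed : ρ^ g (fromLinks both) ≡ fromLinks both
    both-fixed = trans (ρ^-fromLinks g both) (fromLinks-cong {map (shiftE g) both} {both} t r)
      where
      shift-T : map (shiftE g) (links g T) ≡ map (shiftE n) (links 0 T)
      shift-T = trans (sym (links-shift g g T)) (trans (cong (λ z → links z T) 2g+0) (links-n+ 0 T))
      shift-both : map (shiftE g) both ≡ links g T ++ map (shiftE n) (links 0 T)
      shift-both = trans (map-++ (shiftE g) (links 0 T) (links g T)) (cong₂ _++_ (sym links-g) shift-T)
      t : ∀ x y → Link (map (shiftE g) both) x y → Link both x y
      t x y l with Any.++⁻ (links g T) (cast shift-both l)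
      ... | inj₁ p = Any.++⁺ʳ (links 0 T) p
      ... | inj₂ p = Any.++⁺ˡ (Link-n+ p)
      r : ∀ x y → Link both x y → Link (map (shiftE g) both) x y
      r x y l with Any.++⁻ (links 0 T) l
      ... | inj₁ p = cast (sym shift-both) (Any.++⁺ʳ (links g T) (Link-n+⁻ p))
      ... | inj₂ p = cast (sym shift-both) (Any.++⁺ˡ p)

    within-T : ∀ {a b} → (a , b) ∈ links 0 T → a < b × b ≤ g
    within-T e∈ = proj₁ (proj₂ bounds) , ≤-trans (proj₂ (proj₂ bounds)) (≤-reflexive (trans (+-identityʳ (span i ms j)) g≡))
      where bounds = within-piece 0 T e∈

    ≅⇒≡ : ∀ {x y} → x < n → y < n → x ≅ y → x ≡ y
    ≅⇒≡ x< y< (mod e) = trans (sym (m<n⇒m%n≡m x<)) (trans e (m<n⇒m%n≡m y<))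

    top-link : (0 , g) ∈ links 0 T
    top-link = here (cong (0 ,_) (sym g≡))

    -- All edges listed here lie in [0, g], so ends that differ by g modulo n = 2g can only be 0 and
    -- g.
    diameter-unique₀ : ∀ {x} → Link (links 0 T) x (g + x) → x ≅ 0 ⊎ x ≅ g
    diameter-unique₀ {x} l with find l
    ... | (a , b) , e∈ , inj₁ (p , q) = inj₁ (≅-trans (≅-sym p) (≅-reflexive a≡0))
      where
      b≤g : b ≤ g
      b≤g = proj₂ (within-T e∈)
      b≡ : b ≡ g + a
      b≡ = ≅⇒≡ (≤-<-trans b≤g g<n) (subst (g + a <_) g+g≡n (+-monoʳ-< g (<-≤-trans (proj₁ (within-T e∈)) b≤g))) (≅-trans q (≅-+ˡ g (≅-sym p)))
      a≡0 : a ≡ 0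
      a≡0 = n≤0⇒n≡0 (+-cancelˡ-≤ g a 0 (≤-trans (≤-reflexive (sym b≡)) (≤-trans b≤g (≤-reflexive (sym (+-identityʳ g))))))
    ... | (a , b) , e∈ , inj₂ (p , q) with m≤n⇒m<n∨m≡n (proj₂ (within-T e∈))
    ...   | inj₂ b≡g = inj₂ (≅-trans (≅-sym q) (≅-reflexive b≡g))
    ...   | inj₁ b<g = ⊥-elim (<⇒≱ (proj₁ (within-T e∈)) (≤-trans (m≤n+m b g) (≤-reflexive (sym a≡))))
      where
      a≡ : a ≡ g + b
      a≡ = ≅⇒≡ (<-trans (proj₁ (within-T e∈)) (<-trans b<g g<n)) (subst (g + b <_) g+g≡n (+-monoʳ-< g b<g)) (≅-trans p (≅-+ˡ g (≅-sym q)))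

    diameter-unique : ∀ {x} → Link both x (g + x) → x ≅ 0 ⊎ x ≅ g
    diameter-unique {x} l = go (Any.++⁻ (links 0 T) l)
      where
      twice : ∀ y → y ≅ g + (g + y)
      twice y = ≅-sym (≅-trans (≅-reflexive (trans (sym (+-assoc g g y)) (cong (_+ y) g+g≡n))) (≅-n+ y))
      turn : g + x ≅ 0 ⊎ g + x ≅ g → x ≅ 0 ⊎ x ≅ g
      turn (inj₁ e) = inj₂ (≅-trans (twice x) (≅-trans (≅-+ˡ g e) (≅-reflexive (+-identityʳ g))))
      turn (inj₂ e) = inj₁ (≅-cancelˡ g (≅-trans e (≅-reflexive (sym (+-identityʳ g)))))
      go : Link (links 0 T) x (g + x) ⊎ Link (links g T) x (g + x) → x ≅ 0 ⊎ x ≅ g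
      go (inj₁ p) = diameter-unique₀ p
      go (inj₂ p) = turn (diameter-unique₀ (Link-shift⁻ g {links 0 T} (Link-cong (twice x) (twice (g + x)) (cast links-g p))))

  module DiameterCase (n′ g : ℕ) (n≡ : suc n′ ≡ 2 * g) where
    open Circle n′
    open Decode n′
    open Periodic n′ g 0 n≡

    halfGraph : Piece → List Piece → Piece → Graph n
    halfGraph i ms j = fromLinks (links 0 (node i ms j leaf) ++ links g (node i ms j leaf))

    -- An edge inside [0, g] that the other graph lists in its second copy must be the diameter,
    -- which the first copy of that graph contains as well.
    half-⊆ : ∀ i ms j i′ ms′ j′ → span i ms j ≡ g → span i′ ms′ j′ ≡ g → halfGraph i ms j ≡ halfGraph i′ ms′ j′ →
      links 0 (node i ms j leaf) ⊆ links 0 (node i′ ms′ j′ leaf)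
    half-⊆ i ms j i′ ms′ j′ e e′ eq {a} {b} e∈ = go (Any.++⁻ (links 0 H′.T) (At⇒Link H′.both a b
        (subst (λ C → At C a b) eq (Link⇒At H.both a b (Any.++⁺ˡ (lose e∈ (inj₁ (≅-refl , ≅-refl))))))))
      where
      module H = Half n′ g n≡ i ms j e
      module H′ = Half n′ g n≡ i′ ms′ j′ e′
      a<b : a < b
      a<b = proj₁ (H.within-T e∈)
      b≤g : b ≤ g
      b≤g = proj₂ (H.within-T e∈)
      b<n : b < n
      b<n = ≤-<-trans b≤g g<n
      a<g : a < g
      a<g = <-≤-trans a<b b≤g
      first : ∀ c d → (c , d) ∈ links 0 H′.T → Joins a b (c , d) → (a , b) ∈ links 0 H′.T
      first c d f∈ js = pick js
        where
        c<d = proj₁ (H′.within-T f∈)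
        d<n = ≤-<-trans (proj₂ (H′.within-T f∈)) g<n
        pick : Joins a b (c , d) → (a , b) ∈ links 0 H′.T
        pick (inj₁ (p , q)) = subst₂ (λ x y → (x , y) ∈ links 0 H′.T) (H.≅⇒≡ (<-trans c<d d<n) (<-trans a<b b<n) p) (H.≅⇒≡ d<n b<n q) f∈
        pick (inj₂ (p , q)) = ⊥-elim (<-asym a<b (subst₂ _<_ (H.≅⇒≡ (<-trans c<d d<n) b<n p) (H.≅⇒≡ d<n (<-trans a<b b<n) q) c<d))
      second : ∀ c d → (c , d) ∈ links 0 H′.T → Joins a b (g + c , g + d) → (a , b) ∈ links 0 H′.T
      second c d f∈ js = pick js (m≤n⇒m<n∨m≡n (proj₂ (H′.within-T f∈)))
        where
        c<g = <-≤-trans (proj₁ (H′.within-T f∈)) (proj₂ (H′.within-T f∈))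
        g+<n : ∀ {x} → x < g → g + x < n
        g+<n {x} x<g = subst (g + x <_) H.g+g≡n (+-monoʳ-< g x<g)
        beyond : ∀ {x} → x < g → ¬ g + x ≅ a
        beyond {x} x<g p = <⇒≱ a<g (≤-trans (m≤m+n g x) (≤-reflexive (H.≅⇒≡ (g+<n x<g) (<-trans a<b b<n) p)))
        pick : Joins a b (g + c , g + d) → d < g ⊎ d ≡ g → (a , b) ∈ links 0 H′.T
        pick (inj₁ (p , q)) _ = ⊥-elim (beyond c<g p)
        pick (inj₂ (p , q)) (inj₁ d<g) = ⊥-elim (beyond d<g q)
        pick (inj₂ (p , q)) (inj₂ d≡g) = subst₂ (λ x y → (x , y) ∈ links 0 H′.T) (sym a≡0) (sym b≡g) H′.top-link
          where
          b≡g : b ≡ g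
          b≡g = ≤-antisym b≤g (≤-trans (m≤m+n g c) (≤-reflexive (H.≅⇒≡ (g+<n c<g) b<n p)))
          a≡0 : a ≡ 0
          a≡0 = sym (H.≅⇒≡ (s≤s z≤n) (<-trans a<b b<n) (≅-trans (≅-sym (≅-trans (≅-reflexive (cong (g +_) d≡g)) H.2g≅0)) q))
      go : Link (links 0 H′.T) a b ⊎ Link (links g H′.T) a b → (a , b) ∈ links 0 H′.T
      go (inj₁ l) = let (c , d) , f∈ , js = find l in first c d f∈ js
      go (inj₂ l) = let (c , d) , f∈ , js = find (Any.map⁻ (H′.cast H′.links-g l)) in second c d f∈ js

    half-injective : ∀ i ms j i′ ms′ j′ → span i ms j ≡ g → span i′ ms′ j′ ≡ g → halfGraph i ms j ≡ halfGraph i′ ms′ j′ →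
      node i ms j leaf ≡ node i′ ms′ j′ leaf
    half-injective i ms j i′ ms′ j′ e e′ eq = determined (node i ms j leaf) 0 (node i′ ms′ j′ leaf)
      (trans (+-identityʳ _) (trans e (trans (sym e′) (sym (+-identityʳ _)))))
      (half-⊆ i ms j i′ ms′ j′ e e′ eq) (half-⊆ i′ ms′ j′ i ms j e′ e (sym eq))

    -- The graph has a single diameter, with the ends p, p + g and also p′, p′ + g. Since p and p′
    -- are below g, they agree.
    diameter-position : ∀ p i ms j p′ i′ ms′ j′ → p < g → p′ < g → span i ms j ≡ g → span i′ ms′ j′ ≡ g →
      ρ^ p (halfGraph i ms j) ≡ ρ^ p′ (halfGraph i′ ms′ j′) → p ≡ p′
    diameter-position p i ms j p′ i′ ms′ j′ p<g p′<g e e′ eq = conclude (H′.diameter-unique (At⇒Link H′.both x (g + x) here-edge))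
      where
      module H = Half n′ g n≡ i ms j e
      module H′ = Half n′ g n≡ i′ ms′ j′ e′
      -- Modulo n this is p - p′.
      x = p′ * n′ + p
      p≅ : p ≅ p′ + x
      p≅ = ≅-sym (undo p′ p)
      here-edge : At (halfGraph i′ ms′ j′) x (g + x)
      here-edge = At-ρ^⁻ p′ (halfGraph i′ ms′ j′) (At-cong (ρ^ p′ (halfGraph i′ ms′ j′)) (≅-trans (≅-reflexive (+-identityʳ p)) p≅)
        (≅-trans (≅-reflexive (+-comm p g)) (≅-trans (≅-+ˡ g p≅) (≅-reflexive (swap g p′ x))))
        (subst (λ C → At C (p + 0) (p + g)) eq (At-ρ^⁺ p (halfGraph i ms j) (Link⇒At H.both 0 g (Any.++⁺ˡ (lose H.top-link (inj₁ (≅-refl , ≅-refl))))))))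
        where
        swap : ∀ g p x → g + (p + x) ≡ p + (g + x)
        swap = ℕS.solve-∀
      conclude : x ≅ 0 ⊎ x ≅ g → p ≡ p′
      conclude (inj₁ x≅) = H.≅⇒≡ (<-trans p<g g<n) (<-trans p′<g g<n) (≅-trans p≅ (≅-trans (≅-+ˡ p′ x≅) (≅-reflexive (+-identityʳ p′))))
      conclude (inj₂ x≅) = ⊥-elim (<⇒≱ p<g (≤-trans (m≤n+m g p′) (≤-reflexive (sym (H.≅⇒≡ (<-trans p<g g<n)
        (subst (_< n) (+-comm g p′) (subst (g + p′ <_) H.g+g≡n (+-monoʳ-< g p′<g))) (≅-trans p≅ (≅-+ˡ p′ x≅)))))))

    span-sizes : ∀ i ms j → let t = (i ∷ j ∷ [] , ms ∷ []) in span i ms j ≡ edgesˢ t + suc (compsˢ t)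
    span-sizes i ms j = trans (cong suc (cong₂ _+_ (cong₂ _+_ (width≡ i) (order≡ ms)) (width≡ j)))
      (arith (edges i) (inner i) (edges* ms) (comps ms) (edges j) (inner j))
      where
      arith : ∀ a b c d e f → suc (a + b + (c + d) + (e + f)) ≡ a + (e + 0) + (c + 0) + suc (b + (f + 0) + (d + 0))
      arith = ℕS.solve-∀

    DiameterCode : ℕ → Graph n → ℕ → Set
    DiameterCode k A p = ∃ λ i → ∃ λ ms → ∃ λ j → let t = (i ∷ j ∷ [] , ms ∷ []) in
      g ≡ edgesˢ t + suc (compsˢ t) × A ≡ ρ^ p (halfGraph i ms j) × k ≡ suc (2 * compsˢ t)

    -- The number of components comes out odd, which later excludes diameters for even k.
    diameter-code : ∀ {k} A → NCForest n k A → ρ^ g A ≡ A → ∀ p → p < g → At A p (g + p) → DiameterCode k A p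
    diameter-code {k} A F x p p<g h = build (Diameter.halves n′ g n≡ A k F x p (<-trans p<g g<n) h)
      where
      build : (∃ λ i → ∃ λ ms → ∃ λ j → span i ms j ≡ g × ρ^ (n ∸ p) A ≡ halfGraph i ms j) → DiameterCode k A p
      build (i , ms , j , s≡ , eq) = i , ms , j , g≡₁ , A≡ , components-unique {A = halfGraph i ms j} (proj₂ (proj₁ half-forest))
              (proj₂ (proj₂ (proj₂ (subst (NCForest n k) eq (Rotation.ρ^-forest n′ (n ∸ p) A F))))) (proj₂ (proj₂ (proj₂ half-forest)))
        where
        t : Stack 2 1
        t = i ∷ j ∷ [] , ms ∷ []
        A≡ : A ≡ ρ^ p (halfGraph i ms j)
        A≡ = sym (trans (cong (ρ^ p) (sym eq)) (trans (sym (ρ^-+ p (n ∸ p) A)) (trans (cong (λ z → ρ^ z A) (trans (m+[n∸m]≡n (<⇒≤ (<-trans p<g g<n))) (sym (+-identityʳ n)))) (ρ^-period 1 A))))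
        g≡₁ : g ≡ edgesˢ t + suc (compsˢ t)
        g≡₁ = trans (sym s≡) (span-sizes i ms j)
        half-forest : NCForest n (suc (2 * compsˢ t)) (halfGraph i ms j)
        half-forest = Half.both-forest n′ g n≡ i ms j s≡ (edgesˢ t) (compsˢ t) refl g≡₁

    module _ (a b : ℕ) (g≡ : g ≡ a + suc b)
      (diameter : ∀ A → NCForest n (suc (2 * b)) A → ρ^ g A ≡ A → ∃ λ p → p < g × Circle.At n′ A p (g + p)) where

      decode : ℕ × Stack 2 1 → Graph n
      decode (p , (i ∷ j ∷ [] , ms ∷ [])) = ρ^ p (halfGraph i ms j)

      codes : List (ℕ × Stack 2 1)
      codes = cartesianProduct (upTo g) (stacks 2 1 a b)

      Valid : Piece → List Piece → Piece → Set
      Valid i ms j = span i ms j ≡ g × edges i + (edges j + 0) + (edges* ms + 0) ≡ a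

      span≡ : ∀ i ms j → edges i + (edges j + 0) + (edges* ms + 0) ≡ a → inner i + (inner j + 0) + (comps ms + 0) ≡ b → span i ms j ≡ g
      span≡ i ms j e c = trans (span-sizes i ms j) (trans (cong₂ (λ x y → x + suc y) e c) (sym g≡))

      valid : ∀ {p i j ms} → (p , (i ∷ j ∷ [] , ms ∷ [])) ∈ codes → p < g × Valid i ms j
      valid {p} {i} {j} {ms} c∈ = ∈-upTo⁻ (proj₁ mem) , span≡ i ms j (proj₁ sound) (proj₂ sound) , proj₁ sound
        where
        mem = ∈-cartesianProduct⁻ (upTo g) (stacks 2 1 a b) c∈
        sound = All.lookup (stacks-sound 2 1 a b) (proj₂ mem)

      enumeration : Enumeration n (suc (2 * b)) g
      enumeration = record
        { Code = ℕ × Stack 2 1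
        ; codes = codes
        ; unique = Unique.cartesianProduct⁺ (Unique.upTo⁺ g) (stacks-unique 2 1 a b)
        ; decode = decode
        ; forest = λ { {p , (i ∷ j ∷ [] , ms ∷ [])} c∈ → Rotation.ρ^-forest n′ p (halfGraph i ms j)
            (Half.both-forest n′ g n≡ i ms j (proj₁ (proj₂ (valid c∈))) a b (proj₂ (proj₂ (valid c∈))) g≡) }
        ; fixed = λ { {p , (i ∷ j ∷ [] , ms ∷ [])} c∈ → trans (ρ^-comm g p (halfGraph i ms j)) (cong (ρ^ p) (Half.both-fixed n′ g n≡ i ms j (proj₁ (proj₂ (valid c∈))))) }
        ; injective = λ { {p , (i ∷ j ∷ [] , ms ∷ [])} {p′ , (i′ ∷ j′ ∷ [] , ms′ ∷ [])} c∈ c∈′ e →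
            inj p i ms j p′ i′ ms′ j′ (valid c∈) (valid c∈′) e }
        ; complete = λ A F x → comp A F x (diameter A F x) }
        where
        inj : ∀ p i ms j p′ i′ ms′ j′ → p < g × Valid i ms j → p′ < g × Valid i′ ms′ j′ → ρ^ p (halfGraph i ms j) ≡ ρ^ p′ (halfGraph i′ ms′ j′) →
          _≡_ {A = ℕ × Stack 2 1} (p , (i ∷ j ∷ [] , ms ∷ [])) (p′ , (i′ ∷ j′ ∷ [] , ms′ ∷ []))
        inj p i ms j p′ i′ ms′ j′ (p<g , v , _) (p′<g , v′ , _) e =
          same p p′ (diameter-position p i ms j p′ i′ ms′ j′ p<g p′<g v v′ e) e
          where
          nodes : node i ms j leaf ≡ node i′ ms′ j′ leaf → _≡_ {A = Stack 2 1} (i ∷ j ∷ [] , ms ∷ []) (i′ ∷ j′ ∷ [] , ms′ ∷ [])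
          nodes refl = refl
          same : ∀ p p′ → p ≡ p′ → ρ^ p (halfGraph i ms j) ≡ ρ^ p′ (halfGraph i′ ms′ j′) →
            _≡_ {A = ℕ × Stack 2 1} (p , (i ∷ j ∷ [] , ms ∷ [])) (p′ , (i′ ∷ j′ ∷ [] , ms′ ∷ []))
          same p p′ refl e = cong (p ,_) (nodes (half-injective i ms j i′ ms′ j′ v v′ (ρ^-injective p e)))
        comp : ∀ A → NCForest n (suc (2 * b)) A → ρ^ g A ≡ A → (∃ λ p → p < g × At A p (g + p)) → ∃ λ c → c ∈ codes × A ≡ decode c
        comp A F x (p , p<g , h) = build (diameter-code A F x p p<g h)
          where
          build : DiameterCode (suc (2 * b)) A p → ∃ λ c → c ∈ codes × A ≡ decode c
          build (i , ms , j , g≡₁ , A≡ , k≡) = (p , t) , ∈-cartesianProduct⁺ (∈-upTo⁺ p<g) (∈-stacks⁺ 2 1 a b t a≡ (sym b≡)) , A≡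
            where
            t : Stack 2 1
            t = i ∷ j ∷ [] , ms ∷ []
            b≡ : b ≡ compsˢ t
            b≡ = *-cancelˡ-≡ b (compsˢ t) 2 (suc-injective k≡)
            a≡ : edgesˢ t ≡ a
            a≡ = +-cancelʳ-≡ (suc b) (edgesˢ t) a (trans (cong (λ z → edgesˢ t + suc z) b≡) (trans (sym g≡₁) g≡))

      length-codes : length codes ≡ g * length (stacks 2 1 a b)
      length-codes = trans (length-cartesianProduct (upTo g) (stacks 2 1 a b)) (cong (_* length (stacks 2 1 a b)) (length-upTo g))

  module Dichotomy (n′ g l : ℕ) (n≡ : suc n′ ≡ (2 + l) * g) (A : Graph (suc n′)) (k : ℕ) (F : NCForest (suc n′) k A) (inv : ρ^ g A ≡ A) where
    open Circle n′
    open Periodic n′ g l n≡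
    open Inv A k F inv

    At? : ∀ x y → Dec (At A x y)
    At? x y = map′ mkAt isTrue (at A x y ≟ᵇ true)

    diameter-or-not : (∃ λ x → x < n × At A x (g + x)) ⊎ (∀ x → ¬ At A x (g + x))
    diameter-or-not with anyUpTo? (λ x → At? x (g + x)) n
    ... | yes d = inj₁ d
    ... | no ¬d = inj₂ λ x h → ¬d (x % n , m%n<n x n , At-cong A (≅-sym (%≅ x)) (≅-+ˡ g (≅-sym (%≅ x))) h)

    Alternatives : Set
    Alternatives = (∃ λ s → ∃ λ f → order f ≡ g × ρ^ s A ≡ fromLinks (links* 0 (copies m f))) ⊎ (l ≡ 0 × ∃ λ x → x < n × At A x (g + x))

    window-or-diameter : Alternatives
    window-or-diameter = decide diameter-or-not
      where
      decide : (∃ λ x → x < n × At A x (g + x)) ⊎ (∀ x → ¬ At A x (g + x)) → Alternatives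
      decide (inj₂ nd) = inj₁ (Window.window n′ g l n≡ A k F inv nd)
      decide (inj₁ (x , x<n , h)) = polygon l refl
        where
        polygon : ∀ l′ → l ≡ l′ → Alternatives
        polygon zero     e = inj₂ (e , x , x<n , h)
        polygon (suc l′) e = ⊥-elim (no-polygon e x h)

    -- Of the two ends x and x + g of a diameter, one is below g.
    halve : l ≡ 0 → (∃ λ x → x < n × At A x (g + x)) → ∃ λ p → p < g × At A p (g + p)
    halve l≡0 (x , x<n , h) with x <? g
    ... | yes x<g = x , x<g , h
    ... | no x≮g = x ∸ g , +-cancelˡ-< g (x ∸ g) g (subst₂ _<_ (sym x≡) (sym 2g≡n) x<n) ,
        At-sym (At-cong A (≅-reflexive (sym x≡)) (≅-trans (≅-reflexive (trans (cong (g +_) (sym x≡)) (trans (sym (+-assoc g g (x ∸ g))) (cong (_+ (x ∸ g)) 2g≡n)))) (≅-n+ (x ∸ g))) h)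
      where
      x≡ : g + (x ∸ g) ≡ x
      x≡ = m+[n∸m]≡n (≮⇒≥ x≮g)
      2g≡n : g + g ≡ n
      2g≡n = trans (cong (g +_) (sym (+-identityʳ g))) (trans (cong (λ z → (2 + z) * g) (sym l≡0)) (sym n≡))

-- Comparison of both sides, by the order of the rotation and k modulo this order.

open import Defs
open PolynomialRing using (≋⇒≈; polyRing)

open RootsOfUnity
open Pieces
open ClosedForms
open Circles
open Enumerations
open CentralRegions
open Diameters
open import Algebra.Bundles using (CommutativeRing)
open import Data.Empty using (⊥; ⊥-elim)
open import Data.Fin using (Fin)
open import Data.Integer using (+_)
open import Data.List using ([]; length)
open import Data.Nat using (ℕ; zero; suc; _+_; _*_; _∸_; _≤_; _<_; s≤s; z≤n)
open import Data.Nat.DivMod using (_/_; _%_; m≡m%n+[m/n]*n; m%n<n; m*n%n≡0; m*n/n≡m)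
open import Data.Nat.Combinatorics using (_C_)
open import Data.Nat.Divisibility using (_∣_; divides)
open import Data.Nat.GCD using (gcd; gcd[m,n]∣m)
open import Data.Nat.Properties
import Data.Nat.Tactic.RingSolver as ℕS
open import Data.Product using (Σ; ∃; _×_; _,_; proj₁; proj₂)
open import Data.Sum using (inj₁; inj₂)
open import Data.Vec using ([]; _∷_)
open import Function.Bundles using (_↔_)
open import Relation.Binary.PropositionalEquality

private
  f : ℕ → ℕ → Poly
  f = QBinomial.fₙₖ polyRing 𝐪

ordOf≡ : ∀ n d m → 0 < n → n ≡ m * gcd n d → ordOf n d ≡ m
ordOf≡ n d m 0<n e with gcd n d
... | zero  = ⊥-elim (<-irrefl (sym (trans e (*-zeroʳ m))) 0<n)
... | suc g = trans (cong (_/ suc g) e) (m*n/n≡m m (suc g))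

identity : ∀ a b → let n = suc (a + b) in
  qint (2 * n ∸ suc b) *ₚ f a b ≈ₚ qbinom n b *ₚ qbinom (3 * n ∸ 2 * suc b ∸ 1) (n ∸ suc b)
identity a b = ≋⇒≈ (qint (2 * n ∸ suc b) *ₚ f a b) (qbinom n b *ₚ qbinom (3 * n ∸ 2 * suc b ∸ 1) (n ∸ suc b)) (begin
  qint (2 * n ∸ suc b) *ₚ f a b            ≡⟨ cong (λ z → qint z *ₚ f a b) e₁ ⟩
  qint (2 * a + suc b) *ₚ f a b            ≈⟨ S.*-congʳ {f a b} {qint (2 * a + suc b)} {QBinomial.qi polyRing 𝐪 (2 * a + suc b)} (qint≋ (2 * a + suc b)) ⟩
  QBinomial.qi polyRing 𝐪 (2 * a + suc b) *ₚ f a b ≈⟨ QBinomial.fₙₖ-spec polyRing 𝐪 a b ⟩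
  bin (a + suc b) b *ₚ bin (3 * a + b) a   ≈⟨ S.*-cong {qbinom (a + suc b) b} {bin (a + suc b) b} {qbinom (3 * a + b) a} {bin (3 * a + b) a} (qbinom≋ (a + suc b) b) (qbinom≋ (3 * a + b) a) ⟨
  qbinom (a + suc b) b *ₚ qbinom (3 * a + b) a ≡⟨ cong₂ _*ₚ_ (cong (λ z → qbinom z b) (+-suc a b)) (cong₂ qbinom (sym e₂) (sym e₃)) ⟩
  qbinom n b *ₚ qbinom (3 * n ∸ 2 * suc b ∸ 1) (n ∸ suc b) ∎)
  where
  open import Relation.Binary.Reasoning.Setoid (CommutativeRing.setoid polyRing)
  bin = QBinomial.bin polyRing 𝐪
  n = suc (a + b)
  a₁ : ∀ a b → 2 * suc (a + b) ≡ 2 * a + suc b + suc b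
  a₁ = ℕS.solve-∀
  a₂ : ∀ a b → 3 * suc (a + b) ≡ 3 * a + b + 1 + 2 * suc b
  a₂ = ℕS.solve-∀
  e₁ : 2 * n ∸ suc b ≡ 2 * a + suc b
  e₁ = trans (cong (_∸ suc b) (a₁ a b)) (m+n∸n≡m (2 * a + suc b) (suc b))
  e₂ : 3 * n ∸ 2 * suc b ∸ 1 ≡ 3 * a + b
  e₂ = trans (cong (_∸ 1) (trans (cong (_∸ 2 * suc b) (a₂ a b)) (m+n∸n≡m (3 * a + b + 1) (2 * suc b)))) (m+n∸n≡m (3 * a + b) 1)
  e₃ : n ∸ suc b ≡ a
  e₃ = trans (cong (_∸ suc b) (sym (+-suc a b))) (m+n∸n≡m a (suc b))

Sieved : ℕ → ℕ → ℕ → Set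
Sieved a b d = let n = suc (a + b) in Σ ℕ λ c → (Fin c ↔ Fix n (suc b) d) × EvalAtPrimRootIs (ordOf n d) (f a b) (+ c)

-- Holds both sides of the sieving for rotation by g: a list of the fixed forests and the value of f
-- at a primitive m-th root of unity, with the common number c.
data Count (m g a b c : ℕ) : Set₁ where
  counted : (E : Enumeration (suc (a + b)) (suc b) g) → length (Enumeration.codes E) ≡ c → EvalAtPrimRootIs m (f a b) (+ c) → Count m g a b c

-- For n = k the polynomial f is 1, and the only forest is the one without edges.
trivial-value : ∀ m′ b → EvalAtPrimRootIs (suc m′) (f 0 b) (+ 1)
trivial-value m′ b = AtPrimitiveRoot.evalAtPrimRoot m′ 0 b 1 (Q.sym (Q.+-identityʳ Q.1#))
  where module Q = CommutativeRing (AtPrimitiveRoot.quotientRing m′)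

order-one : ∀ a b g → suc (a + b) ≡ 1 * g → ∃ λ c → Count 1 g a b c
order-one a b g n≡ = c , counted E (length-E (trans n≡ (+-identityʳ g)) E₀) (value a)
  where
  c = length (stacks 0 1 a (suc b))
  E₀ : Enumeration (suc (a + b)) (suc b) (suc (a + b))
  E₀ = LinearCase.enumeration (a + b) a (suc b) (sym (+-suc a b))
  E : Enumeration (suc (a + b)) (suc b) g
  E = subst (Enumeration (suc (a + b)) (suc b)) (trans n≡ (+-identityʳ g)) E₀
  length-E : ∀ {d d′} (e : d ≡ d′) (E : Enumeration (suc (a + b)) (suc b) d) → length (Enumeration.codes (subst (Enumeration (suc (a + b)) (suc b)) e E)) ≡ length (Enumeration.codes E)
  length-E refl E = refl
  value : ∀ a → EvalAtPrimRootIs 1 (f a b) (+ length (stacks 0 1 a (suc b)))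
  value zero    = subst (λ c → EvalAtPrimRootIs 1 (f 0 b) (+ c)) (sym (forest-count₀ b)) (trivial-value 0 b)
  value (suc A) = AtPrimitiveRoot.evalAtPrimRoot 0 (suc A) b c′ (AtPrimitiveRoot.Value.fₙₖ-value-one 0 A b c′ refl (forest-count A b))
    where c′ = length (stacks 0 1 (suc A) (suc b))

odd≢even : ∀ x y → suc (2 * x) ≢ 2 * y
odd≢even x       zero    ()
odd≢even zero    (suc y) e with () ← trans (suc-injective e) (+-suc y (y + 0))
odd≢even (suc x) (suc y) e = odd≢even x y (suc-injective (suc-injective (trans (cong suc (arith x)) (trans e (arith′ y)))))
  where
  arith : ∀ x → suc (suc (2 * x)) ≡ 2 * suc x
  arith = ℕS.solve-∀
  arith′ : ∀ y → 2 * suc y ≡ suc (suc (2 * y))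
  arith′ = ℕS.solve-∀

module _ (a b g l : ℕ) (n≡ : suc (a + b) ≡ (2 + l) * g) where
  private
    n′ = a + b
    n = suc n′
    m = 2 + l
  open Circle n′ using (At)
  open CentralRegion n′ g l n≡ using (graphᵐ; graphᵐ-components)

  -- For m ≥ 3 there is no diameter, so a fixed forest consists of m copies of a forest on g
  -- vertices, each with the same number of components.
  components-divisible : ∀ A → NCForest n (suc b) A → ρ^ g A ≡ A → ∀ {l′} → l ≡ suc l′ → ∃ λ c → suc b ≡ m * c
  components-divisible A F x l≡ = use (Dichotomy.window-or-diameter n′ g l n≡ A (suc b) F x)
    where
    use : Dichotomy.Alternatives n′ g l n≡ A (suc b) F x → ∃ λ c → suc b ≡ m * c
    use (inj₁ (s , f , f≡ , e)) = comps f , graphᵐ-components A s f f≡ F e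
    use (inj₂ (l≡0 , _)) with () ← trans (sym l≡) l≡0

  not-divisible : ∀ r q → suc b ≡ suc r + q * m → suc r < m → ∀ c → suc b ≢ m * c
  not-divisible r q b≡ r<m c e = 0≢1+n (begin
    0                       ≡⟨ m*n%n≡0 c m ⟨
    c * m % m               ≡⟨ cong (_% m) (trans (*-comm c m) (trans (sym e) b≡)) ⟩
    (suc r + q * m) % m     ≡⟨ [m+kn]%n≡m%n (suc r) q m ⟩
    suc r % m               ≡⟨ m<n⇒m%n≡m r<m ⟩
    suc r                   ∎)
    where
    open ≡-Reasoning
    open import Data.Nat.DivMod using ([m+kn]%n≡m%n; m<n⇒m%n≡m)

  module _ (l′ : ℕ) (l≡ : l ≡ suc l′) (r q : ℕ) (b≡ : suc b ≡ suc r + q * m) (r<m : suc r < m) where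
    no-fixed : Enumeration n (suc b) g
    no-fixed = empty λ A F x → not-divisible r q b≡ r<m (proj₁ (components-divisible A F x l≡)) (proj₂ (components-divisible A F x l≡))

  q<g : ∀ r q → suc b ≡ suc r + q * m → q < g
  q<g r q b≡ = *-cancelʳ-< m q g (begin-strict
    q * m             ≤⟨ m≤n+m (q * m) r ⟩
    r + q * m         <⟨ n<1+n _ ⟩
    suc r + q * m     ≡⟨ b≡ ⟨
    suc b             ≤⟨ s≤s (m≤n+m b a) ⟩
    n                 ≡⟨ trans n≡ (*-comm m g) ⟩
    g * m             ∎)
    where open ≤-Reasoning

  -- This residue is separate because `bin n b` does not vanish for k ≡ 1, so that `fₙₖ-vanishes`
  -- has to be replaced by `fₙₖ-vanishes′`.
  remainder-one : ∀ l′ q → l ≡ suc l′ → suc b ≡ 1 + q * m → Count m g a b 0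
  remainder-one l′ q refl b≡ = counted (no-fixed l′ refl 0 q b≡ (s≤s (s≤s z≤n))) refl
    (AtPrimitiveRoot.evalAtPrimRoot (suc l) a b 0 (subst₂ (λ x y → QBinomial.fₙₖ R 𝐪 x y ∼ []) (sym a≡) (sym (suc-injective b≡)) (Value.fₙₖ-vanishes′ q Z l′ refl)))
    where
    open AtPrimitiveRoot (suc l) using (_∼_; module Value) renaming (quotientRing to R)
    Z = g ∸ suc q
    g≡ : Z + suc q ≡ g
    g≡ = m∸n+n≡m (q<g 0 q b≡)
    arith : ∀ Z q l → (3 + l) * (Z + suc q) ≡ (Z * (3 + l) + (2 + l)) + suc (q * (3 + l))
    arith = ℕS.solve-∀
    a≡ : a ≡ Z * m + suc l
    a≡ = +-cancelʳ-≡ (suc b) a (Z * m + suc l) (trans (+-suc a b) (trans n≡ (trans (cong (m *_) (sym g≡)) (trans (arith Z q l′) (cong (λ z → Z * m + suc l + z) (sym b≡))))))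

  remainder-more : ∀ l′ r q → l ≡ suc l′ → suc b ≡ 2 + r + q * m → 2 + r < m → Count m g a b 0
  remainder-more l′ r q refl b≡ r<m = counted (no-fixed l′ refl (suc r) q b≡ r<m) refl
    (AtPrimitiveRoot.evalAtPrimRoot (suc l) a b 0 (Value.fₙₖ-vanishes a b g q r (trans (+-suc a b) (trans n≡ (*-comm m g)))
      (trans (suc-injective b≡) (+-comm (suc r) (q * m))) r<m))
    where open AtPrimitiveRoot (suc l) using (module Value)

  remainder-zero : ∀ B → suc b ≡ suc B * m → ∃ λ c → Count m g a b c
  remainder-zero B b≡ = c , counted E (length-E (sym b≡′) E₀) (value a₁ a a≡)
    where
    b≡′ : suc b ≡ m * suc B
    b≡′ = trans b≡ (*-comm (suc B) m)
    B<g : suc B ≤ g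
    B<g = *-cancelʳ-≤ (suc B) g m (≤-trans (≤-reflexive (sym b≡)) (≤-trans (s≤s (m≤n+m b a)) (≤-reflexive (trans n≡ (*-comm m g)))))
    a₁ = g ∸ suc B
    g≡ : g ≡ a₁ + suc B
    g≡ = sym (m∸n+n≡m B<g)
    c = length (pointed (stacks 1 1 a₁ B))
    window : ∀ A → NCForest n (m * suc B) A → ρ^ g A ≡ A → ∃ λ s → ∃ λ f → order f ≡ g × ρ^ s A ≡ graphᵐ f
    window A F x = use l refl n≡ (Dichotomy.window-or-diameter n′ g l n≡ A (m * suc B) F x)
      where
      use : ∀ l₁ → l ≡ l₁ → n ≡ (2 + l) * g → Dichotomy.Alternatives n′ g l n≡ A (m * suc B) F x → ∃ λ s → ∃ λ f → order f ≡ g × ρ^ s A ≡ graphᵐ f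
      use l₁ _ _ (inj₁ w) = w
      use l₁ _ _ (inj₂ (l≡0 , d)) = ⊥-elim (odd l≡0 (Dichotomy.halve n′ g l n≡ A (m * suc B) F x l≡0 d))
        where
        -- For m = 2 a diameter would make the number of components odd, but it is the multiple m (B
        -- + 1).
        odd : l ≡ 0 → (∃ λ p → p < g × At A p (g + p)) → ⊥
        odd l≡0 (p , p<g , h) = parity (DiameterCase.diameter-code n′ g n≡₀ A F x p p<g h)
          where
          n≡₀ : n ≡ 2 * g
          n≡₀ = trans n≡ (cong (λ z → (2 + z) * g) l≡0)
          parity : DiameterCase.DiameterCode n′ g n≡₀ (m * suc B) A p → ⊥
          parity (i , ms , j , _ , _ , k≡) = odd≢even (compsˢ (i ∷ j ∷ [] , ms ∷ [])) (suc B) (trans (sym k≡) (cong (λ z → (2 + z) * suc B) l≡0))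
    E₀ : Enumeration n (m * suc B) g
    E₀ = CentralRegion.enumeration n′ g l n≡ a₁ B g≡ window
    E : Enumeration n (suc b) g
    E = subst (λ k → Enumeration n k g) (sym b≡′) E₀
    length-E : ∀ {k k′} (e : k′ ≡ k) (E : Enumeration n k′ g) → length (Enumeration.codes (subst (λ k → Enumeration n k g) e E)) ≡ length (Enumeration.codes E)
    length-E refl E = refl
    a≡ : a ≡ a₁ * m
    a≡ = +-cancelʳ-≡ (suc b) a (a₁ * m) (trans (+-suc a b) (trans n≡ (trans (*-comm m g) (trans (cong (_* m) g≡) (trans (*-distribʳ-+ m a₁ (suc B)) (cong (λ z → a₁ * m + z) (sym b≡)))))))
    value : ∀ a₁ a → a ≡ a₁ * m → EvalAtPrimRootIs m (f a b) (+ length (pointed (stacks 1 1 a₁ B)))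
    value zero a refl = subst (λ c → EvalAtPrimRootIs m (f 0 b) (+ c)) (sym (+-injective (trans (length-pointed (stacks 1 1 0 B)) (pointed-count₀ B)))) (trivial-value (suc l) b)
      where open import Data.Integer.Properties using (+-injective)
    value (suc A) (suc a) e = AtPrimitiveRoot.evalAtPrimRoot (suc l) (suc a) b c′ (AtPrimitiveRoot.Value.fₙₖ-value-divisible (suc l) A B a b c′ (s≤s z≤n) e b≡
        (pointed-count A B c′ (length-pointed (stacks 1 1 (suc A) B))))
      where c′ = length (pointed (stacks 1 1 (suc A) B))

module _ (a b g : ℕ) (n≡ : suc (a + b) ≡ 2 * g) (q : ℕ) (b≡ : suc b ≡ 1 + q * 2) where
  private
    n′ = a + b
    n = suc n′
  open Circle n′ using (At)

  -- Two copies of one forest would have an even number of components; as k is odd, every fixed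
  -- forest has a diameter.
  remainder-odd : ∃ λ c → Count 2 g a b c
  remainder-odd = c , counted E (trans (length-E k≡ E₀) (trans (DiameterCase.length-codes n′ g n≡ Z q g≡ diameter)
      (trans (cong (_* length (stacks 2 1 Z q)) g≡) (diameter-count Z q)))) value
    where
    Z = g ∸ suc q
    g≡ : g ≡ Z + suc q
    g≡ = sym (m∸n+n≡m (q<g a b g 0 n≡ 0 q b≡))
    c = ((Z + suc q) C q) * ((3 * Z + q + 1) C Z)
    k≡ : suc (2 * q) ≡ suc b
    k≡ = trans (cong suc (*-comm 2 q)) (sym b≡)
    length-E : ∀ {k k′} (e : k′ ≡ k) (E : Enumeration n k′ g) → length (Enumeration.codes (subst (λ k → Enumeration n k g) e E)) ≡ length (Enumeration.codes E)
    length-E refl E = refl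
    diameter : ∀ A → NCForest n (suc (2 * q)) A → ρ^ g A ≡ A → ∃ λ p → p < g × At A p (g + p)
    diameter A F x = use (Dichotomy.window-or-diameter n′ g 0 n≡ A (suc (2 * q)) F x)
      where
      use : Dichotomy.Alternatives n′ g 0 n≡ A (suc (2 * q)) F x → ∃ λ p → p < g × At A p (g + p)
      use (inj₁ (s , f , f≡ , e)) = ⊥-elim (odd≢even q (comps f) (CentralRegion.graphᵐ-components n′ g 0 n≡ A s f f≡ F e))
      use (inj₂ (_ , d)) = Dichotomy.halve n′ g 0 n≡ A (suc (2 * q)) F x refl d
    E₀ : Enumeration n (suc (2 * q)) g
    E₀ = DiameterCase.enumeration n′ g n≡ Z q g≡ diameter
    E : Enumeration n (suc b) g
    E = subst (λ k → Enumeration n k g) k≡ E₀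
    arith : ∀ Z q → 2 * (Z + suc q) ≡ suc (Z * 2) + (1 + q * 2)
    arith = ℕS.solve-∀
    a≡ : a ≡ suc (Z * 2)
    a≡ = +-cancelʳ-≡ (suc b) a (suc (Z * 2)) (trans (+-suc a b) (trans n≡ (trans (cong (2 *_) g≡) (trans (arith Z q) (cong (λ z → suc (Z * 2) + z) (sym b≡))))))
    value : EvalAtPrimRootIs 2 (f a b) (+ c)
    value = subst₂ (λ x y → EvalAtPrimRootIs 2 (f x y) (+ c)) (sym a≡) (sym (suc-injective b≡))
      (AtPrimitiveRoot.evalAtPrimRoot 1 (suc (Z * 2)) (q * 2) c (AtPrimitiveRoot.Value.fₙₖ-value-odd 1 q Z refl))

order-more : ∀ a b g l → suc (a + b) ≡ (2 + l) * g → ∃ λ c → Count (2 + l) g a b c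
order-more a b g l n≡ = split (suc b % m) (suc b / m) (m≡m%n+[m/n]*n (suc b) m) (m%n<n (suc b) m)
  where
  m = 2 + l
  split : ∀ r q → suc b ≡ r + q * m → r < m → ∃ λ c → Count m g a b c
  split zero    (suc B) b≡ r<m = remainder-zero a b g l n≡ B b≡
  split (suc r) q b≡ r<m = by-order l refl n≡ r b≡ r<m
    where
    by-order : ∀ l₁ → l ≡ l₁ → suc (a + b) ≡ (2 + l) * g → ∀ r → suc b ≡ suc r + q * m → suc r < m → ∃ λ c → Count m g a b c
    by-order zero     refl n≡ zero    b≡ _ = remainder-odd a b g n≡ q b≡
    by-order zero     refl n≡ (suc r) b≡ (s≤s (s≤s ()))
    by-order (suc l′) refl n≡ zero    b≡ _ = 0 , remainder-one a b g l n≡ l′ q refl b≡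
    by-order (suc l′) refl n≡ (suc r) b≡ r<m = 0 , remainder-more a b g l n≡ l′ r q refl b≡ r<m

-- With g = gcd n d, the rotations by d and by g generate the same subgroup, and ω^d has order m = n
-- / g. The remaining cases depend on m.
sieved : ∀ a b d → Sieved a b d
sieved a b d = by-order (gcd[m,n]∣m n d)
  where
  n = suc (a + b)
  g = gcd n d
  conclude : ∀ m → n ≡ m * g → (∃ λ c → Count m g a b c) → Sieved a b d
  conclude m n≡ (c , counted E refl value) = c , fixed-points (FixedBy.reduce (a + b) d E)
    , subst (λ o → EvalAtPrimRootIs o (f a b) (+ c)) (sym (ordOf≡ n d m (s≤s z≤n) n≡)) value
  by-order : g ∣ n → Sieved a b d
  by-order (divides zero          ())
  by-order (divides (suc zero)    n≡) = conclude 1 n≡ (order-one a b g n≡)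
  by-order (divides (suc (suc l)) n≡) = conclude (2 + l) n≡ (order-more a b g l n≡)

theorem1p3 : ∀ (n k : ℕ) → 1 ≤ k → k ≤ n →
    Σ Poly λ f →
    (qint (2 * n ∸ k) *ₚ f ≈ₚ qbinom n (k ∸ 1) *ₚ qbinom (3 * n ∸ 2 * k ∸ 1) (n ∸ k))
    × (∀ d → d < n → Σ ℕ λ c → (Fin c ↔ Fix n k d) × EvalAtPrimRootIs (ordOf n d) f (+ c))
theorem1p3 n (suc b) _ k≤n = subst Statement (trans (sym (+-suc (n ∸ suc b) b)) (m∸n+n≡m k≤n))
    (f (n ∸ suc b) b , identity (n ∸ suc b) b , λ d _ → sieved (n ∸ suc b) b d)
  where
  Statement : ℕ → Set
  Statement n = Σ Poly λ f →
    (qint (2 * n ∸ suc b) *ₚ f ≈ₚ qbinom n b *ₚ qbinom (3 * n ∸ 2 * suc b ∸ 1) (n ∸ suc b))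
    × (∀ d → d < n → Σ ℕ λ c → (Fin c ↔ Fix n (suc b) d) × EvalAtPrimRootIs (ordOf n d) f (+ c))
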